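{- Let $M$ be a bicircular matroid. Then $M$ is a lattice path matroid if and only if $M$ has no minor isomorphic to any of the following eight matroids: \[ C^{2,4}=B(P_2),\quad \mathcal{W}^3=B(W),\quad A^3=B(A_3),\quad R^3=B(R_3),\quad R^4=B(R_4),\quad D^4=B(D_4),\quad B^1=B(3K_3),\quad S^1=B(S_1). \]
   Context: Graphs are finite and may have loops and parallel edges. For a graph $G$ with edge set $E$, the bicircular matroid $B(G)$ is the matroid on $E$ whose independent sets are the sets $I\subseteq E$ such that every connected component of the subgraph formed by the edges of $I$ contains at most one cycle (a loop, or a pair of parallel edges, counts as a cycle). A matroid is bicircular if it is isomorphic to $B(G)$ for some graph $G$. A matroid $M$ on $E$ is a lattice path matroid if there is a linear ordering $e_1<e_2<\dots<e_n$ of $E$ and a sequence $(N_1,\dots,N_k)$ of intervals of this ordering, pairwise incomparable under inclusion, such that $M$ is isomorphic to the transversal matroid on $E$ with presentation $(N_1,\dots,N_k)$ (independent sets are the partial transversals). The graphs: $W$ is a triangle with one loop at each vertex. $R_3$ is a triangle on $u,v,w$ with two loops at $u$, two loops at $v$, and no loop at $w$. $A_3$ is a triangle on $u,v,w$ in which $uv$ is a single edge, $uw$ and $vw$ are each doubled (two parallel edges), and there is one loop at $w$. $3K_3$ is a triangle with each edge replaced by three parallel edges. $P_2$ has a vertex $c$ and three further vertices $x,y,z$, each joined to $c$ by two parallel edges (no other edges). $R_4$ has vertices $a,b,c,d$, with single edges $ab$, $ad$, $bd$, two parallel edges $ac$, and two loops at $d$. $D_4$ is obtained from a triangle on $u,v,w$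 by replacing $uw$ and $vw$ each by three parallel edges and subdividing the edge $uv$ once (so $u$ and $v$ are joined by a path of length $2$). $S_1$ has vertices $a,b,c,d,s$ with single edges $ab$, $cd$, $as$, $sd$, two parallel edges $ac$ and two parallel edges $bd$. -}

module Defs where

open import Data.Nat using (ℕ; zero; suc; _+_; _<_)
open import Data.Bool using (Bool; true; false; if_then_else_)
open import Data.Fin using (Fin; #_; _≟_) renaming (_≤_ to _≤ᶠ_)
open import Data.Fin.Subset using (Subset; _∈_; _∉_; _⊆_; _∪_; ⁅_⁆; ∣_∣; Nonempty) renaming (⊥ to ∅)
open import Data.List using (List; map; allFin)
open import Data.Nat.ListAction using (sum)
open import Data.Vec using (Vec; lookup; []; _∷_)
open import Data.Product using (Σ; ∃; ∃-syntax; _×_; _,_; proj₁; proj₂)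
open import Data.Sum using (_⊎_)
open import Relation.Binary.PropositionalEquality using (_≡_; _≢_)
open import Relation.Nullary using (¬_; does)

infix 3 _⇔ₚ_
_⇔ₚ_ : Set → Set → Set
A ⇔ₚ B = (A → B) × (B → A)

record SetSystem : Set₁ where
  field
    size  : ℕ
    Indep : Subset size → Set
open SetSystem public

record IsMatroid (M : SetSystem) : Set where
  field
    indep-empty : Indep M ∅
    indep-hered : ∀ {I J} → J ⊆ I → Indep M I → Indep M J
    indep-aug   : ∀ {I J} → Indep M I → Indep M J → ∣ I ∣ < ∣ J ∣ →
                  ∃[ x ] (x ∈ J × x ∉ I × Indep M (I ∪ ⁅ x ⁆))

Iso : SetSystem → SetSystem → Set
Iso M N =
  Σ (Fin (size M) → Fin (size N)) λ f →
  Σ (Fin (size N) → Fin (size M)) λ g →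
    (∀ x → g (f x) ≡ x) × (∀ y → f (g y) ≡ y) ×
    (∀ S T → (∀ x → x ∈ S ⇔ₚ f x ∈ T) → (Indep M S ⇔ₚ Indep N T))

ContrIndep : (M : SetSystem) → Subset (size M) → Subset (size M) → Set
ContrIndep M C T =
  ∃[ B ] (B ⊆ C × Indep M B ×
          (∀ x → x ∈ C → x ∉ B → ¬ Indep M (B ∪ ⁅ x ⁆)) ×
          Indep M (T ∪ B))

-- N is isomorphic to a minor of M: there are a contraction set C and a set X
-- disjoint from C (the remaining ground set; everything else is deleted) such
-- that N is isomorphic to (M / C) restricted to X.
HasMinorIso : SetSystem → SetSystem → Set
HasMinorIso M N =
  Σ (Subset (size M)) λ C →
  Σ (Subset (size M)) λ X →
  Σ (Fin (size N) → Fin (size M)) λ f →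
    (∀ x → x ∈ X → x ∉ C) ×
    (∀ y → f y ∈ X) ×
    (∀ x → x ∈ X → ∃[ y ] f y ≡ x) ×
    (∀ y z → f y ≡ f z → y ≡ z) ×
    (∀ S T → T ⊆ X → (∀ y → y ∈ S ⇔ₚ f y ∈ T) →
       (Indep N S ⇔ₚ ContrIndep M C T))

record Graph : Set where
  field
    nV   : ℕ
    nE   : ℕ
    ends : Fin nE → Fin nV × Fin nV
open Graph public

mkGraph : (v : ℕ) {m : ℕ} → Vec (Fin v × Fin v) m → Graph
mkGraph v {m} es = record { nV = v ; nE = m ; ends = lookup es }

Joins : (G : Graph) → Fin (nE G) → Fin (nV G) → Fin (nV G) → Set
Joins G e x y = (ends G e ≡ (x , y)) ⊎ (ends G e ≡ (y , x))

data Reach (G : Graph) (S : Subset (nE G)) : Fin (nV G) → Fin (nV G) → Set where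
  here : ∀ {x} → Reach G S x x
  step : ∀ {x y z} (e : Fin (nE G)) → e ∈ S → Joins G e x y → Reach G S y z → Reach G S x z

b2n : Bool → ℕ
b2n true  = 1
b2n false = 0

-- degree of v in the subgraph with edge set C (a loop contributes 2)
deg : (G : Graph) → Subset (nE G) → Fin (nV G) → ℕ
deg G C v = sum (map (λ e → if lookup C e
                              then b2n (does (proj₁ (ends G e) ≟ v)) + b2n (does (proj₂ (ends G e) ≟ v))
                              else 0)
                     (allFin (nE G)))

IsCycle : (G : Graph) → Subset (nE G) → Set
IsCycle G C =
  Nonempty C ×
  (∀ v → (deg G C v ≡ 0) ⊎ (deg G C v ≡ 2)) ×
  (∀ e e′ → e ∈ C → e′ ∈ C → Reach G C (proj₁ (ends G e)) (proj₁ (ends G e′)))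

-- every connected component of the subgraph formed by I contains at most one cycle
BicIndep : (G : Graph) → Subset (nE G) → Set
BicIndep G I =
  ∀ C C′ e e′ → C ⊆ I → C′ ⊆ I → IsCycle G C → IsCycle G C′ →
    e ∈ C → e′ ∈ C′ → Reach G I (proj₁ (ends G e)) (proj₁ (ends G e′)) → C ≡ C′

Bic : Graph → SetSystem
Bic G = record { size = nE G ; Indep = BicIndep G }

IsBicircular : SetSystem → Set
IsBicircular M = ∃[ G ] Iso M (Bic G)

Transversal : (n k : ℕ) → (Fin k → Fin n → Set) → SetSystem
Transversal n k N = record
  { size  = n
  ; Indep = λ I → Σ ((x : Fin n) → x ∈ I → Fin k) λ φ →
              (∀ x y (px : x ∈ I) (py : y ∈ I) → φ x px ≡ φ y py → x ≡ y) ×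
              (∀ x (px : x ∈ I) → N (φ x px) x)
  }

InInterval : {n k : ℕ} → (Fin k → Fin n) → (Fin k → Fin n) → Fin k → Fin n → Set
InInterval lo hi i x = lo i ≤ᶠ x × x ≤ᶠ hi i

-- M is isomorphic to a transversal matroid presented by pairwise incomparable
-- (nonempty) intervals of a linear order of its ground set (the linear order
-- is absorbed into the isomorphism).
IsLPM : SetSystem → Set
IsLPM M =
  Σ ℕ λ k →
  Σ (Fin k → Fin (size M)) λ lo →
  Σ (Fin k → Fin (size M)) λ hi →
    (∀ i → lo i ≤ᶠ hi i) ×
    (∀ i j → i ≢ j → ¬ (∀ x → InInterval lo hi i x → InInterval lo hi j x)) ×
    Iso M (Transversal (size M) k (InInterval lo hi))

W : Graph
W = mkGraph 3 ((# 0 , # 1) ∷ (# 1 , # 2) ∷ (# 0 , # 2) ∷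
               (# 0 , # 0) ∷ (# 1 , # 1) ∷ (# 2 , # 2) ∷ [])

R₃ : Graph
R₃ = mkGraph 3 ((# 0 , # 1) ∷ (# 1 , # 2) ∷ (# 0 , # 2) ∷
                (# 0 , # 0) ∷ (# 0 , # 0) ∷ (# 1 , # 1) ∷ (# 1 , # 1) ∷ [])

A₃ : Graph
A₃ = mkGraph 3 ((# 0 , # 1) ∷ (# 0 , # 2) ∷ (# 0 , # 2) ∷
                (# 1 , # 2) ∷ (# 1 , # 2) ∷ (# 2 , # 2) ∷ [])

K₃³ : Graph
K₃³ = mkGraph 3 ((# 0 , # 1) ∷ (# 0 , # 1) ∷ (# 0 , # 1) ∷
                 (# 1 , # 2) ∷ (# 1 , # 2) ∷ (# 1 , # 2) ∷
                 (# 0 , # 2) ∷ (# 0 , # 2) ∷ (# 0 , # 2) ∷ [])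

P₂ : Graph
P₂ = mkGraph 4 ((# 0 , # 1) ∷ (# 0 , # 1) ∷ (# 0 , # 2) ∷ (# 0 , # 2) ∷
                (# 0 , # 3) ∷ (# 0 , # 3) ∷ [])

R₄ : Graph
R₄ = mkGraph 4 ((# 0 , # 1) ∷ (# 0 , # 3) ∷ (# 1 , # 3) ∷
                (# 0 , # 2) ∷ (# 0 , # 2) ∷ (# 3 , # 3) ∷ (# 3 , # 3) ∷ [])

D₄ : Graph
D₄ = mkGraph 4 ((# 0 , # 2) ∷ (# 0 , # 2) ∷ (# 0 , # 2) ∷
                (# 1 , # 2) ∷ (# 1 , # 2) ∷ (# 1 , # 2) ∷
                (# 0 , # 3) ∷ (# 3 , # 1) ∷ [])

S₁ : Graph
S₁ = mkGraph 5 ((# 0 , # 1) ∷ (# 2 , # 3) ∷ (# 0 , # 4) ∷ (# 4 , # 3) ∷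
                (# 0 , # 2) ∷ (# 0 , # 2) ∷ (# 1 , # 3) ∷ (# 1 , # 3) ∷ [])

{-# OPTIONS --safe #-}
module Submission where

open import Defs
open import Data.Bool using (Bool; true; false; not; _∧_; _∨_; if_then_else_; _xor_) renaming (T to IsTrue)
open import Data.Bool.Properties using (∨-assoc; ∨-comm; ∧-identityʳ) renaming (_≟_ to _≟ᵇ_)
open import Data.Empty using (⊥; ⊥-elim)
open import Data.Fin using (Fin; zero; suc; toℕ; #_; inject₁; fromℕ<) renaming (_≟_ to _≟ᶠ_)
open import Data.Fin.Properties using (any?; all?; ¬∀⟶∃¬; toℕ<n; toℕ-injective; toℕ-fromℕ<)
open import Data.Fin.Subset as Sub using (Subset)
open import Data.Fin.Subset.Properties using (anySubset?; x∈⁅y⁆⇒x≡y; x∈⁅x⁆)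
open import Data.List as List using (List; []; _∷_; _++_)
open import Data.List.Properties using (map-tabulate)
open import Data.Maybe as Maybe using (Maybe; just; nothing; maybe)
open import Data.Maybe.Properties using (just-injective)
open import Data.Nat using (ℕ; zero; suc; _+_; _∸_; _*_; _≤_; _<_; _≤ᵇ_; _≤?_; z≤n; s≤s; s≤s⁻¹; _<?_; _≤′_; ≤′-refl; ≤′-step)
import Data.Nat.ListAction as ListAction
open import Data.Nat.Properties
open import Data.Product using (Σ; ∃; _×_; _,_; proj₁; proj₂)
open import Data.Sum using (_⊎_; inj₁; inj₂; [_,_]′)
open import Data.Unit using (⊤; tt)
open import Data.Vec using (Vec; []; _∷_; lookup; tabulate; zipWith)
open import Data.Vec.Properties using (lookup∘tabulate; tabulate∘lookup; tabulate-cong; []=⇒lookup; lookup⇒[]=; lookup-zipWith)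
open import Function using (_∘_; id)
open import Relation.Binary.Definitions using (tri<; tri≈; tri>)
open import Relation.Binary.PropositionalEquality
open import Relation.Nullary using (¬_; Dec; yes; no; does; contradiction)
open import Relation.Nullary.Decidable using (dec-true; dec-false; _×-dec_)

open import Algebra.Properties.CommutativeSemigroup +-commutativeSemigroup using (interchange)
open import Algebra.Properties.CommutativeMonoid.Sum +-0-commutativeMonoid public using (sum; sum-cong-≗; ∑-distrib-+; ∑-comm)

-- A set I of edges is independent in B(G) exactly when every vertex set X contains at most |X| edges of I.
--
-- In a lattice path matroid, bases are recognised by prefix counts. So if A+x and A+z are bases and y lies
-- between x and z, then A+y is a basis, and likewise for A+x+y, A+y+z and A+x+z. These rules pass to minors,
-- and in each of the eight matroids they leave no possible order for some three or four elements.
--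
-- Conversely, pendant edges and components split off, so let U be connected of minimum degree two. Let 𝓕
-- consist of the connected X ⊊ U with connected complement, more than |X| edges, and every proper part of X
-- touched by more edges of X than it has vertices. Without the eight minors, comparability is an equivalence
-- relation on 𝓕 with at most two classes, and two incomparable members that share an edge contain every
-- edge between them. Hence 𝓕 is the union of two chains, and the edges can be ordered so that the
-- members of one chain are initial segments and those of the other are final segments. A minimal violated
-- Hall condition is that of U, of a member of 𝓕, or of the part common to members L and R of the two chains,
-- so each dependent set is detected by an initial and a final segment. The intervals then join the i-th
-- elements of the bases that are greedy from the left and from the right.

-- Minors are found without following single edges. Disjoint connected vertex sets are fixed and a
-- spanning tree of each is contracted, so that every set becomes a vertex; what counts afterwards
-- is the number of edges between two sets and, as loops, the edges of a set beyond its tree. This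
-- explains the clauses of 𝓕: a connected complement can serve as one part, the excess gives a
-- member two loops, and the condition on proper parts says that a component is held by two edges or
-- by an edge and a loop. For the bicircular matroid these two ways of holding a leaf are often
-- interchangeable, which keeps the list of configurations short. That a configuration represents
-- one of the eight matroids is a finite check left to evaluation.
--
-- A dense set need not lie in 𝓕, since its complement may have two components. It is then the
-- overlap of the two incomparable members obtained by adding either component; three components
-- give P₂. Hence a dependent set is detected by a pair of segments, through an inequality that is
-- inherited by direct sums.

infixr 4 _⇒ᵇ_
_⇒ᵇ_ : Bool → Bool → Bool
true  ⇒ᵇ b = b
false ⇒ᵇ b = true

-- Propositional tautologies by evaluation

BoolFun : ℕ → Set
BoolFun zero    = Bool
BoolFun (suc k) = Bool → BoolFun k

∀ᵇ : ∀ k → BoolFun k → Bool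
∀ᵇ zero    b = b
∀ᵇ (suc k) f = ∀ᵇ k (f true) ∧ ∀ᵇ k (f false)

Valid : ∀ k → BoolFun k → Set
Valid zero    b = b ≡ true
Valid (suc k) f = ∀ b → Valid k (f b)

∧-l : ∀ {a b} → a ∧ b ≡ true → a ≡ true
∧-l {true} _ = refl

∧-r : ∀ {a b} → a ∧ b ≡ true → b ≡ true
∧-r {true} p = p

infixr 5 _∧ⁱ_
_∧ⁱ_ : ∀ {a b} → a ≡ true → b ≡ true → a ∧ b ≡ true
refl ∧ⁱ refl = refl

valid : ∀ k (f : BoolFun k) → ∀ᵇ k f ≡ true → Valid k f
valid zero    f p       = p
valid (suc k) f p true  = valid k (f true) (∧-l p)
valid (suc k) f p false = valid k (f false) (∧-r {∀ᵇ k (f true)} p)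

T-true : ∀ {b} → IsTrue b → b ≡ true
T-true {true} _ = refl

-- The hidden argument is inferred by eta for the unit type as soon as the truth table evaluates to
-- `true`, so every use is a check by computation.
taut : ∀ k (f : BoolFun k) → {IsTrue (∀ᵇ k f)} → Valid k f
taut k f {p} = valid k f (T-true p)

infixl 6 _$ᵇ_
_$ᵇ_ : ∀ {a b} → (a ⇒ᵇ b) ≡ true → a ≡ true → b ≡ true
_$ᵇ_ {true} p refl = p

≤ᵇ-sound : ∀ {m n} → (m ≤ᵇ n) ≡ true → m ≤ n
≤ᵇ-sound {m} {n} p = ≤ᵇ⇒≤ m n (subst IsTrue (sym p) tt)

∨-l : ∀ {a b} → a ≡ true → a ∨ b ≡ true
∨-l refl = refl

∨-r : ∀ {a b} → b ≡ true → a ∨ b ≡ true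
∨-r {true}  _ = refl
∨-r {false} p = p

∨-case : ∀ {a b} → a ∨ b ≡ true → (a ≡ true) ⊎ (b ≡ true)
∨-case {true}  _ = inj₁ refl
∨-case {false} p = inj₂ p

not-t : ∀ {a} → a ≡ false → not a ≡ true
not-t refl = refl

not-f : ∀ {a} → not a ≡ true → a ≡ false
not-f {false} _ = refl

absurdᵇ : ∀ {ℓ} {W : Set ℓ} {a} → a ≡ true → a ≡ false → W
absurdᵇ refl ()

¬t⇒f : ∀ {a} → ¬ (a ≡ true) → a ≡ false
¬t⇒f {true}  p = ⊥-elim (p refl)
¬t⇒f {false} p = refl

dec-t : ∀ {ℓ} {P : Set ℓ} (d : Dec P) → P → does d ≡ true
dec-t = dec-true

dec-f : ∀ {ℓ} {P : Set ℓ} (d : Dec P) → ¬ P → does d ≡ false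
dec-f = dec-false

does-t : ∀ {ℓ} {P : Set ℓ} (d : Dec P) → does d ≡ true → P
does-t (yes p) _ = p

infix 7 _==_
_==_ : ∀ {n} → Fin n → Fin n → Bool
i == j = does (i ≟ᶠ j)

==-t : ∀ {n} {i j : Fin n} → i == j ≡ true → i ≡ j
==-t {i = i} {j} = does-t (i ≟ᶠ j)

==-refl : ∀ {n} (i : Fin n) → i == i ≡ true
==-refl i = dec-t (i ≟ᶠ i) refl

==-f : ∀ {n} {i j : Fin n} → ¬ i ≡ j → i == j ≡ false
==-f {i = i} {j} = dec-f (i ≟ᶠ j)

-- Linear arithmetic: a goal follows when, coefficientwise, its left side plus
-- the right sides of the hypotheses is at most its right side plus their left sides.

infixl 6 _:+_
infix 4 _:≤_
infix 3 _⊢_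

data Ex (k : ℕ) : Set where
  con  : ℕ → Ex k
  var  : Fin k → Ex k
  _:+_ : Ex k → Ex k → Ex k

data Ineq (k : ℕ) : Set where
  _:≤_ : Ex k → Ex k → Ineq k

data Problem (k : ℕ) : Set where
  _⊢_ : List (Ineq k) → Ineq k → Problem k

vars : ∀ {k} → Vec (Ex k) k
vars = tabulate var

module _ {k : ℕ} where

  eval : Ex k → Vec ℕ k → ℕ
  eval (con c)  ρ = c
  eval (var i)  ρ = lookup ρ i
  eval (a :+ b) ρ = eval a ρ + eval b ρ

  holds : Ineq k → Vec ℕ k → Set
  holds (a :≤ b) ρ = eval a ρ ≤ eval b ρ

  allHold : List (Ineq k) → Vec ℕ k → Set
  allHold []       ρ = ⊤
  allHold (h ∷ []) ρ = holds h ρ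
  allHold (h ∷ hs) ρ = holds h ρ × allHold hs ρ

  coef : Fin k → Ex k → ℕ
  coef i (con c)  = 0
  coef i (var j)  = b2n (i == j)
  coef i (a :+ b) = coef i a + coef i b

  const : Ex k → ℕ
  const (con c)  = c
  const (var j)  = 0
  const (a :+ b) = const a + const b

  lhs rhs : List (Ineq k) → Ex k
  lhs []               = con 0
  lhs ((a :≤ b) ∷ [])  = a
  lhs ((a :≤ b) ∷ hs)  = a :+ lhs hs
  rhs []               = con 0
  rhs ((a :≤ b) ∷ [])  = b
  rhs ((a :≤ b) ∷ hs)  = b :+ rhs hs

  allHold-sum : ∀ hs ρ → allHold hs ρ → eval (lhs hs) ρ ≤ eval (rhs hs) ρ
  allHold-sum []                     ρ _        = z≤n
  allHold-sum ((a :≤ b) ∷ [])        ρ p        = p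
  allHold-sum ((a :≤ b) ∷ (h ∷ hs)) ρ (p , ps) = +-mono-≤ p (allHold-sum (h ∷ hs) ρ ps)

conclusion : ∀ {k} → Problem k → Ineq k
conclusion (hs ⊢ g) = g

hypotheses : ∀ {k} → Problem k → List (Ineq k)
hypotheses (hs ⊢ g) = hs

dot : ∀ {k} → Vec ℕ k → Vec ℕ k → ℕ
dot []       []       = 0
dot (c ∷ cs) (x ∷ xs) = c * x + dot cs xs

dot-+ : ∀ {k} (cs ds xs : Vec ℕ k) → dot (zipWith _+_ cs ds) xs ≡ dot cs xs + dot ds xs
dot-+ []       []       []       = refl
dot-+ (c ∷ cs) (d ∷ ds) (x ∷ xs) =
  trans (cong₂ _+_ (*-distribʳ-+ x c d) (dot-+ cs ds xs)) (interchange (c * x) (d * x) _ _)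

coefs : ∀ {k} → Ex k → Vec ℕ k
coefs a = tabulate λ i → coef i a

dot-0 : ∀ {k} (xs : Vec ℕ k) → dot (tabulate λ _ → 0) xs ≡ 0
dot-0 []       = refl
dot-0 (x ∷ xs) = dot-0 xs

dot-var : ∀ {k} (j : Fin k) (xs : Vec ℕ k) → dot (tabulate λ i → b2n (i == j)) xs ≡ lookup xs j
dot-var zero    (x ∷ xs) = trans (cong₂ _+_ (+-identityʳ x) (dot-0 xs)) (+-identityʳ x)
dot-var (suc j) (x ∷ xs) = dot-var j xs

tabulate-zip : ∀ {k} (f g : Fin k → ℕ) → tabulate (λ i → f i + g i) ≡ zipWith _+_ (tabulate f) (tabulate g)
tabulate-zip {zero}  f g = refl
tabulate-zip {suc k} f g = cong (f zero + g zero ∷_) (tabulate-zip (f ∘ suc) (g ∘ suc))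

eval-coefs : ∀ {k} (a : Ex k) ρ → eval a ρ ≡ const a + dot (coefs a) ρ
eval-coefs (con c)  ρ = sym (trans (cong (c +_) (dot-0 ρ)) (+-identityʳ c))
eval-coefs (var i)  ρ = sym (dot-var i ρ)
eval-coefs (a :+ b) ρ = begin
  eval a ρ + eval b ρ                                        ≡⟨ cong₂ _+_ (eval-coefs a ρ) (eval-coefs b ρ) ⟩
  (const a + dot (coefs a) ρ) + (const b + dot (coefs b) ρ)  ≡⟨ interchange (const a) _ _ _ ⟩
  const a + const b + (dot (coefs a) ρ + dot (coefs b) ρ)    ≡⟨ cong (const a + const b +_) (sym (dot-+ (coefs a) (coefs b) ρ)) ⟩
  const a + const b + dot (zipWith _+_ (coefs a) (coefs b)) ρ
    ≡⟨ cong (λ v → const a + const b + dot v ρ) (sym (tabulate-zip (λ i → coef i a) (λ i → coef i b))) ⟩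
  const a + const b + dot (coefs (a :+ b)) ρ                 ∎
  where open ≡-Reasoning

_≤ᵛ_ : ∀ {k} → Vec ℕ k → Vec ℕ k → Bool
[]       ≤ᵛ []       = true
(c ∷ cs) ≤ᵛ (d ∷ ds) = (c ≤ᵇ d) ∧ (cs ≤ᵛ ds)

dot-mono : ∀ {k} (cs ds xs : Vec ℕ k) → (cs ≤ᵛ ds) ≡ true → dot cs xs ≤ dot ds xs
dot-mono []       []       []       _ = z≤n
dot-mono (c ∷ cs) (d ∷ ds) (x ∷ xs) p =
  +-mono-≤ (*-monoˡ-≤ x (≤ᵇ-sound {c} (∧-l p))) (dot-mono cs ds xs (∧-r {c ≤ᵇ d} p))

check : ∀ {k} → Problem k → Bool
check (hs ⊢ (a :≤ b)) =
  (const (a :+ rhs hs) ≤ᵇ const (b :+ lhs hs)) ∧ (coefs (a :+ rhs hs) ≤ᵛ coefs (b :+ lhs hs))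

lin : ∀ {k} (ρ : Vec ℕ k) (f : Vec (Ex k) k → Problem k) → {IsTrue (check (f vars))} →
      allHold (hypotheses (f vars)) ρ → holds (conclusion (f vars)) ρ
lin ρ f {c′} ps with f vars
... | hs ⊢ (a :≤ b) = let c = T-true c′ in +-cancelʳ-≤ (eval (rhs hs) ρ) _ _ (begin
  eval a ρ + eval (rhs hs) ρ                               ≡⟨ eval-coefs (a :+ rhs hs) ρ ⟩
  const (a :+ rhs hs) + dot (coefs (a :+ rhs hs)) ρ        ≤⟨ +-mono-≤ (≤ᵇ-sound (∧-l c)) (dot-mono (coefs (a :+ rhs hs)) (coefs (b :+ lhs hs)) ρ (∧-r {const (a :+ rhs hs) ≤ᵇ const (b :+ lhs hs)} c)) ⟩
  const (b :+ lhs hs) + dot (coefs (b :+ lhs hs)) ρ        ≡⟨ sym (eval-coefs (b :+ lhs hs) ρ) ⟩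
  eval b ρ + eval (lhs hs) ρ                               ≤⟨ +-monoʳ-≤ (eval b ρ) (allHold-sum hs ρ ps) ⟩
  eval b ρ + eval (rhs hs) ρ                               ∎)
  where open ≤-Reasoning

-- Opaque, so that the set is recovered from its cardinality by unification.
opaque
  cnt : ∀ {n} → (Fin n → Bool) → ℕ
  cnt p = sum (b2n ∘ p)

-- Counting in finite sets

sum-mono : ∀ {n} {f g : Fin n → ℕ} → (∀ i → f i ≤ g i) → sum f ≤ sum g
sum-mono {zero}  h = z≤n
sum-mono {suc n} h = +-mono-≤ (h zero) (sum-mono (h ∘ suc))

sum-strict : ∀ {n} {f g : Fin n → ℕ} → (∀ i → f i ≤ g i) → ∀ i → f i < g i → sum f < sum g
sum-strict {suc n} h zero    p = +-mono-<-≤ p (sum-mono (h ∘ suc))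
sum-strict {suc n} h (suc i) p = +-mono-≤-< (h zero) (sum-strict (h ∘ suc) i p)

sum-0 : ∀ n → sum {n} (λ _ → 0) ≡ 0
sum-0 zero    = refl
sum-0 (suc n) = sum-0 n

sum-1 : ∀ n → sum {n} (λ _ → 1) ≡ n
sum-1 zero    = refl
sum-1 (suc n) = cong suc (sum-1 n)

sum-*ʳ : ∀ {n} (f : Fin n → ℕ) c → sum (λ i → f i * c) ≡ sum f * c
sum-*ʳ {zero}  f c = refl
sum-*ʳ {suc n} f c = trans (cong (f zero * c +_) (sum-*ʳ (f ∘ suc) c)) (sym (*-distribʳ-+ c (f zero) _))

b2n≤ : ∀ {a b} → (a ≡ true → b ≡ true) → b2n a ≤ b2n b
b2n≤ {false}         h = z≤n
b2n≤ {true}  {true}  h = ≤-refl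
b2n≤ {true}  {false} h with h refl
... | ()

opaque
  unfolding cnt

  cnt-sum : ∀ {n} (p : Fin n → Bool) → cnt p ≡ sum (b2n ∘ p)
  cnt-sum p = refl

  cnt-cong : ∀ {n} {p q : Fin n → Bool} → (∀ i → p i ≡ q i) → cnt p ≡ cnt q
  cnt-cong h = sum-cong-≗ (λ i → cong b2n (h i))

  cnt-⊆ : ∀ {n} {p q : Fin n → Bool} → (∀ i → p i ≡ true → q i ≡ true) → cnt p ≤ cnt q
  cnt-⊆ h = sum-mono (λ i → b2n≤ (h i))

  cnt-⊂ : ∀ {n} {p q : Fin n → Bool} → (∀ i → p i ≡ true → q i ≡ true) →
          ∀ i → p i ≡ false → q i ≡ true → cnt p < cnt q
  cnt-⊂ {p = p} {q} h i pi qi =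
    sum-strict (λ j → b2n≤ (h j)) i (subst₂ (λ a b → b2n a < b2n b) (sym pi) (sym qi) ≤-refl)

  cnt≤n : ∀ {n} (p : Fin n → Bool) → cnt p ≤ n
  cnt≤n {n} p = subst (cnt p ≤_) (sum-1 n) (sum-mono λ i → b≤1 (p i))
    where
    b≤1 : ∀ b → b2n b ≤ 1
    b≤1 true  = ≤-refl
    b≤1 false = z≤n

  cnt-∃ : ∀ {n} {p : Fin n → Bool} → 1 ≤ cnt p → ∃ λ i → p i ≡ true
  cnt-∃ {suc n} {p} h with p zero in eq
  ... | true  = zero , eq
  ... | false with cnt-∃ {n} {p ∘ suc} h
  ...   | i , q = suc i , q

  ∃-cnt : ∀ {n} {p : Fin n → Bool} i → p i ≡ true → 1 ≤ cnt p
  ∃-cnt {p = p} zero    q rewrite q = s≤s z≤n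
  ∃-cnt {p = p} (suc i) q = ≤-trans (∃-cnt {p = p ∘ suc} i q) (m≤n+m _ (b2n (p zero)))

  cnt-none : ∀ {n} {p : Fin n → Bool} → (∀ i → p i ≡ false) → cnt p ≡ 0
  cnt-none {n} h = trans (cnt-cong h) (sum-0 n)

cnt-0 : ∀ {n} {p : Fin n → Bool} → cnt p ≡ 0 → ∀ i → p i ≡ false
cnt-0 {p = p} h i = ¬t⇒f λ q → 1+n≰n (subst (1 ≤_) h (∃-cnt i q))

opaque
  unfolding cnt

  cnt1≤2 : ∀ {n} (p q r : Fin n → Bool) → (∀ i → b2n (p i) ≤ b2n (q i) + b2n (r i)) → cnt p ≤ cnt q + cnt r
  cnt1≤2 p q r h = ≤-trans (sum-mono h) (≤-reflexive (∑-distrib-+ (b2n ∘ q) (b2n ∘ r)))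

  cnt2≤1 : ∀ {n} (p q r : Fin n → Bool) → (∀ i → b2n (p i) + b2n (q i) ≤ b2n (r i)) → cnt p + cnt q ≤ cnt r
  cnt2≤1 p q r h = ≤-trans (≤-reflexive (sym (∑-distrib-+ (b2n ∘ p) (b2n ∘ q)))) (sum-mono h)

  cnt1≤3 : ∀ {n} (p q r s : Fin n → Bool) → (∀ i → b2n (p i) ≤ b2n (q i) + b2n (r i) + b2n (s i)) →
           cnt p ≤ cnt q + cnt r + cnt s
  cnt1≤3 p q r s h = ≤-trans (sum-mono h) (≤-reflexive (trans
    (∑-distrib-+ (λ i → b2n (q i) + b2n (r i)) (b2n ∘ s)) (cong (_+ cnt s) (∑-distrib-+ (b2n ∘ q) (b2n ∘ r)))))

  cnt3≤1 : ∀ {n} (q r s p : Fin n → Bool) → (∀ i → b2n (q i) + b2n (r i) + b2n (s i) ≤ b2n (p i)) →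
           cnt q + cnt r + cnt s ≤ cnt p
  cnt3≤1 q r s p h = ≤-trans (≤-reflexive (sym (trans
    (∑-distrib-+ (λ i → b2n (q i) + b2n (r i)) (b2n ∘ s)) (cong (_+ cnt s) (∑-distrib-+ (b2n ∘ q) (b2n ∘ r)))))) (sum-mono h)

  sum-== : ∀ {n} (a : Fin n) → cnt (_== a) ≡ 1
  sum-== {suc n} zero    = cong suc (cnt-none {n} {λ i → suc i == zero} (λ _ → refl))
  sum-== {suc n} (suc a) = sum-== a

cnt-remove : ∀ {n} (p : Fin n → Bool) a → p a ≡ true → cnt p ≡ suc (cnt (λ i → p i ∧ not (i == a)))
cnt-remove {n} p a pa = ≤-antisym
  (≤-trans (cnt1≤2 p (_== a) q λ i → ≤ᵇ-sound (taut 2 (λ x y → b2n x ≤ᵇ b2n y + b2n (x ∧ not y)) (p i) (i == a)))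
           (≤-reflexive (cong (_+ cnt q) (sum-== a))))
  (≤-trans (≤-reflexive (sym (cong (_+ cnt q) (sum-== a)))) (cnt2≤1 (_== a) q p λ i → aux i (i ≟ᶠ a)))
  where
  q = λ i → p i ∧ not (i == a)
  aux : ∀ i (d : Dec (i ≡ a)) → b2n (does d) + b2n (p i ∧ not (does d)) ≤ b2n (p i)
  aux i (yes refl) rewrite pa = ≤-refl
  aux i (no _) with p i
  ... | true  = ≤-refl
  ... | false = ≤-refl

≤-cnt-other : ∀ {n} (p : Fin n → Bool) a → p a ≡ true → 2 ≤ cnt p → ∃ λ b → p b ≡ true × ¬ (b ≡ a)
≤-cnt-other p a pa h with cnt-∃ (s≤s⁻¹ (subst (2 ≤_) (cnt-remove p a pa) h))
... | b , q = b , ∧-l q , λ e → absurdᵇ (subst (λ x → b == x ≡ true) e (==-refl b)) (not-f (∧-r {p b} q))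

-- Sets as Boolean functions

BSet : ℕ → Set
BSet n = Fin n → Bool

infixl 7 _∩_ _∖_
infixl 6 _∪_
infix 4 _⊆_

_∩_ _∪_ _∖_ : ∀ {n} → BSet n → BSet n → BSet n
(A ∩ B) v = A v ∧ B v
(A ∪ B) v = A v ∨ B v
(A ∖ B) v = A v ∧ not (B v)

_⊆_ : ∀ {n} → BSet n → BSet n → Set
A ⊆ B = ∀ v → A v ≡ true → B v ≡ true

ε full : ∀ {n} → BSet n
ε    v = false
full v = true

⁅_⁆ : ∀ {n} → Fin n → BSet n
⁅ a ⁆ v = v == a

Inh : ∀ {n} → BSet n → Set
Inh A = ∃ λ v → A v ≡ true

Disj : ∀ {n} → BSet n → BSet n → Set
Disj A B = ∀ v → A v ≡ true → B v ≡ true → ⊥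

-- Finitely many vectors stand for all Boolean functions, but only up to pointwise equality; `resp`
-- bridges that gap.
search : ∀ {n} (P : BSet n → Set) → (∀ {f g} → (∀ v → f v ≡ g v) → P f → P g) →
         (∀ f → Dec (P f)) → ∃ P ⊎ (∀ f → ¬ P f)
search P resp dec with anySubset? (λ p → dec (lookup p))
... | yes (p , h) = inj₁ (lookup p , h)
... | no ¬h       = inj₂ λ f h → ¬h (tabulate f , resp (λ v → sym (lookup∘tabulate f v)) h)

all-true? : ∀ {n} (p : BSet n) → Dec (∃ λ i → p i ≡ true)
all-true? p = any? (λ i → p i ≟ᵇ true)

inh⊎empty : ∀ {n} (p : BSet n) → Inh p ⊎ (∀ i → p i ≡ false)
inh⊎empty p with all-true? p
... | yes h = inj₁ h
... | no ¬h = inj₂ λ i → ¬t⇒f λ q → ¬h (i , q)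

cnt-split : ∀ {n} (A S : BSet n) → cnt A ≡ cnt (A ∩ S) + cnt (A ∖ S)
cnt-split A S = ≤-antisym
  (cnt1≤2 A (A ∩ S) (A ∖ S) λ i → ≤ᵇ-sound (taut 2 (λ a b → b2n a ≤ᵇ b2n (a ∧ b) + b2n (a ∧ not b)) (A i) (S i)))
  (cnt2≤1 (A ∩ S) (A ∖ S) A λ i → ≤ᵇ-sound (taut 2 (λ a b → b2n (a ∧ b) + b2n (a ∧ not b) ≤ᵇ b2n a) (A i) (S i)))

cnt-insert : ∀ {n} (K : BSet n) v → K v ≡ false → cnt (K ∪ ⁅ v ⁆) ≡ suc (cnt K)
cnt-insert K v h = trans (cnt-remove (K ∪ ⁅ v ⁆) v (∨-r {K v} (==-refl v))) (cong suc (cnt-cong aux))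
  where
  aux : ∀ i → (K i ∨ i == v) ∧ not (i == v) ≡ K i
  aux i with i ≟ᶠ v
  ... | yes refl rewrite h = refl
  ... | no _ with K i
  ...   | true  = refl
  ...   | false = refl

-- The Hall condition, connectivity and components

module Gr {n m : ℕ} (s t : Fin m → Fin n) where

  E[_] : BSet n → BSet m
  E[ X ] e = X (s e) ∧ X (t e)

  joins : BSet n → BSet n → BSet m
  joins A B e = (A (s e) ∧ B (t e)) ∨ (B (s e) ∧ A (t e))

  crosses : BSet n → BSet n → BSet m
  crosses A S e = E[ A ] e ∧ (S (s e) xor S (t e))

  Hall : BSet m → Set
  Hall I = ∀ X → cnt (I ∩ E[ X ]) ≤ cnt X

  -- Connectivity is expressed by cuts, not by paths: it can then be decided by a search over vertex
  -- sets, and its failure delivers the separation along which a proof splits.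
  record Conn (I : BSet m) (A : BSet n) : Set where
    constructor _,_
    field
      inh : Inh A
      cut : ∀ S → Inh (A ∩ S) → Inh (A ∖ S) → Inh (I ∩ crosses A S)

  Sep : BSet m → BSet n → BSet n → Set
  Sep I A S = Inh (A ∩ S) × Inh (A ∖ S) × (∀ e → (I ∩ crosses A S) e ≡ false)

  Hall-resp : ∀ {I J} → (∀ e → I e ≡ J e) → Hall I → Hall J
  Hall-resp h p X = subst (_≤ cnt X) (cnt-cong λ e → cong (_∧ E[ X ] e) (h e)) (p X)

  Hall-⊆ : ∀ {I J} → J ⊆ I → Hall I → Hall J
  Hall-⊆ {I} {J} h p X = ≤-trans (cnt-⊆ λ e q → h e (∧-l q) ∧ⁱ ∧-r {J e} q) (p X)

  hall⊎ : ∀ I → (∃ λ X → cnt X < cnt (I ∩ E[ X ])) ⊎ Hall I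
  hall⊎ I with search (λ X → cnt X < cnt (I ∩ E[ X ]))
                 (λ h → subst₂ _<_ (cnt-cong h) (cnt-cong λ e → cong (I e ∧_) (cong₂ _∧_ (h (s e)) (h (t e)))))
                 (λ X → _ ≤? _)
  ... | inj₁ x = inj₁ x
  ... | inj₂ f = inj₂ λ X → ≮⇒≥ (f X)

  hall? : ∀ I → Dec (Hall I)
  hall? I with hall⊎ I
  ... | inj₁ (X , h) = no λ p → <⇒≱ h (p X)
  ... | inj₂ p       = yes p

  Sep-resp : ∀ {I A S S′} → (∀ v → S v ≡ S′ v) → Sep I A S → Sep I A S′
  Sep-resp {I} {A} h ((a , p) , (b , q) , r) =
      (a , trans (cong (A a ∧_) (sym (h a))) p)
    , (b , trans (cong (λ x → A b ∧ not x) (sym (h b))) q)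
    , λ e → trans (cong (λ x → I e ∧ (E[ A ] e ∧ x)) (cong₂ _xor_ (sym (h (s e))) (sym (h (t e))))) (r e)

  conn⊎sep : ∀ I A → Inh A → Conn I A ⊎ ∃ (Sep I A)
  conn⊎sep I A nonempty with search (Sep I A) (Sep-resp {I} {A})
    (λ S → all-true? (A ∩ S) ×-dec (all-true? (A ∖ S) ×-dec all? (λ e → (I ∩ crosses A S) e ≟ᵇ false)))
  ... | inj₁ x = inj₂ x
  ... | inj₂ f = inj₁ (nonempty , λ S p q → [ id , (λ r → ⊥-elim (f S (p , q , r))) ]′ (inh⊎empty (I ∩ crosses A S)))

  Conn-resp : ∀ {I A B} → (∀ v → A v ≡ B v) → Conn I A → Conn I B
  Conn-resp {I} {A} {B} h ((a , p) , c) = (a , trans (sym (h a)) p) , λ S (b , q) (d , r) →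
    let e , x = c S (b , trans (cong (_∧ S b) (h b)) q) (d , trans (cong (_∧ not (S d)) (h d)) r)
    in e , trans (cong (λ y → I e ∧ (y ∧ (S (s e) xor S (t e)))) (sym (cong₂ _∧_ (h (s e)) (h (t e))))) x

  Conn-mono : ∀ {I J A} → I ⊆ J → Conn I A → Conn J A
  Conn-mono {I} h (p , c) = p , λ S a b → let e , x = c S a b in e , h e (∧-l x) ∧ⁱ ∧-r {I e} x

  cut-ends : ∀ A S e → crosses A S e ≡ true →
    (A (s e) ≡ true × S (s e) ≡ true × A (t e) ≡ true × S (t e) ≡ false) ⊎
    (A (t e) ≡ true × S (t e) ≡ true × A (s e) ≡ true × S (s e) ≡ false)
  cut-ends A S e h with A (s e) | A (t e) | S (s e) | S (t e)
  ... | true | true | true  | false = inj₁ (refl , refl , refl , refl)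
  ... | true | true | false | true  = inj₂ (refl , refl , refl , refl)

  exit : ∀ {I A K} → Conn I A → Inh (A ∩ K) → Inh (A ∖ K) →
         ∃ λ e → ∃ λ u → ∃ λ v → I e ≡ true × A u ≡ true × K u ≡ true × A v ≡ true × K v ≡ false ×
         ((s e ≡ u × t e ≡ v) ⊎ (s e ≡ v × t e ≡ u))
  exit {I} {A} {K} (_ , c) p q with c K p q
  ... | e , h with cut-ends A K e (∧-r {I e} h)
  ...   | inj₁ (a , b , x , y) = e , _ , _ , ∧-l h , a , b , x , y , inj₁ (refl , refl)
  ...   | inj₂ (a , b , x , y) = e , _ , _ , ∧-l h , a , b , x , y , inj₂ (refl , refl)

  by-ends : ∀ {e u v} (Q : Fin n → Fin n → Set) → (s e ≡ u × t e ≡ v) ⊎ (s e ≡ v × t e ≡ u) → Q u v → Q v u → Q (s e) (t e)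
  by-ends Q (inj₁ (refl , refl)) p q = p
  by-ends Q (inj₂ (refl , refl)) p q = q

  -- A vertex outside the current set is absorbed along an edge that leaves the set, and each
  -- absorption brings at least one new edge into the induced subgraph.
  grow : ∀ {I A K} → Conn I A → K ⊆ A → Inh K →
         cnt (I ∩ E[ K ]) + cnt (A ∖ K) ≤ cnt (I ∩ E[ A ])
  grow {I} {A} {K} c K⊆A iK = go _ K K⊆A iK ≤-refl
    where
    go : ∀ b K → K ⊆ A → Inh K → cnt (A ∖ K) ≤ b → cnt (I ∩ E[ K ]) + cnt (A ∖ K) ≤ cnt (I ∩ E[ A ])
    go b K K⊆A (k , Kk) le with inh⊎empty (A ∖ K)
    ... | inj₂ em rewrite cnt-none em | +-identityʳ (cnt (I ∩ E[ K ])) =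
      cnt-⊆ λ e h → ∧-l {I e} h ∧ⁱ K⊆A (s e) (∧-l (∧-r {I e} h)) ∧ⁱ K⊆A (t e) (∧-r {K (s e)} (∧-r {I e} h))
    go zero K K⊆A _ le | inj₁ (v , q) = ⊥-elim (1+n≰n (≤-trans (∃-cnt v q) le))
    go (suc b) K K⊆A (k , Kk) le | inj₁ (w , q) with exit c (k , K⊆A k Kk ∧ⁱ Kk) (w , q)
    ... | e , u , v , Ie , Au , Ku , Av , Kv , ends =
      lin (cnt (I ∩ E[ K ]) ∷ cnt (A ∖ K) ∷ cnt (I ∩ E[ K′ ]) ∷ cnt (A ∖ K′) ∷ cnt (I ∩ E[ A ]) ∷ [])
        (λ { (iK ∷ aK ∷ iK′ ∷ aK′ ∷ iA ∷ []) →
          (iK′ :+ aK′ :≤ iA) ∷ (con 1 :+ iK :≤ iK′) ∷ (aK :≤ con 1 :+ aK′) ∷ [] ⊢ (iK :+ aK :≤ iA) })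
        (go b K′ K′⊆A (k , ∨-l Kk) (s≤s⁻¹ (≤-trans (≤-reflexive (sym less)) le)) , more , ≤-reflexive less)
      where
      K′ = K ∪ ⁅ v ⁆
      K′⊆A : K′ ⊆ A
      K′⊆A x h with ∨-case {K x} h
      ... | inj₁ p = K⊆A x p
      ... | inj₂ p rewrite ==-t {i = x} {v} p = Av
      less : cnt (A ∖ K) ≡ suc (cnt (A ∖ K′))
      less = trans (cnt-remove (A ∖ K) v (Av ∧ⁱ not-t Kv)) (cong suc (cnt-cong λ i →
        eqᵇ (taut 3 (λ a k x → ((a ∧ not k) ∧ not x) iff (a ∧ not (k ∨ x))) (A i) (K i) (i == v))))
        where
        infix 5 _iff_
        _iff_ : Bool → Bool → Bool
        a iff b = not (a xor b)
        eqᵇ : ∀ {a b} → (a iff b) ≡ true → a ≡ b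
        eqᵇ {true}  {true}  _ = refl
        eqᵇ {false} {false} _ = refl
      inK′ : ∀ x → K x ≡ true → K′ x ≡ true
      inK′ x p = ∨-l p
      new : (I ∩ E[ K′ ]) e ≡ true × (I ∩ E[ K ]) e ≡ false
      new = by-ends (λ x y → I e ∧ (K′ x ∧ K′ y) ≡ true × I e ∧ (K x ∧ K y) ≡ false) ends
        (Ie ∧ⁱ ∨-l Ku ∧ⁱ ∨-r {K v} (==-refl v) , ¬t⇒f λ h → absurdᵇ (∧-r {K u} (∧-r {I e} h)) Kv)
        (Ie ∧ⁱ ∨-r {K v} (==-refl v) ∧ⁱ ∨-l Ku , ¬t⇒f λ h → absurdᵇ (∧-l (∧-r {I e} h)) Kv)
      more : 1 + cnt (I ∩ E[ K ]) ≤ cnt (I ∩ E[ K′ ])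
      more = cnt-⊂ (λ x h → ∧-l {I x} h ∧ⁱ inK′ _ (∧-l (∧-r {I x} h)) ∧ⁱ inK′ _ (∧-r {K (s x)} (∧-r {I x} h))) e (proj₂ new) (proj₁ new)

  spanning : ∀ {I A} → Conn I A → cnt A ≤ 1 + cnt (I ∩ E[ A ])
  spanning {I} {A} c@((a , p) , _) =
    lin (cnt A ∷ cnt (A ∖ ⁅ a ⁆) ∷ cnt (I ∩ E[ ⁅ a ⁆ ]) ∷ cnt (I ∩ E[ A ]) ∷ [])
      (λ { (x ∷ y ∷ z ∷ w ∷ []) → (z :+ y :≤ w) ∷ (x :≤ con 1 :+ y) ∷ [] ⊢ (x :≤ con 1 :+ w) })
      (grow c (λ v h → subst (λ v → A v ≡ true) (sym (==-t {i = v} {a} h)) p) (a , ==-refl a) , ≤-reflexive (cnt-remove A a p))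

  Closed : BSet m → BSet n → BSet n → Set
  Closed I A K = ∀ e → I e ≡ true → joins K (A ∖ K) e ≡ false

  record Comp (I : BSet m) (A : BSet n) (a : Fin n) : Set where
    field
      K      : BSet n
      sub    : K ⊆ A
      has    : K a ≡ true
      conn   : Conn I K
      closed : Closed I A K

  opaque
    -- Split along a separation and keep the side of `a` until no separation is left. The result is
    -- closed in all of `A` because no split cuts an edge of `I`.
    comp : ∀ I A a → A a ≡ true → Comp I A a
    comp I A a p = go _ A a p ≤-refl
      where
      go : ∀ b A a → A a ≡ true → cnt A ≤ b → Comp I A a
      go b A a p le with conn⊎sep I A (a , p)
      ... | inj₁ c = record { K = A ; sub = λ _ → id ; has = p ; conn = c ; closed = λ e _ →
        taut 2 (λ x y → not ((x ∧ (y ∧ not y)) ∨ ((x ∧ not x) ∧ y))) (A (s e)) (A (t e)) `not-f }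
        where
        infix 5 _`not-f
        _`not-f : ∀ {a} → not a ≡ true → a ≡ false
        h `not-f = not-f h
      go zero A a p le | inj₂ _ = ⊥-elim (1+n≰n (≤-trans (∃-cnt a p) le))
      go (suc b) A a p le | inj₂ (S , (x , hx) , (y , hy) , none) = side (S a) refl
        where
        lift : ∀ (R : BSet n) → Inh (A ∖ R) → (∀ e → I e ≡ true → joins (A ∩ R) (A ∖ R) e ≡ false) →
               R a ≡ true → Comp I A a
        lift R (z , hz) cl Ra = record { K = C.K ; sub = λ v h → ∧-l (C.sub v h) ; has = C.has ; conn = C.conn
                                       ; closed = λ e Ie → ¬t⇒f (bad e Ie) }
          where
          C : Comp I (A ∩ R) a
          C = go b (A ∩ R) a (p ∧ⁱ Ra)
                (s≤s⁻¹ (≤-trans (cnt-⊂ {p = A ∩ R} (λ v h → ∧-l h) z (¬t⇒f λ h → absurdᵇ (∧-r {A z} h) (not-f (∧-r {A z} hz))) (∧-l hz)) le))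
          module C = Comp C
          out : ∀ e → I e ≡ true → ∀ u v → C.K u ≡ true → A v ≡ true → C.K v ≡ false → ((s e ≡ u) × (t e ≡ v)) ⊎ ((s e ≡ v) × (t e ≡ u)) → ⊥
          out e Ie u v Ku Av Kv ends with R v in Rv
          out e Ie u v Ku Av Kv (inj₁ (refl , refl)) | true = absurdᵇ (∨-l (Ku ∧ⁱ (Av ∧ⁱ Rv) ∧ⁱ not-t Kv)) (C.closed e Ie)
          out e Ie u v Ku Av Kv (inj₂ (refl , refl)) | true = absurdᵇ (∨-r {C.K (s e) ∧ (A ∩ R ∖ C.K) (t e)} (((Av ∧ⁱ Rv) ∧ⁱ not-t Kv) ∧ⁱ Ku)) (C.closed e Ie)
          out e Ie u v Ku Av Kv (inj₁ (refl , refl)) | false = absurdᵇ (∨-l (C.sub u Ku ∧ⁱ Av ∧ⁱ not-t Rv)) (cl e Ie)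
          out e Ie u v Ku Av Kv (inj₂ (refl , refl)) | false = absurdᵇ (∨-r {(A ∩ R) (s e) ∧ (A ∖ R) (t e)} ((Av ∧ⁱ not-t Rv) ∧ⁱ C.sub u Ku)) (cl e Ie)
          bad : ∀ e → I e ≡ true → ¬ (joins C.K (A ∖ C.K) e ≡ true)
          bad e Ie h with ∨-case {C.K (s e) ∧ (A ∖ C.K) (t e)} h
          ... | inj₁ q = out e Ie _ _ (∧-l q) (∧-l (∧-r {C.K (s e)} q)) (not-f (∧-r {A (t e)} (∧-r {C.K (s e)} q))) (inj₁ (refl , refl))
          ... | inj₂ q = out e Ie _ _ (∧-r {(A ∖ C.K) (s e)} q) (∧-l (∧-l q)) (not-f (∧-r {A (s e)} (∧-l q))) (inj₂ (refl , refl))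
        nocross : ∀ e → I e ≡ true → crosses A S e ≡ false
        nocross e Ie = ¬t⇒f λ h → absurdᵇ (Ie ∧ⁱ h) (none e)
        cl₁ : ∀ e → I e ≡ true → joins (A ∩ S) (A ∖ S) e ≡ false
        cl₁ e Ie = ¬t⇒f λ h → absurdᵇ (taut 4 (λ a b x y → (((a ∧ x) ∧ (b ∧ not y)) ∨ ((a ∧ not x) ∧ (b ∧ y))) ⇒ᵇ ((a ∧ b) ∧ (x xor y)))
                     (A (s e)) (A (t e)) (S (s e)) (S (t e)) $ᵇ h) (nocross e Ie)
        cl₂ : ∀ e → I e ≡ true → joins (A ∩ (not ∘ S)) (A ∖ (not ∘ S)) e ≡ false
        cl₂ e Ie = ¬t⇒f λ h → absurdᵇ (taut 4 (λ a b x y → (((a ∧ not x) ∧ (b ∧ not (not y))) ∨ ((a ∧ not (not x)) ∧ (b ∧ not y))) ⇒ᵇ ((a ∧ b) ∧ (x xor y)))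
                     (A (s e)) (A (t e)) (S (s e)) (S (t e)) $ᵇ h) (nocross e Ie)
        side : ∀ c → S a ≡ c → Comp I A a
        side true  Sa = lift S (y , hy) cl₁ Sa
        side false Sa = lift (not ∘ S) (x , (∧-l hx ∧ⁱ not-t (cong not (∧-r {A x} hx)))) cl₂ (not-t Sa)

-- Bicircular independence as a Hall condition

listSum-tabulate : ∀ {n} (f : Fin n → ℕ) → ListAction.sum (List.tabulate f) ≡ sum f
listSum-tabulate {zero}  f = refl
listSum-tabulate {suc n} f = cong (f zero +_) (listSum-tabulate (f ∘ suc))

listSum-allFin : ∀ {n} (f : Fin n → ℕ) → ListAction.sum (List.map f (List.allFin n)) ≡ sum f
listSum-allFin f = trans (cong ListAction.sum (map-tabulate id f)) (listSum-tabulate f)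

lookup-ext : ∀ {n} (A B : Vec Bool n) → (∀ i → lookup A i ≡ lookup B i) → A ≡ B
lookup-ext A B h = trans (sym (tabulate∘lookup A)) (trans (tabulate-cong h) (tabulate∘lookup B))

sum-pick : ∀ {n} (X : BSet n) a → sum (λ v → b2n (X v ∧ a == v)) ≡ b2n (X a)
sum-pick {n} X a with X a in eq
... | true  = trans (sum-cong-≗ aux) (trans (sym (cnt-sum (_== a))) (sum-== a))
  where
  aux : ∀ v → b2n (X v ∧ a == v) ≡ b2n (v == a)
  aux v with v ≟ᶠ a
  ... | yes refl rewrite eq | ==-refl a = refl
  ... | no ne rewrite ==-f (ne ∘ sym) with X v
  ...   | true  = refl
  ...   | false = refl
... | false = trans (sum-cong-≗ aux) (sum-0 n)
  where
  aux : ∀ v → b2n (X v ∧ a == v) ≡ 0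
  aux v with a ≟ᶠ v
  ... | yes refl rewrite eq = refl
  ... | no _ with X v
  ...   | true  = refl
  ...   | false = refl

module Cycles (G : Graph) where

  private
    n = nV G
    m = nE G

  s t : Fin m → Fin n
  s e = proj₁ (ends G e)
  t e = proj₂ (ends G e)

  open Gr s t

  dg : BSet m → Fin n → ℕ
  dg J v = sum λ e → if J e then b2n (s e == v) + b2n (t e == v) else 0

  deg-dg : ∀ C v → deg G C v ≡ dg (lookup C) v
  deg-dg C v = listSum-allFin λ e → if lookup C e then b2n (s e == v) + b2n (t e == v) else 0

  dg-cong : ∀ {J K} → (∀ e → J e ≡ K e) → ∀ v → dg J v ≡ dg K v
  dg-cong h v = sum-cong-≗ λ e → cong (λ b → if b then b2n (s e == v) + b2n (t e == v) else 0) (h e)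

  handshake : ∀ (J : BSet m) (X : BSet n) → sum (λ v → if X v then dg J v else 0) ≡
                      sum (λ e → if J e then b2n (X (s e)) + b2n (X (t e)) else 0)
  handshake J X = begin
    sum (λ v → if X v then dg J v else 0)    ≡⟨ sum-cong-≗ (λ v → push (X v) (f v)) ⟩
    sum (λ v → sum λ e → if X v then f v e else 0) ≡⟨ ∑-comm (λ v e → if X v then f v e else 0) ⟩
    sum (λ e → sum λ v → if X v then f v e else 0) ≡⟨ sum-cong-≗ edge ⟩
    sum (λ e → if J e then b2n (X (s e)) + b2n (X (t e)) else 0) ∎
    where
    open ≡-Reasoning
    f : Fin n → Fin m → ℕ
    f v e = if J e then b2n (s e == v) + b2n (t e == v) else 0
    push : ∀ (b : Bool) (g : Fin m → ℕ) → (if b then sum g else 0) ≡ sum (λ e → if b then g e else 0)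
    push true  g = refl
    push false g = sym (sum-0 m)
    zeros : ∀ v → (if X v then 0 else 0) ≡ 0
    zeros v with X v
    ... | true  = refl
    ... | false = refl
    both : ∀ (x a b : Bool) → (if x then b2n a + b2n b else 0) ≡ b2n (x ∧ a) + b2n (x ∧ b)
    both true  a b = refl
    both false a b = refl
    edge : ∀ e → sum (λ v → if X v then f v e else 0) ≡ (if J e then b2n (X (s e)) + b2n (X (t e)) else 0)
    edge e with J e
    ... | false = trans (sum-cong-≗ zeros) (sum-0 n)
    ... | true  = trans (sum-cong-≗ (λ v → both (X v) (s e == v) (t e == v)))
      (trans (∑-distrib-+ (λ v → b2n (X v ∧ s e == v)) (λ v → b2n (X v ∧ t e == v)))
             (cong₂ _+_ (sum-pick X (s e)) (sum-pick X (t e))))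

  Even : BSet m → Set
  Even C = ∀ v → (dg C v ≡ 0) ⊎ (dg C v ≡ 2)

  boundary : BSet n → BSet m
  boundary X e = X (s e) xor X (t e)

  -- Summing degrees over `X` counts inner edges twice and boundary edges once. All degrees are 0 or
  -- 2, so a single boundary edge would make an even number odd.
  even-boundary : ∀ C X → Even C → 1 ≤ cnt (C ∩ boundary X) → 2 ≤ cnt (C ∩ boundary X)
  even-boundary C X ev h with cnt (C ∩ boundary X) in eq
  even-boundary C X ev h | suc (suc _) = s≤s (s≤s z≤n)
  even-boundary C X ev h | suc zero = ⊥-elim (even≢odd (sum two) (cnt (C ∩ E[ X ])) (begin
    2 * sum two                                              ≡⟨ trans (*-comm 2 (sum two)) (sym (sum-*ʳ two 2)) ⟩
    sum (λ v → two v * 2)                                    ≡⟨ sum-cong-≗ half ⟩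
    sum (λ v → if X v then dg C v else 0)                    ≡⟨ handshake C X ⟩
    sum (λ e → if C e then b2n (X (s e)) + b2n (X (t e)) else 0) ≡⟨ sum-cong-≗ (λ e → edge (C e) (X (s e)) (X (t e))) ⟩
    sum (λ e → b2n ((C ∩ boundary X) e) + b2n ((C ∩ E[ X ]) e) * 2)
      ≡⟨ trans (∑-distrib-+ (λ e → b2n ((C ∩ boundary X) e)) (λ e → b2n ((C ∩ E[ X ]) e) * 2))
           (cong₂ _+_ (trans (sym (cnt-sum (C ∩ boundary X))) eq)
             (trans (sum-*ʳ (b2n ∘ (C ∩ E[ X ])) 2) (cong (_* 2) (sym (cnt-sum (C ∩ E[ X ])))))) ⟩
    suc (cnt (C ∩ E[ X ]) * 2)                               ≡⟨ cong suc (*-comm (cnt (C ∩ E[ X ])) 2) ⟩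
    suc (2 * cnt (C ∩ E[ X ]))                               ∎))
    where
    open ≡-Reasoning
    two : Fin n → ℕ
    two v = if X v then [ (λ _ → 0) , (λ _ → 1) ]′ (ev v) else 0
    half : ∀ v → two v * 2 ≡ (if X v then dg C v else 0)
    half v with X v | ev v
    ... | false | _      = refl
    ... | true  | inj₁ p = sym p
    ... | true  | inj₂ p = sym p
    edge : ∀ (c x y : Bool) → (if c then b2n x + b2n y else 0) ≡ b2n (c ∧ (x xor y)) + b2n (c ∧ (x ∧ y)) * 2
    edge true  true  true  = refl
    edge true  true  false = refl
    edge true  false true  = refl
    edge true  false false = refl
    edge false _     _     = refl

  -- If `d` were the only edge across a cut of `X`, then `C` would cross this cut exactly once,
  -- against parity. Closedness of `X` makes sure that the second crossing edge also runs inside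
  -- `X`.
  remove-cycle-edge : ∀ {I X C d} → Conn I X → Closed I full X → C ⊆ I → Even C → C d ≡ true →
                      Conn (I ∖ ⁅ d ⁆) X
  remove-cycle-edge {I} {X} {C} {d} (ne , cut) cl C⊆I ev Cd = ne , cut′
    where
    cut′ : ∀ S → Inh (X ∩ S) → Inh (X ∖ S) → Inh (I ∖ ⁅ d ⁆ ∩ crosses X S)
    cut′ S p q with cut S p q
    ... | e , h with e ≟ᶠ d
    ...   | no e≢d = e , (∧-l {I e} h ∧ⁱ not-t (==-f e≢d)) ∧ⁱ ∧-r {I e} h
    ...   | yes refl = g , (C⊆I g (∧-l {C g} Cg) ∧ⁱ not-t (==-f g≢d)) ∧ⁱ
              (taut 4 (λ x y a b → not ((x ∧ not y) ∨ (not x ∧ y)) ⇒ᵇ ((x ∧ a) xor (y ∧ b)) ⇒ᵇ ((x ∧ y) ∧ (a xor b)))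
                 (X (s g)) (X (t g)) (S (s g)) (S (t g)) $ᵇ not-t (cl g (C⊆I g (∧-l {C g} Cg))) $ᵇ ∧-r {C g} Cg)
      where
      d∈ : (C ∩ boundary (X ∩ S)) d ≡ true
      d∈ = Cd ∧ⁱ (taut 4 (λ x y a b → ((x ∧ y) ∧ (a xor b)) ⇒ᵇ ((x ∧ a) xor (y ∧ b)))
                    (X (s d)) (X (t d)) (S (s d)) (S (t d)) $ᵇ ∧-r {I d} h)
      other = ≤-cnt-other (C ∩ boundary (X ∩ S)) d d∈ (even-boundary C (X ∩ S) ev (∃-cnt d d∈))
      g = proj₁ other
      Cg = proj₁ (proj₂ other)
      g≢d = proj₂ (proj₂ other)

  closed-reach : ∀ {I X x y} → Closed (lookup I) full X → X x ≡ true → Reach G I x y → X y ≡ true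
  closed-reach cl Xx here = Xx
  closed-reach {I} {X} cl Xx (step {x} {y} e e∈I j r) = closed-reach {I} {X} cl (next j (X y) refl) r
    where
    Ie = []=⇒lookup e∈I
    next : Joins G e x y → ∀ b → X y ≡ b → X y ≡ true
    next _        true  h = h
    next (inj₁ q) false h = absurdᵇ (∨-l (subst (λ z → X (proj₁ z) ∧ not (X (proj₂ z)) ≡ true) (sym q) (Xx ∧ⁱ not-t h))) (cl e Ie)
    next (inj₂ q) false h = absurdᵇ (∨-r {X (s e) ∧ not (X (t e))} (subst (λ z → not (X (proj₁ z)) ∧ X (proj₂ z) ≡ true) (sym q) (not-t h ∧ⁱ Xx))) (cl e Ie)

  reach-⊆ : ∀ {I J x y} → I Sub.⊆ J → Reach G I x y → Reach G J x y
  reach-⊆ h here           = here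
  reach-⊆ h (step e p j r) = step e (h p) j (reach-⊆ h r)

  cycle-even : ∀ {C} → IsCycle G C → Even (lookup C)
  cycle-even {C} (_ , d , _) v = subst (λ k → (k ≡ 0) ⊎ (k ≡ 2)) (deg-dg C v) (d v)

  lookup-⊆ : ∀ {C I : Sub.Subset m} → C Sub.⊆ I → lookup C ⊆ lookup I
  lookup-⊆ h e p = []=⇒lookup (h (lookup⇒[]= e _ p))

  -- A component with two cycles stays connected after the deletion of an edge
  -- of each, so it has more edges than vertices.
  hall⇒bic : ∀ I → Hall (lookup I) → BicIndep G I
  hall⇒bic I hall C C′ e e′ C⊆I C′⊆I cyc cyc′ e∈C e′∈C′ r with all? (λ i → lookup C i ≟ᵇ lookup C′ i)
  ... | yes eq = lookup-ext C C′ eq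
  ... | no ¬eq with ¬∀⟶∃¬ m _ (λ i → lookup C i ≟ᵇ lookup C′ i) ¬eq
  ...   | d , ne = ⊥-elim (pick (lookup C d) (lookup C′ d) refl refl)
    where
    open Comp (comp (lookup I) full (s e) refl)
    in-K : ∀ x → K (s x) ≡ true → lookup I x ≡ true → E[ K ] x ≡ true
    in-K x h Ix = h ∧ⁱ ¬f⇒t λ q → absurdᵇ (∨-l (h ∧ⁱ not-t q)) (closed x Ix)
      where
      ¬f⇒t : ∀ {b} → ¬ (b ≡ false) → b ≡ true
      ¬f⇒t {true}  _ = refl
      ¬f⇒t {false} p = ⊥-elim (p refl)
    Ke′ : K (s e′) ≡ true
    Ke′ = closed-reach {I} {K} closed has r
    -- Since `x` is not on `B`, its deletion leaves `B` a cycle, from which `y` can be deleted next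
    -- without disconnecting `K`.
    clash : ∀ A B x y → IsCycle G A → IsCycle G B → A Sub.⊆ I → B Sub.⊆ I → lookup A x ≡ true → lookup B x ≡ false →
            lookup B y ≡ true → K (s x) ≡ true → K (s y) ≡ true → ⊥
    clash A B x y cA cB A⊆I B⊆I Ax Bx By Kx Ky = 1+n≰n
      (lin (cnt K ∷ cnt (I₂ ∩ E[ K ]) ∷ cnt (lookup I ∩ E[ K ]) ∷ [])
        (λ { (k ∷ j ∷ i ∷ []) → (k :≤ con 1 :+ j) ∷ (i :≤ k) ∷ (con 2 :+ j :≤ i) ∷ [] ⊢ (con 1 :+ k :≤ k) })
        (spanning conn₂ , hall K , two))
      where
      I₁ = lookup I ∖ ⁅ x ⁆
      I₂ = I₁ ∖ ⁅ y ⁆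
      y≢x : ¬ y ≡ x
      y≢x refl = absurdᵇ By Bx
      conn₁ : Conn I₁ K
      conn₁ = remove-cycle-edge conn closed (lookup-⊆ A⊆I) (cycle-even cA) Ax
      conn₂ : Conn I₂ K
      conn₂ = remove-cycle-edge conn₁ (λ g h → closed g (∧-l {lookup I g} h))
        (λ g h → lookup-⊆ B⊆I g h ∧ⁱ not-t (==-f {i = g} {x} λ { refl → absurdᵇ h Bx })) (cycle-even cB) By
      Ix = lookup-⊆ A⊆I x Ax
      Iy = lookup-⊆ B⊆I y By
      two : 2 + cnt (I₂ ∩ E[ K ]) ≤ cnt (lookup I ∩ E[ K ])
      two = ≤-trans (s≤s (≤-trans (s≤s (cnt-⊆ λ g h →
                taut 4 (λ i a b c → (((i ∧ a) ∧ b) ∧ c) ⇒ᵇ (((i ∧ c) ∧ a) ∧ b)) (lookup I g) (not (g == x)) (not (g == y)) (E[ K ] g) $ᵇ h))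
              (≤-reflexive (sym (cnt-remove ((lookup I ∩ E[ K ]) ∖ ⁅ x ⁆) y ((Iy ∧ⁱ in-K y Ky Iy) ∧ⁱ not-t (==-f y≢x)))))))
            (≤-reflexive (sym (cnt-remove (lookup I ∩ E[ K ]) x (Ix ∧ⁱ in-K x Kx Ix))))
    pick : ∀ a b → lookup C d ≡ a → lookup C′ d ≡ b → ⊥
    pick true  true  p q = ne (trans p (sym q))
    pick false false p q = ne (trans p (sym q))
    pick true  false p q = clash C C′ d e′ cyc cyc′ C⊆I C′⊆I p q ([]=⇒lookup e′∈C′)
      (closed-reach {I} {K} closed has (reach-⊆ C⊆I (proj₂ (proj₂ cyc) e d e∈C (lookup⇒[]= d C p)))) Ke′
    pick false true  p q = clash C′ C d e cyc′ cyc C′⊆I C⊆I q p ([]=⇒lookup e∈C)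
      (closed-reach {I} {K} closed Ke′ (reach-⊆ C′⊆I (proj₂ (proj₂ cyc′) e′ d e′∈C′ (lookup⇒[]= d C′ q)))) has

  conn-reach : ∀ {J X x y} → Conn J X → X x ≡ true → X y ≡ true → Reach G (tabulate J) x y
  conn-reach {J} {X} {x} {y} c Xx Xy = go _ ⁅ x ⁆ (λ v h → subst (Reach G (tabulate J) x) (sym (==-t {i = v} h)) here)
      (==-refl x) ≤-refl
    where
    _▷_ : ∀ {x y z} → Reach G (tabulate J) x y → Reach G (tabulate J) y z → Reach G (tabulate J) x z
    here         ▷ r′ = r′
    step e p j r ▷ r′ = step e p j (r ▷ r′)
    go : ∀ b K → (∀ v → K v ≡ true → Reach G (tabulate J) x v) → K x ≡ true → cnt (X ∖ K) ≤ b → Reach G (tabulate J) x y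
    go b K h Kx le with K y in Ky
    ... | true = h y Ky
    go zero K h Kx le | false = ⊥-elim (1+n≰n (≤-trans (∃-cnt y (Xy ∧ⁱ not-t Ky)) le))
    go (suc b) K h Kx le | false with exit c (x , Xx ∧ⁱ Kx) (y , Xy ∧ⁱ not-t Ky)
    ... | e , u , v , Je , Xu , Ku , Xv , Kv , es = go b (K ∪ ⁅ v ⁆) h′ (∨-l Kx)
        (s≤s⁻¹ (≤-trans (cnt-⊂ {p = X ∖ (K ∪ ⁅ v ⁆)} {q = X ∖ K}
          (λ i → (taut 3 (λ a k z → (a ∧ not (k ∨ z)) ⇒ᵇ (a ∧ not k)) (X i) (K i) (i == v)) $ᵇ_) v
          (trans (cong (λ z → X v ∧ not (K v ∨ z)) (==-refl v)) (taut 2 (λ a k → not (a ∧ not (k ∨ true))) (X v) (K v) ·)) (Xv ∧ⁱ not-t Kv)) le))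
      where
      _· : ∀ {a} → not a ≡ true → a ≡ false
      _· = not-f
      joinsuv : Joins G e u v
      joinsuv = [ (λ (p , q) → inj₁ (cong₂ _,_ p q)) , (λ (p , q) → inj₂ (cong₂ _,_ p q)) ]′ es
      h′ : ∀ w → (K ∪ ⁅ v ⁆) w ≡ true → Reach G (tabulate J) x w
      h′ w q with ∨-case {K w} q
      ... | inj₁ p = h w p
      ... | inj₂ p rewrite ==-t {i = w} p = h u Ku ▷ step e (lookup⇒[]= e _ (trans (lookup∘tabulate J e) Je)) joinsuv here

  inc : Fin n → BSet m
  inc v e = s e == v ∨ t e == v

  -- Discard surplus edges, pass to a side of a separation that still has enough edges, delete
  -- vertices of degree at most one. When none of this applies, the subgraph is connected with as
  -- many edges as vertices and all degrees at least 2; the degree sum then forces every degree to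
  -- be 2.
  find-cycle : ∀ b J X → cnt J + cnt X ≤ b → Inh X → J ⊆ E[ X ] → cnt X ≤ cnt J →
               ∃ λ C → IsCycle G C × lookup C ⊆ J
  find-cycle zero J X le (x , Xx) _ _ = ⊥-elim (1+n≰n (≤-trans (∃-cnt x Xx) (≤-trans (m≤n+m _ _) le)))
  find-cycle (suc b) J X le iX J⊆ X≤J with cnt J ≤? cnt X
  ... | no J≰X with cnt-∃ {p = J} (≤-trans (s≤s z≤n) (≰⇒> J≰X))
  ...   | e , Je = let C , c , h = find-cycle b (J ∖ ⁅ e ⁆) X
                        (s≤s⁻¹ (≤-trans (≤-reflexive (cong (_+ cnt X) (sym (cnt-remove J e Je)))) le)) iX
                        (λ g q → J⊆ g (∧-l {J g} q))
                        (s≤s⁻¹ (≤-trans (≰⇒> J≰X) (≤-reflexive (cnt-remove J e Je))))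
                   in C , c , λ g q → ∧-l {J g} (h g q)
  find-cycle (suc b) J X le iX J⊆ X≤J | yes J≤X with conn⊎sep J X iX
  ... | inj₂ (S , iA , iB , none) with cnt (X ∩ S) ≤? cnt (J ∩ E[ X ∩ S ])
  ...   | yes p = let C , c , h = find-cycle b (J ∩ E[ X ∩ S ]) (X ∩ S)
                        (s≤s⁻¹ (≤-trans (+-mono-≤-< (cnt-⊆ {p = J ∩ E[ X ∩ S ]} {q = J} λ g → ∧-l {J g}) (less iB)) le)) iA (λ g → ∧-r {J g}) p
                  in C , c , λ g q → ∧-l {J g} (h g q)
    where
    less : Inh (X ∖ S) → cnt (X ∩ S) < cnt X
    less (w , q) = ≤-trans (≤-trans (≤-reflexive (+-comm 1 _)) (+-monoʳ-≤ (cnt (X ∩ S)) (∃-cnt w q))) (≤-reflexive (sym (cnt-split X S)))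
  ...   | no ¬p = let C , c , h = find-cycle b (J ∩ E[ X ∖ S ]) (X ∖ S)
                        (s≤s⁻¹ (≤-trans (+-mono-≤-< (cnt-⊆ {p = J ∩ E[ X ∖ S ]} {q = J} λ g → ∧-l {J g}) (less iA)) le)) iB (λ g → ∧-r {J g})
                        (lin (cnt X ∷ cnt (X ∩ S) ∷ cnt (X ∖ S) ∷ cnt J ∷ cnt (J ∩ E[ X ∩ S ]) ∷ cnt (J ∩ E[ X ∖ S ]) ∷ [])
                          (λ { (x ∷ a ∷ b ∷ j ∷ ja ∷ jb ∷ []) → (a :+ b :≤ x) ∷ (x :≤ j) ∷ (j :≤ ja :+ jb) ∷ (con 1 :+ ja :≤ a) ∷ [] ⊢ (b :≤ jb) })
                          (≤-reflexive (sym (cnt-split X S)) , X≤J , halves , ≰⇒> ¬p))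
                  in C , c , λ g q → ∧-l {J g} (h g q)
    where
    less : Inh (X ∩ S) → cnt (X ∖ S) < cnt X
    less (w , q) = ≤-trans (+-monoˡ-≤ (cnt (X ∖ S)) (∃-cnt w q)) (≤-reflexive (sym (cnt-split X S)))
    halves : cnt J ≤ cnt (J ∩ E[ X ∩ S ]) + cnt (J ∩ E[ X ∖ S ])
    halves = cnt1≤2 J _ _ λ g → ≤ᵇ-sound
      (taut 5 (λ j x y a b → (j ⇒ᵇ (x ∧ y)) ⇒ᵇ not (j ∧ ((x ∧ y) ∧ (a xor b))) ⇒ᵇ
         (b2n j ≤ᵇ b2n (j ∧ ((x ∧ a) ∧ (y ∧ b))) + b2n (j ∧ ((x ∧ not a) ∧ (y ∧ not b)))))
         (J g) (X (s g)) (X (t g)) (S (s g)) (S (t g)) $ᵇ imp (J⊆ g) $ᵇ not-t (none g))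
      where
      imp : ∀ {a b} → (a ≡ true → b ≡ true) → (a ⇒ᵇ b) ≡ true
      imp {true}  h = h refl
      imp {false} h = refl
  find-cycle (suc b) J X le iX J⊆ X≤J | yes J≤X | inj₁ c
    with any? (λ v → (X v ≟ᵇ true) ×-dec (dg J v ≤? 1))
  ... | yes (v , Xv , small) = let C , c , h = find-cycle b J′ X′ (s≤s⁻¹ (≤-trans (+-mono-≤-< (cnt-⊆ λ g → ∧-l {J g}) (≤-reflexive (sym X-eq))) le))
                                     rest J′⊆ (s≤s⁻¹ (≤-trans (≤-reflexive (sym X-eq)) (≤-trans X≤J (≤-trans J-le (≤-trans (+-monoʳ-≤ (cnt J′) small) (≤-reflexive (+-comm _ 1)))))))
                               in C , c , λ g q → ∧-l {J g} (h g q)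
    where
    J′ = J ∖ inc v
    X′ = X ∖ ⁅ v ⁆
    X-eq = cnt-remove X v Xv
    J-le : cnt J ≤ cnt J′ + dg J v
    J-le = subst₂ (λ x y → x ≤ y + dg J v) (sym (cnt-sum J)) (sym (cnt-sum J′))
      (≤-trans (sum-mono λ e → ≤ᵇ-sound
         (taut 3 (λ j a b → b2n j ≤ᵇ b2n (j ∧ not (a ∨ b)) + (if j then b2n a + b2n b else 0)) (J e) (s e == v) (t e == v)))
         (≤-reflexive (∑-distrib-+ (b2n ∘ J′) (λ e → if J e then b2n (s e == v) + b2n (t e == v) else 0))))
    J′⊆ : J′ ⊆ E[ X′ ]
    J′⊆ g h = taut 5 (λ j a b x y → (x ∧ y) ⇒ᵇ (j ∧ not (a ∨ b)) ⇒ᵇ ((x ∧ not a) ∧ (y ∧ not b)))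
                (J g) (s g == v) (t g == v) (X (s g)) (X (t g)) $ᵇ J⊆ g (∧-l {J g} h) $ᵇ h
    -- Were `v` the only vertex, any edge would be a loop at `v` and contribute 2 to its degree.
    rest : Inh X′
    rest with inh⊎empty X′
    ... | inj₁ i = i
    ... | inj₂ em = ⊥-elim (1+n≰n (≤-trans two small))
      where
      edge = cnt-∃ {p = J} (≤-trans (∃-cnt v Xv) X≤J)
      e = proj₁ edge
      isv : ∀ w → X w ≡ true → w == v ≡ true
      isv w Xw = taut 2 (λ x a → x ⇒ᵇ not (x ∧ not a) ⇒ᵇ a) (X w) (w == v) $ᵇ Xw $ᵇ not-t (em w)
      ends-v = J⊆ e (proj₂ edge)
      two : 2 ≤ dg J v
      two = ≤-trans (≤-reflexive (sym at-e)) (≤-sum (λ e → if J e then b2n (s e == v) + b2n (t e == v) else 0) e)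
        where
        ≤-sum : ∀ {k} (f : Fin k → ℕ) i → f i ≤ sum f
        ≤-sum f zero    = m≤m+n _ _
        ≤-sum f (suc i) = ≤-trans (≤-sum (f ∘ suc) i) (m≤n+m _ _)
        at-e : (if J e then b2n (s e == v) + b2n (t e == v) else 0) ≡ 2
        at-e rewrite proj₂ edge | isv (s e) (∧-l {X (s e)} ends-v) | isv (t e) (∧-r {X (s e)} ends-v) = refl
  ... | no none = tabulate J , (nonempty , degrees , connected) , λ g q → trans (sym (lookup∘tabulate J g)) q
    where
    edge = cnt-∃ {p = J} (≤-trans (∃-cnt (proj₁ iX) (proj₂ iX)) X≤J)
    nonempty : Sub.Nonempty (tabulate J)
    nonempty = proj₁ edge , lookup⇒[]= _ _ (trans (lookup∘tabulate J _) (proj₂ edge))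
    ≥2 : ∀ v → X v ≡ true → 2 ≤ dg J v
    ≥2 v Xv = ≰⇒> λ q → none (v , Xv , q)
    total : sum (λ v → if X v then dg J v else 0) ≡ cnt X * 2
    total = trans (handshake J X) (trans (sum-cong-≗ λ e → per (J e) (X (s e)) (X (t e)) (J⊆ e))
              (trans (sum-*ʳ (b2n ∘ J) 2) (cong (_* 2) (trans (sym (cnt-sum J)) (≤-antisym J≤X X≤J)))))
      where
      per : ∀ (j x y : Bool) → (j ≡ true → x ∧ y ≡ true) → (if j then b2n x + b2n y else 0) ≡ b2n j * 2
      per false x y h = refl
      per true x y h with x | y | h refl
      ... | true | true | _ = refl
    degree : ∀ v → (dg J v ≡ 0) ⊎ (dg J v ≡ 2)
    degree v with X v in Xv
    ... | true = inj₂ (≤-antisym (≮⇒≥ λ big → <-irrefl (trans (sum-*ʳ (b2n ∘ X) 2) (trans (cong (_* 2) (sym (cnt-sum X))) (sym total)))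
                    (sum-strict (λ w → low w) v (at big))) (≥2 v Xv))
      where
      low : ∀ w → b2n (X w) * 2 ≤ (if X w then dg J w else 0)
      low w with X w in Xw
      ... | true  = ≥2 w Xw
      ... | false = z≤n
      at : 2 < dg J v → b2n (X v) * 2 < (if X v then dg J v else 0)
      at h rewrite Xv = h
    ... | false = inj₁ (trans (sum-cong-≗ zero-at) (sum-0 m))
      where
      zero-at : ∀ e → (if J e then b2n (s e == v) + b2n (t e == v) else 0) ≡ 0
      zero-at e with J e in Je
      ... | false = refl
      ... | true rewrite ==-f {i = s e} {v} (λ { refl → absurdᵇ (∧-l {X (s e)} (J⊆ e Je)) Xv })
                       | ==-f {i = t e} {v} (λ { refl → absurdᵇ (∧-r {X (s e)} (J⊆ e Je)) Xv }) = refl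
    degrees : ∀ v → (deg G (tabulate J) v ≡ 0) ⊎ (deg G (tabulate J) v ≡ 2)
    degrees v = subst (λ k → (k ≡ 0) ⊎ (k ≡ 2)) (sym (trans (deg-dg (tabulate J) v) (dg-cong (lookup∘tabulate J) v))) (degree v)
    connected : ∀ e e′ → e Sub.∈ tabulate J → e′ Sub.∈ tabulate J → Reach G (tabulate J) (s e) (s e′)
    connected e e′ p q = conn-reach c (at e p) (at e′ q)
      where
      at : ∀ e → e Sub.∈ tabulate J → X (s e) ≡ true
      at e p = ∧-l {X (s e)} (J⊆ e (trans (sym (lookup∘tabulate J e)) ([]=⇒lookup {xs = tabulate J} p)))

  -- A set with more edges than vertices contains a cycle through some edge d
  -- and, in a connected part, another one avoiding d.
  two-cycles : ∀ b J X → cnt J + cnt X ≤ b → J ⊆ E[ X ] → cnt X < cnt J → ∀ I → J ⊆ lookup I → ¬ BicIndep G I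
  two-cycles zero J X le _ X<J _ _ _ = 1+n≰n (≤-trans (≤-trans (s≤s z≤n) X<J) (≤-trans (m≤m+n _ _) le))
  two-cycles (suc b) J X le J⊆ X<J I J⊆I bic with cnt-∃ {p = J} (≤-trans (s≤s z≤n) X<J)
  ... | e₀ , Je₀ with conn⊎sep J X (s e₀ , ∧-l {X (s e₀)} (J⊆ e₀ Je₀))
  ...   | inj₂ (S , iA , iB , none) with cnt (X ∩ S) <? cnt (J ∩ E[ X ∩ S ])
  ...     | yes p = two-cycles b (J ∩ E[ X ∩ S ]) (X ∩ S) (s≤s⁻¹ (≤-trans (+-mono-≤-< (cnt-⊆ {p = J ∩ E[ X ∩ S ]} {q = J} λ g → ∧-l {J g}) less) le))
                      (λ g → ∧-r {J g}) p I (λ g h → J⊆I g (∧-l {J g} h)) bic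
    where
    less : cnt (X ∩ S) < cnt X
    less = ≤-trans (≤-trans (≤-reflexive (+-comm 1 _)) (+-monoʳ-≤ (cnt (X ∩ S)) (∃-cnt _ (proj₂ iB)))) (≤-reflexive (sym (cnt-split X S)))
  ...     | no ¬p = two-cycles b (J ∩ E[ X ∖ S ]) (X ∖ S) (s≤s⁻¹ (≤-trans (+-mono-≤-< (cnt-⊆ {p = J ∩ E[ X ∖ S ]} {q = J} λ g → ∧-l {J g}) less) le))
                      (λ g → ∧-r {J g})
                      (lin (cnt X ∷ cnt (X ∩ S) ∷ cnt (X ∖ S) ∷ cnt J ∷ cnt (J ∩ E[ X ∩ S ]) ∷ cnt (J ∩ E[ X ∖ S ]) ∷ [])
                          (λ { (x ∷ a ∷ b ∷ j ∷ ja ∷ jb ∷ []) → (a :+ b :≤ x) ∷ (con 1 :+ x :≤ j) ∷ (j :≤ ja :+ jb) ∷ (ja :≤ a) ∷ [] ⊢ (con 1 :+ b :≤ jb) })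
                          (≤-reflexive (sym (cnt-split X S)) , X<J , halves , ≮⇒≥ ¬p))
                      I (λ g h → J⊆I g (∧-l {J g} h)) bic
    where
    less : cnt (X ∖ S) < cnt X
    less = ≤-trans (+-monoˡ-≤ (cnt (X ∖ S)) (∃-cnt _ (proj₂ iA))) (≤-reflexive (sym (cnt-split X S)))
    halves : cnt J ≤ cnt (J ∩ E[ X ∩ S ]) + cnt (J ∩ E[ X ∖ S ])
    halves = cnt1≤2 J _ _ λ g → ≤ᵇ-sound
      (taut 5 (λ j x y a b → (j ⇒ᵇ (x ∧ y)) ⇒ᵇ not (j ∧ ((x ∧ y) ∧ (a xor b))) ⇒ᵇ
         (b2n j ≤ᵇ b2n (j ∧ ((x ∧ a) ∧ (y ∧ b))) + b2n (j ∧ ((x ∧ not a) ∧ (y ∧ not b)))))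
         (J g) (X (s g)) (X (t g)) (S (s g)) (S (t g)) $ᵇ imp (J⊆ g) $ᵇ not-t (none g))
      where
      imp : ∀ {a b} → (a ≡ true → b ≡ true) → (a ⇒ᵇ b) ≡ true
      imp {true}  h = h refl
      imp {false} h = refl
  two-cycles (suc b) J X le J⊆ X<J I J⊆I bic | e₀ , Je₀ | inj₁ c
    with find-cycle _ J X ≤-refl (Conn.inh c) J⊆ (<⇒≤ X<J)
  ... | C , cyc , C⊆J with proj₁ cyc
  ...   | d , d∈C with find-cycle _ (J ∖ ⁅ d ⁆) X ≤-refl (Conn.inh c) (λ g h → J⊆ g (∧-l {J g} h))
                         (s≤s⁻¹ (≤-trans X<J (≤-reflexive (cnt-remove J d (C⊆J d ([]=⇒lookup d∈C))))))
  ...     | C′ , cyc′ , C′⊆J with proj₁ cyc′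
  ...       | d′ , d′∈C′ = absurdᵇ (==-refl d) (not-f (∧-r {J d} (C′⊆J d (trans (cong (λ D → lookup D d) (sym same)) ([]=⇒lookup {xs = C} d∈C)))))
    where
    C′⊆ : lookup C′ ⊆ J
    C′⊆ g h = ∧-l {J g} (C′⊆J g h)
    sub : ∀ {D} → lookup D ⊆ J → D Sub.⊆ I
    sub h {x} q = lookup⇒[]= x I (J⊆I x (h x ([]=⇒lookup q)))
    same : C ≡ C′
    same = bic C C′ d d′ (sub C⊆J) (sub C′⊆) cyc cyc′ d∈C d′∈C′
      (reach-⊆ (λ {x} q → lookup⇒[]= x I (J⊆I x (trans (sym (lookup∘tabulate J x)) ([]=⇒lookup {xs = tabulate J} q))))
        (conn-reach c (∧-l {X (s d)} (J⊆ d (C⊆J d ([]=⇒lookup d∈C)))) (∧-l {X (s d′)} (J⊆ d′ (C′⊆ d′ ([]=⇒lookup d′∈C′))))))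

  bic⇒hall : ∀ I → BicIndep G I → Hall (lookup I)
  bic⇒hall I bic X = ≮⇒≥ λ h → two-cycles _ (lookup I ∩ E[ X ]) X ≤-refl (λ g → ∧-r {lookup I g}) h I (λ g → ∧-l {lookup I g}) bic

-- Unions of connected sets and spanning trees

module Trees {n m : ℕ} (s t : Fin m → Fin n) where

  open Gr s t public

  conn-single : ∀ {I} v → Conn I ⁅ v ⁆
  conn-single {I} v = (v , ==-refl v) , λ S (a , p) (b , q) →
    absurdᵇ (subst (λ z → S z ≡ true) (trans (==-t {i = a} (∧-l p)) (sym (==-t {i = b} (∧-l q)))) (∧-r {a == v} p)) (not-f (∧-r {b == v} q))

  -- A cut that splits neither `A` nor `B` has them on opposite sides; a common vertex makes this
  -- impossible and a joining edge crosses the cut.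
  conn-∪ : ∀ {I A B} → Conn I A → Conn I B → Inh (A ∩ B) ⊎ Inh (I ∩ joins A B) → Conn I (A ∪ B)
  conn-∪ {I} {A} {B} cA cB link = (proj₁ (Conn.inh cA) , ∨-l (proj₂ (Conn.inh cA))) , cut
    where
    liftA : ∀ S e → (I ∩ crosses A S) e ≡ true → (I ∩ crosses (A ∪ B) S) e ≡ true
    liftA S e h = taut 6 (λ i a a′ b b′ x → (i ∧ ((a ∧ a′) ∧ x)) ⇒ᵇ (i ∧ (((a ∨ b) ∧ (a′ ∨ b′)) ∧ x)))
      (I e) (A (s e)) (A (t e)) (B (s e)) (B (t e)) (S (s e) xor S (t e)) $ᵇ h
    liftB : ∀ S e → (I ∩ crosses B S) e ≡ true → (I ∩ crosses (A ∪ B) S) e ≡ true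
    liftB S e h = taut 6 (λ i a a′ b b′ x → (i ∧ ((b ∧ b′) ∧ x)) ⇒ᵇ (i ∧ (((a ∨ b) ∧ (a′ ∨ b′)) ∧ x)))
      (I e) (A (s e)) (A (t e)) (B (s e)) (B (t e)) (S (s e) xor S (t e)) $ᵇ h
    cut : ∀ S → Inh ((A ∪ B) ∩ S) → Inh ((A ∪ B) ∖ S) → Inh (I ∩ crosses (A ∪ B) S)
    cut S (x , hx) (y , hy) with inh⊎empty (A ∩ S) | inh⊎empty (A ∖ S) | inh⊎empty (B ∩ S) | inh⊎empty (B ∖ S)
    ... | inj₁ p | inj₁ q | _ | _ = let e , h = Conn.cut cA S p q in e , liftA S e h
    ... | _ | _ | inj₁ p | inj₁ q = let e , h = Conn.cut cB S p q in e , liftB S e h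
    ... | inj₂ p | _ | inj₂ q | _ = absurdᵇ (taut 3 (λ a b σ → not (a ∧ σ) ⇒ᵇ not (b ∧ σ) ⇒ᵇ not ((a ∨ b) ∧ σ)) (A x) (B x) (S x) $ᵇ not-t (p x) $ᵇ not-t (q x)) (cong not hx)
    ... | _ | inj₂ p | _ | inj₂ q = absurdᵇ (taut 3 (λ a b σ → not (a ∧ not σ) ⇒ᵇ not (b ∧ not σ) ⇒ᵇ not ((a ∨ b) ∧ not σ)) (A y) (B y) (S y) $ᵇ not-t (p y) $ᵇ not-t (q y)) (cong not hy)
    ... | inj₁ _ | inj₂ p | inj₂ q | inj₁ _ = mixed₁ link
      where
      mixed₁ : Inh (A ∩ B) ⊎ Inh (I ∩ joins A B) → Inh (I ∩ crosses (A ∪ B) S)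
      mixed₁ (inj₁ (w , h)) = absurdᵇ (taut 3 (λ a b σ → not (a ∧ not σ) ⇒ᵇ not (b ∧ σ) ⇒ᵇ not (a ∧ b)) (A w) (B w) (S w) $ᵇ not-t (p w) $ᵇ not-t (q w)) (cong not h)
      mixed₁ (inj₂ (e , h)) = e , (taut 7 (λ i a a′ b b′ x y → (i ∧ ((a ∧ b′) ∨ (b ∧ a′))) ⇒ᵇ not (a ∧ not x) ⇒ᵇ not (a′ ∧ not y) ⇒ᵇ not (b ∧ x) ⇒ᵇ not (b′ ∧ y) ⇒ᵇ
              (i ∧ (((a ∨ b) ∧ (a′ ∨ b′)) ∧ (x xor y)))) (I e) (A (s e)) (A (t e)) (B (s e)) (B (t e)) (S (s e)) (S (t e))
              $ᵇ h $ᵇ not-t (p (s e)) $ᵇ not-t (p (t e)) $ᵇ not-t (q (s e)) $ᵇ not-t (q (t e)))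
    ... | inj₂ p | inj₁ _ | inj₁ _ | inj₂ q = mixed₂ link
      where
      mixed₂ : Inh (A ∩ B) ⊎ Inh (I ∩ joins A B) → Inh (I ∩ crosses (A ∪ B) S)
      mixed₂ (inj₁ (w , h)) = absurdᵇ (taut 3 (λ a b σ → not (a ∧ σ) ⇒ᵇ not (b ∧ not σ) ⇒ᵇ not (a ∧ b)) (A w) (B w) (S w) $ᵇ not-t (p w) $ᵇ not-t (q w)) (cong not h)
      mixed₂ (inj₂ (e , h)) = e , (taut 7 (λ i a a′ b b′ x y → (i ∧ ((a ∧ b′) ∨ (b ∧ a′))) ⇒ᵇ not (a ∧ x) ⇒ᵇ not (a′ ∧ y) ⇒ᵇ not (b ∧ not x) ⇒ᵇ not (b′ ∧ not y) ⇒ᵇ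
              (i ∧ (((a ∨ b) ∧ (a′ ∨ b′)) ∧ (x xor y)))) (I e) (A (s e)) (A (t e)) (B (s e)) (B (t e)) (S (s e)) (S (t e))
              $ᵇ h $ᵇ not-t (p (s e)) $ᵇ not-t (p (t e)) $ᵇ not-t (q (s e)) $ᵇ not-t (q (t e)))

  -- A tree is recorded by connectedness and an upper bound on its size, the only two facts that
  -- counting needs; `spanning` gives the matching lower bound.
  record SpanTree (J : BSet m) (A : BSet n) : Set where
    field
      tree : BSet m
      sub  : tree ⊆ J ∩ E[ A ]
      conn : Conn tree A
      card : suc (cnt tree) ≤ cnt A

  span-tree : ∀ {J A} → Conn J A → SpanTree J A
  span-tree {J} {A} c@((a , Aa) , _) =
    go _ ⁅ a ⁆ ε (λ v h → subst (λ v → A v ≡ true) (sym (==-t {i = v} h)) Aa) (conn-single a) (λ _ ())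
      (≤-reflexive (trans (cong suc (cnt-none (λ _ → refl))) (sym (sum-== a)))) ≤-refl
    where
    go : ∀ b K T → K ⊆ A → Conn T K → T ⊆ J ∩ E[ K ] → suc (cnt T) ≤ cnt K → cnt (A ∖ K) ≤ b → SpanTree J A
    go b K T K⊆A cT T⊆ sz le with inh⊎empty (A ∖ K)
    ... | inj₂ em = record { tree = T ; conn = Conn-resp {T} same cT ; card = subst (suc (cnt T) ≤_) (cnt-cong same) sz
                           ; sub = λ e h → let p = T⊆ e h in ∧-l {J e} p ∧ⁱ K⊆A _ (∧-l {K (s e)} (∧-r {J e} p)) ∧ⁱ K⊆A _ (∧-r {K (s e)} (∧-r {J e} p)) }
      where
      same : ∀ v → K v ≡ A v
      same v with K v in Kv | A v in Av | em v
      ... | true  | true  | _ = refl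
      ... | false | false | _ = refl
      ... | true  | false | _ = absurdᵇ (K⊆A v Kv) Av
    go zero K T _ _ _ _ le | inj₁ (v , q) = ⊥-elim (1+n≰n (≤-trans (∃-cnt v q) le))
    go (suc b) K T K⊆A cT T⊆ sz le | inj₁ (w , q) with exit c (proj₁ (Conn.inh cT) , K⊆A _ (proj₂ (Conn.inh cT)) ∧ⁱ proj₂ (Conn.inh cT)) (w , q)
    ... | e , u , v , Je , Au , Ku , Av , Kv , es = go b (K ∪ ⁅ v ⁆) T′ K′⊆A
          (conn-∪ (Conn-mono (λ _ → ∨-l) cT) (conn-single v) (inj₂ (e , ∨-r {T e} (==-refl e) ∧ⁱ by-ends (λ x y → (K x ∧ y == v) ∨ (x == v ∧ K y) ≡ true) es
              (∨-l (Ku ∧ⁱ ==-refl v)) (∨-r {K v ∧ u == v} (==-refl v ∧ⁱ Ku)))))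
          T′⊆ (≤-trans (s≤s grow1) (≤-trans (s≤s sz) (≤-reflexive (sym (cnt-insert K v Kv)))))
          (s≤s⁻¹ (≤-trans (cnt-⊂ {p = A ∖ (K ∪ ⁅ v ⁆)} {q = A ∖ K}
            (λ i → (taut 3 (λ a k z → (a ∧ not (k ∨ z)) ⇒ᵇ (a ∧ not k)) (A i) (K i) (i == v)) $ᵇ_) v
            (trans (cong (λ z → A v ∧ not (K v ∨ z)) (==-refl v)) (not-f (taut 2 (λ a k → not (a ∧ not (k ∨ true))) (A v) (K v)))) (Av ∧ⁱ not-t Kv)) le))
      where
      T′ = T ∪ ⁅ e ⁆
      K′⊆A : K ∪ ⁅ v ⁆ ⊆ A
      K′⊆A x h with ∨-case {K x} h
      ... | inj₁ p = K⊆A x p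
      ... | inj₂ p rewrite ==-t {i = x} p = Av
      T′⊆ : T′ ⊆ J ∩ E[ K ∪ ⁅ v ⁆ ]
      T′⊆ g h with ∨-case {T g} h
      ... | inj₁ p = ∧-l {J g} (T⊆ g p) ∧ⁱ ∨-l (∧-l {K (s g)} (∧-r {J g} (T⊆ g p))) ∧ⁱ ∨-l (∧-r {K (s g)} (∧-r {J g} (T⊆ g p)))
      ... | inj₂ p rewrite ==-t {i = g} p = Je ∧ⁱ by-ends (λ x y → (K x ∨ x == v) ∧ (K y ∨ y == v) ≡ true) es
              (∨-l Ku ∧ⁱ ∨-r {K v} (==-refl v)) (∨-r {K v} (==-refl v) ∧ⁱ ∨-l Ku)
      grow1 : cnt T′ ≤ suc (cnt T)
      grow1 = ≤-trans (cnt1≤2 T′ ⁅ e ⁆ T λ i → ≤ᵇ-sound (taut 2 (λ a b → b2n (a ∨ b) ≤ᵇ b2n b + b2n a) (T i) (i == e))) (≤-reflexive (cong (_+ cnt T) (sum-== e)))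

-- Deciding the Hall condition of a concrete graph

allᵛ : ∀ k → (Vec Bool k → Bool) → Bool
allᵛ zero    f = f []
allᵛ (suc k) f = allᵛ k (λ v → f (true ∷ v)) ∧ allᵛ k (λ v → f (false ∷ v))

allᵛ-sound : ∀ k f → allᵛ k f ≡ true → ∀ v → f v ≡ true
allᵛ-sound zero    f p []          = p
allᵛ-sound (suc k) f p (true ∷ v)  = allᵛ-sound k _ (∧-l p) v
allᵛ-sound (suc k) f p (false ∷ v) = allᵛ-sound k _ (∧-r {allᵛ k (λ v → f (true ∷ v))} p) v

allᵛ-complete : ∀ k f → (∀ v → f v ≡ true) → allᵛ k f ≡ true
allᵛ-complete zero    f p = p []
allᵛ-complete (suc k) f p = allᵛ-complete k _ (λ v → p (true ∷ v)) ∧ⁱ allᵛ-complete k _ (λ v → p (false ∷ v))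

-- Written with plain sums because the opaque `cnt` would block evaluation.
hallᵇ : ∀ {k h} (a b : Fin h → Fin k) → BSet h → Bool
hallᵇ {k} a b I = allᵛ k λ X → sum (λ e → b2n (I e ∧ (lookup X (a e) ∧ lookup X (b e)))) ≤ᵇ sum (λ i → b2n (lookup X i))

≤ᵇ-complete : ∀ {m n} → m ≤ n → (m ≤ᵇ n) ≡ true
≤ᵇ-complete p = T-true (≤⇒≤ᵇ p)

module _ {k h : ℕ} (a b : Fin h → Fin k) where
  open Gr a b

  hallᵇ-sound : ∀ I → hallᵇ a b I ≡ true → Hall I
  hallᵇ-sound I p X = subst₂ _≤_
    (trans (sum-cong-≗ λ e → cong (λ x → b2n (I e ∧ x)) (cong₂ _∧_ (lookup∘tabulate X (a e)) (lookup∘tabulate X (b e)))) (sym (cnt-sum (I ∩ E[ X ]))))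
    (trans (sum-cong-≗ λ i → cong b2n (lookup∘tabulate X i)) (sym (cnt-sum X)))
    (≤ᵇ-sound (allᵛ-sound k _ p (tabulate X)))

  hallᵇ-complete : ∀ I → Hall I → hallᵇ a b I ≡ true
  hallᵇ-complete I p = allᵛ-complete k _ λ X → ≤ᵇ-complete (subst₂ _≤_ (cnt-sum (I ∩ E[ lookup X ])) (cnt-sum (lookup X)) (p (lookup X)))

-- Images of edge sets under injections

module Image {h m : ℕ} (f : Fin h → Fin m) (inj : ∀ x y → f x ≡ f y → x ≡ y) where

  im : BSet h → BSet m
  im K e = does (any? λ y → (K y ∧ f y == e) ≟ᵇ true)

  im-∋ : ∀ {K} y → K y ≡ true → im K (f y) ≡ true
  im-∋ y p = dec-t (any? _) (y , p ∧ⁱ ==-refl (f y))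

  im-∈ : ∀ {K e} → im K e ≡ true → ∃ λ y → K y ≡ true × f y ≡ e
  im-∈ {K} {e} p with does-t (any? λ y → (K y ∧ f y == e) ≟ᵇ true) p
  ... | y , q = y , ∧-l q , ==-t (∧-r {K y} q)

  im-at : ∀ K y → im K (f y) ≡ K y
  im-at K y with K y in eq
  ... | true  = im-∋ y eq
  ... | false = ¬t⇒f λ p → let z , Kz , e = im-∈ {K} p in absurdᵇ (subst (λ w → K w ≡ true) (inj z y e) Kz) eq

  im-cnt : ∀ K g → cnt (im K ∩ g) ≡ cnt (λ y → K y ∧ g (f y))
  im-cnt K g = begin
    cnt (im K ∩ g)                                              ≡⟨ cnt-sum (im K ∩ g) ⟩
    sum (λ e → b2n (im K e ∧ g e))                              ≡⟨ sum-cong-≗ per ⟩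
    sum (λ e → sum λ y → b2n ((K y ∧ g (f y)) ∧ f y == e))      ≡⟨ ∑-comm (λ e y → b2n ((K y ∧ g (f y)) ∧ f y == e)) ⟩
    sum (λ y → sum λ e → b2n ((K y ∧ g (f y)) ∧ f y == e))      ≡⟨ sum-cong-≗ (λ y → sum-pick (λ _ → K y ∧ g (f y)) (f y)) ⟩
    sum (λ y → b2n (K y ∧ g (f y)))                             ≡⟨ sym (cnt-sum (λ y → K y ∧ g (f y))) ⟩
    cnt (λ y → K y ∧ g (f y))                                   ∎
    where
    open ≡-Reasoning
    per : ∀ e → b2n (im K e ∧ g e) ≡ sum (λ y → b2n ((K y ∧ g (f y)) ∧ f y == e))
    per e with all-true? (λ y → f y == e)
    ... | yes (y , q) rewrite sym (==-t {i = f y} {e} q) | im-at K y =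
      trans (sym (sum-pick (λ y → K y ∧ g (f y)) y)) (sum-cong-≗ λ z → cong (λ b → b2n ((K z ∧ g (f z)) ∧ b)) (same z))
      where
      same : ∀ z → y == z ≡ f z == f y
      same z with y ≟ᶠ z
      ... | yes refl = sym (==-refl (f y))
      ... | no ne = sym (==-f λ e → ne (sym (inj z y e)))
    ... | no none = trans (cong (λ b → b2n (b ∧ g e)) (¬t⇒f λ p → let y , _ , q = im-∈ {K} p in none (y , subst (λ z → f y == z ≡ true) q (==-refl (f y)))))
      (trans (sym (sum-0 h)) (sum-cong-≗ λ y → zero-at y))
      where
      zero-at : ∀ y → 0 ≡ b2n ((K y ∧ g (f y)) ∧ f y == e)
      zero-at y rewrite ¬t⇒f {f y == e} (λ q → none (y , q)) with K y ∧ g (f y)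
      ... | true  = refl
      ... | false = refl

module _ {h₀ h m} (ι : Fin h₀ → Fin h) (f : Fin h → Fin m) (ι-inj : ∀ x y → ι x ≡ ι y → x ≡ y) (f-inj : ∀ x y → f x ≡ f y → x ≡ y)
         (fι-inj : ∀ x y → f (ι x) ≡ f (ι y) → x ≡ y) where

  private
    module Ι = Image ι ι-inj
    module I = Image f f-inj
    module F = Image (f ∘ ι) fι-inj

  im-∪-∘ : ∀ S L e → I.im (L ∪ Ι.im S) e ≡ F.im S e ∨ I.im L e
  im-∪-∘ S L e with I.im (L ∪ Ι.im S) e in p
  ... | true with I.im-∈ {L ∪ Ι.im S} p
  ...   | y , r , refl with ∨-case {L y} r
  ...     | inj₁ l = sym (∨-r {F.im S (f y)} (I.im-∋ {L} y l))
  ...     | inj₂ q with Ι.im-∈ {S} q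
  ...       | x , Sx , refl = sym (∨-l (F.im-∋ {S} x Sx))
  im-∪-∘ S L e | false = sym (¬t⇒f λ q → [ (λ u → absurdᵇ (from-S (F.im-∈ {S} u)) p)
                                          , (λ u → absurdᵇ (from-L (I.im-∈ {L} u)) p) ]′ (∨-case {F.im S e} q))
      where
      from-S : (∃ λ x → S x ≡ true × f (ι x) ≡ e) → I.im (L ∪ Ι.im S) e ≡ true
      from-S (x , Sx , refl) = I.im-∋ {L ∪ Ι.im S} (ι x) (∨-r {L (ι x)} (Ι.im-∋ {S} x Sx))
      from-L : (∃ λ y → L y ≡ true × f y ≡ e) → I.im (L ∪ Ι.im S) e ≡ true
      from-L (y , Ly , refl) = I.im-∋ {L ∪ Ι.im S} y (∨-l Ly)

-- Quotients: disjoint connected parts become single vertices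

module Parts {n m k : ℕ} (s t : Fin m → Fin n) (lab : Fin n → Maybe (Fin k)) where

  open Trees s t

  part : Fin k → BSet n
  part i v = maybe (_== i) false (lab v)

  part-t : ∀ {i v} → part i v ≡ true → lab v ≡ just i
  part-t {i} {v} p with lab v
  ... | just j = cong just (==-t p)

  t-part : ∀ {i v} → lab v ≡ just i → part i v ≡ true
  t-part {i} p rewrite p = ==-refl i

  parts : BSet k → BSet n
  parts X v = maybe X false (lab v)

  cnt-parts : ∀ (Y : BSet n) X → sum (λ i → b2n (X i) * cnt (Y ∩ part i)) ≡ cnt (Y ∩ parts X)
  cnt-parts Y X = begin
    sum (λ i → b2n (X i) * cnt (Y ∩ part i))              ≡⟨ sum-cong-≗ (λ i → scale (X i) i) ⟩
    sum (λ i → sum λ v → b2n (X i ∧ (Y v ∧ part i v)))    ≡⟨ ∑-comm (λ i v → b2n (X i ∧ (Y v ∧ part i v))) ⟩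
    sum (λ v → sum λ i → b2n (X i ∧ (Y v ∧ part i v)))    ≡⟨ sum-cong-≗ per ⟩
    sum (λ v → b2n (Y v ∧ parts X v))                     ≡⟨ sym (cnt-sum (Y ∩ parts X)) ⟩
    cnt (Y ∩ parts X)                                     ∎
    where
    open ≡-Reasoning
    scale : ∀ (c : Bool) i → b2n c * cnt (Y ∩ part i) ≡ sum λ v → b2n (c ∧ (Y v ∧ part i v))
    scale true  i = trans (+-identityʳ _) (cnt-sum (Y ∩ part i))
    scale false i = sym (sum-0 n)
    per : ∀ v → sum (λ i → b2n (X i ∧ (Y v ∧ part i v))) ≡ b2n (Y v ∧ parts X v)
    per v with lab v | Y v
    ... | nothing | true  = trans (sum-cong-≗ λ i → cong b2n (not-f (taut 1 (λ x → not (x ∧ false)) (X i)))) (sum-0 k)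
    ... | nothing | false = trans (sum-cong-≗ λ i → cong b2n (not-f (taut 1 (λ x → not (x ∧ false)) (X i)))) (sum-0 k)
    ... | just j  | false = trans (sum-cong-≗ λ i → cong b2n (not-f (taut 1 (λ x → not (x ∧ false)) (X i)))) (sum-0 k)
    ... | just j  | true  = sum-pick X j

  module _ {J : BSet m} (trees : ∀ i → SpanTree J (part i)) where

    tr : Fin k → BSet m
    tr i = SpanTree.tree (trees i)

    -- The union of the trees. The tree of a part stays inside the part, so the label of one end of
    -- an edge tells which tree to consult.
    T∪ : BSet m
    T∪ e = maybe (λ i → tr i e) false (lab (s e))

    tr-lab : ∀ {i e} → tr i e ≡ true → lab (s e) ≡ just i × lab (t e) ≡ just i
    tr-lab {i} {e} p = let q = ∧-r {J e} (SpanTree.sub (trees i) e p) in part-t (∧-l {part i (s e)} q) , part-t (∧-r {part i (s e)} q)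

    sum-trees : ∀ (g : BSet m) X → sum (λ i → b2n (X i) * cnt (g ∩ tr i)) ≡ cnt (λ e → T∪ e ∧ (g e ∧ parts X (s e)))
    sum-trees g X = begin
      sum (λ i → b2n (X i) * cnt (g ∩ tr i))              ≡⟨ sum-cong-≗ (λ i → scale (X i) i) ⟩
      sum (λ i → sum λ e → b2n (X i ∧ (g e ∧ tr i e)))    ≡⟨ ∑-comm (λ i e → b2n (X i ∧ (g e ∧ tr i e))) ⟩
      sum (λ e → sum λ i → b2n (X i ∧ (g e ∧ tr i e)))    ≡⟨ sum-cong-≗ per ⟩
      sum (λ e → b2n (T∪ e ∧ (g e ∧ parts X (s e))))      ≡⟨ sym (cnt-sum _) ⟩
      cnt (λ e → T∪ e ∧ (g e ∧ parts X (s e)))            ∎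
      where
      open ≡-Reasoning
      scale : ∀ (c : Bool) i → b2n c * cnt (g ∩ tr i) ≡ sum λ e → b2n (c ∧ (g e ∧ tr i e))
      scale true  i = trans (+-identityʳ _) (cnt-sum (g ∩ tr i))
      scale false i = sym (sum-0 m)
      off : ∀ e i → ¬ (lab (s e) ≡ just i) → b2n (X i ∧ (g e ∧ tr i e)) ≡ 0
      off e i ne rewrite ¬t⇒f {tr i e} (λ p → ne (proj₁ (tr-lab {i} {e} p))) with X i | g e
      ... | true  | true  = refl
      ... | true  | false = refl
      ... | false | _     = refl
      per : ∀ e → sum (λ i → b2n (X i ∧ (g e ∧ tr i e))) ≡ b2n (T∪ e ∧ (g e ∧ parts X (s e)))
      per e with lab (s e) in eq
      ... | nothing = trans (sum-cong-≗ λ i → off e i λ q → contradiction (trans (sym eq) q) λ ()) (sum-0 k)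
      ... | just j  = trans (sum-cong-≗ one) (trans (sum-pick (λ i → tr i e ∧ (g e ∧ X i)) j) refl)
        where
        one : ∀ i → b2n (X i ∧ (g e ∧ tr i e)) ≡ b2n ((tr i e ∧ (g e ∧ X i)) ∧ j == i)
        one i with j ≟ᶠ i
        ... | yes refl with X j | g e | tr j e
        ...   | true  | true  | true  = refl
        ...   | true  | true  | false = refl
        ...   | true  | false | true  = refl
        ...   | true  | false | false = refl
        ...   | false | true  | true  = refl
        ...   | false | true  | false = refl
        ...   | false | false | true  = refl
        ...   | false | false | false = refl
        one i | no ne = trans (off e i λ q → ne (just-injective (trans (sym eq) q)))
          (cong b2n (sym (not-f (taut 1 (λ x → not (x ∧ false)) (tr i e ∧ (g e ∧ X i))))))

module Quotient {n m k h : ℕ} (s t : Fin m → Fin n) (lab : Fin n → Maybe (Fin k))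
                (a b : Fin h → Fin k) (sel : Fin h → Fin m) (inj : ∀ x y → sel x ≡ sel y → x ≡ y) where

  open Trees s t
  open Parts s t lab
  open Image sel inj
  private module H = Gr a b

  module _ {J : BSet m} (trees : ∀ i → SpanTree J (part i)) where

    Typed : Fin h → Set
    Typed y = (lab (s (sel y)) ≡ just (a y) × lab (t (sel y)) ≡ just (b y)) ⊎
              (lab (s (sel y)) ≡ just (b y) × lab (t (sel y)) ≡ just (a y))

    module _ (typed : ∀ y → Typed y) (off : ∀ y → T∪ trees (sel y) ≡ false) where

      -- For X ⊆ Fin k the trees use up cnt (part i) - 1 of the bound for each i in X.
      quotient-→ : ∀ K → Hall (im K ∪ T∪ trees) → H.Hall K
      quotient-→ K hall X =
        lin (cnt (K ∩ H.E[ X ]) ∷ cnt (im K ∩ E[ Y ]) ∷ sum (λ i → b2n (X i) * cnt (full ∩ tr trees i)) ∷ cnt (T∪ trees ∩ E[ Y ]) ∷ cnt ((im K ∪ T∪ trees) ∩ E[ Y ]) ∷ cnt Y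
             ∷ sum (λ i → b2n (X i) * cnt (full ∩ part i)) ∷ cnt X ∷ [])
          (λ { (k ∷ i ∷ st ∷ ty ∷ u ∷ y ∷ sp ∷ x ∷ []) → (k :≤ i) ∷ (st :≤ ty) ∷ (i :+ ty :≤ u) ∷ (u :≤ y) ∷ (y :≤ sp) ∷ (sp :≤ st :+ x) ∷ [] ⊢ (k :≤ x) })
          (edges , trees-in , split , hall Y , ≤-reflexive (sym (trans (cnt-parts full X) (cnt-cong {p = full ∩ Y} {q = Y} λ _ → refl))) , sizes)
        where
        Y = parts X
        edges : cnt (K ∩ H.E[ X ]) ≤ cnt (im K ∩ E[ Y ])
        edges = ≤-reflexive (sym (trans (im-cnt K E[ Y ]) (cnt-cong λ y → cong (K y ∧_) (at y))))
          where
          at : ∀ y → E[ Y ] (sel y) ≡ X (a y) ∧ X (b y)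
          at y with typed y
          ... | inj₁ (p , q) rewrite p | q = refl
          ... | inj₂ (p , q) rewrite p | q with X (a y) | X (b y)
          ...   | true  | true  = refl
          ...   | true  | false = refl
          ...   | false | true  = refl
          ...   | false | false = refl
        trees-in : sum (λ i → b2n (X i) * cnt (full ∩ tr trees i)) ≤ cnt (T∪ trees ∩ E[ Y ])
        trees-in = ≤-trans (≤-reflexive (sum-trees trees full X)) (cnt-⊆ inside)
          where
          inside : ∀ e → T∪ trees e ∧ (true ∧ Y (s e)) ≡ true → (T∪ trees ∩ E[ Y ]) e ≡ true
          inside e p with lab (s e) in eq
          ... | just j rewrite proj₂ (tr-lab trees {j} {e} (∧-l p)) = ∧-l {tr trees j e} p ∧ⁱ ∧-r {tr trees j e} p ∧ⁱ ∧-r {tr trees j e} p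
        split : cnt (im K ∩ E[ Y ]) + cnt (T∪ trees ∩ E[ Y ]) ≤ cnt ((im K ∪ T∪ trees) ∩ E[ Y ])
        split = cnt2≤1 _ _ _ λ e → ≤ᵇ-sound (taut 3 (λ i t y → not (i ∧ t) ⇒ᵇ (b2n (i ∧ y) + b2n (t ∧ y) ≤ᵇ b2n ((i ∨ t) ∧ y))) (im K e) (T∪ trees e) (E[ Y ] e)
                  $ᵇ not-t (¬t⇒f λ p → let y , _ , q = im-∈ {K} (∧-l p) in absurdᵇ (∧-r {im K e} p) (subst (λ z → T∪ trees z ≡ false) q (off y))))
        sizes : sum (λ i → b2n (X i) * cnt (full ∩ part i)) ≤ sum (λ i → b2n (X i) * cnt (full ∩ tr trees i)) + cnt X
        sizes = ≤-trans (sum-mono λ i → one (X i) i) (≤-reflexive (trans (∑-distrib-+ (λ i → b2n (X i) * cnt (full ∩ tr trees i)) (b2n ∘ X)) (cong (sum (λ i → b2n (X i) * cnt (full ∩ tr trees i)) +_) (sym (cnt-sum X)))))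
          where
          one : ∀ (c : Bool) i → b2n c * cnt (full ∩ part i) ≤ b2n c * cnt (full ∩ tr trees i) + b2n c
          one false i = z≤n
          one true  i rewrite +-identityʳ (cnt (full ∩ part i)) | +-identityʳ (cnt (full ∩ tr trees i)) =
            ≤-trans (spanning (SpanTree.conn (trees i))) (≤-trans (s≤s (cnt-⊆ λ e → ∧-l {tr trees i e})) (≤-reflexive (+-comm 1 _)))

      -- Conversely a tree has fewer edges than vertices inside every set meeting its part.
      quotient-← : ∀ K → H.Hall K → Hall (im K ∪ T∪ trees)
      quotient-← K hall Y =
        lin (cnt ((im K ∪ T∪ trees) ∩ E[ Y ]) ∷ cnt (im K ∩ E[ Y ]) ∷ cnt (T∪ trees ∩ E[ Y ]) ∷ cnt (K ∩ H.E[ X ]) ∷ cnt X ∷ sum (λ i → b2n (X i) * cnt (E[ Y ] ∩ tr trees i))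
             ∷ sum (λ i → b2n (X i) * cnt (Y ∩ part i)) ∷ cnt Y ∷ [])
          (λ { (u ∷ i ∷ ty ∷ k ∷ x ∷ st ∷ sp ∷ y ∷ []) → (u :≤ i :+ ty) ∷ (i :≤ k) ∷ (k :≤ x) ∷ (ty :≤ st) ∷ (st :+ x :≤ sp) ∷ (sp :≤ y) ∷ [] ⊢ (u :≤ y) })
          ( cnt1≤2 _ _ _ (λ e → ≤ᵇ-sound (taut 3 (λ i t y → b2n ((i ∨ t) ∧ y) ≤ᵇ b2n (i ∧ y) + b2n (t ∧ y)) (im K e) (T∪ trees e) (E[ Y ] e)))
          , edges , hall X , trees-in , sizes , ≤-trans (≤-reflexive (cnt-parts Y X)) (cnt-⊆ λ v → ∧-l {Y v}))
        where
        X : BSet k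
        X i = does (all-true? (Y ∩ part i))
        X-∋ : ∀ {i v} → Y v ≡ true → lab v ≡ just i → X i ≡ true
        X-∋ {i} {v} p q = dec-t (all-true? (Y ∩ part i)) (v , p ∧ⁱ t-part q)
        edges : cnt (im K ∩ E[ Y ]) ≤ cnt (K ∩ H.E[ X ])
        edges = ≤-trans (≤-reflexive (im-cnt K E[ Y ])) (cnt-⊆ λ y p → ∧-l {K y} p ∧ⁱ at y (∧-r {K y} p))
          where
          at : ∀ y → E[ Y ] (sel y) ≡ true → X (a y) ∧ X (b y) ≡ true
          at y p with typed y
          ... | inj₁ (q , r) = X-∋ (∧-l {Y (s (sel y))} p) q ∧ⁱ X-∋ (∧-r {Y (s (sel y))} p) r
          ... | inj₂ (q , r) = X-∋ (∧-r {Y (s (sel y))} p) r ∧ⁱ X-∋ (∧-l {Y (s (sel y))} p) q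
        trees-in : cnt (T∪ trees ∩ E[ Y ]) ≤ sum (λ i → b2n (X i) * cnt (E[ Y ] ∩ tr trees i))
        trees-in = ≤-trans (cnt-⊆ inside) (≤-reflexive (sym (sum-trees trees E[ Y ] X)))
          where
          inside : ∀ e → (T∪ trees ∩ E[ Y ]) e ≡ true → T∪ trees e ∧ (E[ Y ] e ∧ parts X (s e)) ≡ true
          inside e p with lab (s e) in eq
          ... | just j = ∧-l {tr trees j e} p ∧ⁱ ∧-r {tr trees j e} p ∧ⁱ X-∋ (∧-l {Y (s e)} (∧-r {tr trees j e} p)) eq
        sizes : sum (λ i → b2n (X i) * cnt (E[ Y ] ∩ tr trees i)) + cnt X ≤ sum (λ i → b2n (X i) * cnt (Y ∩ part i))
        sizes = ≤-trans (≤-reflexive (trans (cong (sum (λ i → b2n (X i) * cnt (E[ Y ] ∩ tr trees i)) +_) (cnt-sum X)) (sym (∑-distrib-+ (λ i → b2n (X i) * cnt (E[ Y ] ∩ tr trees i)) (b2n ∘ X)))))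
                  (sum-mono λ i → one i)
          where
          one : ∀ i → b2n (X i) * cnt (E[ Y ] ∩ tr trees i) + b2n (X i) ≤ b2n (X i) * cnt (Y ∩ part i)
          one i with all-true? (Y ∩ part i)
          ... | no _ = z≤n
          ... | yes (w , hw) rewrite +-identityʳ (cnt (E[ Y ] ∩ tr trees i)) | +-identityʳ (cnt (Y ∩ part i)) =
            -- Growing `Y ∩ part i` to the whole part uses one tree edge per added vertex, and the
            -- tree has fewer edges than the part has vertices.
            lin (cnt (E[ Y ] ∩ tr trees i) ∷ cnt (tr trees i ∩ E[ Y ∩ part i ]) ∷ cnt (part i ∖ (Y ∩ part i)) ∷ cnt (tr trees i ∩ E[ part i ]) ∷ cnt (tr trees i) ∷ cnt (part i) ∷ cnt (Y ∩ part i) ∷ [])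
              (λ { (x ∷ x′ ∷ r ∷ f ∷ t ∷ p ∷ y ∷ []) → (x :≤ x′) ∷ (x′ :+ r :≤ f) ∷ (f :≤ t) ∷ (con 1 :+ t :≤ p) ∷ (p :≤ y :+ r) ∷ [] ⊢ (x :+ con 1 :≤ y) })
              ( cnt-⊆ inner , grow (SpanTree.conn (trees i)) (λ v → ∧-r {Y v}) (w , hw) , cnt-⊆ (λ e → ∧-l {tr trees i e}) , SpanTree.card (trees i)
              , cnt1≤2 _ _ _ (λ v → ≤ᵇ-sound (taut 2 (λ p y → b2n p ≤ᵇ b2n (y ∧ p) + b2n (p ∧ not (y ∧ p))) (part i v) (Y v))))
            where
            inner : ∀ e → (E[ Y ] ∩ tr trees i) e ≡ true → (tr trees i ∩ E[ Y ∩ part i ]) e ≡ true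
            inner e p = let q = ∧-r {E[ Y ] e} p ; r = ∧-l {E[ Y ] e} p ; l = tr-lab trees {i} {e} q in
              q ∧ⁱ (∧-l {Y (s e)} r ∧ⁱ t-part (proj₁ l)) ∧ⁱ (∧-r {Y (s e)} r ∧ⁱ t-part (proj₂ l))

-- Minors obtained by contracting disjoint connected parts

bool-iff : ∀ {a b} → (a ≡ true → b ≡ true) → (b ≡ true → a ≡ true) → a ≡ b
bool-iff {true}          h k = sym (h refl)
bool-iff {false} {true}  h k = k refl
bool-iff {false} {false} h k = refl

lookup-∪ : ∀ {n} (A B : Vec Bool n) i → lookup (A Sub.∪ B) i ≡ lookup A i ∨ lookup B i
lookup-∪ A B i = lookup-zipWith _∨_ i A B

-- A pattern prescribes the number of edges of each type (i , j).

Req : ℕ → Set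
Req k = Fin k × Fin k × ℕ

expand : ∀ {k} → List (Req k) → List (Fin k × Fin k)
expand []                 = []
expand ((i , j , c) ∷ rs) = List.replicate c (i , j) ++ expand rs

sameType : ∀ {k} → Fin k → Fin k → Req k → Bool
sameType i j (i′ , j′ , _) = (i == i′ ∧ j == j′) ∨ (i == j′ ∧ j == i′)

fresh : ∀ {k} → Fin k → Fin k → List (Req k) → Bool
fresh i j []       = true
fresh i j (r ∷ rs) = not (sameType i j r) ∧ fresh i j rs

-- Requirements of different unordered types never compete for an edge, so each can be counted and
-- served independently.
distinct : ∀ {k} → List (Req k) → Bool
distinct []                 = true
distinct ((i , j , c) ∷ rs) = fresh i j rs ∧ distinct rs

module Select {n m k : ℕ} (s t : Fin m → Fin n) (lab : Fin n → Maybe (Fin k)) where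

  ty : Fin k → Fin k → BSet m
  ty i j e = (maybe (_== i) false (lab (s e)) ∧ maybe (_== j) false (lab (t e))) ∨
             (maybe (_== j) false (lab (s e)) ∧ maybe (_== i) false (lab (t e)))

  private
    lab-t : ∀ {i v} → maybe (_== i) false (lab v) ≡ true → lab v ≡ just i
    lab-t {i} {v} p with lab v
    ... | just j = cong just (==-t p)

  ty-lab : ∀ {i j e} → ty i j e ≡ true →
           (lab (s e) ≡ just i × lab (t e) ≡ just j) ⊎ (lab (s e) ≡ just j × lab (t e) ≡ just i)
  ty-lab {i} {j} {e} h with ∨-case h
  ... | inj₁ p = inj₁ (lab-t (∧-l p) , lab-t (∧-r {maybe (_== i) false (lab (s e))} p))
  ... | inj₂ p = inj₂ (lab-t (∧-l p) , lab-t (∧-r {maybe (_== j) false (lab (s e))} p))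

  ty-unique : ∀ {i j r e} → ty i j e ≡ true → ty (proj₁ r) (proj₁ (proj₂ r)) e ≡ true → sameType i j r ≡ true
  ty-unique {i} {j} {i′ , j′ , c} {e} p q with ty-lab {i} {j} {e} p | ty-lab {i′} {j′} {e} q
  ... | inj₁ (a , b) | inj₁ (a′ , b′) rewrite just-injective (trans (sym a) a′) | just-injective (trans (sym b) b′) = ∨-l (==-refl i′ ∧ⁱ ==-refl j′)
  ... | inj₁ (a , b) | inj₂ (a′ , b′) rewrite just-injective (trans (sym a) a′) | just-injective (trans (sym b) b′) = ∨-r {j′ == i′ ∧ i′ == j′} (==-refl j′ ∧ⁱ ==-refl i′)
  ... | inj₂ (a , b) | inj₁ (a′ , b′) rewrite just-injective (trans (sym a) a′) | just-injective (trans (sym b) b′) = ∨-r {j′ == i′ ∧ i′ == j′} (==-refl j′ ∧ⁱ ==-refl i′)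
  ... | inj₂ (a , b) | inj₂ (a′ , b′) rewrite just-injective (trans (sym a) a′) | just-injective (trans (sym b) b′) = ∨-l (==-refl i′ ∧ⁱ ==-refl j′)

  -- Every chosen edge leaves the pool, which makes the selection injective by construction.
  data Sel (J : BSet m) : List (Fin k × Fin k) → Set where
    []   : Sel J []
    pick : ∀ {i j es} e → J e ≡ true → ty i j e ≡ true → Sel (J ∖ ⁅ e ⁆) es → Sel J ((i , j) ∷ es)

  at : ∀ {J es} → Sel J es → Fin (List.length es) → Fin m
  at (pick e _ _ S) zero    = e
  at (pick e _ _ S) (suc y) = at S y

  at-J : ∀ {J es} (S : Sel J es) y → J (at S y) ≡ true
  at-J     (pick e p _ S) zero    = p
  at-J {J} (pick e _ _ S) (suc y) = ∧-l {J (at S y)} (at-J S y)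

  at-ty : ∀ {J es} (S : Sel J es) y → ty (proj₁ (List.lookup es y)) (proj₂ (List.lookup es y)) (at S y) ≡ true
  at-ty (pick e _ q S) zero    = q
  at-ty (pick e _ _ S) (suc y) = at-ty S y

  at-≢ : ∀ {J es} e (S : Sel (J ∖ ⁅ e ⁆) es) y → ¬ e ≡ at S y
  at-≢ {J} e S y eq = absurdᵇ (subst (λ z → z == e ≡ true) eq (==-refl e)) (not-f (∧-r {J (at S y)} (at-J S y)))

  at-inj : ∀ {J es} (S : Sel J es) x y → at S x ≡ at S y → x ≡ y
  at-inj (pick e p q S) zero    zero    _  = refl
  at-inj (pick e p q S) zero    (suc y) eq = ⊥-elim (at-≢ e S y eq)
  at-inj (pick e p q S) (suc x) zero    eq = ⊥-elim (at-≢ e S x (sym eq))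
  at-inj (pick e p q S) (suc x) (suc y) eq = cong suc (at-inj S x y eq)

  Enough : BSet m → List (Req k) → Set
  Enough J []                 = ⊤
  Enough J ((i , j , c) ∷ rs) = c ≤ cnt (J ∩ ty i j) × Enough J rs

  pick-many : ∀ {J i j es} c → c ≤ cnt (J ∩ ty i j) →
              (∀ J′ → (∀ e → J e ≡ true → ty i j e ≡ false → J′ e ≡ true) → Sel J′ es) →
              Sel J (List.replicate c (i , j) ++ es)
  pick-many {J} zero le rest = rest J (λ _ p _ → p)
  pick-many {J} {i} {j} (suc c) le rest with cnt-∃ (≤-trans (s≤s z≤n) le)
  ... | e , h = pick e (∧-l h) (∧-r {J e} h) (pick-many c
      (s≤s⁻¹ (≤-trans le (≤-trans (≤-reflexive (cnt-remove (J ∩ ty i j) e h)) (s≤s (cnt-⊆ λ g →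
        taut 3 (λ a b c → ((a ∧ b) ∧ c) ⇒ᵇ ((a ∧ c) ∧ b)) (J g) (ty i j g) (not (g == e)) $ᵇ_)))))
      (λ J′ sub → rest J′ λ g p q → sub g (p ∧ⁱ not-t (==-f {i = g} {e} λ { refl → absurdᵇ (∧-r {J g} h) q })) q))

  enough-⊆ : ∀ {J J′ i j} rs → fresh i j rs ≡ true → (∀ e → J e ≡ true → ty i j e ≡ false → J′ e ≡ true) →
             Enough J rs → Enough J′ rs
  enough-⊆ [] _ _ _ = tt
  enough-⊆ {J} {J′} {i} {j} (r@(i′ , j′ , c) ∷ rs) fr sub (le , en) =
    ≤-trans le (cnt-⊆ λ e h → sub e (∧-l h) (¬t⇒f λ p → absurdᵇ (ty-unique {i} {j} {r} {e} p (∧-r {J e} h)) (not-f (∧-l fr))) ∧ⁱ ∧-r {J e} h)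
    , enough-⊆ rs (∧-r {not (sameType i j r)} fr) sub en

  select : ∀ {J} rs → distinct rs ≡ true → Enough J rs → Sel J (expand rs)
  select [] _ _ = []
  select ((i , j , c) ∷ rs) d (le , en) =
    pick-many c le λ J′ sub → select rs (∧-r {fresh i j rs} d) (enough-⊆ rs (∧-l d) sub en)

-- The final conjunct is not padded with a unit, so that proofs for a list of parts are plain nested
-- tuples.
DisjFrom : ∀ {n k} → BSet n → Vec (BSet n) k → Set
DisjFrom A []       = ⊤
DisjFrom A (B ∷ []) = Disj A B
DisjFrom A (B ∷ Bs) = Disj A B × DisjFrom A Bs

DisjAll : ∀ {n k} → Vec (BSet n) k → Set
DisjAll []           = ⊤
DisjAll (A ∷ [])     = ⊤
DisjAll (A ∷ B ∷ []) = Disj A B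
DisjAll (A ∷ Bs)     = DisjFrom A Bs × DisjAll Bs

label : ∀ {n k} → Vec (BSet n) k → Fin n → Maybe (Fin k)
label []       v = nothing
label (A ∷ As) v = if A v then just zero else Maybe.map suc (label As v)

disjFrom-at : ∀ {n k} {A : BSet n} (Bs : Vec (BSet n) k) → DisjFrom A Bs → ∀ i → Disj A (lookup Bs i)
disjFrom-at (B ∷ [])      d       zero    = d
disjFrom-at (B ∷ C ∷ Bs)  (d , _) zero    = d
disjFrom-at (B ∷ C ∷ Bs)  (_ , d) (suc i) = disjFrom-at (C ∷ Bs) d i

disjAll-cons : ∀ {n k} {A : BSet n} (Bs : Vec (BSet n) k) → DisjAll (A ∷ Bs) → DisjFrom A Bs × DisjAll Bs
disjAll-cons []           _ = tt , tt
disjAll-cons (B ∷ [])     d = d , tt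
disjAll-cons (B ∷ C ∷ Bs) d = d

label-part : ∀ {n k} (As : Vec (BSet n) k) → DisjAll As → ∀ i v → lookup As i v ≡ maybe (_== i) false (label As v)
label-part (A ∷ As) d i v with A v in Av
label-part (A ∷ As) d zero    v | true  = Av
label-part (A ∷ As) d (suc i) v | true  = ¬t⇒f λ h → disjFrom-at As (proj₁ (disjAll-cons As d)) i v Av h
label-part (A ∷ As) d zero    v | false rewrite Av with label As v
... | just _  = refl
... | nothing = refl
label-part (A ∷ As) d (suc i) v | false = trans (label-part As (proj₂ (disjAll-cons As d)) i v) (shift (label As v))
  where
  shift : ∀ x → maybe (_== i) false x ≡ maybe (_== suc i) false (Maybe.map suc x)
  shift (just j) = refl
  shift nothing  = refl

dichotomy : ∀ b → (b ≡ true) ⊎ (b ≡ false)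
dichotomy true  = inj₁ refl
dichotomy false = inj₂ refl

∈-lookup : ∀ {m} {p : BSet m} {e} → e Sub.∈ tabulate p → p e ≡ true
∈-lookup {p = p} {e} q = trans (sym (lookup∘tabulate p e)) ([]=⇒lookup q)

lookup-∈ : ∀ {m} {p : BSet m} {e} → p e ≡ true → e Sub.∈ tabulate p
lookup-∈ {p = p} {e} q = lookup⇒[]= e _ (trans (lookup∘tabulate p e) q)

module Minor (G H₀ : Graph) (f : Fin (nE H₀) → Fin (nE G)) (inj : ∀ x y → f x ≡ f y → x ≡ y)
             (Con : BSet (nE G)) (off : ∀ x → Con (f x) ≡ false) where

  private
    m = nE G
    module C = Cycles G
    module C₀ = Cycles H₀
  open Gr C.s C.t
  private module G₀ = Gr C₀.s C₀.t
  open Image f inj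

  -- The case of the empty `S` shows that `Con` is independent. A maximal independent subset of
  -- `Con` is therefore `Con` itself, and independence in the contraction becomes independence of
  -- the union with `Con`.
  minor-iso : (∀ S → G₀.Hall S → Hall (im S ∪ Con)) → (∀ S → Hall (im S ∪ Con) → G₀.Hall S) →
              HasMinorIso (Bic G) (Bic H₀)
  minor-iso to from = tabulate Con , tabulate Keep , f , disjoint , f∈ , (λ e p → keep-∃ (∈-lookup p)) , inj
                    , λ S T T⊆ S⇔T → indep→ S T T⊆ S⇔T , indep← S T T⊆ S⇔T
    where
    Keep : BSet m
    Keep = im full
    keep-∃ : ∀ {e} → Keep e ≡ true → ∃ λ x → f x ≡ e
    keep-∃ p = let x , _ , q = im-∈ {full} p in x , q
    disjoint : ∀ e → e Sub.∈ tabulate Keep → e Sub.∉ tabulate Con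
    disjoint e p q with keep-∃ (∈-lookup p)
    ... | x , refl = absurdᵇ (∈-lookup q) (off x)
    f∈ : ∀ y → f y Sub.∈ tabulate Keep
    f∈ y = lookup-∈ (im-∋ {full} y refl)
    module _ (S : Sub.Subset (nE H₀)) (T : Sub.Subset m) (T⊆ : T Sub.⊆ tabulate Keep)
             (S⇔T : ∀ y → (y Sub.∈ S) ⇔ₚ (f y Sub.∈ T)) where
      same : ∀ e → (im (lookup S) ∪ Con) e ≡ lookup (T Sub.∪ tabulate Con) e
      same e = trans (cong (_∨ Con e) (bool-iff to′ from′))
                     (sym (trans (lookup-∪ T (tabulate Con) e) (cong (lookup T e ∨_) (lookup∘tabulate Con e))))
        where
        to′ : im (lookup S) e ≡ true → lookup T e ≡ true
        to′ p with im-∈ {lookup S} p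
        ... | y , r , refl = []=⇒lookup (proj₁ (S⇔T y) (lookup⇒[]= y S r))
        from′ : lookup T e ≡ true → im (lookup S) e ≡ true
        from′ p with keep-∃ (∈-lookup (T⊆ (lookup⇒[]= e T p)))
        ... | x , refl = im-∋ {lookup S} x ([]=⇒lookup (proj₂ (S⇔T x) (lookup⇒[]= (f x) T p)))
      indep→ : BicIndep H₀ S → ContrIndep (Bic G) (tabulate Con) T
      indep→ bi = tabulate Con , id , C.hall⇒bic _ (Hall-resp (λ e → sym (lookup∘tabulate Con e)) (Hall-⊆ {im (lookup S) ∪ Con} (λ e → ∨-r {im (lookup S) e}) hl))
                  , (λ x p q _ → q p) , C.hall⇒bic _ (Hall-resp same hl)
        where
        hl : Hall (im (lookup S) ∪ Con)
        hl = to (lookup S) (C₀.bic⇒hall S bi)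
      indep← : ContrIndep (Bic G) (tabulate Con) T → BicIndep H₀ S
      indep← (B , B⊆ , _ , Bmax , TB) = C₀.hall⇒bic S (from (lookup S) (Hall-resp (λ e → sym (same e))
          (Hall-⊆ {lookup (T Sub.∪ B)} up (C.bic⇒hall _ TB))))
        where
        base : Hall Con
        base = Hall-⊆ {im ε ∪ Con} (λ e → ∨-r {im ε e}) (to ε λ X → ≤-trans (≤-reflexive (cnt-none λ _ → refl)) z≤n)
        sub : ∀ e → Con e ≡ true → ∀ x → lookup (B Sub.∪ Sub.⁅ e ⁆) x ≡ true → Con x ≡ true
        sub e p x q with ∨-case {lookup B x} (trans (sym (lookup-∪ B Sub.⁅ e ⁆ x)) q)
        ... | inj₁ r = ∈-lookup (B⊆ (lookup⇒[]= x B r))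
        ... | inj₂ r = subst (λ z → Con z ≡ true) (sym (x∈⁅y⁆⇒x≡y e (lookup⇒[]= x _ r))) p
        Con⊆B : ∀ e → Con e ≡ true → lookup B e ≡ true
        Con⊆B e p with lookup B e in eq
        ... | true  = refl
        ... | false = ⊥-elim (Bmax e (lookup-∈ p) (λ q → absurdᵇ ([]=⇒lookup q) eq) (C.hall⇒bic _ (Hall-⊆ {Con} (sub e p) base)))
        up : ∀ e → lookup (T Sub.∪ tabulate Con) e ≡ true → lookup (T Sub.∪ B) e ≡ true
        up e p with ∨-case {lookup T e} (trans (sym (lookup-∪ T (tabulate Con) e)) p)
        ... | inj₁ q = trans (lookup-∪ T B e) (∨-l q)
        ... | inj₂ q = trans (lookup-∪ T B e) (∨-r {lookup T e} (Con⊆B e (trans (sym (lookup∘tabulate Con e)) q)))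

module Patterns (G : Graph) (J : BSet (nE G)) where

  private
    n = nV G
    m = nE G
  open Cycles G using (s; t; hall⇒bic; bic⇒hall) public
  open Trees s t public

  opaque
    ins : BSet n → ℕ
    ins A = cnt (J ∩ E[ A ])

    bet : BSet n → BSet n → ℕ
    bet A B = cnt (J ∩ joins A B)

  -- For i = j the request is for c loops: a spanning tree of the part takes all but one as many
  -- edges as there are vertices, and c further inner edges must remain.
  Need : ∀ {k} → Vec (BSet n) k → Req k → Set
  Need Ps (i , j , c) with i ≟ᶠ j
  ... | yes _ = cnt (lookup Ps i) + c ≤ suc (ins (lookup Ps i))
  ... | no  _ = c ≤ bet (lookup Ps i) (lookup Ps j)

  Needs : ∀ {k} → Vec (BSet n) k → List (Req k) → Set
  Needs Ps []           = ⊤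
  Needs Ps (r ∷ [])     = Need Ps r
  Needs Ps (r ∷ r′ ∷ rs) = Need Ps r × Needs Ps (r′ ∷ rs)

  ConnAll : ∀ {k} → Vec (BSet n) k → Set
  ConnAll []           = ⊤
  ConnAll (A ∷ [])     = Conn J A
  ConnAll (A ∷ B ∷ Bs) = Conn J A × ConnAll (B ∷ Bs)

  connAll-at : ∀ {k} (As : Vec (BSet n) k) → ConnAll As → ∀ i → Conn J (lookup As i)
  connAll-at (A ∷ [])     c       zero    = c
  connAll-at (A ∷ B ∷ Bs) (c , _) zero    = c
  connAll-at (A ∷ B ∷ Bs) (_ , c) (suc i) = connAll-at (B ∷ Bs) c i

  b≤+ : ∀ {x y z} → (x ≡ true → y ≡ true ⊎ z ≡ true) → b2n x ≤ b2n y + b2n z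
  b≤+ {false}             h = z≤n
  b≤+ {true} {true}       h = s≤s z≤n
  b≤+ {true} {false} {true} h = ≤-refl
  b≤+ {true} {false} {false} h with h refl
  ... | inj₁ ()
  ... | inj₂ ()

  module _ {k} (Ps : Vec (BSet n) k) (d : DisjAll Ps) where
    open Parts s t (label Ps)
    open Select s t (label Ps) using (ty; ty-lab; Enough)

    opaque
      unfolding ins bet

      needs-enough : (trees : ∀ i → SpanTree J (part i)) → ∀ rs → Needs Ps rs → Enough (J ∖ T∪ trees) rs
      needs-enough trees []       _  = tt
      needs-enough trees (r ∷ rs) nd = one r (headNeed rs nd) , needs-enough trees rs (tailNeed rs nd)
        where
        headNeed : ∀ rs → Needs Ps (r ∷ rs) → Need Ps r
        headNeed []       x       = x
        headNeed (_ ∷ _)  (x , _) = x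
        tailNeed : ∀ rs → Needs Ps (r ∷ rs) → Needs Ps rs
        tailNeed []       x       = tt
        tailNeed (_ ∷ _)  (_ , x) = x
        at : ∀ {i v} → lookup Ps i v ≡ true → part i v ≡ true
        at {i} {v} p = trans (sym (label-part Ps d i v)) p
        one : ∀ r → Need Ps r → proj₂ (proj₂ r) ≤ cnt ((J ∖ T∪ trees) ∩ ty (proj₁ r) (proj₁ (proj₂ r)))
        one (i , j , c) nd with i ≟ᶠ j
        ... | yes refl = lin (cnt (lookup Ps i) ∷ c ∷ cnt (J ∩ E[ lookup Ps i ]) ∷ cnt ((J ∖ T∪ trees) ∩ ty i i) ∷ cnt (tr trees i) ∷ [])
            (λ { (p ∷ c ∷ e ∷ r ∷ t ∷ []) → (p :+ c :≤ con 1 :+ e) ∷ (e :≤ r :+ t) ∷ (con 1 :+ t :≤ p) ∷ [] ⊢ (c :≤ r) })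
            ( nd , cnt1≤2 (J ∩ E[ lookup Ps i ]) ((J ∖ T∪ trees) ∩ ty i i) (tr trees i) (λ e → b≤+ (split e))
            , ≤-trans (SpanTree.card (trees i)) (≤-reflexive (cnt-cong λ v → sym (label-part Ps d i v))))
          where
          split : ∀ e → (J ∩ E[ lookup Ps i ]) e ≡ true → (((J ∖ T∪ trees) ∩ ty i i) e ≡ true) ⊎ (tr trees i e ≡ true)
          split e h with tr trees i e in eq
          ... | true  = inj₂ refl
          ... | false = inj₁ ((∧-l h ∧ⁱ not-t (trans (cong (maybe (λ l → tr trees l e) false) (part-t ps)) eq)) ∧ⁱ ∨-l (ps ∧ⁱ pt))
            where
            ps : part i (s e) ≡ true
            ps = at {i} (∧-l {lookup Ps i (s e)} (∧-r {J e} h))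
            pt : part i (t e) ≡ true
            pt = at {i} (∧-r {lookup Ps i (s e)} (∧-r {J e} h))
        ... | no ne = ≤-trans nd (cnt-⊆ keep)
          where
          keep : ∀ e → (J ∩ joins (lookup Ps i) (lookup Ps j)) e ≡ true → ((J ∖ T∪ trees) ∩ ty i j) e ≡ true
          keep e h = (∧-l h ∧ⁱ not-t (¬t⇒f off)) ∧ⁱ typed
            where
            typed : ty i j e ≡ true
            typed with ∨-case (∧-r {J e} h)
            ... | inj₁ p = ∨-l (at {i} (∧-l p) ∧ⁱ at {j} (∧-r {lookup Ps i (s e)} p))
            ... | inj₂ p = ∨-r {part i (s e) ∧ part j (t e)} (at {j} (∧-l p) ∧ⁱ at {i} (∧-r {lookup Ps j (s e)} p))
            off : ¬ (T∪ trees e ≡ true)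
            off p with label Ps (s e) in eq
            ... | just l with ty-lab {i} {j} {e} typed | tr-lab trees {l} {e} p
            ...   | inj₁ (q , r) | q′ , r′ = ne (just-injective (trans (sym q) (trans q′ (trans (sym r′) r))))
            ...   | inj₂ (q , r) | q′ , r′ = ne (just-injective (trans (sym r) (trans r′ (trans (sym q′) q))))

  -- The pattern with edges expand rs has H₀ as the minor obtained by contracting L
  -- and keeping the edges ι.
  module _ {k} (rs : List (Req k)) (H₀ : Graph) (ι : Fin (nE H₀) → Fin (List.length (expand rs)))
           (L : BSet (List.length (expand rs))) where

    private
      h₀ = nE H₀
      h = List.length (expand rs)
      a b : Fin h → Fin k
      a y = proj₁ (List.lookup (expand rs) y)
      b y = proj₂ (List.lookup (expand rs) y)
      a₀ b₀ : Fin h₀ → Fin (nV H₀)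
      a₀ y = proj₁ (ends H₀ y)
      b₀ y = proj₂ (ends H₀ y)
      module H₀ = Gr a₀ b₀
      module H = Gr a b
      module C₀ = Cycles H₀

    ext : BSet h₀ → BSet h
    ext S y = L y ∨ does (any? λ x → (S x ∧ ι x == y) ≟ᵇ true)

    sameᵇ : Bool → Bool → Bool
    sameᵇ x y = not (x xor y)

    sameᵇ-sound : ∀ {x y} → sameᵇ x y ≡ true → x ≡ y
    sameᵇ-sound {true}  {true}  _ = refl
    sameᵇ-sound {false} {false} _ = refl

    -- That contracting `L` in the pattern leaves the matroid of `H₀` is a statement about finitely
    -- many Boolean vectors; each use below discharges it by `refl`.
    wellformed agree : Bool
    wellformed = does (all? λ x → L (ι x) ≟ᵇ false) ∧ does (all? λ x → all? λ y → (not (ι x == ι y) ∨ x == y) ≟ᵇ true)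
    agree = allᵛ h₀ λ S → sameᵇ (hallᵇ a₀ b₀ (lookup S)) (hallᵇ a b (ext (lookup S)))

    minor : (Ps : Vec (BSet n) k) → DisjAll Ps → ConnAll Ps → Needs Ps rs →
            distinct rs ≡ true → wellformed ≡ true → agree ≡ true → HasMinorIso (Bic G) (Bic H₀)
    minor Ps d cs nd dist wf ag =
      minor-iso (λ S p → Hall-resp (same S) (hall-S S p)) (λ S p → S-hall S (Hall-resp (λ e → sym (same S e)) p))
      where
      open Parts s t (label Ps)
      trees : ∀ i → SpanTree J (part i)
      trees i = span-tree (Conn-resp {J} (label-part Ps d i) (connAll-at Ps cs i))
      open Select s t (label Ps)
      sels : Sel (J ∖ T∪ trees) (expand rs)
      sels = select rs dist (needs-enough Ps d trees rs nd)
      sel : Fin h → Fin m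
      sel = at sels
      sel-inj : ∀ x y → sel x ≡ sel y → x ≡ y
      sel-inj = at-inj sels
      module I = Image sel sel-inj
      open Quotient s t (label Ps) a b sel sel-inj
      off : ∀ y → T∪ trees (sel y) ≡ false
      off y = not-f (∧-r {J (sel y)} (at-J sels y))
      typed : ∀ y → Typed trees y
      typed y = ty-lab {e = sel y} (at-ty sels y)
      f : Fin h₀ → Fin m
      f x = sel (ι x)
      L-ι : ∀ x → L (ι x) ≡ false
      L-ι = does-t (all? λ x → L (ι x) ≟ᵇ false) (∧-l wf)
      ι-inj : ∀ x y → ι x ≡ ι y → x ≡ y
      ι-inj x y eq = [ (λ p → absurdᵇ (subst (λ z → ι x == z ≡ true) eq (==-refl (ι x))) (not-f p)) , ==-t ]′
        (∨-case (does-t (all? λ x → all? λ y → (not (ι x == ι y) ∨ x == y) ≟ᵇ true) (∧-r {does (all? λ x → L (ι x) ≟ᵇ false)} wf) x y))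
      f-inj : ∀ x y → f x ≡ f y → x ≡ y
      f-inj x y eq = ι-inj x y (sel-inj _ _ eq)
      Con : BSet m
      Con e = I.im L e ∨ T∪ trees e
      f-off : ∀ x → Con (f x) ≡ false
      f-off x = trans (cong₂ _∨_ (I.im-at L (ι x)) (off (ι x))) (trans (cong (_∨ false) (L-ι x)) refl)
      open Minor G H₀ f f-inj Con f-off
      module F = Image f f-inj
      ext-im : ∀ S e → I.im (ext S) e ≡ F.im S e ∨ I.im L e
      ext-im S e = im-∪-∘ ι sel ι-inj sel-inj f-inj S L e
      same : ∀ S e → (I.im (ext S) ∪ T∪ trees) e ≡ (F.im S ∪ Con) e
      same S e = trans (cong (_∨ T∪ trees e) (ext-im S e)) (∨-assoc (F.im S e) (I.im L e) (T∪ trees e))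
      hallᵇ-cong : ∀ {k h} (a b : Fin h → Fin k) {I K : BSet h} → (∀ e → I e ≡ K e) → hallᵇ a b I ≡ hallᵇ a b K
      hallᵇ-cong a b {I} {K} e = bool-iff
        (λ q → hallᵇ-complete a b K (Gr.Hall-resp a b e (hallᵇ-sound a b I q)))
        (λ q → hallᵇ-complete a b I (Gr.Hall-resp a b (λ x → sym (e x)) (hallᵇ-sound a b K q)))
      ext-cong : ∀ {S S′} → (∀ x → S x ≡ S′ x) → ∀ y → ext S y ≡ ext S′ y
      ext-cong {S} {S′} eq y = cong (L y ∨_) (bool-iff
        (λ p → let x , q = does-t (any? λ x → (S x ∧ ι x == y) ≟ᵇ true) p in dec-t (any? λ x → (S′ x ∧ ι x == y) ≟ᵇ true) (x , trans (cong (_∧ ι x == y) (sym (eq x))) q))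
        (λ p → let x , q = does-t (any? λ x → (S′ x ∧ ι x == y) ≟ᵇ true) p in dec-t (any? λ x → (S x ∧ ι x == y) ≟ᵇ true) (x , trans (cong (_∧ ι x == y) (eq x)) q)))
      checks : ∀ S → hallᵇ a₀ b₀ S ≡ hallᵇ a b (ext S)
      checks S = trans (hallᵇ-cong a₀ b₀ (λ x → sym (lookup∘tabulate S x)))
        (trans (sameᵇ-sound (allᵛ-sound h₀ _ ag (tabulate S))) (hallᵇ-cong a b (ext-cong (lookup∘tabulate S))))
      hall-S : ∀ S → H₀.Hall S → Hall (I.im (ext S) ∪ T∪ trees)
      hall-S S p = quotient-← trees typed off (ext S) (hallᵇ-sound a b (ext S) (trans (sym (checks S)) (hallᵇ-complete a₀ b₀ S p)))
      S-hall : ∀ S → Hall (I.im (ext S) ∪ T∪ trees) → H₀.Hall S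
      S-hall S p = hallᵇ-sound a₀ b₀ S (trans (checks S) (hallᵇ-complete a b (ext S) (quotient-→ trees typed off (ext S) p)))

record NoMinors (G : Graph) : Set where
  field
    noP2 : ¬ HasMinorIso (Bic G) (Bic P₂)
    noW  : ¬ HasMinorIso (Bic G) (Bic W)
    noA3 : ¬ HasMinorIso (Bic G) (Bic A₃)
    noR3 : ¬ HasMinorIso (Bic G) (Bic R₃)
    noR4 : ¬ HasMinorIso (Bic G) (Bic R₄)
    noD4 : ¬ HasMinorIso (Bic G) (Bic D₄)
    noK3 : ¬ HasMinorIso (Bic G) (Bic K₃³)
    noS1 : ¬ HasMinorIso (Bic G) (Bic S₁)

-- Configurations of connected parts that yield one of the eight matroids

module Excluded (G : Graph) (J : BSet (nE G)) (excl : NoMinors G) where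

  private n = nV G
  open NoMinors excl
  open Patterns G J public

  opaque
    unfolding bet

    bet-sym : ∀ A B → bet A B ≡ bet B A
    bet-sym A B = cnt-cong λ e → cong (J e ∧_) (∨-comm (A (s e) ∧ B (t e)) (B (s e) ∧ A (t e)))

  -- With A connected, the number of edges from A to K plus the cyclomatic number of A is at least two.
  Two : BSet n → BSet n → Set
  Two A K = suc (cnt A) ≤ ins A + bet A K

  -- For a connected set: contraction of a spanning tree leaves a loop.
  Cyclic : BSet n → Set
  Cyclic A = cnt A ≤ ins A

  Adj : BSet n → BSet n → Set
  Adj A B = 1 ≤ bet A B

  sym-adj : ∀ {A B} → Adj A B → Adj B A
  sym-adj {A} {B} = subst (1 ≤_) (bet-sym A B)

  sym-disj : ∀ {A B : BSet n} → Disj A B → Disj B A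
  sym-disj d v p q = d v q p

  leaf-cases : ∀ A K → Two A K → Cyclic A ⊎ (2 ≤ bet A K)
  leaf-cases A K two with cnt A ≤? ins A
  ... | yes c = inj₁ c
  ... | no ¬c = inj₂ (lin (cnt A ∷ ins A ∷ bet A K ∷ [])
          (λ { (a ∷ i ∷ b ∷ []) → (con 1 :+ a :≤ i :+ b) ∷ (con 1 :+ i :≤ a) ∷ [] ⊢ (con 2 :≤ b) }) (two , ≰⇒> ¬c))

  private
    loop : ∀ {A} → Cyclic A → cnt A + 1 ≤ suc (ins A)
    loop {A} c = ≤-trans (≤-reflexive (+-comm (cnt A) 1)) (s≤s c)

    none : ∀ {k} → BSet k
    none _ = false

  -- A leaf is attached to the hub by two edges or by an edge and a loop. Both ways give the same
  -- matroid, and evaluation confirms this for all eight combinations.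
  excl-P2 : ∀ K L₁ L₂ L₃ → Conn J K → Conn J L₁ → Conn J L₂ → Conn J L₃ →
            Disj L₁ L₂ → Disj L₁ L₃ → Disj L₂ L₃ → Disj L₁ K → Disj L₂ K → Disj L₃ K →
            Adj L₁ K → Two L₁ K → Adj L₂ K → Two L₂ K → Adj L₃ K → Two L₃ K → ⊥
  excl-P2 K L₁ L₂ L₃ cK c₁ c₂ c₃ d₁₂ d₁₃ d₂₃ d₁ d₂ d₃ a₁ t₁ a₂ t₂ a₃ t₃
    with leaf-cases L₁ K t₁ | leaf-cases L₂ K t₂ | leaf-cases L₃ K t₃
  ... | inj₁ p₁ | inj₁ p₂ | inj₁ p₃ =
    noP2 (minor ((# 1 , # 0 , 1) ∷ (# 1 , # 1 , 1) ∷ (# 2 , # 0 , 1) ∷ (# 2 , # 2 , 1) ∷ (# 3 , # 0 , 1) ∷ (# 3 , # 3 , 1) ∷ []) P₂ id none (K ∷ L₁ ∷ L₂ ∷ L₃ ∷ [])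
      ((sym-disj d₁ , sym-disj d₂ , sym-disj d₃) , (d₁₂ , d₁₃) , d₂₃) (cK , c₁ , c₂ , c₃) (a₁ , loop p₁ , a₂ , loop p₂ , a₃ , loop p₃) refl refl refl)
  ... | inj₁ p₁ | inj₁ p₂ | inj₂ p₃ =
    noP2 (minor ((# 1 , # 0 , 1) ∷ (# 1 , # 1 , 1) ∷ (# 2 , # 0 , 1) ∷ (# 2 , # 2 , 1) ∷ (# 3 , # 0 , 2) ∷ []) P₂ id none (K ∷ L₁ ∷ L₂ ∷ L₃ ∷ [])
      ((sym-disj d₁ , sym-disj d₂ , sym-disj d₃) , (d₁₂ , d₁₃) , d₂₃) (cK , c₁ , c₂ , c₃) (a₁ , loop p₁ , a₂ , loop p₂ , p₃) refl refl refl)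
  ... | inj₁ p₁ | inj₂ p₂ | inj₁ p₃ =
    noP2 (minor ((# 1 , # 0 , 1) ∷ (# 1 , # 1 , 1) ∷ (# 2 , # 0 , 2) ∷ (# 3 , # 0 , 1) ∷ (# 3 , # 3 , 1) ∷ []) P₂ id none (K ∷ L₁ ∷ L₂ ∷ L₃ ∷ [])
      ((sym-disj d₁ , sym-disj d₂ , sym-disj d₃) , (d₁₂ , d₁₃) , d₂₃) (cK , c₁ , c₂ , c₃) (a₁ , loop p₁ , p₂ , a₃ , loop p₃) refl refl refl)
  ... | inj₁ p₁ | inj₂ p₂ | inj₂ p₃ =
    noP2 (minor ((# 1 , # 0 , 1) ∷ (# 1 , # 1 , 1) ∷ (# 2 , # 0 , 2) ∷ (# 3 , # 0 , 2) ∷ []) P₂ id none (K ∷ L₁ ∷ L₂ ∷ L₃ ∷ [])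
      ((sym-disj d₁ , sym-disj d₂ , sym-disj d₃) , (d₁₂ , d₁₃) , d₂₃) (cK , c₁ , c₂ , c₃) (a₁ , loop p₁ , p₂ , p₃) refl refl refl)
  ... | inj₂ p₁ | inj₁ p₂ | inj₁ p₃ =
    noP2 (minor ((# 1 , # 0 , 2) ∷ (# 2 , # 0 , 1) ∷ (# 2 , # 2 , 1) ∷ (# 3 , # 0 , 1) ∷ (# 3 , # 3 , 1) ∷ []) P₂ id none (K ∷ L₁ ∷ L₂ ∷ L₃ ∷ [])
      ((sym-disj d₁ , sym-disj d₂ , sym-disj d₃) , (d₁₂ , d₁₃) , d₂₃) (cK , c₁ , c₂ , c₃) (p₁ , a₂ , loop p₂ , a₃ , loop p₃) refl refl refl)
  ... | inj₂ p₁ | inj₁ p₂ | inj₂ p₃ =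
    noP2 (minor ((# 1 , # 0 , 2) ∷ (# 2 , # 0 , 1) ∷ (# 2 , # 2 , 1) ∷ (# 3 , # 0 , 2) ∷ []) P₂ id none (K ∷ L₁ ∷ L₂ ∷ L₃ ∷ [])
      ((sym-disj d₁ , sym-disj d₂ , sym-disj d₃) , (d₁₂ , d₁₃) , d₂₃) (cK , c₁ , c₂ , c₃) (p₁ , a₂ , loop p₂ , p₃) refl refl refl)
  ... | inj₂ p₁ | inj₂ p₂ | inj₁ p₃ =
    noP2 (minor ((# 1 , # 0 , 2) ∷ (# 2 , # 0 , 2) ∷ (# 3 , # 0 , 1) ∷ (# 3 , # 3 , 1) ∷ []) P₂ id none (K ∷ L₁ ∷ L₂ ∷ L₃ ∷ [])
      ((sym-disj d₁ , sym-disj d₂ , sym-disj d₃) , (d₁₂ , d₁₃) , d₂₃) (cK , c₁ , c₂ , c₃) (p₁ , p₂ , a₃ , loop p₃) refl refl refl)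
  ... | inj₂ p₁ | inj₂ p₂ | inj₂ p₃ =
    noP2 (minor ((# 1 , # 0 , 2) ∷ (# 2 , # 0 , 2) ∷ (# 3 , # 0 , 2) ∷ []) P₂ id none (K ∷ L₁ ∷ L₂ ∷ L₃ ∷ [])
      ((sym-disj d₁ , sym-disj d₂ , sym-disj d₃) , (d₁₂ , d₁₃) , d₂₃) (cK , c₁ , c₂ , c₃) (p₁ , p₂ , p₃) refl refl refl)

  -- The cyclic part O is contracted; the edges joining it to the leaves become loops.
  excl-P2-ground : ∀ K L₁ L₂ L₃ O → Conn J K → Conn J L₁ → Conn J L₂ → Conn J L₃ → Conn J O →
            Disj L₁ L₂ → Disj L₁ L₃ → Disj L₂ L₃ → Disj L₁ K → Disj L₂ K → Disj L₃ K →
            Disj L₁ O → Disj L₂ O → Disj L₃ O → Disj K O → Cyclic O →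
            Adj L₁ K → Adj L₁ O → Adj L₂ K → Adj L₂ O → Adj L₃ K → Adj L₃ O ⊎ Two L₃ K → ⊥
  excl-P2-ground K L₁ L₂ L₃ O cK c₁ c₂ c₃ cO d₁₂ d₁₃ d₂₃ d₁ d₂ d₃ o₁ o₂ o₃ oK cyc a₁ g₁ a₂ g₂ a₃ last
    = [ (λ g₃ → noP2 (minor ((# 1 , # 0 , 1) ∷ (# 1 , # 4 , 1) ∷ (# 2 , # 0 , 1) ∷ (# 2 , # 4 , 1) ∷ (# 3 , # 0 , 1) ∷ (# 3 , # 4 , 1) ∷ (# 4 , # 4 , 1) ∷ [])
              P₂ inject₁ (_== # 6) parts ds cs (a₁ , g₁ , a₂ , g₂ , a₃ , g₃ , loop cyc) refl refl refl))
      , (λ t₃ → [ (λ p₃ → noP2 (minor ((# 1 , # 0 , 1) ∷ (# 1 , # 4 , 1) ∷ (# 2 , # 0 , 1) ∷ (# 2 , # 4 , 1) ∷ (# 3 , # 0 , 1) ∷ (# 3 , # 3 , 1) ∷ (# 4 , # 4 , 1) ∷ [])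
                    P₂ inject₁ (_== # 6) parts ds cs (a₁ , g₁ , a₂ , g₂ , a₃ , loop p₃ , loop cyc) refl refl refl))
                , (λ p₃ → noP2 (minor ((# 1 , # 0 , 1) ∷ (# 1 , # 4 , 1) ∷ (# 2 , # 0 , 1) ∷ (# 2 , # 4 , 1) ∷ (# 3 , # 0 , 2) ∷ (# 4 , # 4 , 1) ∷ [])
                    P₂ inject₁ (_== # 6) parts ds cs (a₁ , g₁ , a₂ , g₂ , p₃ , loop cyc) refl refl refl)) ]′ (leaf-cases L₃ K t₃)) ]′ last
    where
    parts : Vec (BSet n) 5
    parts = K ∷ L₁ ∷ L₂ ∷ L₃ ∷ O ∷ []
    ds : DisjAll parts
    ds = (sym-disj d₁ , sym-disj d₂ , sym-disj d₃ , oK) , (d₁₂ , d₁₃ , o₁) , (d₂₃ , o₂) , o₃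
    cs : ConnAll parts
    cs = cK , c₁ , c₂ , c₃ , cO

  -- The contracted triangle with a loop at `C` has two further edges, one for each of `A` and `B`:
  -- a loop there or a second edge to `C`. Two loops give `W`; every other choice represents the
  -- matroid of `A₃`. Most configurations below are reduced to this one.
  excl-A3 : ∀ A B C → Conn J A → Conn J B → Conn J C → Disj A B → Disj A C → Disj B C →
            Adj A B → Adj A C → Adj B C → Cyclic C → Two A C → Two B C → ⊥
  excl-A3 A B C cA cB cC dAB dAC dBC ab ac bc cyc tA tB with leaf-cases A C tA | leaf-cases B C tB
  ... | inj₁ p | inj₁ q = noW (minor ((# 0 , # 1 , 1) ∷ (# 1 , # 2 , 1) ∷ (# 0 , # 2 , 1) ∷ (# 0 , # 0 , 1) ∷ (# 1 , # 1 , 1) ∷ (# 2 , # 2 , 1) ∷ []) W id none (A ∷ B ∷ C ∷ []) ((dAB , dAC) , dBC) (cA , cB , cC) (ab , bc , ac , loop p , loop q , loop cyc) refl refl refl)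
  ... | inj₁ p | inj₂ q = noA3 (minor ((# 0 , # 1 , 1) ∷ (# 0 , # 2 , 1) ∷ (# 0 , # 0 , 1) ∷ (# 1 , # 2 , 2) ∷ (# 2 , # 2 , 1) ∷ []) A₃ id none (A ∷ B ∷ C ∷ []) ((dAB , dAC) , dBC) (cA , cB , cC) (ab , ac , loop p , q , loop cyc) refl refl refl)
  ... | inj₂ p | inj₁ q = noA3 (minor ((# 0 , # 1 , 1) ∷ (# 0 , # 2 , 2) ∷ (# 1 , # 2 , 1) ∷ (# 1 , # 1 , 1) ∷ (# 2 , # 2 , 1) ∷ []) A₃ id none (A ∷ B ∷ C ∷ []) ((dAB , dAC) , dBC) (cA , cB , cC) (ab , p , bc , loop q , loop cyc) refl refl refl)
  ... | inj₂ p | inj₂ q = noA3 (minor ((# 0 , # 1 , 1) ∷ (# 0 , # 2 , 2) ∷ (# 1 , # 2 , 2) ∷ (# 2 , # 2 , 1) ∷ []) A₃ id none (A ∷ B ∷ C ∷ []) ((dAB , dAC) , dBC) (cA , cB , cC) (ab , p , q , loop cyc) refl refl refl)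

  private
    loops : ∀ {A} → suc (cnt A) ≤ ins A → cnt A + 2 ≤ suc (ins A)
    loops {A} c = ≤-trans (≤-reflexive (+-comm (cnt A) 2)) (s≤s c)

  excl-R3 : ∀ X Y Z → Conn J X → Conn J Y → Conn J Z → Disj X Y → Disj X Z → Disj Y Z →
            Adj X Y → Adj X Z → Adj Y Z → suc (cnt X) ≤ ins X → suc (cnt Y) ≤ ins Y → ⊥
  excl-R3 X Y Z cX cY cZ dXY dXZ dYZ xy xz yz lX lY = noR3 (minor
    ((# 0 , # 1 , 1) ∷ (# 1 , # 2 , 1) ∷ (# 0 , # 2 , 1) ∷ (# 0 , # 0 , 2) ∷ (# 1 , # 1 , 2) ∷ []) R₃ id none
    (X ∷ Y ∷ Z ∷ []) ((dXY , dXZ) , dYZ) (cX , cY , cZ) (xy , yz , xz , loops lX , loops lY) refl refl refl)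

  excl-K3 : ∀ X Y Z → Conn J X → Conn J Y → Conn J Z → Disj X Y → Disj X Z → Disj Y Z →
            3 ≤ bet X Y → 3 ≤ bet Y Z → 3 ≤ bet X Z → ⊥
  excl-K3 X Y Z cX cY cZ dXY dXZ dYZ xy yz xz = noK3 (minor
    ((# 0 , # 1 , 3) ∷ (# 1 , # 2 , 3) ∷ (# 0 , # 2 , 3) ∷ []) K₃³ id none
    (X ∷ Y ∷ Z ∷ []) ((dXY , dXZ) , dYZ) (cX , cY , cZ) (xy , yz , xz) refl refl refl)

  excl-S1 : ∀ A B C D S → Conn J A → Conn J B → Conn J C → Conn J D → Conn J S →
            Disj A B → Disj A C → Disj A D → Disj A S → Disj B C → Disj B D → Disj B S → Disj C D → Disj C S → Disj D S →
            Adj A B → Adj C D → Adj A S → Adj S D → 2 ≤ bet A C → 2 ≤ bet B D → ⊥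
  excl-S1 A B C D S cA cB cC cD cS ab ac ad as bc bd bs cd cs ds eab ecd eas esd eac ebd = noS1 (minor
    ((# 0 , # 1 , 1) ∷ (# 2 , # 3 , 1) ∷ (# 0 , # 4 , 1) ∷ (# 4 , # 3 , 1) ∷ (# 0 , # 2 , 2) ∷ (# 1 , # 3 , 2) ∷ []) S₁ id none
    (A ∷ B ∷ C ∷ D ∷ S ∷ []) ((ab , ac , ad , as) , (bc , bd , bs) , (cd , cs) , ds) (cA , cB , cC , cD , cS)
    (eab , ecd , eas , esd , eac , ebd) refl refl refl)

  -- A loop at `A` can stand for the third edge between `A` and `C` without changing the matroid.
  excl-D4 : ∀ A B C S → Conn J A → Conn J B → Conn J C → Conn J S →
            Disj A B → Disj A C → Disj A S → Disj B C → Disj B S → Disj C S →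
            (Cyclic A × 2 ≤ bet A C) ⊎ (3 ≤ bet A C) → 3 ≤ bet B C → Adj A S → Adj S B → ⊥
  excl-D4 A B C S cA cB cC cS ab ac as bc bs cs (inj₁ (cyc , eac)) ebc eas esb = noD4 (minor
    ((# 0 , # 2 , 2) ∷ (# 0 , # 0 , 1) ∷ (# 1 , # 2 , 3) ∷ (# 0 , # 3 , 1) ∷ (# 3 , # 1 , 1) ∷ []) D₄ id none
    (A ∷ B ∷ C ∷ S ∷ []) ((ab , ac , as) , (bc , bs) , cs) (cA , cB , cC , cS) (eac , loop cyc , ebc , eas , esb) refl refl refl)
  excl-D4 A B C S cA cB cC cS ab ac as bc bs cs (inj₂ eac) ebc eas esb = noD4 (minor
    ((# 0 , # 2 , 3) ∷ (# 1 , # 2 , 3) ∷ (# 0 , # 3 , 1) ∷ (# 3 , # 1 , 1) ∷ []) D₄ id none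
    (A ∷ B ∷ C ∷ S ∷ []) ((ab , ac , as) , (bc , bs) , cs) (cA , cB , cC , cS) (eac , ebc , eas , esb) refl refl refl)

  module _ (K A B Z : BSet n) (cK : Conn J K) (cA : Conn J A) (cB : Conn J B) (cZ : Conn J Z)
           (ka : Disj K A) (kb : Disj K B) (kz : Disj K Z) (ab : Disj A B) (az : Disj A Z) (bz : Disj B Z)
           (zz : suc (cnt Z) ≤ ins Z) (eka : Adj K A) (ekb : Adj K B) where

    private
      parts : Vec (BSet n) 4
      parts = K ∷ A ∷ B ∷ Z ∷ []
      ds : DisjAll parts
      ds = (ka , kb , kz) , (ab , az) , bz
      cs : ConnAll parts
      cs = cK , cA , cB , cZ

    excl-R4-pendant : Adj K Z → Adj A Z → Two B K → ⊥
    excl-R4-pendant ekz eaz tB with leaf-cases B K tB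
    ... | inj₁ p = noR4 (minor ((# 0 , # 1 , 1) ∷ (# 0 , # 3 , 1) ∷ (# 1 , # 3 , 1) ∷ (# 0 , # 2 , 1) ∷ (# 2 , # 2 , 1) ∷ (# 3 , # 3 , 2) ∷ []) R₄ id none
          parts ds cs (eka , ekz , eaz , ekb , loop p , loops zz) refl refl refl)
    ... | inj₂ p = noR4 (minor ((# 0 , # 1 , 1) ∷ (# 0 , # 3 , 1) ∷ (# 1 , # 3 , 1) ∷ (# 0 , # 2 , 2) ∷ (# 3 , # 3 , 2) ∷ []) R₄ id none
          parts ds cs (eka , ekz , eaz , subst (2 ≤_) (bet-sym B K) p , loops zz) refl refl refl)

    private
      -- The two patterns below are a four-cycle through `K`, `A`, `Z`, `B` with two loops at `Z`
      -- and a loop at `K` or a chord. They differ from `R₄` as graphs, and this renaming of edges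
      -- identifies the matroids: one of the parallel edges of `R₄` becomes the edge from `B` to
      -- `Z`.
      ι : Fin 7 → Fin 7
      ι = lookup (# 0 ∷ # 4 ∷ # 2 ∷ # 1 ∷ # 3 ∷ # 5 ∷ # 6 ∷ [])

    excl-R4-loop : Adj A Z → Adj B Z → Cyclic K → ⊥
    excl-R4-loop eaz ebz cyc = noR4 (minor ((# 0 , # 1 , 1) ∷ (# 0 , # 2 , 1) ∷ (# 1 , # 3 , 1) ∷ (# 2 , # 3 , 1) ∷ (# 0 , # 0 , 1) ∷ (# 3 , # 3 , 2) ∷ []) R₄ ι none
      parts ds cs (eka , ekb , eaz , ebz , loop cyc , loops zz) refl refl refl)

    excl-R4-chord : Adj A Z → Adj B Z → Adj K Z → ⊥
    excl-R4-chord eaz ebz ekz = noR4 (minor ((# 0 , # 1 , 1) ∷ (# 0 , # 2 , 1) ∷ (# 1 , # 3 , 1) ∷ (# 2 , # 3 , 1) ∷ (# 0 , # 3 , 1) ∷ (# 3 , # 3 , 2) ∷ []) R₄ ι none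
      parts ds cs (eka , ekb , eaz , ebz , ekz , loops zz) refl refl refl)

-- Dense connected vertex sets

disj-not : ∀ {n} {A B : BSet n} → Disj A B → ∀ v → not (A v ∧ B v) ≡ true
disj-not {A = A} {B} d v = not-t (¬t⇒f λ h → d v (∧-l h) (∧-r {A v} h))

disj-∪ˡ : ∀ {n} {A B C : BSet n} → Disj A C → Disj B C → Disj (A ∪ B) C
disj-∪ˡ {A = A} d₁ d₂ v p q = [ (λ a → d₁ v a q) , (λ b → d₂ v b q) ]′ (∨-case {A v} p)

disj-∪ʳ : ∀ {n} {A B C : BSet n} → Disj A B → Disj A C → Disj A (B ∪ C)
disj-∪ʳ {B = B} d₁ d₂ v p q = [ d₁ v p , d₂ v p ]′ (∨-case {B v} q)

disj-⊆ : ∀ {n} {A A′ B B′ : BSet n} → A′ ⊆ A → B′ ⊆ B → Disj A B → Disj A′ B′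
disj-⊆ h k d v p q = d v (h v p) (k v q)

∪-⊆ : ∀ {n} {A B C : BSet n} → A ⊆ C → B ⊆ C → A ∪ B ⊆ C
∪-⊆ {A = A} h k v p = [ h v , k v ]′ (∨-case {A v} p)

⊆-∪ˡ : ∀ {n} {A : BSet n} B → A ⊆ A ∪ B
⊆-∪ˡ B v = ∨-l

⊆-∪ʳ : ∀ {n} (A : BSet n) {B} → B ⊆ A ∪ B
⊆-∪ʳ A v = ∨-r {A v}

∖-⊆ : ∀ {n} (A : BSet n) {B} → A ∖ B ⊆ A
∖-⊆ A v = ∧-l

∖-disj : ∀ {n} (A B : BSet n) → Disj (A ∖ B) B
∖-disj A B v p q = absurdᵇ q (not-f (∧-r {A v} p))

⊆-trans : ∀ {n} {A B C : BSet n} → A ⊆ B → B ⊆ C → A ⊆ C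
⊆-trans h k v p = k v (h v p)

cnt-∪ : ∀ {n} {A B : BSet n} → Disj A B → cnt A + cnt B ≤ cnt (A ∪ B)
cnt-∪ {A = A} {B} d = cnt2≤1 _ _ _ λ v → ≤ᵇ-sound (taut 2 (λ a b → not (a ∧ b) ⇒ᵇ (b2n a + b2n b ≤ᵇ b2n (a ∨ b))) (A v) (B v) $ᵇ disj-not d v)

cnt-∪-≤ : ∀ {n} (A B : BSet n) → cnt (A ∪ B) ≤ cnt A + cnt B
cnt-∪-≤ A B = cnt1≤2 _ _ _ λ v → ≤ᵇ-sound (taut 2 (λ a b → b2n (a ∨ b) ≤ᵇ b2n a + b2n b) (A v) (B v))

∪-∖ : ∀ {n} {A X : BSet n} → A ⊆ X → ∀ v → X v ≡ (A ∪ (X ∖ A)) v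
∪-∖ {A = A} {X} h v with A v in eq
... | true  = h v eq
... | false = sym (trans (cong (X v ∧_) refl) (trans (bool-iff ∧-l (λ p → p ∧ⁱ refl)) refl))

⊆⇒ᵇ : ∀ {a b} → (a ≡ true → b ≡ true) → (a ⇒ᵇ b) ≡ true
⊆⇒ᵇ {true}  h = h refl
⊆⇒ᵇ {false} h = refl

module Counting (G : Graph) (J : BSet (nE G)) (excl : NoMinors G) where

  open Excluded G J excl public
  private n = nV G

  opaque
    touch : BSet n → BSet n → ℕ
    touch X S = cnt (J ∩ (E[ X ] ∩ λ e → S (s e) ∨ S (t e)))

  opaque
    unfolding ins bet touch

    bet-mono : ∀ {A A′ B B′} → A ⊆ A′ → B ⊆ B′ → bet A B ≤ bet A′ B′
    bet-mono {A} {A′} {B} {B′} h k = cnt-⊆ λ e p → ∧-l {J e} p ∧ⁱ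
      [ (λ q → ∨-l (h _ (∧-l q) ∧ⁱ k _ (∧-r {A (s e)} q)))
      , (λ q → ∨-r {A′ (s e) ∧ B′ (t e)} (k _ (∧-l q) ∧ⁱ h _ (∧-r {B (s e)} q))) ]′ (∨-case (∧-r {J e} p))

  adj-mono : ∀ {A A′ B B′} → A ⊆ A′ → B ⊆ B′ → Adj A B → Adj A′ B′
  adj-mono h k p = ≤-trans p (bet-mono h k)

  opaque
    unfolding ins bet touch

    ins-mono : ∀ {A B} → A ⊆ B → ins A ≤ ins B
    ins-mono {A} h = cnt-⊆ λ e p → ∧-l {J e} p ∧ⁱ h _ (∧-l {A (s e)} (∧-r {J e} p)) ∧ⁱ h _ (∧-r {A (s e)} (∧-r {J e} p))

    ins-∪ : ∀ {A B} → Disj A B → ins A + ins B + bet A B ≤ ins (A ∪ B)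
    ins-∪ {A} {B} d = cnt3≤1 _ _ _ _ λ e → ≤ᵇ-sound
      (taut 5 (λ j a a′ b b′ → not (a ∧ b) ⇒ᵇ not (a′ ∧ b′) ⇒ᵇ
         (b2n (j ∧ (a ∧ a′)) + b2n (j ∧ (b ∧ b′)) + b2n (j ∧ ((a ∧ b′) ∨ (b ∧ a′))) ≤ᵇ b2n (j ∧ ((a ∨ b) ∧ (a′ ∨ b′)))))
         (J e) (A (s e)) (A (t e)) (B (s e)) (B (t e)) $ᵇ disj-not d (s e) $ᵇ disj-not d (t e))

    ins-∪-≤ : ∀ A B → ins (A ∪ B) ≤ ins A + ins B + bet A B
    ins-∪-≤ A B = cnt1≤3 _ _ _ _ λ e → ≤ᵇ-sound
      (taut 5 (λ j a a′ b b′ → b2n (j ∧ ((a ∨ b) ∧ (a′ ∨ b′))) ≤ᵇ b2n (j ∧ (a ∧ a′)) + b2n (j ∧ (b ∧ b′)) + b2n (j ∧ ((a ∧ b′) ∨ (b ∧ a′))))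
         (J e) (A (s e)) (A (t e)) (B (s e)) (B (t e)))

    bet-∪ : ∀ {A B C} → Disj A B → Disj A C → Disj B C → bet A B + bet A C ≤ bet A (B ∪ C)
    bet-∪ {A} {B} {C} dB dC dBC = cnt2≤1 _ _ _ λ e → ≤ᵇ-sound
      (taut 7 (λ j a a′ b b′ c c′ → not (a ∧ b) ⇒ᵇ not (a′ ∧ b′) ⇒ᵇ not (a ∧ c) ⇒ᵇ not (a′ ∧ c′) ⇒ᵇ not (b ∧ c) ⇒ᵇ not (b′ ∧ c′) ⇒ᵇ
         (b2n (j ∧ ((a ∧ b′) ∨ (b ∧ a′))) + b2n (j ∧ ((a ∧ c′) ∨ (c ∧ a′))) ≤ᵇ b2n (j ∧ ((a ∧ (b′ ∨ c′)) ∨ ((b ∨ c) ∧ a′)))))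
         (J e) (A (s e)) (A (t e)) (B (s e)) (B (t e)) (C (s e)) (C (t e))
         $ᵇ disj-not dB (s e) $ᵇ disj-not dB (t e) $ᵇ disj-not dC (s e) $ᵇ disj-not dC (t e) $ᵇ disj-not dBC (s e) $ᵇ disj-not dBC (t e))

    bet-∪-≤ : ∀ A B C → bet A (B ∪ C) ≤ bet A B + bet A C
    bet-∪-≤ A B C = cnt1≤2 _ _ _ λ e → ≤ᵇ-sound
      (taut 7 (λ j a a′ b b′ c c′ →
         b2n (j ∧ ((a ∧ (b′ ∨ c′)) ∨ ((b ∨ c) ∧ a′))) ≤ᵇ b2n (j ∧ ((a ∧ b′) ∨ (b ∧ a′))) + b2n (j ∧ ((a ∧ c′) ∨ (c ∧ a′))))
         (J e) (A (s e)) (A (t e)) (B (s e)) (B (t e)) (C (s e)) (C (t e)))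

  Apart : BSet n → BSet n → Set
  Apart A B = bet A B ≡ 0

  adj? : ∀ A B → Adj A B ⊎ Apart A B
  adj? A B with 1 ≤? bet A B
  ... | yes p = inj₁ p
  ... | no ¬p = inj₂ (n<1⇒n≡0 (≰⇒> ¬p))

  apart-sym : ∀ {A B} → Apart A B → Apart B A
  apart-sym {A} {B} p = trans (bet-sym B A) p

  apart-mono : ∀ {A A′ B B′} → A′ ⊆ A → B′ ⊆ B → Apart A B → Apart A′ B′
  apart-mono h k p = n≤0⇒n≡0 (subst (bet _ _ ≤_) p (bet-mono h k))

  apart-¬adj : ∀ {A B} → Apart A B → ¬ Adj A B
  apart-¬adj p q = 1+n≰n (subst (1 ≤_) p q)

  adj-∪ : ∀ {A} B C → Adj A (B ∪ C) → Adj A B ⊎ Adj A C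
  adj-∪ {A} B C p with adj? A B | adj? A C
  ... | inj₁ q | _ = inj₁ q
  ... | _ | inj₁ q = inj₂ q
  ... | inj₂ q | inj₂ r = ⊥-elim (1+n≰n (≤-trans p (≤-trans (bet-∪-≤ A B C) (≤-reflexive (cong₂ _+_ q r)))))

  opaque
    unfolding ins bet touch

    adj-edge : ∀ {A B} → Adj A B → Inh (J ∩ joins A B)
    adj-edge = cnt-∃

  conn-join : ∀ {A B} → Conn J A → Conn J B → Adj A B → Conn J (A ∪ B)
  conn-join cA cB p = conn-∪ cA cB (inj₂ (adj-edge p))

  opaque
    unfolding ins bet touch

    conn-adj : ∀ {X A B} → Conn J X → A ⊆ X → Inh A → Inh (X ∖ A) → X ⊆ A ∪ B → Adj A B
    conn-adj {X} {A} {B} c A⊆X (a , Aa) out cov with Conn.cut c A (a , A⊆X a Aa ∧ⁱ Aa) out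
    ... | e , h = ∃-cnt e (taut 7 (λ j x x′ a a′ b b′ → (x ⇒ᵇ (a ∨ b)) ⇒ᵇ (x′ ⇒ᵇ (a′ ∨ b′)) ⇒ᵇ (j ∧ ((x ∧ x′) ∧ (a xor a′))) ⇒ᵇ (j ∧ ((a ∧ b′) ∨ (b ∧ a′))))
                     (J e) (X (s e)) (X (t e)) (A (s e)) (A (t e)) (B (s e)) (B (t e)) $ᵇ ⊆⇒ᵇ (cov (s e)) $ᵇ ⊆⇒ᵇ (cov (t e)) $ᵇ h)

  adj-of : ∀ {A B} → Conn J (A ∪ B) → Disj A B → Inh A → Inh B → Adj A B
  adj-of {A} {B} c d iA (b , Bb) = conn-adj c (⊆-∪ˡ B) iA (b , ∨-r {A b} Bb ∧ⁱ not-t (¬t⇒f λ p → d b p Bb)) (λ _ p → p)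

  opaque
    unfolding ins bet touch

    touch-≤ : ∀ {X A B} → X ⊆ A ∪ B → touch X A ≤ ins A + bet A B
    touch-≤ {X} {A} {B} cov = cnt1≤2 _ _ _ λ e → ≤ᵇ-sound
      (taut 7 (λ j x x′ a a′ b b′ → (x ⇒ᵇ (a ∨ b)) ⇒ᵇ (x′ ⇒ᵇ (a′ ∨ b′)) ⇒ᵇ
         (b2n (j ∧ ((x ∧ x′) ∧ (a ∨ a′))) ≤ᵇ b2n (j ∧ (a ∧ a′)) + b2n (j ∧ ((a ∧ b′) ∨ (b ∧ a′)))))
         (J e) (X (s e)) (X (t e)) (A (s e)) (A (t e)) (B (s e)) (B (t e)) $ᵇ ⊆⇒ᵇ (cov (s e)) $ᵇ ⊆⇒ᵇ (cov (t e)))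

  opaque
    unfolding ins bet touch

    spanning-ins : ∀ {A} → Conn J A → cnt A ≤ 1 + ins A
    spanning-ins = spanning

    grow-ins : ∀ {A K} → Conn J A → K ⊆ A → Inh K → ins K + cnt (A ∖ K) ≤ ins A
    grow-ins = grow

  two-of-adj : ∀ {A B C} → Conn J A → Disj A B → Disj A C → Disj B C → Adj A B → Adj A C → Two A (B ∪ C)
  two-of-adj {A} {B} {C} cA dB dC dBC p q =
    lin (cnt A ∷ ins A ∷ bet A B ∷ bet A C ∷ bet A (B ∪ C) ∷ [])
      (λ { (a ∷ i ∷ b ∷ c ∷ u ∷ []) → (a :≤ con 1 :+ i) ∷ (con 1 :≤ b) ∷ (con 1 :≤ c) ∷ (b :+ c :≤ u) ∷ [] ⊢ (con 1 :+ a :≤ i :+ u) })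
      (spanning-ins cA , p , q , bet-∪ dB dC dBC)

  two-mono : ∀ {A B B′} → B ⊆ B′ → Two A B → Two A B′
  two-mono {A} h t = ≤-trans t (+-monoʳ-≤ (ins A) (bet-mono (λ _ → id) h))

  two-cyclic : ∀ {A B} → Cyclic A → Adj A B → Two A B
  two-cyclic {A} {B} c p = ≤-trans (≤-reflexive (+-comm 1 (cnt A))) (+-mono-≤ c p)

  cyclic-∪ : ∀ {A B} → Conn J A → Conn J B → Disj A B → 2 ≤ bet A B → Cyclic (A ∪ B)
  cyclic-∪ {A} {B} cA cB d p = lin (cnt A ∷ cnt B ∷ ins A ∷ ins B ∷ bet A B ∷ cnt (A ∪ B) ∷ ins (A ∪ B) ∷ [])
    (λ { (a ∷ b ∷ i ∷ j ∷ e ∷ u ∷ v ∷ []) → (a :≤ con 1 :+ i) ∷ (b :≤ con 1 :+ j) ∷ (con 2 :≤ e) ∷ (u :≤ a :+ b) ∷ (i :+ j :+ e :≤ v) ∷ [] ⊢ (u :≤ v) })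
    (spanning-ins cA , spanning-ins cB , p , cnt-∪-≤ A B , ins-∪ d)

  cyclic-mono : ∀ {A B} → Conn J B → A ⊆ B → Inh A → Cyclic A → Cyclic B
  cyclic-mono {A} {B} cB A⊆B iA c = lin (cnt A ∷ ins A ∷ cnt B ∷ cnt (B ∖ A) ∷ ins B ∷ [])
    (λ { (a ∷ i ∷ b ∷ r ∷ j ∷ []) → (a :≤ i) ∷ (b :≤ a :+ r) ∷ (i :+ r :≤ j) ∷ [] ⊢ (b :≤ j) })
    (c , (≤-trans (cnt-⊆ λ v p → trans (sym (∪-∖ A⊆B v)) p) (cnt-∪-≤ A (B ∖ A))) , grow-ins cB A⊆B iA)

  two-cyclic-∪ : ∀ {A B} → Conn J B → Disj A B → Two A B → Cyclic (A ∪ B)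
  two-cyclic-∪ {A} {B} cB d tw = lin (cnt A ∷ cnt B ∷ ins A ∷ ins B ∷ bet A B ∷ cnt (A ∪ B) ∷ ins (A ∪ B) ∷ [])
    (λ { (a ∷ b ∷ i ∷ j ∷ e ∷ u ∷ v ∷ []) → (con 1 :+ a :≤ i :+ e) ∷ (b :≤ con 1 :+ j) ∷ (u :≤ a :+ b) ∷ (i :+ j :+ e :≤ v) ∷ [] ⊢ (u :≤ v) })
    (tw , spanning-ins cB , cnt-∪-≤ A B , ins-∪ d)

  opaque
    unfolding ins bet touch

    closed-apart : ∀ {A K} → Closed J A K → Apart K (A ∖ K)
    closed-apart cl = cnt-none λ e → ¬t⇒f λ h → absurdᵇ (∧-r {J e} h) (cl e (∧-l h))

  opaque
    unfolding ins bet touch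

    -- Within `A ∪ C` the set `K` is attached to `A` only. A cut that does not split `A` is extended
    -- by placing `K` on the side of `A`; the edge that crosses the extended cut then avoids `K`.
    conn-delete : ∀ {A C K} → Conn J A → Conn J (A ∪ C) → Disj A C → Apart K (C ∖ K) → Conn J (A ∪ (C ∖ K))
    conn-delete {A} {C} {K} cA c d ap = (proj₁ (Conn.inh cA) , ∨-l (proj₂ (Conn.inh cA))) , cut
      where
      none : ∀ e → not (J e ∧ joins K (C ∖ K) e) ≡ true
      none e = not-t (cnt-0 ap e)
      cut : ∀ S → Inh ((A ∪ (C ∖ K)) ∩ S) → Inh ((A ∪ (C ∖ K)) ∖ S) → Inh (J ∩ crosses (A ∪ (C ∖ K)) S)
      cut S (x , hx) (y , hy) with inh⊎empty (A ∩ S) | inh⊎empty (A ∖ S)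
      ... | inj₁ p | inj₁ q = let e , h = Conn.cut cA S p q in
        e , (taut 6 (λ j a a′ c c′ x → (j ∧ ((a ∧ a′) ∧ x)) ⇒ᵇ (j ∧ (((a ∨ c) ∧ (a′ ∨ c′)) ∧ x)))
               (J e) (A (s e)) (A (t e)) ((C ∖ K) (s e)) ((C ∖ K) (t e)) (S (s e) xor S (t e)) $ᵇ h)
      ... | inj₂ noS | _ with Conn.cut c (S ∖ K) (x , (taut 4 (λ a c k σ → not (a ∧ σ) ⇒ᵇ ((a ∨ (c ∧ not k)) ∧ σ) ⇒ᵇ ((a ∨ c) ∧ (σ ∧ not k))) (A x) (C x) (K x) (S x) $ᵇ not-t (noS x) $ᵇ hx))
                                            (y , (taut 4 (λ a c k σ → ((a ∨ (c ∧ not k)) ∧ not σ) ⇒ᵇ ((a ∨ c) ∧ not (σ ∧ not k))) (A y) (C y) (K y) (S y) $ᵇ hy))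
      ...   | e , h = e , (taut 9 (λ j a a′ c c′ k k′ σ σ′ → not (j ∧ ((k ∧ (c′ ∧ not k′)) ∨ ((c ∧ not k) ∧ k′))) ⇒ᵇ not (a ∧ σ) ⇒ᵇ not (a′ ∧ σ′) ⇒ᵇ not (a ∧ c) ⇒ᵇ not (a′ ∧ c′) ⇒ᵇ
                (j ∧ (((a ∨ c) ∧ (a′ ∨ c′)) ∧ ((σ ∧ not k) xor (σ′ ∧ not k′)))) ⇒ᵇ (j ∧ (((a ∨ (c ∧ not k)) ∧ (a′ ∨ (c′ ∧ not k′))) ∧ (σ xor σ′))))
                (J e) (A (s e)) (A (t e)) (C (s e)) (C (t e)) (K (s e)) (K (t e)) (S (s e)) (S (t e))
                $ᵇ none e $ᵇ not-t (noS (s e)) $ᵇ not-t (noS (t e)) $ᵇ disj-not d (s e) $ᵇ disj-not d (t e) $ᵇ h)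
      cut S (x , hx) (y , hy) | inj₁ _ | inj₂ all with Conn.cut c (S ∪ (C ∩ K)) (x , (taut 4 (λ a c k σ → ((a ∨ (c ∧ not k)) ∧ σ) ⇒ᵇ ((a ∨ c) ∧ (σ ∨ (c ∧ k)))) (A x) (C x) (K x) (S x) $ᵇ hx))
                                            (y , (taut 4 (λ a c k σ → not (a ∧ not σ) ⇒ᵇ ((a ∨ (c ∧ not k)) ∧ not σ) ⇒ᵇ ((a ∨ c) ∧ not (σ ∨ (c ∧ k)))) (A y) (C y) (K y) (S y) $ᵇ not-t (all y) $ᵇ hy))
      ...   | e , h = e , (taut 9 (λ j a a′ c c′ k k′ σ σ′ → not (j ∧ ((k ∧ (c′ ∧ not k′)) ∨ ((c ∧ not k) ∧ k′))) ⇒ᵇ not (a ∧ not σ) ⇒ᵇ not (a′ ∧ not σ′) ⇒ᵇ not (a ∧ c) ⇒ᵇ not (a′ ∧ c′) ⇒ᵇ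
                (j ∧ (((a ∨ c) ∧ (a′ ∨ c′)) ∧ ((σ ∨ (c ∧ k)) xor (σ′ ∨ (c′ ∧ k′))))) ⇒ᵇ (j ∧ (((a ∨ (c ∧ not k)) ∧ (a′ ∨ (c′ ∧ not k′))) ∧ (σ xor σ′))))
                (J e) (A (s e)) (A (t e)) (C (s e)) (C (t e)) (K (s e)) (K (t e)) (S (s e)) (S (t e))
                $ᵇ none e $ᵇ not-t (all (s e)) $ᵇ not-t (all (t e)) $ᵇ disj-not d (s e) $ᵇ disj-not d (t e) $ᵇ h)

  -- What a member A ∪ C of the family 𝓕 provides for its part C.
  record Side (A C : BSet n) : Set where
    field
      conn : Conn J (A ∪ C)
      core : ∀ S → S ⊆ C → Inh S → suc (cnt S) ≤ touch (A ∪ C) S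
      two  : Two A C
      exc  : suc (cnt (A ∪ C)) ≤ ins (A ∪ C)

  -- Two adjacent sets over a common `C`. Here and in `B1′` it is shown that `C` can only be a
  -- single vertex without loop.
  module B1 {A B C : BSet n} (cA : Conn J A) (cB : Conn J B) (dAB : Disj A B) (dAC : Disj A C) (dBC : Disj B C)
            (AB : Adj A B) (X : Side A C) (Y : Side B C) where

    private
      module X = Side X
      module Y = Side Y
      iA = Conn.inh cA
      iB = Conn.inh cB

    -- The density of `R` makes `A ∪ R` cyclic, and `K`, `B`, `A ∪ R` form the triangle of
    -- `excl-A3`.
    disconnected : ∀ {K} → K ⊆ C → Conn J K → Apart K (C ∖ K) → Inh (C ∖ K) → ⊥
    disconnected {K} K⊆C cK ap iR = excl-A3 K B (A ∪ R) cK cB (conn-delete cA X.conn dAC ap)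
      (disj-⊆ K⊆C (λ _ → id) (sym-disj dBC)) (disj-∪ʳ (disj-⊆ K⊆C (λ _ → id) (sym-disj dAC)) (sym-disj (∖-disj C K)))
      (disj-∪ʳ (sym-disj dAB) dBR)
      (sym-adj (adj-part B dBC iB Y.conn (λ _ → id))) (adj-mono (λ _ → id) (⊆-∪ˡ R) (sym-adj (adj-part A dAC iA X.conn (λ _ → id))))
      (adj-mono (λ _ → id) (⊆-∪ˡ R) (sym-adj AB)) cyc twoK
      (two-of-adj cB (sym-disj dAB) dBR dAR (sym-adj AB) (adj-rest B dBC iB Y.conn))
      where
      R = C ∖ K
      dAR : Disj A R
      dAR = disj-⊆ (λ _ → id) (∖-⊆ C) dAC
      dBR : Disj B R
      dBR = disj-⊆ (λ _ → id) (∖-⊆ C) dBC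
      adj-part : ∀ D → Disj D C → Inh D → Conn J (D ∪ C) → K ⊆ K → Adj D K
      adj-part D dDC (x , Dx) c _ = sym-adj ([ id , (λ q → ⊥-elim (apart-¬adj ap q)) ]′ (adj-∪ D R
        (conn-adj c (λ v p → ∨-r {D v} (K⊆C v p)) (Conn.inh cK) (x , ∨-l Dx ∧ⁱ not-t (¬t⇒f λ p → dDC x Dx (K⊆C x p)))
          (λ v p → taut 3 (λ d c k → (d ∨ c) ⇒ᵇ (k ∨ (d ∨ (c ∧ not k)))) (D v) (C v) (K v) $ᵇ p))))
      adj-rest : ∀ D → Disj D C → Inh D → Conn J (D ∪ C) → Adj D R
      adj-rest D dDC (x , Dx) c = sym-adj ([ id , (λ q → ⊥-elim (apart-¬adj ap (sym-adj q))) ]′ (adj-∪ D K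
        (conn-adj c (λ v p → ∨-r {D v} (∧-l p)) iR (x , ∨-l Dx ∧ⁱ not-t (¬t⇒f λ p → dDC x Dx (∧-l p)))
          (λ v p → taut 3 (λ d c k → (d ∨ c) ⇒ᵇ ((c ∧ not k) ∨ (d ∨ k))) (D v) (C v) (K v) $ᵇ p))))
      cyc : Cyclic (A ∪ R)
      cyc = lin (cnt (A ∪ R) ∷ cnt A ∷ cnt R ∷ ins A ∷ touch (A ∪ C) R ∷ ins R ∷ bet R A ∷ bet R K ∷ bet A R ∷ bet R (A ∪ K) ∷ ins (A ∪ R) ∷ [])
        (λ { (u ∷ a ∷ r ∷ iA ∷ t ∷ iR ∷ ra ∷ rk ∷ ar ∷ rak ∷ iu ∷ []) →
          (u :≤ a :+ r) ∷ (a :≤ con 1 :+ iA) ∷ (con 1 :+ r :≤ t) ∷ (t :≤ iR :+ rak) ∷ (rak :≤ ra :+ rk) ∷ (rk :≤ con 0) ∷ (ra :≤ ar) ∷ (iA :+ iR :+ ar :≤ iu) ∷ [] ⊢ (u :≤ iu) })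
        ( cnt-∪-≤ A R , spanning-ins cA , X.core R (∖-⊆ C) iR
        , touch-≤ (λ v p → taut 3 (λ d c k → (d ∨ c) ⇒ᵇ ((c ∧ not k) ∨ (d ∨ k))) (A v) (C v) (K v) $ᵇ p)
        , bet-∪-≤ R A K , ≤-reflexive (apart-sym {K} {R} ap) , ≤-reflexive (bet-sym R A) , ins-∪ dAR)
      twoK : Two K (A ∪ R)
      twoK = ≤-trans (X.core K K⊆C (Conn.inh cK)) (touch-≤ λ v p → taut 3 (λ d c k → (d ∨ c) ⇒ᵇ (k ∨ (d ∨ (c ∧ not k)))) (A v) (C v) (K v) $ᵇ p)

    cyclic : Conn J C → Cyclic C → ⊥
    cyclic cC cyc = excl-A3 A B C cA cB cC dAB dAC dBC AB (adj-of X.conn dAC iA (Conn.inh cC)) (adj-of Y.conn dBC iB (Conn.inh cC)) cyc X.two Y.two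

sep : ∀ {n} {A B : BSet n} Y → A ⊆ Y → B ⊆ (not ∘ Y) → Disj A B
sep Y h k v p q = absurdᵇ (h v p) (not-f (k v q))

inh-mono : ∀ {n} {A B : BSet n} → A ⊆ B → Inh A → Inh B
inh-mono h (v , p) = v , h v p

-- Components as parts, and two sets over a common third

module Splitting (G : Graph) (J : BSet (nE G)) (excl : NoMinors G) where

  open Counting G J excl public
  private n = nV G

  record Piece (C : BSet n) (a : Fin n) : Set where
    field
      K     : BSet n
      sub   : K ⊆ C
      has   : K a ≡ true
      conn  : Conn J K
      apart : Apart K (C ∖ K)

  opaque
    piece : ∀ C a → C a ≡ true → Piece C a
    piece C a p = record { K = K ; sub = sub ; has = has ; conn = conn ; apart = closed-apart {C} {K} closed }
      where open Comp (comp J C a p)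

  absorb : ∀ {C K A} → Conn J A → A ⊆ C → Apart K (C ∖ K) → Inh (A ∩ K) → A ⊆ K
  absorb {C} {K} {A} cA A⊆C ap (x , hx) v Av with K v in Kv
  ... | true  = refl
  ... | false = ⊥-elim (apart-¬adj ap (adj-mono {A ∩ K} {K} {C ∖ K} {C ∖ K} (λ w → ∧-r {A w}) (λ _ → id)
        (conn-adj cA (λ w → ∧-l) (x , hx) (v , (Av ∧ⁱ not-t (¬t⇒f λ p → absurdᵇ (∧-r {A v} p) Kv)))
          (λ w p → taut 3 (λ a c k → (a ⇒ᵇ c) ⇒ᵇ a ⇒ᵇ ((a ∧ k) ∨ (c ∧ not k))) (A w) (C w) (K w) $ᵇ ⊆⇒ᵇ (A⊆C w) $ᵇ p))))

  -- Connectedness of `X` gives `K` an edge to the rest of `X`, and the rest of `D` is out of reach.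
  piece-adj : ∀ {X P D K} → Conn J X → X ⊆ P ∪ D → K ⊆ X → Inh K → Inh (X ∖ K) → Apart K (D ∖ K) → Adj K P
  piece-adj {X} {P} {D} {K} cX cov K⊆X iK out ap = [ id , (λ q → ⊥-elim (apart-¬adj ap q)) ]′ (adj-∪ P (D ∖ K)
    (conn-adj cX K⊆X iK out λ v p → taut 4 (λ x p d k → (x ⇒ᵇ (p ∨ d)) ⇒ᵇ x ⇒ᵇ (k ∨ (p ∨ (d ∧ not k)))) (X v) (P v) (D v) (K v) $ᵇ ⊆⇒ᵇ (cov v) $ᵇ p))

  excess-mono : ∀ {X Y} → Conn J Y → X ⊆ Y → Inh X → suc (cnt X) ≤ ins X → suc (cnt Y) ≤ ins Y
  excess-mono {X} {Y} cY X⊆Y iX ex = lin (cnt X ∷ ins X ∷ cnt Y ∷ cnt (Y ∖ X) ∷ ins Y ∷ [])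
    (λ { (a ∷ i ∷ b ∷ r ∷ j ∷ []) → (con 1 :+ a :≤ i) ∷ (b :≤ a :+ r) ∷ (i :+ r :≤ j) ∷ [] ⊢ (con 1 :+ b :≤ j) })
    (ex , (≤-trans (cnt-⊆ λ v p → trans (sym (∪-∖ X⊆Y v)) p) (cnt-∪-≤ X (Y ∖ X))) , grow-ins cY X⊆Y iX)

  two-touch : ∀ {X S B} → suc (cnt S) ≤ touch X S → X ⊆ S ∪ B → Two S B
  two-touch h cov = ≤-trans h (touch-≤ cov)

  two-apart : ∀ {A B C} → Two A (B ∪ C) → Apart A C → Two A B
  two-apart {A} {B} {C} tw ap = ≤-trans tw (+-monoʳ-≤ (ins A) (≤-trans (bet-∪-≤ A B C) (≤-reflexive (trans (cong (bet A B +_) ap) (+-identityʳ _)))))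

  -- The two edges between `B` and `U` make `B ∪ U` cyclic; `A` and `V` are adjacent to each other
  -- and have an edge to each of its halves.
  heavy : ∀ {A B U V} → Conn J A → Conn J B → Conn J U → Conn J V → Disj A B → Disj A U → Disj A V → Disj B U → Disj B V → Disj U V →
          Adj A B → Adj A U → Adj A V → Adj V B → Adj V U → 2 ≤ bet B U → ⊥
  heavy {A} {B} {U} {V} cA cB cU cV dAB dAU dAV dBU dBV dUV ab au av vb vu bu =
    excl-A3 A V (B ∪ U) cA cV (conn-join cB cU (≤-trans (s≤s z≤n) bu)) dAV (disj-∪ʳ dAB dAU) (disj-∪ʳ (sym-disj dBV) (sym-disj dUV))
      av (adj-mono (λ _ → id) (⊆-∪ˡ U) ab) (adj-mono (λ _ → id) (⊆-∪ˡ U) vb) (cyclic-∪ cB cU dBU bu)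
      (two-of-adj cA dAB dAU dBU ab au) (two-of-adj cV (sym-disj dBV) (sym-disj dUV) dBU vb vu)

  opaque
    unfolding ins

    ins-edge : ∀ {C} → 1 ≤ ins C → ∃ λ e → J e ≡ true × C (s e) ≡ true × C (t e) ≡ true
    ins-edge {C} p = let e , h = cnt-∃ p in e , ∧-l {J e} h , ∧-l {C (s e)} (∧-r {J e} h) , ∧-r {C (s e)} (∧-r {J e} h)

    edge-ins : ∀ {C} e → J e ≡ true → C (s e) ≡ true → C (t e) ≡ true → 1 ≤ ins C
    edge-ins e p q r = ∃-cnt e (p ∧ⁱ q ∧ⁱ r)

  record Halves (C : BSet n) : Set where
    field
      {U V} : BSet n
      cU   : Conn J U
      cV   : Conn J V
      dUV  : Disj U V
      U⊆   : U ⊆ C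
      V⊆   : V ⊆ C
      cov  : C ⊆ U ∪ V

  -- One half is the component of `v` after removal of `u`; the remainder is held together by `u`.
  halve : ∀ {C} u v → Conn J C → C u ≡ true → C v ≡ true → ¬ u ≡ v → Halves C
  halve {C} u v cC Cu Cv u≢v = record
    { U = K ; V = ⁅ u ⁆ ∪ (D ∖ K) ; cU = P.conn ; cV = conn-delete {⁅ u ⁆} {D} {K} (conn-single u)
        (Conn-resp {J} (∪-∖ (λ w h → subst (λ z → C z ≡ true) (sym (==-t {i = w} h)) Cu)) cC) (sym-disj (∖-disj C ⁅ u ⁆)) P.apart
    ; dUV = disj-∪ʳ (disj-⊆ P.sub (λ _ → id) (∖-disj C ⁅ u ⁆)) (sym-disj (∖-disj D K))
    ; U⊆ = λ w h → ∧-l (P.sub w h)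
    ; V⊆ = ∪-⊆ (λ w h → subst (λ z → C z ≡ true) (sym (==-t {i = w} h)) Cu) (λ w h → ∧-l (∧-l {D w} h))
    ; cov = λ w h → taut 3 (λ c x k → c ⇒ᵇ (k ∨ (x ∨ ((c ∧ not x) ∧ not k)))) (C w) (w == u) (K w) $ᵇ h }
    where
    D = C ∖ ⁅ u ⁆
    P : Piece D v
    P = piece D v (Cv ∧ⁱ not-t (==-f (u≢v ∘ sym)))
    module P = Piece P
    K = P.K

  module B1′ {A B C : BSet n} (cA : Conn J A) (cB : Conn J B) (dAB : Disj A B) (dAC : Disj A C) (dBC : Disj B C)
             (AB : Adj A B) (X : Side A C) (Y : Side B C) where

    open B1 cA cB dAB dAC dBC AB X Y

    connected : Inh C → Conn J C
    connected (c , Cc) with inh⊎empty (C ∖ Piece.K (piece C c Cc))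
    ... | inj₁ i = ⊥-elim (disconnected (Piece.sub P) (Piece.conn P) (Piece.apart P) i)
      where P = piece C c Cc
    ... | inj₂ em = Conn-resp {J} same (Piece.conn P)
      where
      P = piece C c Cc
      same : ∀ v → Piece.K P v ≡ C v
      same v = bool-iff (Piece.sub P v) λ p → taut 2 (λ c k → c ⇒ᵇ not (c ∧ not k) ⇒ᵇ k) (C v) (Piece.K P v) $ᵇ p $ᵇ not-t (em v)

    module _ (iC : Inh C) where
      private cC = connected iC

      -- `C` is a tree, so at most |U| edges run inside `U` or from `U` to `V`. The density of `U`
      -- demands one more, which must lead to `D`.
      half-adj : ∀ {D U V} → Side D C → suc (ins C) ≤ cnt C → Conn J U → Conn J V → Disj U V → U ⊆ C → V ⊆ C → C ⊆ U ∪ V → Adj U D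
      half-adj {D} {U} {V} S small cU cV dUV U⊆ V⊆ cov =
        lin (cnt U ∷ cnt V ∷ cnt C ∷ ins U ∷ ins V ∷ ins C ∷ bet U V ∷ bet U D ∷ touch (D ∪ C) U ∷ bet U (D ∪ V) ∷ ins (U ∪ V) ∷ [])
          (λ { (u ∷ v ∷ c ∷ iu ∷ iv ∷ ic ∷ uv ∷ ud ∷ t ∷ udv ∷ iuv ∷ []) →
            (con 1 :+ u :≤ t) ∷ (t :≤ iu :+ udv) ∷ (udv :≤ ud :+ uv) ∷ (iu :+ iv :+ uv :≤ iuv) ∷ (iuv :≤ ic) ∷ (v :≤ con 1 :+ iv) ∷ (con 1 :+ ic :≤ c) ∷ (c :≤ u :+ v) ∷ []
            ⊢ (con 1 :≤ ud) })
          ( Side.core S U U⊆ (Conn.inh cU)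
          , touch-≤ (λ w p → taut 4 (λ d c u v → (c ⇒ᵇ (u ∨ v)) ⇒ᵇ (d ∨ c) ⇒ᵇ (u ∨ (d ∨ v))) (D w) (C w) (U w) (V w) $ᵇ ⊆⇒ᵇ (cov w) $ᵇ p)
          , bet-∪-≤ U D V , ins-∪ dUV , ins-mono (∪-⊆ U⊆ V⊆) , spanning-ins cV , small , ≤-trans (cnt-⊆ cov) (cnt-∪-≤ U V))

      -- A cyclic `C` is already excluded and a loop would make it cyclic. Otherwise `C` is a tree
      -- with two vertices and falls into two halves, each adjacent to both `A` and `B`; a double
      -- edge from `A` or `B` to a half is then `heavy`.
      no-edges : ins C ≡ 0
      no-edges with ins C in eq
      ... | zero  = refl
      ... | suc _ with ins-edge {C} (subst (1 ≤_) (sym eq) (s≤s z≤n)) | cnt C ≤? ins C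
      ...   | _ | yes cyc = ⊥-elim (cyclic cC cyc)
      ...   | e , Je , Cs , Ct | no ¬cyc with s e ≟ᶠ t e
      ...     | yes same = ⊥-elim (cyclic cC (cyclic-mono cC (λ w h → subst (λ z → C z ≡ true) (sym (==-t {i = w} h)) Cs) (s e , ==-refl (s e))
                  (≤-trans (≤-reflexive (sum-== (s e))) (edge-ins {⁅ s e ⁆} e Je (==-refl (s e)) (subst (λ z → z == s e ≡ true) same (==-refl (s e)))))))
      ...     | no differ = ⊥-elim (tree (halve (s e) (t e) cC Cs Ct differ))
        where
        small : suc (ins C) ≤ cnt C
        small = ≰⇒> ¬cyc
        tree : Halves C → ⊥
        tree H with 2 ≤? bet B U | 2 ≤? bet B V | 2 ≤? bet A U | 2 ≤? bet A V
          where open Halves H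
        ... | yes p | _ | _ | _ = heavy cA cB cU cV dAB dAU dAV dBU dBV dUV AB (sym-adj au) (sym-adj av) bv (sym-adj uv) p
          where
          open Halves H
          dAU = disj-⊆ (λ _ → id) U⊆ dAC
          dAV = disj-⊆ (λ _ → id) V⊆ dAC
          dBU = disj-⊆ (λ _ → id) U⊆ dBC
          dBV = disj-⊆ (λ _ → id) V⊆ dBC
          au = half-adj X small cU cV dUV U⊆ V⊆ cov
          av = half-adj X small cV cU (sym-disj dUV) V⊆ U⊆ (λ w p → trans (∨-comm (V w) (U w)) (cov w p))
          bv = half-adj Y small cV cU (sym-disj dUV) V⊆ U⊆ (λ w p → trans (∨-comm (V w) (U w)) (cov w p))
          uv = adj-of (Conn-resp {J} (λ w → bool-iff (cov w) (∪-⊆ U⊆ V⊆ w)) cC) dUV (Conn.inh cU) (Conn.inh cV)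
        ... | _ | yes p | _ | _ = heavy cA cB cV cU dAB dAV dAU dBV dBU (sym-disj dUV) AB (sym-adj av) (sym-adj au) bu uv p
          where
          open Halves H
          dAU = disj-⊆ (λ _ → id) U⊆ dAC
          dAV = disj-⊆ (λ _ → id) V⊆ dAC
          dBU = disj-⊆ (λ _ → id) U⊆ dBC
          dBV = disj-⊆ (λ _ → id) V⊆ dBC
          au = half-adj X small cU cV dUV U⊆ V⊆ cov
          av = half-adj X small cV cU (sym-disj dUV) V⊆ U⊆ (λ w p → trans (∨-comm (V w) (U w)) (cov w p))
          bu = half-adj Y small cU cV dUV U⊆ V⊆ cov
          uv = adj-of (Conn-resp {J} (λ w → bool-iff (cov w) (∪-⊆ U⊆ V⊆ w)) cC) dUV (Conn.inh cU) (Conn.inh cV)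
        ... | _ | _ | yes p | _ = heavy cB cA cU cV (sym-disj dAB) dBU dBV dAU dAV dUV (sym-adj AB) (sym-adj bu) (sym-adj bv) av (sym-adj uv) p
          where
          open Halves H
          dAU = disj-⊆ (λ _ → id) U⊆ dAC
          dAV = disj-⊆ (λ _ → id) V⊆ dAC
          dBU = disj-⊆ (λ _ → id) U⊆ dBC
          dBV = disj-⊆ (λ _ → id) V⊆ dBC
          av = half-adj X small cV cU (sym-disj dUV) V⊆ U⊆ (λ w p → trans (∨-comm (V w) (U w)) (cov w p))
          bu = half-adj Y small cU cV dUV U⊆ V⊆ cov
          bv = half-adj Y small cV cU (sym-disj dUV) V⊆ U⊆ (λ w p → trans (∨-comm (V w) (U w)) (cov w p))
          uv = adj-of (Conn-resp {J} (λ w → bool-iff (cov w) (∪-⊆ U⊆ V⊆ w)) cC) dUV (Conn.inh cU) (Conn.inh cV)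
        ... | _ | _ | _ | yes p = heavy cB cA cV cU (sym-disj dAB) dBV dBU dAV dAU (sym-disj dUV) (sym-adj AB) (sym-adj bv) (sym-adj bu) au uv p
          where
          open Halves H
          dAU = disj-⊆ (λ _ → id) U⊆ dAC
          dAV = disj-⊆ (λ _ → id) V⊆ dAC
          dBU = disj-⊆ (λ _ → id) U⊆ dBC
          dBV = disj-⊆ (λ _ → id) V⊆ dBC
          au = half-adj X small cU cV dUV U⊆ V⊆ cov
          bu = half-adj Y small cU cV dUV U⊆ V⊆ cov
          bv = half-adj Y small cV cU (sym-disj dUV) V⊆ U⊆ (λ w p → trans (∨-comm (V w) (U w)) (cov w p))
          uv = adj-of (Conn-resp {J} (λ w → bool-iff (cov w) (∪-⊆ U⊆ V⊆ w)) cC) dUV (Conn.inh cU) (Conn.inh cV)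
        -- With at most one edge from `A` and from `B` to each half, the excess of `A ∪ C` and of
        -- `B ∪ C` must come from cycles in `A` and in `B`.
        ... | no b₁ | no b₂ | no a₁ | no a₂ = excl-A3 C B A cC cB cA (sym-disj dBC) (sym-disj dAC) (sym-disj dAB)
              (sym-adj (adj-of (Side.conn Y) dBC (Conn.inh cB) iC)) (sym-adj (adj-of (Side.conn X) dAC (Conn.inh cA) iC)) (sym-adj AB)
              (cyc X dAC (≤-pred (≰⇒> a₁)) (≤-pred (≰⇒> a₂))) twoC (two-cyclic (cyc Y dBC (≤-pred (≰⇒> b₁)) (≤-pred (≰⇒> b₂))) (sym-adj AB))
          where
          open Halves H
          cyc : ∀ {D} → Side D C → Disj D C → bet D U ≤ 1 → bet D V ≤ 1 → Cyclic D
          cyc {D} S dDC p q = lin (cnt D ∷ cnt C ∷ cnt (D ∪ C) ∷ ins D ∷ ins C ∷ ins (D ∪ C) ∷ bet D C ∷ bet D (U ∪ V) ∷ bet D U ∷ bet D V ∷ [])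
            (λ { (d ∷ c ∷ dc ∷ id ∷ ic ∷ idc ∷ b ∷ buv ∷ bu ∷ bv ∷ []) →
              (d :+ c :≤ dc) ∷ (con 1 :+ dc :≤ idc) ∷ (idc :≤ id :+ ic :+ b) ∷ (b :≤ buv) ∷ (buv :≤ bu :+ bv) ∷ (bu :≤ con 1) ∷ (bv :≤ con 1) ∷ (con 1 :+ ic :≤ c) ∷ []
              ⊢ (d :≤ id) })
            (cnt-∪ dDC , Side.exc S , ins-∪-≤ D C , bet-mono (λ _ → id) cov , bet-∪-≤ D U V , p , q , small)
          twoC : Two C A
          twoC = lin (cnt C ∷ ins C ∷ bet C A ∷ bet A C ∷ bet A (U ∪ V) ∷ bet A U ∷ bet A V ∷ bet U A ∷ bet V A ∷ [])
            (λ { (c ∷ i ∷ ca ∷ ac ∷ auv ∷ au ∷ av ∷ ua ∷ va ∷ []) →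
              (c :≤ con 1 :+ i) ∷ (ac :≤ ca) ∷ (auv :≤ ac) ∷ (au :+ av :≤ auv) ∷ (ua :≤ au) ∷ (va :≤ av) ∷ (con 1 :≤ ua) ∷ (con 1 :≤ va) ∷ [] ⊢ (con 1 :+ c :≤ i :+ ca) })
            ( spanning-ins cC , ≤-reflexive (bet-sym A C) , bet-mono (λ _ → id) (∪-⊆ U⊆ V⊆)
            , bet-∪ (disj-⊆ (λ _ → id) U⊆ dAC) (disj-⊆ (λ _ → id) V⊆ dAC) dUV , ≤-reflexive (bet-sym U A) , ≤-reflexive (bet-sym V A)
            , half-adj X small cU cV dUV U⊆ V⊆ cov
            , half-adj X small cV cU (sym-disj dUV) V⊆ U⊆ (λ w p → trans (∨-comm (V w) (U w)) (cov w p)))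

      singleton : cnt C ≤ 1
      singleton = ≤-trans (spanning-ins cC) (≤-reflexive (cong suc no-edges))

-- The family 𝓕 and its incomparable pairs

module Family (G : Graph) (J : BSet (nE G)) (excl : NoMinors G) (U : BSet (nV G))
              (cU : Gr.Conn (Cycles.s G) (Cycles.t G) J U)
              (coreU : ∀ S → S ⊆ U → Inh S → Inh (U ∖ S) → suc (cnt S) ≤ Counting.touch G J excl U S) where

  open Splitting G J excl public
  private n = nV G

  record F (X : BSet n) : Set where
    field
      sub  : X ⊆ U
      out  : Inh (U ∖ X)
      conn : Conn J X
      core : ∀ S → S ⊆ X → Inh S → Inh (X ∖ S) → suc (cnt S) ≤ touch X S
      exc  : suc (cnt X) ≤ ins X
      co   : Conn J (U ∖ X)

  opaque
    unfolding touch

    touch-⊆ : ∀ {X Y S} → X ⊆ Y → touch X S ≤ touch Y S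
    touch-⊆ {X} {Y} {S} h = cnt-⊆ λ e p → ∧-l {J e} p ∧ⁱ
      (h _ (∧-l {X (s e)} (∧-l {E[ X ] e} (∧-r {J e} p))) ∧ⁱ h _ (∧-r {X (s e)} (∧-l {E[ X ] e} (∧-r {J e} p)))) ∧ⁱ ∧-r {E[ X ] e} (∧-r {J e} p)

    -- Edges of the first kind have an end outside `X`, so they differ from those of the second
    -- kind. They stay in `X′` because their end in `S` without `X` is not adjacent to `K`.
    touch-split : ∀ {X X′ Y K S} → S ⊆ Y ∖ K → Apart K ((Y ∖ X) ∖ K) → X ⊆ X′ → Y ∖ K ⊆ X′ → Disj X K →
                  touch Y (S ∖ X) + touch X (S ∩ X) ≤ touch X′ S
    touch-split {X} {X′} {Y} {K} {S} hS ap hX hY dXK = cnt2≤1 _ _ _ λ e → ≤ᵇ-sound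
      (taut 11 (λ j x x′ y y′ k k′ σ σ′ w w′ → (σ ⇒ᵇ (y ∧ not k)) ⇒ᵇ (σ′ ⇒ᵇ (y′ ∧ not k′)) ⇒ᵇ
        not (j ∧ ((k ∧ ((y′ ∧ not x′) ∧ not k′)) ∨ (((y ∧ not x) ∧ not k) ∧ k′))) ⇒ᵇ (x ⇒ᵇ w) ⇒ᵇ (x′ ⇒ᵇ w′) ⇒ᵇ ((y ∧ not k) ⇒ᵇ w) ⇒ᵇ ((y′ ∧ not k′) ⇒ᵇ w′) ⇒ᵇ
        (b2n (j ∧ ((y ∧ y′) ∧ ((σ ∧ not x) ∨ (σ′ ∧ not x′)))) + b2n (j ∧ ((x ∧ x′) ∧ ((σ ∧ x) ∨ (σ′ ∧ x′)))) ≤ᵇ b2n (j ∧ ((w ∧ w′) ∧ (σ ∨ σ′)))))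
        (J e) (X (s e)) (X (t e)) (Y (s e)) (Y (t e)) (K (s e)) (K (t e)) (S (s e)) (S (t e)) (X′ (s e)) (X′ (t e))
        $ᵇ ⊆⇒ᵇ (hS (s e)) $ᵇ ⊆⇒ᵇ (hS (t e)) $ᵇ not-t (apart-edge ap e)
        $ᵇ ⊆⇒ᵇ (hX (s e)) $ᵇ ⊆⇒ᵇ (hX (t e)) $ᵇ ⊆⇒ᵇ (hY (s e)) $ᵇ ⊆⇒ᵇ (hY (t e)))
      where
      opaque
        unfolding bet
        apart-edge : ∀ {A B} → Apart A B → ∀ e → J e ∧ joins A B e ≡ false
        apart-edge ap e = cnt-0 ap e

  side-of : ∀ {X A C} → F X → (∀ v → X v ≡ (A ∪ C) v) → Disj A C → Inh A → Inh C → Side A C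
  side-of {X} {A} {C} f eq d (a , Aa) (c , Cc) = record
    { conn = Conn-resp {J} eq conn
    ; core = λ S S⊆ iS → ≤-trans (core S (λ v p → inX (∨-r {A v} (S⊆ v p))) iS (a , inX (∨-l Aa) ∧ⁱ not-t (¬t⇒f λ p → d a Aa (S⊆ a p)))) (touch-⊆ λ v p → trans (sym (eq v)) p)
    ; two = two-touch (core A (λ v p → inX (∨-l p)) (a , Aa) (c , inX (∨-r {A c} Cc) ∧ⁱ not-t (¬t⇒f λ p → d c p Cc))) (λ v p → trans (sym (eq v)) p)
    ; exc = ≤-trans (≤-reflexive (cong suc (cnt-cong λ v → sym (eq v)))) (≤-trans exc (ins-mono λ v p → trans (sym (eq v)) p)) }
    where
    open F f
    inX : ∀ {v} → (A ∪ C) v ≡ true → X v ≡ true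
    inX {v} = trans (eq v)

  Incomp : BSet n → BSet n → Set
  Incomp X Y = Inh (X ∖ Y) × Inh (Y ∖ X)

  -- `B1′` is applied to the complement of `Y` and a component `K` of `Y` without `X`, over the rest
  -- of `Y`. That rest is then a single loopless vertex; as it contains `X ∩ Y`, it equals `X ∩ Y`,
  -- and `Y` without `X` is connected.
  module Apex {X Y : BSet n} (fX : F X) (fY : F Y) (inc : Incomp X Y) (iD : Inh (U ∖ (X ∪ Y))) (iC : Inh (X ∩ Y)) where

    private
      module X = F fX
      module Y = F fY
      A = X ∖ Y
      B = Y ∖ X
      b = proj₁ (proj₂ inc)
      P : Piece B b
      P = piece B b (proj₂ (proj₂ inc))
      module P = Piece P
      K = P.K
      A′ = U ∖ Y
      C′ = Y ∖ K
      X′ = U ∖ K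

    private
      K⊆Y : K ⊆ Y
      K⊆Y v p = ∧-l (P.sub v p)
      K⊆U : K ⊆ U
      K⊆U v p = Y.sub v (K⊆Y v p)
      dXK : Disj X K
      dXK v p q = absurdᵇ p (not-f (∧-r {Y v} (P.sub v q)))
      dA′K : Disj A′ K
      dA′K = disj-⊆ (λ _ → id) K⊆Y (∖-disj U Y)
      dA′C′ : Disj A′ C′
      dA′C′ = disj-⊆ (λ _ → id) (∖-⊆ Y) (∖-disj U Y)
      iC′ : Inh C′
      iC′ = proj₁ iC , ∧-r {X (proj₁ iC)} (proj₂ iC) ∧ⁱ not-t (¬t⇒f λ p → dXK (proj₁ iC) (∧-l (proj₂ iC)) p)
      iA : Inh A
      iA = proj₁ inc
      A⊆A′ : A ⊆ A′
      A⊆A′ v p = X.sub v (∧-l p) ∧ⁱ ∧-r {X v} p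
      A′K : Adj A′ K
      A′K = sym-adj (piece-adj {U ∖ X} {A′} {B} Y-co (λ v p → taut 3 (λ u x y → (u ∧ not x) ⇒ᵇ ((u ∧ not y) ∨ (y ∧ not x))) (U v) (X v) (Y v) $ᵇ p)
               (λ v p → K⊆U v p ∧ⁱ ∧-r {Y v} (P.sub v p)) (Conn.inh P.conn)
               (proj₁ iD , taut 4 (λ u x y k → (k ⇒ᵇ (y ∧ not x)) ⇒ᵇ (u ∧ not (x ∨ y)) ⇒ᵇ ((u ∧ not x) ∧ not k)) (U _) (X _) (Y _) (K _) $ᵇ ⊆⇒ᵇ (P.sub _) $ᵇ proj₂ iD)
               P.apart)
        where Y-co = X.co
      cX′ : Conn J X′
      cX′ = Conn-resp {J} same (conn-delete {X ∪ A′} {B} {K} cXA′ (Conn-resp {J} sameU cU) dXB P.apart)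
        where
        cXA′ : Conn J (X ∪ A′)
        cXA′ = conn-∪ X.conn Y.co (inj₁ (proj₁ iA , ∧-l {X (proj₁ iA)} (proj₂ iA) ∧ⁱ A⊆A′ _ (proj₂ iA)))
        dXB : Disj (X ∪ A′) B
        dXB = disj-∪ˡ (sym-disj (∖-disj Y X)) (disj-⊆ (λ _ → id) (∖-⊆ Y) (∖-disj U Y))
        sameU : ∀ v → U v ≡ ((X ∪ A′) ∪ B) v
        sameU v = bool-iff (λ p → taut 3 (λ u x y → u ⇒ᵇ ((x ∨ (u ∧ not y)) ∨ (y ∧ not x))) (U v) (X v) (Y v) $ᵇ p)
                           (λ p → taut 3 (λ u x y → (x ⇒ᵇ u) ⇒ᵇ (y ⇒ᵇ u) ⇒ᵇ ((x ∨ (u ∧ not y)) ∨ (y ∧ not x)) ⇒ᵇ u) (U v) (X v) (Y v) $ᵇ ⊆⇒ᵇ (X.sub v) $ᵇ ⊆⇒ᵇ (Y.sub v) $ᵇ p)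
        same : ∀ v → ((X ∪ A′) ∪ (B ∖ K)) v ≡ X′ v
        same v = bool-iff
          (λ p → taut 4 (λ u x y k → (x ⇒ᵇ u) ⇒ᵇ (y ⇒ᵇ u) ⇒ᵇ (k ⇒ᵇ (y ∧ not x)) ⇒ᵇ ((x ∨ (u ∧ not y)) ∨ ((y ∧ not x) ∧ not k)) ⇒ᵇ (u ∧ not k)) (U v) (X v) (Y v) (K v)
                   $ᵇ ⊆⇒ᵇ (X.sub v) $ᵇ ⊆⇒ᵇ (Y.sub v) $ᵇ ⊆⇒ᵇ (P.sub v) $ᵇ p)
          (λ p → taut 4 (λ u x y k → (u ∧ not k) ⇒ᵇ ((x ∨ (u ∧ not y)) ∨ ((y ∧ not x) ∧ not k))) (U v) (X v) (Y v) (K v) $ᵇ p)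
      X⊆X′ : X ⊆ X′
      X⊆X′ v p = X.sub v p ∧ⁱ not-t (¬t⇒f (dXK v p))
      X′-eq : ∀ v → X′ v ≡ (A′ ∪ C′) v
      X′-eq v = bool-iff (λ p → taut 3 (λ u y k → (u ∧ not k) ⇒ᵇ ((u ∧ not y) ∨ (y ∧ not k))) (U v) (Y v) (K v) $ᵇ p)
        (λ p → taut 3 (λ u y k → (y ⇒ᵇ u) ⇒ᵇ (k ⇒ᵇ y) ⇒ᵇ ((u ∧ not y) ∨ (y ∧ not k)) ⇒ᵇ (u ∧ not k)) (U v) (Y v) (K v) $ᵇ ⊆⇒ᵇ (Y.sub v) $ᵇ ⊆⇒ᵇ (K⊆Y v) $ᵇ p)
      C′⊆X′ : C′ ⊆ X′
      C′⊆X′ v p = trans (X′-eq v) (∨-r {A′ v} p)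

      coreX′ : ∀ S → S ⊆ C′ → Inh S → suc (cnt S) ≤ touch X′ S
      coreX′ S S⊆ (w , Sw) with inh⊎empty (S ∖ X) | inh⊎empty (S ∩ X)
      ... | inj₁ i | inj₁ j = lin (cnt S ∷ cnt (S ∩ X) ∷ cnt (S ∖ X) ∷ touch Y (S ∖ X) ∷ touch X (S ∩ X) ∷ touch X′ S ∷ [])
            (λ { (c ∷ a ∷ b ∷ y ∷ x ∷ t ∷ []) → (c :≤ a :+ b) ∷ (con 1 :+ b :≤ y) ∷ (con 1 :+ a :≤ x) ∷ (y :+ x :≤ t) ∷ [] ⊢ (con 1 :+ c :≤ t) })
            (≤-reflexive (cnt-split S X) , inY i , inX j , touch-split S⊆ P.apart X⊆X′ C′⊆X′ dXK)
        where
        inY : Inh (S ∖ X) → suc (cnt (S ∖ X)) ≤ touch Y (S ∖ X)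
        inY i = Y.core (S ∖ X) (λ v p → ∧-l (S⊆ v (∧-l p))) i (b , K⊆Y b P.has ∧ⁱ not-t (¬t⇒f λ p → absurdᵇ P.has (not-f (∧-r {Y b} (S⊆ b (∧-l p))))))
        inX : Inh (S ∩ X) → suc (cnt (S ∩ X)) ≤ touch X (S ∩ X)
        inX i = X.core (S ∩ X) (λ v → ∧-r {S v}) i (proj₁ iA , ∧-l (proj₂ iA) ∧ⁱ not-t (¬t⇒f λ p → absurdᵇ (∧-l {Y (proj₁ iA)} (S⊆ _ (∧-l p))) (not-f (∧-r {X (proj₁ iA)} (proj₂ iA)))))
      ... | inj₂ em | _ = ≤-trans (X.core S S⊆X (w , Sw) (proj₁ iA , ∧-l (proj₂ iA) ∧ⁱ not-t (¬t⇒f λ p → absurdᵇ (∧-l {Y (proj₁ iA)} (S⊆ _ p)) (not-f (∧-r {X (proj₁ iA)} (proj₂ iA)))))) (touch-⊆ X⊆X′)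
        where
        S⊆X : S ⊆ X
        S⊆X v p = taut 2 (λ σ x → not (σ ∧ not x) ⇒ᵇ σ ⇒ᵇ x) (S v) (X v) $ᵇ not-t (em v) $ᵇ p
      ... | _ | inj₂ em = lin (cnt S ∷ cnt (S ∖ X) ∷ cnt (S ∩ X) ∷ touch Y (S ∖ X) ∷ touch X (S ∩ X) ∷ touch X′ S ∷ [])
            (λ { (c ∷ b ∷ a ∷ y ∷ x ∷ t ∷ []) → (c :≤ a :+ b) ∷ (a :≤ con 0) ∷ (con 1 :+ b :≤ y) ∷ (y :+ x :≤ t) ∷ [] ⊢ (con 1 :+ c :≤ t) })
            (≤-reflexive (cnt-split S X) , ≤-reflexive (cnt-none em)
            , Y.core (S ∖ X) (λ v p → ∧-l (S⊆ v (∧-l p))) (w , Sw ∧ⁱ not-t (¬t⇒f λ p → absurdᵇ (Sw ∧ⁱ p) (em w)))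
                (b , K⊆Y b P.has ∧ⁱ not-t (¬t⇒f λ p → absurdᵇ P.has (not-f (∧-r {Y b} (S⊆ b (∧-l p))))))
            , touch-split S⊆ P.apart X⊆X′ C′⊆X′ dXK)

      sideX : Side A′ C′
      sideX = record
        { conn = Conn-resp {J} X′-eq cX′
        ; core = λ S S⊆ i → ≤-trans (coreX′ S S⊆ i) (touch-⊆ λ v p → trans (sym (X′-eq v)) p)
        ; two = lin (cnt A′ ∷ cnt A ∷ cnt (A′ ∖ A) ∷ ins A ∷ bet A (X ∩ Y) ∷ bet A′ C′ ∷ ins A′ ∷ [])
            (λ { (a′ ∷ a ∷ r ∷ i ∷ b ∷ b′ ∷ i′ ∷ []) → (a′ :≤ a :+ r) ∷ (con 1 :+ a :≤ i :+ b) ∷ (i :+ r :≤ i′) ∷ (b :≤ b′) ∷ [] ⊢ (con 1 :+ a′ :≤ i′ :+ b′) })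
            ( ≤-trans (cnt-⊆ λ v p → trans (sym (∪-∖ A⊆A′ v)) p) (cnt-∪-≤ A (A′ ∖ A))
            , two-touch (X.core A (∖-⊆ X) iA (proj₁ iC , ∧-l (proj₂ iC) ∧ⁱ not-t (¬t⇒f λ p → absurdᵇ (∧-r {X (proj₁ iC)} (proj₂ iC)) (not-f (∧-r {X (proj₁ iC)} p)))))
                (λ v p → taut 2 (λ x y → x ⇒ᵇ ((x ∧ not y) ∨ (x ∧ y))) (X v) (Y v) $ᵇ p)
            , grow-ins Y.co A⊆A′ iA
            , bet-mono A⊆A′ λ v p → ∧-r {X v} p ∧ⁱ not-t (¬t⇒f (dXK v (∧-l p))))
        ; exc = ≤-trans (≤-reflexive (cong suc (cnt-cong λ v → sym (X′-eq v)))) (≤-trans (excess-mono cX′ X⊆X′ (Conn.inh X.conn) X.exc) (ins-mono λ v p → trans (sym (X′-eq v)) p)) }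

      sideY : Side K C′
      sideY = side-of fY (λ v → ∪-∖ K⊆Y v) (sym-disj (∖-disj Y K)) (Conn.inh P.conn) iC′

      open B1′ Y.co P.conn dA′K dA′C′ (sym-disj (∖-disj Y K)) A′K sideX sideY

      single : cnt C′ ≤ 1
      single = singleton iC′

      C⊆C′ : X ∩ Y ⊆ C′
      C⊆C′ v p = ∧-r {X v} p ∧ⁱ not-t (¬t⇒f (dXK v (∧-l p)))

      B⊆K : B ⊆ K
      B⊆K v p with K v in Kv
      ... | true  = refl
      ... | false = ⊥-elim (1+n≰n (≤-trans (≤-trans (+-mono-≤ (∃-cnt {p = C′ ∩ X} (proj₁ iC) (C⊆C′ _ (proj₂ iC) ∧ⁱ ∧-l (proj₂ iC))) (∃-cnt {p = C′ ∖ X} v ((∧-l p ∧ⁱ not-t Kv) ∧ⁱ ∧-r {Y v} p)))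
                             (≤-reflexive (sym (cnt-split C′ X)))) single))

      C-eq : ∀ v → C′ v ≡ (X ∩ Y) v
      C-eq v = bool-iff (λ p → taut 3 (λ x y k → ((y ∧ not x) ⇒ᵇ k) ⇒ᵇ (y ∧ not k) ⇒ᵇ (x ∧ y)) (X v) (Y v) (K v) $ᵇ ⊆⇒ᵇ (B⊆K v) $ᵇ p) (C⊆C′ v)

    conn-B : Conn J (Y ∖ X)
    conn-B = Conn-resp {J} (λ v → bool-iff (P.sub v) (B⊆K v)) P.conn

    conn-C : Conn J (X ∩ Y)
    conn-C = Conn-resp {J} C-eq (connected iC′)

    ins-C : ins (X ∩ Y) ≡ 0
    ins-C = n≤0⇒n≡0 (≤-trans (ins-mono C⊆C′) (≤-reflexive (no-edges iC′)))

  ∩-comm : ∀ (X Y : BSet n) v → (X ∩ Y) v ≡ (Y ∩ X) v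
  ∩-comm X Y v = bool-iff (λ p → ∧-r {X v} p ∧ⁱ ∧-l p) (λ p → ∧-r {Y v} p ∧ⁱ ∧-l p)

  -- `C` is a loopless vertex, so the excess of `X` comes from a cycle in `A` or from three edges
  -- between `A` and `C`, and similarly for `Y` and `B`. A component outside `X ∪ Y` joins `A` to
  -- `B`. Two cycles lead to `excl-A3`, everything else to `excl-D4`.
  pair-disjoint : ∀ {X Y} → F X → F Y → Incomp X Y → Inh (U ∖ (X ∪ Y)) → Inh (X ∩ Y) → ⊥
  pair-disjoint {X} {Y} fX fY inc iD iC = main
    where
    module X = F fX
    module Y = F fY
    module P = Apex fX fY inc iD iC
    module Q = Apex fY fX (proj₂ inc , proj₁ inc) (proj₁ iD , trans (cong (λ z → U _ ∧ not z) (∨-comm (Y _) (X _))) (proj₂ iD)) (inh-mono (λ v → trans (sym (∩-comm X Y v))) iC)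
    A = X ∖ Y
    B = Y ∖ X
    C = X ∩ Y
    D = U ∖ (X ∪ Y)
    S = piece D (proj₁ iD) (proj₂ iD)
    module S = Piece S
    cA = Q.conn-B
    cB = P.conn-B
    cC = P.conn-C
    dAB : Disj A B
    dAB = sep X (∖-⊆ X) (λ v → ∧-r {Y v})
    dAC : Disj A C
    dAC v p q = absurdᵇ (∧-r {X v} q) (not-f (∧-r {X v} p))
    dBC : Disj B C
    dBC v p q = absurdᵇ (∧-l q) (not-f (∧-r {Y v} p))
    S-out : ∀ v → S.K v ≡ true → X v ∨ Y v ≡ false
    S-out v p = not-f (∧-r {U v} (S.sub v p))
    dXS : Disj X S.K
    dXS v p q = absurdᵇ (∨-l p) (S-out v q)
    dYS : Disj Y S.K
    dYS v p q = absurdᵇ (∨-r {X v} p) (S-out v q)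
    dAS = disj-⊆ (∖-⊆ X) (λ _ → id) dXS
    dBS = disj-⊆ (∖-⊆ Y) (λ _ → id) dYS
    dCS : Disj C S.K
    dCS = disj-⊆ (λ v → ∧-l) (λ _ → id) dXS
    SA : Adj S.K A
    SA = piece-adj {U ∖ Y} {A} {D} Y.co (λ v p → taut 3 (λ u x y → (u ∧ not y) ⇒ᵇ ((x ∧ not y) ∨ (u ∧ not (x ∨ y)))) (U v) (X v) (Y v) $ᵇ p)
      (λ v p → taut 3 (λ u x y → (u ∧ not (x ∨ y)) ⇒ᵇ (u ∧ not y)) (U v) (X v) (Y v) $ᵇ S.sub v p) (Conn.inh S.conn)
      (proj₁ (proj₁ inc) , (X.sub _ (∧-l (proj₂ (proj₁ inc))) ∧ⁱ ∧-r {X _} (proj₂ (proj₁ inc))) ∧ⁱ not-t (¬t⇒f (dXS _ (∧-l (proj₂ (proj₁ inc))))))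
      S.apart
    SB : Adj S.K B
    SB = piece-adj {U ∖ X} {B} {D} X.co (λ v p → taut 3 (λ u x y → (u ∧ not x) ⇒ᵇ ((y ∧ not x) ∨ (u ∧ not (x ∨ y)))) (U v) (X v) (Y v) $ᵇ p)
      (λ v p → taut 3 (λ u x y → (u ∧ not (x ∨ y)) ⇒ᵇ (u ∧ not x)) (U v) (X v) (Y v) $ᵇ S.sub v p) (Conn.inh S.conn)
      (proj₁ (proj₂ inc) , (Y.sub _ (∧-l (proj₂ (proj₂ inc))) ∧ⁱ ∧-r {Y _} (proj₂ (proj₂ inc))) ∧ⁱ not-t (¬t⇒f (dYS _ (∧-l (proj₂ (proj₂ inc))))))
      S.apart
    twoCA : Two C A
    twoCA = two-touch (X.core C (λ v → ∧-l) iC (proj₁ (proj₁ inc) , ∧-l (proj₂ (proj₁ inc)) ∧ⁱ not-t (¬t⇒f (dAC _ (proj₂ (proj₁ inc))))))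
      (λ v p → taut 2 (λ x y → x ⇒ᵇ ((x ∧ y) ∨ (x ∧ not y))) (X v) (Y v) $ᵇ p)
    twoCB : Two C B
    twoCB = two-touch (Y.core C (λ v → ∧-r {X v}) iC (proj₁ (proj₂ inc) , ∧-l (proj₂ (proj₂ inc)) ∧ⁱ not-t (¬t⇒f (dBC _ (proj₂ (proj₂ inc))))))
      (λ v p → taut 2 (λ x y → y ⇒ᵇ ((x ∧ y) ∨ (y ∧ not x))) (X v) (Y v) $ᵇ p)
    bet2 : ∀ {D} → Two C D → 2 ≤ bet D C
    bet2 {D} tw = lin (cnt C ∷ ins C ∷ bet C D ∷ bet D C ∷ [])
      (λ { (c ∷ i ∷ b ∷ b′ ∷ []) → (con 1 :+ c :≤ i :+ b) ∷ (con 1 :≤ c) ∷ (i :≤ con 0) ∷ (b :≤ b′) ∷ [] ⊢ (con 2 :≤ b′) })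
      (tw , ∃-cnt (proj₁ iC) (proj₂ iC) , ≤-reflexive P.ins-C , ≤-reflexive (bet-sym C D))
    three : ∀ {Z D} → F Z → Disj D C → (∀ v → (D ∪ C) v ≡ Z v) → ¬ Cyclic D → 3 ≤ bet D C
    three {Z} {D} f d eq ¬c = lin (cnt D ∷ cnt C ∷ cnt (D ∪ C) ∷ ins D ∷ ins C ∷ bet D C ∷ ins (D ∪ C) ∷ [])
      (λ { (a ∷ c ∷ z ∷ i ∷ ic ∷ b ∷ iz ∷ []) → (a :+ c :≤ z) ∷ (con 1 :+ z :≤ iz) ∷ (iz :≤ i :+ ic :+ b) ∷ (ic :≤ con 0) ∷ (con 1 :≤ c) ∷ (con 1 :+ i :≤ a) ∷ [] ⊢ (con 3 :≤ b) })
      ( cnt-∪ d , ≤-trans (≤-reflexive (cong suc (cnt-cong eq))) (≤-trans (F.exc f) (ins-mono λ v p → trans (eq v) p))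
      , ins-∪-≤ D C , ≤-reflexive P.ins-C , ∃-cnt (proj₁ iC) (proj₂ iC) , ≰⇒> ¬c)
    eqX : ∀ v → (A ∪ C) v ≡ X v
    eqX v = bool-iff (λ p → taut 2 (λ x y → ((x ∧ not y) ∨ (x ∧ y)) ⇒ᵇ x) (X v) (Y v) $ᵇ p) (λ p → taut 2 (λ x y → x ⇒ᵇ ((x ∧ not y) ∨ (x ∧ y))) (X v) (Y v) $ᵇ p)
    eqY : ∀ v → (B ∪ C) v ≡ Y v
    eqY v = bool-iff (λ p → taut 2 (λ x y → ((y ∧ not x) ∨ (x ∧ y)) ⇒ᵇ y) (X v) (Y v) $ᵇ p) (λ p → taut 2 (λ x y → y ⇒ᵇ ((y ∧ not x) ∨ (x ∧ y))) (X v) (Y v) $ᵇ p)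
    main : ⊥
    main with cnt A ≤? ins A | cnt B ≤? ins B
    ... | yes cycA | yes cycB = excl-A3 C (B ∪ S.K) A cC (conn-join cB S.conn (sym-adj SB)) cA (disj-∪ʳ (sym-disj dBC) dCS) (sym-disj dAC)
          (disj-∪ˡ (sym-disj dAB) (sym-disj dAS))
          (adj-mono (λ _ → id) (⊆-∪ˡ S.K) (sym-adj (≤-trans (s≤s z≤n) (bet2 twoCB)))) (sym-adj (≤-trans (s≤s z≤n) (bet2 twoCA)))
          (adj-mono (⊆-∪ʳ B) (λ _ → id) SA) cycA twoCA
          (two-cyclic (cyclic-mono (conn-join cB S.conn (sym-adj SB)) (⊆-∪ˡ S.K) (Conn.inh cB) cycB) (adj-mono (⊆-∪ʳ B) (λ _ → id) SA))
    ... | yes cycA | no ¬b = excl-D4 A B C S.K cA cB cC S.conn dAB dAC dAS dBC dBS dCS (inj₁ (cycA , bet2 twoCA)) (three fY dBC eqY ¬b) (sym-adj SA) SB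
    ... | no ¬a | yes cycB = excl-D4 B A C S.K cB cA cC S.conn (sym-disj dAB) dBC dBS dAC dAS dCS (inj₁ (cycB , bet2 twoCB)) (three fX dAC eqX ¬a) (sym-adj SB) SA
    ... | no ¬a | no ¬b = excl-D4 A B C S.K cA cB cC S.conn dAB dAC dAS dBC dBS dCS (inj₂ (three fX dAC eqX ¬a)) (three fY dBC eqY ¬b) (sym-adj SA) SB

  -- When `X` and `Y` cover `U`, each is the complement of the other together with `X ∩ Y`, so
  -- adjacent complements are exactly the setting of `B1′`.
  module Cover {X Y : BSet n} (fX : F X) (fY : F Y) (cov : U ⊆ X ∪ Y) (iC : Inh (X ∩ Y)) (AB : Adj (U ∖ Y) (U ∖ X)) where

    private
      module X = F fX
      module Y = F fY
      eqX : ∀ v → X v ≡ ((U ∖ Y) ∪ (X ∩ Y)) v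
      eqX v = bool-iff (λ p → taut 3 (λ u x y → (x ⇒ᵇ u) ⇒ᵇ x ⇒ᵇ ((u ∧ not y) ∨ (x ∧ y))) (U v) (X v) (Y v) $ᵇ ⊆⇒ᵇ (X.sub v) $ᵇ p)
                       (λ p → taut 3 (λ u x y → (u ⇒ᵇ (x ∨ y)) ⇒ᵇ ((u ∧ not y) ∨ (x ∧ y)) ⇒ᵇ x) (U v) (X v) (Y v) $ᵇ ⊆⇒ᵇ (cov v) $ᵇ p)
      eqY : ∀ v → Y v ≡ ((U ∖ X) ∪ (X ∩ Y)) v
      eqY v = bool-iff (λ p → taut 3 (λ u x y → (y ⇒ᵇ u) ⇒ᵇ y ⇒ᵇ ((u ∧ not x) ∨ (x ∧ y))) (U v) (X v) (Y v) $ᵇ ⊆⇒ᵇ (Y.sub v) $ᵇ p)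
                       (λ p → taut 3 (λ u x y → (u ⇒ᵇ (x ∨ y)) ⇒ᵇ ((u ∧ not x) ∨ (x ∧ y)) ⇒ᵇ y) (U v) (X v) (Y v) $ᵇ ⊆⇒ᵇ (cov v) $ᵇ p)
      dA : Disj (U ∖ Y) (X ∩ Y)
      dA v p q = absurdᵇ (∧-r {X v} q) (not-f (∧-r {U v} p))
      dB : Disj (U ∖ X) (X ∩ Y)
      dB v p q = absurdᵇ (∧-l q) (not-f (∧-r {U v} p))
      dAB : Disj (U ∖ Y) (U ∖ X)
      dAB v p q = [ (λ x → absurdᵇ x (not-f (∧-r {U v} q))) , (λ y → absurdᵇ y (not-f (∧-r {U v} p))) ]′ (∨-case {X v} (cov v (∧-l p)))
    open B1′ Y.co X.co dAB dA dB AB (side-of fX eqX dA (Conn.inh Y.co) iC) (side-of fY eqY dB (Conn.inh X.co) iC)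

    one-vertex : cnt (X ∩ Y) ≤ 1
    one-vertex = singleton iC

    no-loops : ins (X ∩ Y) ≡ 0
    no-loops = no-edges iC

-- Three members: two below a third, two above a third, three disjoint

module Triples (G : Graph) (J : BSet (nE G)) (excl : NoMinors G) (U : BSet (nV G))
               (cU : Gr.Conn (Cycles.s G) (Cycles.t G) J U)
               (coreU : ∀ S → S ⊆ U → Inh S → Inh (U ∖ S) → suc (cnt S) ≤ Counting.touch G J excl U S) where

  open Family G J excl U cU coreU public
  private n = nV G

  opaque
    unfolding bet

    adj-vertex : ∀ {A B} → Adj A B → ∃ λ v → A v ≡ true × Adj ⁅ v ⁆ B
    adj-vertex {A} {B} p with cnt-∃ p
    ... | e , h = [ (λ q → s e , ∧-l q , ∃-cnt e (∧-l {J e} h ∧ⁱ ∨-l (==-refl (s e) ∧ⁱ ∧-r {A (s e)} q)))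
                  , (λ q → t e , ∧-r {B (s e)} q , ∃-cnt e (∧-l {J e} h ∧ⁱ ∨-r {s e == t e ∧ B (t e)} (∧-l q ∧ⁱ ==-refl (t e)))) ]′ (∨-case (∧-r {J e} h))

  pieces-disj : ∀ {C a b} (P : Piece C a) (Q : Piece C b) → Piece.K P b ≡ false → Disj (Piece.K P) (Piece.K Q)
  pieces-disj P Q out v p q = absurdᵇ (absorb (Piece.conn Q) (Piece.sub Q) (Piece.apart P) (v , q ∧ⁱ p) _ (Piece.has Q)) out

  cyclic-exc : ∀ {X} → F X → Cyclic X
  cyclic-exc f = ≤-trans (n≤1+n _) (F.exc f)

  record Link (X Y T : BSet n) : Set where
    field
      K     : BSet n
      sub   : K ⊆ T
      conn  : Conn J K
      apart : Apart K (T ∖ K)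
      toX   : Adj K X
      toY   : Adj K Y

  opaque
    -- The component of `X` in `Z` without `Y` has an edge to `Y`, and it does not start in `X`. Its
    -- starting vertex lies in `T`, and the component of `T` there still reaches `X` inside the
    -- larger component.
    link : ∀ {Z X Y T} → Conn J Z → X ⊆ Z → Y ⊆ Z → Conn J X → Inh Y → Disj X Y → Apart X Y →
           (∀ v → T v ≡ ((Z ∖ X) ∖ Y) v) → Link X Y T
    link {Z} {X} {Y} {T} cZ X⊆ Y⊆ cX (y , Yy) d ap T≡ = record { K = P.K ; sub = P.sub ; conn = P.conn ; apart = P.apart
        ; toX = piece-adj {S.K} {X} {T} S.conn S⊆ K⊆S (Conn.inh P.conn) (x , X⊆S x Xx ∧ⁱ not-t (¬t⇒f λ p → notX x Xx (P.sub x p))) P.apart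
        ; toY = adj-mono (λ w h → subst (λ z → P.K z ≡ true) (sym (==-t {i = w} h)) P.has) (λ _ → id) (proj₂ (proj₂ vt)) }
      where
      x : Fin n
      x = proj₁ (Conn.inh cX)
      Xx : X x ≡ true
      Xx = proj₂ (Conn.inh cX)
      X⊆ZY : X ⊆ Z ∖ Y
      X⊆ZY v p = X⊆ v p ∧ⁱ not-t (¬t⇒f (d v p))
      S : Piece (Z ∖ Y) x
      S = piece (Z ∖ Y) x (X⊆ZY x Xx)
      module S = Piece S
      X⊆S : X ⊆ S.K
      X⊆S = absorb cX X⊆ZY S.apart (x , Xx ∧ⁱ S.has)
      notX : ∀ v → X v ≡ true → T v ≡ true → ⊥
      notX v p q = absurdᵇ p (not-f (∧-r {Z v} (∧-l (trans (sym (T≡ v)) q))))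
      S⊆ : S.K ⊆ X ∪ T
      S⊆ v p = subst (λ b → X v ∨ b ≡ true) (sym (T≡ v)) (taut 3 (λ z x y → (z ∧ not y) ⇒ᵇ (x ∨ ((z ∧ not x) ∧ not y))) (Z v) (X v) (Y v) $ᵇ S.sub v p)
      SY : Adj S.K Y
      SY = piece-adj {Z} {Y} {Z ∖ Y} cZ (λ v p → taut 2 (λ z y → z ⇒ᵇ (y ∨ (z ∧ not y))) (Z v) (Y v) $ᵇ p) (λ v p → ∧-l (S.sub v p)) (Conn.inh S.conn)
             (y , Y⊆ y Yy ∧ⁱ not-t (¬t⇒f λ p → absurdᵇ Yy (not-f (∧-r {Z y} (S.sub y p))))) S.apart
      vt : ∃ λ v → (S.K ∩ T) v ≡ true × Adj ⁅ v ⁆ Y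
      vt = [ (λ q → ⊥-elim (apart-¬adj ap (sym-adj q))) , (λ q → adj-vertex (sym-adj q)) ]′ (adj-∪ X (S.K ∩ T) (sym-adj (adj-mono {S.K} {X ∪ (S.K ∩ T)}
             (λ v p → taut 3 (λ s x t → (s ⇒ᵇ (x ∨ t)) ⇒ᵇ s ⇒ᵇ (x ∨ (s ∧ t))) (S.K v) (X v) (T v) $ᵇ ⊆⇒ᵇ (S⊆ v) $ᵇ p) (λ _ → id) SY)))
      P : Piece T (proj₁ vt)
      P = piece T (proj₁ vt) (∧-r {S.K (proj₁ vt)} (proj₁ (proj₂ vt)))
      module P = Piece P
      K⊆ZY : P.K ⊆ Z ∖ Y
      K⊆ZY v p = let q = trans (sym (T≡ v)) (P.sub v p) in ∧-l (∧-l {Z v ∧ not (X v)} q) ∧ⁱ ∧-r {Z v ∧ not (X v)} q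
      t∈S : S.K (proj₁ vt) ≡ true
      t∈S = ∧-l (proj₁ (proj₂ vt))
      K⊆S : P.K ⊆ S.K
      K⊆S = absorb P.conn K⊆ZY S.apart (proj₁ vt , P.has ∧ⁱ t∈S)

  -- Both members carry two loops after contraction, so any triangle through them is `R₃`. Hence
  -- they are not adjacent, and the rest is connected, since a second component of it would close a
  -- triangle once the first is merged with `X`.
  module Disjoint {X Y : BSet n} (fX : F X) (fY : F Y) (d : Disj X Y) (iD : Inh (U ∖ (X ∪ Y))) where
    private
      module X = F fX
      module Y = F fY
      D = U ∖ (X ∪ Y)

    offX : ∀ {K} → K ⊆ D → Disj X K
    offX h v p q = absurdᵇ (∨-l p) (not-f (∧-r {U v} (h v q)))

    offY : ∀ {K} → K ⊆ D → Disj Y K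
    offY h v p q = absurdᵇ (∨-r {X v} p) (not-f (∧-r {U v} (h v q)))

    toX : ∀ {a} (P : Piece D a) → Adj (Piece.K P) X
    toX P = piece-adj {U ∖ Y} {X} {D} Y.co (λ v p → taut 3 (λ u x y → (u ∧ not y) ⇒ᵇ (x ∨ (u ∧ not (x ∨ y)))) (U v) (X v) (Y v) $ᵇ p)
      (λ v p → taut 3 (λ u x y → (u ∧ not (x ∨ y)) ⇒ᵇ (u ∧ not y)) (U v) (X v) (Y v) $ᵇ sub v p) (Conn.inh conn)
      (proj₁ iX , (X.sub _ (proj₂ iX) ∧ⁱ not-t (¬t⇒f (d _ (proj₂ iX)))) ∧ⁱ not-t (¬t⇒f (offX sub _ (proj₂ iX)))) apart
      where open Piece P
            iX = Conn.inh X.conn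

    toY : ∀ {a} (P : Piece D a) → Adj (Piece.K P) Y
    toY P = piece-adj {U ∖ X} {Y} {D} X.co (λ v p → taut 3 (λ u x y → (u ∧ not x) ⇒ᵇ (y ∨ (u ∧ not (x ∨ y)))) (U v) (X v) (Y v) $ᵇ p)
      (λ v p → taut 3 (λ u x y → (u ∧ not (x ∨ y)) ⇒ᵇ (u ∧ not x)) (U v) (X v) (Y v) $ᵇ sub v p) (Conn.inh conn)
      (proj₁ iY , (Y.sub _ (proj₂ iY) ∧ⁱ not-t (¬t⇒f λ p → d _ p (proj₂ iY))) ∧ⁱ not-t (¬t⇒f (offY sub _ (proj₂ iY)))) apart
      where open Piece P
            iY = Conn.inh Y.conn

    XY-apart : Apart X Y
    XY-apart with adj? X Y
    ... | inj₂ ap = ap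
    ... | inj₁ xy = ⊥-elim (excl-R3 X Y K X.conn Y.conn conn d (offX sub) (offY sub) xy (sym-adj (toX P)) (sym-adj (toY P)) X.exc Y.exc)
      where P = piece D (proj₁ iD) (proj₂ iD)
            open Piece P

    D-conn : Conn J D
    D-conn with inh⊎empty (D ∖ Piece.K (piece D (proj₁ iD) (proj₂ iD)))
    ... | inj₂ em = Conn-resp {J} (λ v → bool-iff (Piece.sub P v) (λ p → taut 2 (λ c k → c ⇒ᵇ not (c ∧ not k) ⇒ᵇ k) (D v) (Piece.K P v) $ᵇ p $ᵇ not-t (em v))) (Piece.conn P)
      where P = piece D (proj₁ iD) (proj₂ iD)
    ... | inj₁ (v , hv) = ⊥-elim (excl-R3 (X ∪ P.K) Y Q.K cXP Y.conn Q.conn (disj-∪ˡ d (sym-disj (offY P.sub))) (disj-∪ˡ (offX Q.sub) (pieces-disj P Q (not-f (∧-r {D v} hv))))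
          (offY Q.sub) (adj-mono (⊆-∪ʳ X) (λ _ → id) (toY P)) (adj-mono (⊆-∪ˡ P.K) (λ _ → id) (sym-adj (toX Q))) (sym-adj (toY Q))
          (excess-mono cXP (⊆-∪ˡ P.K) (Conn.inh X.conn) X.exc) Y.exc)
      where
      P = piece D (proj₁ iD) (proj₂ iD)
      Q = piece D v (∧-l hv)
      module P = Piece P
      module Q = Piece Q
      cXP : Conn J (X ∪ P.K)
      cXP = conn-join X.conn P.conn (sym-adj (toX P))

  -- For disjoint `X` and `Y`, a component `K` links them inside `Z`, and the component `S` of a
  -- vertex outside `Z` is adjacent to `K`. If `S` also touches `X` or `Y`, merging closes a
  -- triangle with two doubly looped corners, `R₃`; otherwise `K` is the hub of `P₂` with leaves
  -- `X`, `Y`, `S`.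
  triple-below : ∀ {X Y Z} → F X → F Y → F Z → X ⊆ Z → Y ⊆ Z → Incomp X Y → ⊥
  triple-below {X} {Y} {Z} fX fY fZ XZ YZ inc with inh⊎empty (X ∩ Y)
  ... | inj₁ iC = pair-disjoint fX fY inc iD iC
    where
    iD : Inh (U ∖ (X ∪ Y))
    iD = proj₁ (F.out fZ) , (taut 4 (λ u x y z → (x ⇒ᵇ z) ⇒ᵇ (y ⇒ᵇ z) ⇒ᵇ (u ∧ not z) ⇒ᵇ (u ∧ not (x ∨ y))) (U _) (X _) (Y _) (Z _) $ᵇ ⊆⇒ᵇ (XZ _) $ᵇ ⊆⇒ᵇ (YZ _) $ᵇ proj₂ (F.out fZ))
  ... | inj₂ em = main
    where
    module X = F fX
    module Y = F fY
    module Z = F fZ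
    D = U ∖ (X ∪ Y)
    d : Disj X Y
    d v p q = absurdᵇ (p ∧ⁱ q) (em v)
    w = proj₁ Z.out
    hw = proj₂ Z.out
    w∈D : D w ≡ true
    w∈D = taut 4 (λ u x y z → (x ⇒ᵇ z) ⇒ᵇ (y ⇒ᵇ z) ⇒ᵇ (u ∧ not z) ⇒ᵇ (u ∧ not (x ∨ y))) (U w) (X w) (Y w) (Z w) $ᵇ ⊆⇒ᵇ (XZ w) $ᵇ ⊆⇒ᵇ (YZ w) $ᵇ hw
    open Disjoint fX fY d (w , w∈D)
    T = (Z ∖ X) ∖ Y
    L : Link X Y T
    L = link Z.conn XZ YZ X.conn (Conn.inh Y.conn) d XY-apart (λ _ → refl)
    module L = Link L
    K = L.K
    K⊆D : K ⊆ D
    K⊆D v p = taut 4 (λ u x y z → (z ⇒ᵇ u) ⇒ᵇ ((z ∧ not x) ∧ not y) ⇒ᵇ (u ∧ not (x ∨ y))) (U v) (X v) (Y v) (Z v) $ᵇ ⊆⇒ᵇ (Z.sub v) $ᵇ L.sub v p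
    w∉K : K w ≡ false
    w∉K = ¬t⇒f λ p → absurdᵇ (∧-l (∧-l {Z w ∧ not (X w)} (L.sub w p))) (not-f (∧-r {U w} hw))
    S : Piece (D ∖ K) w
    S = piece (D ∖ K) w (w∈D ∧ⁱ not-t w∉K)
    module S = Piece S
    S⊆D : S.K ⊆ D
    S⊆D v p = ∧-l (S.sub v p)
    dKS : Disj K S.K
    dKS v p q = absurdᵇ p (not-f (∧-r {D v} (S.sub v q)))
    SK : Adj S.K K
    SK = piece-adj {D} {K} {D ∖ K} D-conn (λ v p → taut 2 (λ d k → d ⇒ᵇ (k ∨ (d ∧ not k))) (D v) (K v) $ᵇ p) S⊆D (Conn.inh S.conn)
      (proj₁ (Conn.inh L.conn) , K⊆D _ (proj₂ (Conn.inh L.conn)) ∧ⁱ not-t (¬t⇒f (dKS _ (proj₂ (Conn.inh L.conn))))) S.apart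
    dXK = offX K⊆D
    dYK = offY K⊆D
    main : ⊥
    main with adj? S.K X | adj? S.K Y
    ... | inj₁ sx | _ = excl-R3 X (Y ∪ K) S.K X.conn cYK S.conn (disj-∪ʳ d dXK) (offX S⊆D) (disj-∪ˡ (offY S⊆D) dKS)
          (adj-mono (λ _ → id) (⊆-∪ʳ Y) (sym-adj L.toX)) (sym-adj sx) (adj-mono (⊆-∪ʳ Y) (λ _ → id) (sym-adj SK)) X.exc (excess-mono cYK (⊆-∪ˡ K) (Conn.inh Y.conn) Y.exc)
      where cYK = conn-join Y.conn L.conn (sym-adj L.toY)
    ... | _ | inj₁ sy = excl-R3 Y (X ∪ K) S.K Y.conn cXK S.conn (disj-∪ʳ (sym-disj d) dYK) (offY S⊆D) (disj-∪ˡ (offX S⊆D) dKS)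
          (adj-mono (λ _ → id) (⊆-∪ʳ X) (sym-adj L.toY)) (sym-adj sy) (adj-mono (⊆-∪ʳ X) (λ _ → id) (sym-adj SK)) Y.exc (excess-mono cXK (⊆-∪ˡ K) (Conn.inh X.conn) X.exc)
      where cXK = conn-join X.conn L.conn (sym-adj L.toX)
    ... | inj₂ ax | inj₂ ay = excl-P2 K X Y S.K L.conn X.conn Y.conn S.conn d (offX S⊆D) (offY S⊆D) dXK dYK (sym-disj dKS)
          (sym-adj L.toX) (two-cyclic (cyclic-exc fX) (sym-adj L.toX)) (sym-adj L.toY) (two-cyclic (cyclic-exc fY) (sym-adj L.toY)) SK
          (two-apart {S.K} {K} {(D ∖ K) ∖ S.K} (two-apart {S.K} {K ∪ ((D ∖ K) ∖ S.K)} {X ∪ Y} twoS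
             (n≤0⇒n≡0 (≤-trans (bet-∪-≤ S.K X Y) (≤-reflexive (cong₂ _+_ ax ay))))) S.apart)
      where
      twoS : Two S.K ((K ∪ ((D ∖ K) ∖ S.K)) ∪ (X ∪ Y))
      twoS = two-touch (coreU S.K (λ v p → ∧-l (S⊆D v p)) (Conn.inh S.conn) (proj₁ (Conn.inh X.conn) , X.sub _ (proj₂ (Conn.inh X.conn)) ∧ⁱ not-t (¬t⇒f (offX S⊆D _ (proj₂ (Conn.inh X.conn))))))
        (λ v p → taut 5 (λ u x y k s → u ⇒ᵇ (s ∨ ((k ∨ (((u ∧ not (x ∨ y)) ∧ not k) ∧ not s)) ∨ (x ∨ y)))) (U v) (X v) (Y v) (K v) (S.K v) $ᵇ p)

  module Above {X Y Z : BSet n} (fX : F X) (fY : F Y) (fZ : F Z) (ZX : Z ⊆ X) (ZY : Z ⊆ Y) (inc : Incomp X Y)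
               (cov : U ⊆ X ∪ Y) (AB : Apart (U ∖ Y) (U ∖ X)) where
    private
      module X = F fX
      module Y = F fY
      module Z = F fZ
      A = U ∖ Y
      B = U ∖ X
      C = X ∩ Y
      iZ = Conn.inh Z.conn
      z = proj₁ iZ

    A⊆X : A ⊆ X
    A⊆X v p = taut 3 (λ u x y → (u ⇒ᵇ (x ∨ y)) ⇒ᵇ (u ∧ not y) ⇒ᵇ x) (U v) (X v) (Y v) $ᵇ ⊆⇒ᵇ (cov v) $ᵇ p

    B⊆Y : B ⊆ Y
    B⊆Y v p = taut 3 (λ u x y → (u ⇒ᵇ (x ∨ y)) ⇒ᵇ (u ∧ not x) ⇒ᵇ y) (U v) (X v) (Y v) $ᵇ ⊆⇒ᵇ (cov v) $ᵇ p

    dA : ∀ {K} → K ⊆ C → Disj K A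
    dA h v p q = absurdᵇ (∧-r {X v} (h v p)) (not-f (∧-r {U v} q))

    dB : ∀ {K} → K ⊆ C → Disj K B
    dB h v p q = absurdᵇ (∧-l (h v p)) (not-f (∧-r {U v} q))

    dAB : Disj A B
    dAB v p q = absurdᵇ (A⊆X v p) (not-f (∧-r {U v} q))

    X⊆ : X ⊆ A ∪ C
    X⊆ v p = taut 3 (λ u x y → (x ⇒ᵇ u) ⇒ᵇ x ⇒ᵇ ((u ∧ not y) ∨ (x ∧ y))) (U v) (X v) (Y v) $ᵇ ⊆⇒ᵇ (X.sub v) $ᵇ p

    Y⊆ : Y ⊆ B ∪ C
    Y⊆ v p = taut 3 (λ u x y → (y ⇒ᵇ u) ⇒ᵇ y ⇒ᵇ ((u ∧ not x) ∨ (x ∧ y))) (U v) (X v) (Y v) $ᵇ ⊆⇒ᵇ (Y.sub v) $ᵇ p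

    outX : ∀ {K} → K ⊆ C → Inh (X ∖ K)
    outX h = let a , p = Conn.inh Y.co in a , A⊆X a p ∧ⁱ not-t (¬t⇒f λ q → dA h a q p)

    outY : ∀ {K} → K ⊆ C → Inh (Y ∖ K)
    outY h = let b , p = Conn.inh X.co in b , B⊆Y b p ∧ⁱ not-t (¬t⇒f λ q → dB h b q p)

    toA : ∀ {K} → K ⊆ C → Conn J K → Apart K (C ∖ K) → Adj K A
    toA h c ap = piece-adj {X} {A} {C} X.conn X⊆ (λ v p → ∧-l (h v p)) (Conn.inh c) (outX h) ap

    toB : ∀ {K} → K ⊆ C → Conn J K → Apart K (C ∖ K) → Adj K B
    toB h c ap = piece-adj {Y} {B} {C} Y.conn Y⊆ (λ v p → ∧-r {X v} (h v p)) (Conn.inh c) (outY h) ap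

    twoA : ∀ {K} → K ⊆ C → Conn J K → Two K (A ∪ (C ∖ K))
    twoA {K} h c = two-touch (X.core K (λ v p → ∧-l (h v p)) (Conn.inh c) (outX h))
      (λ v p → taut 3 (λ a c k → (a ∨ c) ⇒ᵇ (k ∨ (a ∨ (c ∧ not k)))) (A v) (C v) (K v) $ᵇ X⊆ v p)

    twoB : ∀ {K} → K ⊆ C → Conn J K → Two K (B ∪ (C ∖ K))
    twoB {K} h c = two-touch (Y.core K (λ v p → ∧-r {X v} (h v p)) (Conn.inh c) (outY h))
      (λ v p → taut 3 (λ a c k → (a ∨ c) ⇒ᵇ (k ∨ (a ∨ (c ∧ not k)))) (B v) (C v) (K v) $ᵇ Y⊆ v p)

    -- `K` and the component `P` around `Z` both touch `A` and `B`, a four-cycle with two loops at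
    -- `P` from the excess of `Z`. A cycle in `K` gives `R₄`; without one, `K` has double edges to
    -- `A` and `B`, and merging `K` with `A` leads to `excl-A3`.
    isolated : ∀ {K} → K ⊆ C → Conn J K → Apart K (C ∖ K) → Disj K Z → ⊥
    isolated {K} h c ap dKZ = main
      where
      z∈ : (C ∖ K) z ≡ true
      z∈ = (ZX z (proj₂ iZ) ∧ⁱ ZY z (proj₂ iZ)) ∧ⁱ not-t (¬t⇒f λ p → dKZ z p (proj₂ iZ))
      P = piece (C ∖ K) z z∈
      module P = Piece P
      P⊆C : P.K ⊆ C
      P⊆C v p = ∧-l (P.sub v p)
      Z⊆P : Z ⊆ P.K
      Z⊆P = absorb Z.conn (λ v p → (ZX v p ∧ⁱ ZY v p) ∧ⁱ not-t (¬t⇒f λ q → dKZ v q p)) P.apart (z , proj₂ iZ ∧ⁱ P.has)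
      dKP : Disj K P.K
      dKP v p q = absurdᵇ p (not-f (∧-r {C v} (P.sub v q)))
      apP : Apart P.K (C ∖ P.K)
      apP = n≤0⇒n≡0 (≤-trans (bet-mono (λ _ → id) (λ v p → taut 3 (λ c k q → (c ∧ not q) ⇒ᵇ (k ∨ ((c ∧ not k) ∧ not q))) (C v) (K v) (P.K v) $ᵇ p))
              (≤-trans (bet-∪-≤ P.K K ((C ∖ K) ∖ P.K)) (≤-reflexive (cong₂ _+_ (apart-sym {K} {P.K} (apart-mono (λ _ → id) P.sub ap)) P.apart))))
      excP = excess-mono P.conn Z⊆P iZ Z.exc
      KA = toA h c ap
      KB = toB h c ap
      PA = toA P⊆C P.conn apP
      PB = toB P⊆C P.conn apP
      main : ⊥
      main with leaf-cases K A (two-apart (twoA h c) ap) | leaf-cases K B (two-apart (twoB h c) ap)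
      ... | inj₁ cyc | _ = excl-R4-loop K A B P.K c Y.co X.co P.conn (dA h) (dB h) dKP dAB (sym-disj (dA P⊆C)) (sym-disj (dB P⊆C)) excP KA KB (sym-adj PA) (sym-adj PB) cyc
      ... | _ | inj₁ cyc = excl-R4-loop K A B P.K c Y.co X.co P.conn (dA h) (dB h) dKP dAB (sym-disj (dA P⊆C)) (sym-disj (dB P⊆C)) excP KA KB (sym-adj PA) (sym-adj PB) cyc
      ... | inj₂ a2 | inj₂ b2 = excl-A3 P.K B (K ∪ A) P.conn X.co (conn-join c Y.co KA) (dB P⊆C) (disj-∪ʳ (sym-disj dKP) (dA P⊆C)) (disj-∪ʳ (sym-disj (dB h)) (sym-disj dAB))
            PB (adj-mono (λ _ → id) (⊆-∪ʳ K) PA) (adj-mono (λ _ → id) (⊆-∪ˡ A) (sym-adj KB)) (cyclic-∪ c Y.co (dA h) a2)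
            (two-cyclic (≤-trans (n≤1+n _) excP) (adj-mono (λ _ → id) (⊆-∪ʳ K) PA))
            (lin (cnt B ∷ ins B ∷ bet K B ∷ bet B K ∷ bet B (K ∪ A) ∷ [])
              (λ { (b ∷ i ∷ kb ∷ bk ∷ u ∷ []) → (b :≤ con 1 :+ i) ∷ (con 2 :≤ kb) ∷ (kb :≤ bk) ∷ (bk :≤ u) ∷ [] ⊢ (con 1 :+ b :≤ i :+ u) })
              (spanning-ins X.co , b2 , ≤-reflexive (bet-sym K B) , bet-mono (λ _ → id) (⊆-∪ˡ A)))

    -- `R` inherits two loops from `Z`. If both `A` and `B` touch it, there is a four-cycle with a
    -- chord, if one does, a pendant double edge, and both represent `R₄`; if none does, `K` is the
    -- hub of `P₂`.
    hub : ∀ {K} → K ⊆ C → Conn J K → Adj K A → Adj K B → Z ⊆ C ∖ K → Adj K Z → Conn J (C ∖ K) → ⊥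
    hub {K} h c KA KB Z⊆ KZ cR = main
      where
      R = C ∖ K
      R⊆C : R ⊆ C
      R⊆C = ∖-⊆ C
      dKR : Disj K R
      dKR = sym-disj (∖-disj C K)
      excR = excess-mono cR Z⊆ iZ Z.exc
      KR : Adj K R
      KR = adj-mono (λ _ → id) Z⊆ KZ
      twoAK : Two A (K ∪ R)
      twoAK = two-touch (X.core A A⊆X (Conn.inh Y.co) (proj₁ (Conn.inh c) , ∧-l (h _ (proj₂ (Conn.inh c))) ∧ⁱ not-t (¬t⇒f (dA h _ (proj₂ (Conn.inh c))))))
        (λ v p → taut 3 (λ a c k → (a ∨ c) ⇒ᵇ (a ∨ (k ∨ (c ∧ not k)))) (A v) (C v) (K v) $ᵇ X⊆ v p)
      twoBK : Two B (K ∪ R)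
      twoBK = two-touch (Y.core B B⊆Y (Conn.inh X.co) (proj₁ (Conn.inh c) , ∧-r {X _} (h _ (proj₂ (Conn.inh c))) ∧ⁱ not-t (¬t⇒f (dB h _ (proj₂ (Conn.inh c))))))
        (λ v p → taut 3 (λ a c k → (a ∨ c) ⇒ᵇ (a ∨ (k ∨ (c ∧ not k)))) (B v) (C v) (K v) $ᵇ Y⊆ v p)
      main : ⊥
      main with adj? A R | adj? B R
      ... | inj₁ ar | inj₁ br = excl-R4-chord K A B R c Y.co X.co cR (dA h) (dB h) dKR dAB (sym-disj (dA R⊆C)) (sym-disj (dB R⊆C)) excR KA KB ar br KR
      ... | inj₁ ar | inj₂ br = excl-R4-pendant K A B R c Y.co X.co cR (dA h) (dB h) dKR dAB (sym-disj (dA R⊆C)) (sym-disj (dB R⊆C)) excR KA KB KR ar (two-apart twoBK br)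
      ... | inj₂ ar | inj₁ br = excl-R4-pendant K B A R c X.co Y.co cR (dB h) (dA h) dKR (sym-disj dAB) (sym-disj (dB R⊆C)) (sym-disj (dA R⊆C)) excR KB KA KR br (two-apart twoAK ar)
      ... | inj₂ ar | inj₂ br = excl-P2 K R A B c cR Y.co X.co (dA R⊆C) (dB R⊆C) dAB (sym-disj dKR) (sym-disj (dA h)) (sym-disj (dB h))
            (sym-adj KR) (two-cyclic (≤-trans (n≤1+n _) excR) (sym-adj KR)) (sym-adj KA) (two-apart twoAK ar) (sym-adj KB) (two-apart twoBK br)

    absurd : ⊥
    absurd with link {U ∖ Z} {A} {B} {C ∖ Z} Z.co (λ v p → ∧-l p ∧ⁱ not-t (¬t⇒f λ q → absurdᵇ (ZY v q) (not-f (∧-r {U v} p))))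
                  (λ v p → ∧-l p ∧ⁱ not-t (¬t⇒f λ q → absurdᵇ (ZX v q) (not-f (∧-r {U v} p)))) Y.co (Conn.inh X.co) dAB AB
                  (λ v → bool-iff
                    (λ p → taut 4 (λ u x y z → (x ⇒ᵇ u) ⇒ᵇ ((x ∧ y) ∧ not z) ⇒ᵇ (((u ∧ not z) ∧ not (u ∧ not y)) ∧ not (u ∧ not x))) (U v) (X v) (Y v) (Z v) $ᵇ ⊆⇒ᵇ (X.sub v) $ᵇ p)
                    (λ p → taut 4 (λ u x y z → (((u ∧ not z) ∧ not (u ∧ not y)) ∧ not (u ∧ not x)) ⇒ᵇ ((x ∧ y) ∧ not z)) (U v) (X v) (Y v) (Z v) $ᵇ p))
    ... | L = main
      where
      open Link L
      K⊆C : K ⊆ C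
      K⊆C v p = ∧-l (sub v p)
      dKZ : Disj K Z
      dKZ v p q = absurdᵇ q (not-f (∧-r {C v} (sub v p)))
      Z⊆ : Z ⊆ C ∖ K
      Z⊆ v p = (ZX v p ∧ⁱ ZY v p) ∧ⁱ not-t (¬t⇒f λ q → dKZ v q p)
      P = piece (C ∖ K) z (Z⊆ z (proj₂ iZ))
      module P = Piece P
      main : ⊥
      main with adj? K Z
      ... | inj₂ ap = isolated K⊆C conn (n≤0⇒n≡0 (≤-trans (bet-mono (λ _ → id) (λ v p → taut 3 (λ c k z → (c ∧ not k) ⇒ᵇ (z ∨ ((c ∧ not z) ∧ not k))) (C v) (K v) (Z v) $ᵇ p))
                        (≤-trans (bet-∪-≤ K Z ((C ∖ Z) ∖ K)) (≤-reflexive (cong₂ _+_ ap apart))))) dKZ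
      ... | inj₁ KZ with inh⊎empty ((C ∖ K) ∖ P.K)
      ...   | inj₂ em = hub K⊆C conn toX toY Z⊆ KZ (Conn-resp {J} (λ v → bool-iff (P.sub v) (λ p → taut 2 (λ c k → c ⇒ᵇ not (c ∧ not k) ⇒ᵇ k) ((C ∖ K) v) (P.K v) $ᵇ p $ᵇ not-t (em v))) P.conn)
      ...   | inj₁ (v , hv) = isolated Q⊆C Q.conn apQ dQZ
        where
        Q = piece (C ∖ K) v (∧-l {(C ∖ K) v} hv)
        module Q = Piece Q
        Q⊆C : Q.K ⊆ C
        Q⊆C w p = ∧-l (Q.sub w p)
        Z⊆P : Z ⊆ P.K
        Z⊆P = absorb Z.conn Z⊆ P.apart (z , proj₂ iZ ∧ⁱ P.has)
        dQZ : Disj Q.K Z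
        dQZ w p q = pieces-disj P Q (not-f (∧-r {(C ∖ K) v} hv)) w (Z⊆P w q) p
        apQ : Apart Q.K (C ∖ Q.K)
        apQ = n≤0⇒n≡0 (≤-trans (bet-mono (λ _ → id) (λ w p → taut 3 (λ c k q → (c ∧ not q) ⇒ᵇ (k ∨ ((c ∧ not k) ∧ not q))) (C w) (K w) (Q.K w) $ᵇ p))
                (≤-trans (bet-∪-≤ Q.K K ((C ∖ K) ∖ Q.K)) (≤-reflexive (cong₂ _+_
                  (apart-sym {K} {Q.K} (apart-mono (λ _ → id) (λ w p → (Q⊆C w p ∧ⁱ not-t (¬t⇒f (dQZ w p))) ∧ⁱ ∧-r {C w} (Q.sub w p)) apart)) Q.apart))))

  triple-above : ∀ {X Y Z} → F X → F Y → F Z → Z ⊆ X → Z ⊆ Y → Incomp X Y → ⊥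
  triple-above {X} {Y} {Z} fX fY fZ ZX ZY inc with inh⊎empty (U ∖ (X ∪ Y)) | adj? (U ∖ Y) (U ∖ X)
  ... | inj₁ iD | _ = pair-disjoint fX fY inc iD (inh-mono (λ v p → ZX v p ∧ⁱ ZY v p) (Conn.inh (F.conn fZ)))
  ... | inj₂ em | inj₂ ap = Above.absurd fX fY fZ ZX ZY inc (λ v p → taut 2 (λ u x → u ⇒ᵇ not (u ∧ not x) ⇒ᵇ x) (U v) ((X ∪ Y) v) $ᵇ p $ᵇ not-t (em v)) ap
  -- Adjacent complements would leave no edge inside `X ∩ Y`, yet `Z` lies there and has edges.
  ... | inj₂ em | inj₁ ab = 1+n≰n (≤-trans (s≤s z≤n) (≤-trans (F.exc fZ) (≤-trans (ins-mono λ v p → ZX v p ∧ⁱ ZY v p)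
        (≤-reflexive (Cover.no-loops fX fY (λ v p → taut 2 (λ u x → u ⇒ᵇ not (u ∧ not x) ⇒ᵇ x) (U v) ((X ∪ Y) v) $ᵇ p $ᵇ not-t (em v)) (inh-mono (λ v p → ZX v p ∧ⁱ ZY v p) (Conn.inh (F.conn fZ))) ab)))))

  -- A component `K` that links `X` and `Y` outside `Z` must also touch `Z`, because the complement
  -- of `X ∪ Y` is connected. So `K` is the hub of `P₂`.
  triple-disjoint : ∀ {X Y Z} → F X → F Y → F Z → Disj X Y → Disj X Z → Disj Y Z → ⊥
  triple-disjoint {X} {Y} {Z} fX fY fZ dXY dXZ dYZ = excl-P2 K X Y Z conn X.conn Y.conn Z.conn dXY dXZ dYZ
      (λ v p q → absurdᵇ p (not-f (∧-r {U v ∧ not (Z v)} (∧-l {(U ∖ Z ∖ X) v} (sub v q))))) (λ v p q → absurdᵇ p (not-f (∧-r {(U ∖ Z ∖ X) v} (sub v q))))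
      (λ v p q → absurdᵇ p (not-f (∧-r {U v} (∧-l {U v ∧ not (Z v)} (∧-l {(U ∖ Z ∖ X) v} (sub v q))))))
      (sym-adj toX) (two-cyclic (cyclic-exc fX) (sym-adj toX)) (sym-adj toY) (two-cyclic (cyclic-exc fY) (sym-adj toY)) (sym-adj KZ) (two-cyclic (cyclic-exc fZ) (sym-adj KZ))
    where
    module X = F fX
    module Y = F fY
    module Z = F fZ
    z = proj₁ (Conn.inh Z.conn)
    Zz = proj₂ (Conn.inh Z.conn)
    D = U ∖ (X ∪ Y)
    z∈D : D z ≡ true
    z∈D = Z.sub z Zz ∧ⁱ not-t (¬t⇒f λ p → [ (λ q → dXZ z q Zz) , (λ q → dYZ z q Zz) ]′ (∨-case {X z} p))
    module XY = Disjoint fX fY dXY (z , z∈D)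
    L : Link X Y ((U ∖ Z ∖ X) ∖ Y)
    L = link {U ∖ Z} {X} {Y} Z.co (λ v p → X.sub v p ∧ⁱ not-t (¬t⇒f (dXZ v p))) (λ v p → Y.sub v p ∧ⁱ not-t (¬t⇒f (dYZ v p))) X.conn (Conn.inh Y.conn) dXY XY.XY-apart (λ _ → refl)
    open Link L
    KZ : Adj K Z
    KZ = piece-adj {D} {Z} {(U ∖ Z ∖ X) ∖ Y} XY.D-conn
      (λ v p → taut 4 (λ u x y z → (u ∧ not (x ∨ y)) ⇒ᵇ (z ∨ (((u ∧ not z) ∧ not x) ∧ not y))) (U v) (X v) (Y v) (Z v) $ᵇ p)
      (λ v p → taut 4 (λ u x y z → (((u ∧ not z) ∧ not x) ∧ not y) ⇒ᵇ (u ∧ not (x ∨ y))) (U v) (X v) (Y v) (Z v) $ᵇ sub v p) (Conn.inh conn)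
      (z , z∈D ∧ⁱ not-t (¬t⇒f λ p → absurdᵇ Zz (not-f (∧-r {U z} (∧-l {U z ∧ not (Z z)} (∧-l {(U ∖ Z ∖ X) z} (sub z p))))))) apart

-- Three members with disjoint, pairwise non-adjacent complements

module Complements (G : Graph) (J : BSet (nE G)) (excl : NoMinors G) (U : BSet (nV G))
               (cU : Gr.Conn (Cycles.s G) (Cycles.t G) J U)
               (coreU : ∀ S → S ⊆ U → Inh S → Inh (U ∖ S) → suc (cnt S) ≤ Counting.touch G J excl U S) where

  open Triples G J excl U cU coreU public
  private n = nV G

  -- Three members whose complements are disjoint and pairwise non-adjacent; T is the rest of U.
  record Tri (X Y Z T : BSet n) : Set where
    field
      fX  : F X
      fY  : F Y
      fZ  : F Z
      cXY : U ⊆ X ∪ Y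
      cXZ : U ⊆ X ∪ Z
      cYZ : U ⊆ Y ∪ Z
      TX  : T ⊆ X
      TY  : T ⊆ Y
      TZ  : T ⊆ Z
      XYZ : ∀ v → X v ≡ true → Y v ≡ true → Z v ≡ true → T v ≡ true
      pq  : Apart (U ∖ X) (U ∖ Y)
      pr  : Apart (U ∖ X) (U ∖ Z)
      qr  : Apart (U ∖ Y) (U ∖ Z)

  swap₁₂ : ∀ {X Y Z T} → Tri X Y Z T → Tri Y X Z T
  swap₁₂ {X} {Y} d = record { fX = fY ; fY = fX ; fZ = fZ ; cXY = λ v p → trans (∨-comm (Y v) (X v)) (cXY v p) ; cXZ = cYZ ; cYZ = cXZ
    ; TX = TY ; TY = TX ; TZ = TZ ; XYZ = λ v p q → XYZ v q p ; pq = apart-sym {U ∖ X} {U ∖ Y} pq ; pr = qr ; qr = pr }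
    where open Tri d

  swap₂₃ : ∀ {X Y Z T} → Tri X Y Z T → Tri X Z Y T
  swap₂₃ {X} {Y} {Z} d = record { fX = fX ; fY = fZ ; fZ = fY ; cXY = cXZ ; cXZ = cXY ; cYZ = λ v p → trans (∨-comm (Z v) (Y v)) (cYZ v p)
    ; TX = TX ; TY = TZ ; TZ = TY ; XYZ = λ v p q r → XYZ v p r q ; pq = pr ; pr = pq ; qr = apart-sym {U ∖ Y} {U ∖ Z} qr }
    where open Tri d

  swap₁₃ : ∀ {X Y Z T} → Tri X Y Z T → Tri Z Y X T
  swap₁₃ d = swap₁₂ (swap₂₃ (swap₁₂ d))

  bet-cross : ∀ {A B C D} → Disj A C → Disj A D → Disj B C → Disj B D → Disj C D → Adj A D → Adj B C → 2 ≤ bet (A ∪ B) (C ∪ D)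
  bet-cross {A} {B} {C} {D} ac ad bc bd cd p q = ≤-trans (+-mono-≤ (adj-mono (⊆-∪ʳ A) (λ _ → id) q) (adj-mono (⊆-∪ˡ B) (λ _ → id) p))
    (bet-∪ (disj-∪ˡ ac bc) (disj-∪ˡ ad bd) cd)

  module TriFacts {X Y Z T : BSet n} (d : Tri X Y Z T) where
    open Tri d
    private
      module X = F fX
      module Y = F fY
      module Z = F fZ

    P Q R : BSet n
    P = U ∖ X
    Q = U ∖ Y
    R = U ∖ Z

    P⊆Z : P ⊆ Z
    P⊆Z v p = taut 3 (λ u x z → (u ⇒ᵇ (x ∨ z)) ⇒ᵇ (u ∧ not x) ⇒ᵇ z) (U v) (X v) (Z v) $ᵇ ⊆⇒ᵇ (cXZ v) $ᵇ p
    Q⊆Z : Q ⊆ Z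
    Q⊆Z v p = taut 3 (λ u y z → (u ⇒ᵇ (y ∨ z)) ⇒ᵇ (u ∧ not y) ⇒ᵇ z) (U v) (Y v) (Z v) $ᵇ ⊆⇒ᵇ (cYZ v) $ᵇ p
    P⊆Y : P ⊆ Y
    P⊆Y v p = taut 3 (λ u x z → (u ⇒ᵇ (x ∨ z)) ⇒ᵇ (u ∧ not x) ⇒ᵇ z) (U v) (X v) (Y v) $ᵇ ⊆⇒ᵇ (cXY v) $ᵇ p

    dPQ : Disj P Q
    dPQ v p q = absurdᵇ (P⊆Y v p) (not-f (∧-r {U v} q))
    dPR : Disj P R
    dPR v p q = absurdᵇ (P⊆Z v p) (not-f (∧-r {U v} q))
    dQR : Disj Q R
    dQR v p q = absurdᵇ (Q⊆Z v p) (not-f (∧-r {U v} q))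
    dTP : Disj T P
    dTP v p q = absurdᵇ (TX v p) (not-f (∧-r {U v} q))
    dTQ : Disj T Q
    dTQ v p q = absurdᵇ (TY v p) (not-f (∧-r {U v} q))
    dTR : Disj T R
    dTR v p q = absurdᵇ (TZ v p) (not-f (∧-r {U v} q))

    cP = X.co
    cQ = Y.co
    cR = Z.co

    Z⊆ : Z ⊆ (P ∪ Q) ∪ T
    Z⊆ v p = taut 5 (λ u x y z t → (z ⇒ᵇ u) ⇒ᵇ (x ⇒ᵇ (y ⇒ᵇ (z ⇒ᵇ t))) ⇒ᵇ z ⇒ᵇ (((u ∧ not x) ∨ (u ∧ not y)) ∨ t)) (U v) (X v) (Y v) (Z v) (T v)
      $ᵇ ⊆⇒ᵇ (Z.sub v) $ᵇ ⊆⇒ᵇ (λ a → ⊆⇒ᵇ λ b → ⊆⇒ᵇ (XYZ v a b)) $ᵇ p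

    module _ {a} (K : Piece T a) where
      private module K = Piece K

      outZ : Inh (Z ∖ K.K)
      outZ = let x , p = Conn.inh cP in x , P⊆Z x p ∧ⁱ not-t (¬t⇒f λ q → dTP x (K.sub x q) p)

      two-off : Two K.K (P ∪ Q)
      two-off = two-apart (two-touch (Z.core K.K (λ v p → TZ v (K.sub v p)) (Conn.inh K.conn) outZ)
        (λ v p → taut 3 (λ a t k → (a ∨ t) ⇒ᵇ (k ∨ (a ∨ (t ∧ not k)))) ((P ∪ Q) v) (T v) (K.K v) $ᵇ Z⊆ v p)) K.apart

      adj-off : Adj K.K (P ∪ Q)
      adj-off = piece-adj {Z} {P ∪ Q} {T} Z.conn Z⊆ (λ v p → TZ v (K.sub v p)) (Conn.inh K.conn) outZ K.apart

    leaf-R : Two R T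
    leaf-R = two-apart (two-touch (coreU R (∖-⊆ U) (Conn.inh cR) (let x , p = Conn.inh cP in x , ∧-l p ∧ⁱ not-t (¬t⇒f (dPR x p))))
        (λ v p → taut 5 (λ u x y z t → (x ⇒ᵇ (y ⇒ᵇ (z ⇒ᵇ t))) ⇒ᵇ u ⇒ᵇ ((u ∧ not z) ∨ (t ∨ ((u ∧ not x) ∨ (u ∧ not y))))) (U v) (X v) (Y v) (Z v) (T v)
           $ᵇ ⊆⇒ᵇ (λ a → ⊆⇒ᵇ λ b → ⊆⇒ᵇ (XYZ v a b)) $ᵇ p))
      (n≤0⇒n≡0 (≤-trans (bet-∪-≤ R P Q) (≤-reflexive (cong₂ _+_ (apart-sym {P} {R} pr) (apart-sym {Q} {R} qr)))))

    link-PQ : Link P Q T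
    link-PQ = link Z.conn P⊆Z Q⊆Z cP (Conn.inh cQ) dPQ pq λ v → bool-iff
      (λ p → (TZ v p ∧ⁱ not-t (¬t⇒f (dTP v p))) ∧ⁱ not-t (¬t⇒f (dTQ v p)))
      (λ p → taut 3 (λ z a t → (z ⇒ᵇ (a ∨ t)) ⇒ᵇ (z ∧ not a) ⇒ᵇ t) (Z v) ((P ∪ Q) v) (T v) $ᵇ ⊆⇒ᵇ (Z⊆ v) $ᵇ (taut 3 (λ z p q → ((z ∧ not p) ∧ not q) ⇒ᵇ (z ∧ not (p ∨ q))) (Z v) (P v) (Q v) $ᵇ p))

  -- By `adj-off` and its permuted forms a component of `T` touches at least two of the three
  -- complements. `Miss` leaves out the third one; the other two cases arise by permuting the
  -- members.
  Full Miss : ∀ {X Y Z T} → Tri X Y Z T → BSet n → Set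
  Full {X} {Y} {Z} d K = Adj K (U ∖ X) × Adj K (U ∖ Y) × Adj K (U ∖ Z)
  Miss {X} {Y} {Z} d K = Adj K (U ∖ X) × Adj K (U ∖ Y) × Apart K (U ∖ Z)

  module TriCases {X Y Z T : BSet n} (d : Tri X Y Z T) where
    open TriFacts d
    private
      module D₂₃ = TriFacts (swap₂₃ d)
      module D₁₃ = TriFacts (swap₁₃ d)

    miss-P : ∀ {a} (K : Piece T a) → Apart (Piece.K K) R → Two (Piece.K K) P
    miss-P K ap = two-apart (D₂₃.two-off K) ap

    miss-Q : ∀ {a} (K : Piece T a) → Apart (Piece.K K) R → Two (Piece.K K) Q
    miss-Q K ap = two-apart (two-mono (λ v p → trans (∨-comm (Q v) (R v)) p) (D₁₃.two-off K)) ap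

    private
      dP : ∀ {a} (K : Piece T a) → Disj (Piece.K K) P
      dP K = disj-⊆ (Piece.sub K) (λ _ → id) dTP
      dQ : ∀ {a} (K : Piece T a) → Disj (Piece.K K) Q
      dQ K = disj-⊆ (Piece.sub K) (λ _ → id) dTQ
      dR : ∀ {a} (K : Piece T a) → Disj (Piece.K K) R
      dR K = disj-⊆ (Piece.sub K) (λ _ → id) dTR

    -- Three components and three complements alternate around a hexagon. Each component together
    -- with one neighbouring complement is cyclic, which leaves a triangle of cyclic parts.
    hexagon : ∀ {a b c} (A : Piece T a) (B : Piece T b) (C : Piece T c) →
      Disj (Piece.K A) (Piece.K B) → Disj (Piece.K A) (Piece.K C) → Disj (Piece.K B) (Piece.K C) →
      Two (Piece.K A) P → Adj (Piece.K A) P → Adj (Piece.K A) Q → Two (Piece.K B) Q → Adj (Piece.K B) Q → Adj (Piece.K B) R →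
      Two (Piece.K C) R → Adj (Piece.K C) R → Adj (Piece.K C) P → ⊥
    hexagon A B C dAB dAC dBC tA AP AQ tB BQ BR tC CR CP = excl-A3 (A.K ∪ P) (B.K ∪ Q) (C.K ∪ R)
      (conn-join A.conn cP AP) (conn-join B.conn cQ BQ) (conn-join C.conn cR CR)
      (disj-∪ˡ (disj-∪ʳ dAB (dQ A)) (disj-∪ʳ (sym-disj (dP B)) dPQ)) (disj-∪ˡ (disj-∪ʳ dAC (dR A)) (disj-∪ʳ (sym-disj (dP C)) dPR))
      (disj-∪ˡ (disj-∪ʳ dBC (dR B)) (disj-∪ʳ (sym-disj (dQ C)) dQR))
      (adj-mono (⊆-∪ˡ P) (⊆-∪ʳ B.K) AQ) ac bc (two-cyclic-∪ cR (dR C) tC) (two-cyclic (two-cyclic-∪ cP (dP A) tA) ac) (two-cyclic (two-cyclic-∪ cQ (dQ B) tB) bc)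
      where
      module A = Piece A
      module B = Piece B
      module C = Piece C
      ac = adj-mono (⊆-∪ʳ A.K) (⊆-∪ˡ R) (sym-adj CP)
      bc = adj-mono (⊆-∪ˡ Q) (⊆-∪ʳ C.K) BR

    module _ {a b} (A : Piece T a) (B : Piece T b) (dAB : Disj (Piece.K A) (Piece.K B)) (fA : Full d (Piece.K A)) where
      private
        module A = Piece A
        module B = Piece B
        AP = proj₁ fA
        AQ = proj₁ (proj₂ fA)
        AR = proj₂ (proj₂ fA)

      -- If `B` is cyclic, contracting it with its cycle turns its edges to `P` and `Q` into loops,
      -- and `R` is held by `A` alone. If not, `B` has two edges to `Q`, and `Q`, `R ∪ A`, `B ∪ P`
      -- form the triangle of `excl-A3`.
      two-miss : T ⊆ A.K ∪ B.K → Miss d B.K → ⊥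
      two-miss cov (BP , BQ , ap) = main
        where
        tR : Two R A.K
        tR = two-apart (two-mono cov leaf-R) (apart-sym {B.K} {R} ap)
        main : ⊥
        main with cnt B.K ≤? ins B.K
        ... | yes cyc = excl-P2-ground A.K P Q R B.K A.conn cP cQ cR B.conn dPQ dPR dQR (sym-disj (dP A)) (sym-disj (dQ A)) (sym-disj (dR A))
              (sym-disj (dP B)) (sym-disj (dQ B)) (sym-disj (dR B)) dAB cyc (sym-adj AP) (sym-adj BP) (sym-adj AQ) (sym-adj BQ) (sym-adj AR) (inj₂ tR)
        ... | no ¬c = excl-A3 Q (R ∪ A.K) (B.K ∪ P) cQ (conn-join cR A.conn (sym-adj AR)) (conn-join B.conn cP BP)
              (disj-∪ʳ dQR (sym-disj (dQ A))) (disj-∪ʳ (sym-disj (dQ B)) (sym-disj dPQ)) (disj-∪ˡ (disj-∪ʳ (sym-disj (dR B)) (sym-disj dPR)) (disj-∪ʳ dAB (dP A)))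
              (adj-mono (λ _ → id) (⊆-∪ʳ R) (sym-adj AQ)) (adj-mono (λ _ → id) (⊆-∪ˡ P) (sym-adj BQ)) adjC (two-cyclic-∪ cP (dP B) (miss-P B ap))
              (lin (cnt Q ∷ ins Q ∷ bet B.K Q ∷ bet Q B.K ∷ bet Q (B.K ∪ P) ∷ [])
                (λ { (b ∷ i ∷ kb ∷ bk ∷ u ∷ []) → (b :≤ con 1 :+ i) ∷ (con 2 :≤ kb) ∷ (kb :≤ bk) ∷ (bk :≤ u) ∷ [] ⊢ (con 1 :+ b :≤ i :+ u) })
                (spanning-ins cQ , bQ2 , ≤-reflexive (bet-sym B.K Q) , bet-mono (λ _ → id) (⊆-∪ˡ P)))
              (two-cyclic (two-cyclic-∪ A.conn (sym-disj (dR A)) tR) adjC)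
          where
          adjC = adj-mono (⊆-∪ʳ R) (⊆-∪ʳ B.K) AP
          bQ2 : 2 ≤ bet B.K Q
          bQ2 = [ (λ c → ⊥-elim (¬c c)) , id ]′ (leaf-cases B.K Q (miss-Q B ap))

      private
        double : ∀ {L I} → Conn J L → Conn J I → Disj L I → Adj L I → Cyclic L ⊎ (2 ≤ bet L I) → Cyclic (I ∪ L) × Two L I
        double {L} {I} cL cI dLI li (inj₁ cyc) = cyclic-mono (conn-join cI cL (sym-adj li)) (⊆-∪ʳ I) (Conn.inh cL) cyc , two-cyclic cyc li
        double {L} {I} cL cI dLI li (inj₂ two) = cyclic-∪ cI cL (sym-disj dLI) (subst (2 ≤_) (bet-sym L I) two)
          , lin (cnt L ∷ ins L ∷ bet L I ∷ []) (λ { (l ∷ i ∷ b ∷ []) → (l :≤ con 1 :+ i) ∷ (con 2 :≤ b) ∷ [] ⊢ (con 1 :+ l :≤ i :+ b) }) (spanning-ins cL , two)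

      -- A cycle in `P` or a double edge to `I` makes `I ∪ P` cyclic, the same for `Q` holds `Q`
      -- twice at `I`, and `K ∪ R` is adjacent to `I`, to `P` and to `Q`.
      same-side : ∀ {I K} → Conn J I → Conn J K → Disj I K → Disj I P → Disj I Q → Disj I R → Disj K P → Disj K Q → Disj K R →
        Adj I P → Adj I Q → Adj I R → Adj K P → Adj K Q → Adj K R → Cyclic P ⊎ (2 ≤ bet P I) → Cyclic Q ⊎ (2 ≤ bet Q I) → ⊥
      same-side {I} {K} cI cK dIK iP iQ iR kP kQ kR IP IQ IR KP KQ KR xP xQ = excl-A3 Q (K ∪ R) (I ∪ P) cQ (conn-join cK cR KR) (conn-join cI cP IP)
        (disj-∪ʳ (sym-disj kQ) dQR) (disj-∪ʳ (sym-disj iQ) (sym-disj dPQ)) dKRIP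
        (adj-mono (λ _ → id) (⊆-∪ˡ R) (sym-adj KQ)) (adj-mono (λ _ → id) (⊆-∪ˡ P) (sym-adj IQ)) (adj-mono (⊆-∪ˡ R) (⊆-∪ʳ I) KP)
        (proj₁ (double cP cI (sym-disj iP) (sym-adj IP) xP)) (two-mono (⊆-∪ˡ P) (proj₂ (double cQ cI (sym-disj iQ) (sym-adj IQ) xQ)))
        (two-of-adj (conn-join cK cR KR) (disj-∪ˡ (sym-disj dIK) (sym-disj iR)) (disj-∪ˡ kP (sym-disj dPR)) iP (adj-mono (⊆-∪ʳ K) (λ _ → id) (sym-adj IR)) (adj-mono (⊆-∪ˡ R) (λ _ → id) KP))
        where
        dKRIP = disj-∪ˡ (disj-∪ʳ (sym-disj dIK) kP) (disj-∪ʳ (sym-disj iR) (sym-disj dPR))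

      -- A spanning tree of `L` and one edge to each of `A` and `B` amount to |L| + 1 edges. One
      -- more means a cycle in `L` or a double edge to `A` or to `B`.
      spare : BSet n → Set
      spare L = suc (suc (cnt L)) ≤ ins L + (bet L A.K + bet L B.K)

      spare-cases : ∀ L → spare L → Cyclic L ⊎ (2 ≤ bet L A.K) ⊎ (2 ≤ bet L B.K)
      spare-cases L sp with cnt L ≤? ins L | 2 ≤? bet L A.K | 2 ≤? bet L B.K
      ... | yes c | _ | _ = inj₁ c
      ... | _ | yes p | _ = inj₂ (inj₁ p)
      ... | _ | _ | yes q = inj₂ (inj₂ q)
      ... | no c | no p | no q = ⊥-elim (1+n≰n (lin (cnt L ∷ ins L ∷ bet L A.K ∷ bet L B.K ∷ [])
            (λ { (l ∷ i ∷ a ∷ b ∷ []) → (con 2 :+ l :≤ i :+ (a :+ b)) ∷ (con 1 :+ i :≤ l) ∷ (a :≤ con 1) ∷ (b :≤ con 1) ∷ [] ⊢ (con 1 :+ a :≤ a) })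
            (sp , ≰⇒> c , ≤-pred (≰⇒> p) , ≤-pred (≰⇒> q))))

      module _ (fB : Full d B.K) where
        private
          BP = proj₁ fB
          BQ = proj₁ (proj₂ fB)
          BR = proj₂ (proj₂ fB)
          atA = same-side A.conn B.conn dAB (dP A) (dQ A) (dR A) (dP B) (dQ B) (dR B) AP AQ AR BP BQ BR
          atB = same-side B.conn A.conn (sym-disj dAB) (dP B) (dQ B) (dR B) (dP A) (dQ A) (dR A) BP BQ BR AP AQ AR

        -- A cycle, or double edges towards the same component, is the case of `same-side`. Double
        -- edges towards different components form `S₁`, with `R` subdividing the remaining
        -- connection.
        two-spare : spare P → spare Q → ⊥
        two-spare sp sq with spare-cases P sp | spare-cases Q sq
        ... | inj₁ c | inj₁ c′ = atA (inj₁ c) (inj₁ c′)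
        ... | inj₁ c | inj₂ (inj₁ q) = atA (inj₁ c) (inj₂ q)
        ... | inj₁ c | inj₂ (inj₂ q) = atB (inj₁ c) (inj₂ q)
        ... | inj₂ (inj₁ p) | inj₁ c = atA (inj₂ p) (inj₁ c)
        ... | inj₂ (inj₂ p) | inj₁ c = atB (inj₂ p) (inj₁ c)
        ... | inj₂ (inj₁ p) | inj₂ (inj₁ q) = atA (inj₂ p) (inj₂ q)
        ... | inj₂ (inj₂ p) | inj₂ (inj₂ q) = atB (inj₂ p) (inj₂ q)
        ... | inj₂ (inj₁ p) | inj₂ (inj₂ q) = excl-S1 A.K Q P B.K R A.conn cQ cP B.conn cR (dQ A) (dP A) dAB (dR A) (sym-disj dPQ) (sym-disj (dQ B)) dQR (sym-disj (dP B)) dPR (dR B)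
              AQ (sym-adj BP) AR (sym-adj BR) (subst (2 ≤_) (bet-sym P A.K) p) q
        ... | inj₂ (inj₂ p) | inj₂ (inj₁ q) = excl-S1 B.K Q P A.K R B.conn cQ cP A.conn cR (dQ B) (dP B) (sym-disj dAB) (dR B) (sym-disj dPQ) (sym-disj (dQ A)) dQR (sym-disj (dP A)) dPR (dR A)
              BQ (sym-adj AP) BR (sym-adj AR) (subst (2 ≤_) (bet-sym P B.K) p) q

        -- The excess of Z = P ∪ Q ∪ T, with both pieces of T acyclic.
        one-spare : T ⊆ A.K ∪ B.K → ¬ Cyclic A.K → ¬ Cyclic B.K → spare P ⊎ spare Q
        one-spare cov ¬cA ¬cB with suc (suc (cnt P)) ≤? ins P + (bet P A.K + bet P B.K) | suc (suc (cnt Q)) ≤? ins Q + (bet Q A.K + bet Q B.K)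
        ... | yes p | _ = inj₁ p
        ... | _ | yes q = inj₂ q
        ... | no ¬p | no ¬q = ⊥-elim (1+n≰n (lin
            ( cnt P ∷ cnt Q ∷ cnt A.K ∷ cnt B.K ∷ cnt Z ∷ ins P ∷ ins Q ∷ ins A.K ∷ ins B.K ∷ ins Z ∷ bet P A.K ∷ bet P B.K ∷ bet Q A.K ∷ bet Q B.K
            ∷ ins (P ∪ Q) ∷ ins (A.K ∪ B.K) ∷ bet (P ∪ Q) (A.K ∪ B.K) ∷ [])
            (λ { (p ∷ q ∷ a ∷ b ∷ z ∷ ip ∷ iq ∷ ia ∷ ib ∷ iz ∷ pa ∷ pb ∷ qa ∷ qb ∷ ipq ∷ iab ∷ w ∷ []) →
                (ip :+ (pa :+ pb) :≤ con 1 :+ p) ∷ (iq :+ (qa :+ qb) :≤ con 1 :+ q) ∷ (con 1 :+ ia :≤ a) ∷ (con 1 :+ ib :≤ b) ∷ (con 1 :+ z :≤ iz) ∷ ((p :+ q) :+ (a :+ b) :≤ z) ∷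
                (iz :≤ ipq :+ iab :+ w) ∷ (ipq :≤ ip :+ iq) ∷ (iab :≤ ia :+ ib) ∷ (w :≤ (pa :+ pb) :+ (qa :+ qb)) ∷ [] ⊢ (con 1 :+ p :≤ p) })
            ( ≤-pred (≰⇒> ¬p) , ≤-pred (≰⇒> ¬q) , ≰⇒> ¬cA , ≰⇒> ¬cB , F.exc (Tri.fZ d) , card
            , ≤-trans (ins-mono λ v p → taut 4 (λ w t a b → (t ⇒ᵇ (a ∨ b)) ⇒ᵇ (w ∨ t) ⇒ᵇ (w ∨ (a ∨ b))) ((P ∪ Q) v) (T v) (A.K v) (B.K v) $ᵇ ⊆⇒ᵇ (cov v) $ᵇ Z⊆ v p) (ins-∪-≤ (P ∪ Q) (A.K ∪ B.K))
            , ≤-trans (ins-∪-≤ P Q) (≤-reflexive (trans (cong (ins P + ins Q +_) (Tri.pq d)) (+-identityʳ _)))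
            , ≤-trans (ins-∪-≤ A.K B.K) (≤-reflexive (trans (cong (ins A.K + ins B.K +_) apAB) (+-identityʳ _)))
            , cross)))
            where
            apAB : Apart A.K B.K
            apAB = apart-mono (λ _ → id) (λ v p → B.sub v p ∧ⁱ not-t (¬t⇒f λ q → dAB v q p)) A.apart
            card : (cnt P + cnt Q) + (cnt A.K + cnt B.K) ≤ cnt Z
            card = ≤-trans (+-mono-≤ (cnt-∪ dPQ) (cnt-∪ dAB)) (≤-trans (cnt-∪ (disj-∪ˡ (disj-∪ʳ (sym-disj (dP A)) (sym-disj (dP B))) (disj-∪ʳ (sym-disj (dQ A)) (sym-disj (dQ B)))))
              (cnt-⊆ (∪-⊆ (∪-⊆ P⊆Z Q⊆Z) (∪-⊆ (λ v p → Tri.TZ d v (A.sub v p)) (λ v p → Tri.TZ d v (B.sub v p))))))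
            cross : bet (P ∪ Q) (A.K ∪ B.K) ≤ (bet P A.K + bet P B.K) + (bet Q A.K + bet Q B.K)
            cross = ≤-trans (≤-reflexive (bet-sym (P ∪ Q) (A.K ∪ B.K))) (≤-trans (bet-∪-≤ (A.K ∪ B.K) P Q)
              (+-mono-≤ (≤-trans (≤-reflexive (bet-sym (A.K ∪ B.K) P)) (bet-∪-≤ P A.K B.K)) (≤-trans (≤-reflexive (bet-sym (A.K ∪ B.K) Q)) (bet-∪-≤ Q A.K B.K))))

        ground : Cyclic B.K → ⊥
        ground cyc = excl-P2-ground A.K P Q R B.K A.conn cP cQ cR B.conn dPQ dPR dQR (sym-disj (dP A)) (sym-disj (dQ A)) (sym-disj (dR A))
          (sym-disj (dP B)) (sym-disj (dQ B)) (sym-disj (dR B)) dAB cyc (sym-adj AP) (sym-adj BP) (sym-adj AQ) (sym-adj BQ) (sym-adj AR) (inj₁ (sym-adj BR))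

        module _ {c} (C : Piece T c) (dAC : Disj (Piece.K A) (Piece.K C)) (dBC : Disj (Piece.K B) (Piece.K C)) where
          private module C = Piece C

          full-full-miss : Miss d C.K → ⊥
          full-full-miss (CP , CQ , ap) = excl-A3 A.K (B.K ∪ R) ((C.K ∪ P) ∪ Q) A.conn cBR cM (disj-∪ʳ dAB (dR A))
            (disj-∪ʳ (disj-∪ʳ dAC (dP A)) (dQ A)) dBRM (adj-mono (λ _ → id) (⊆-∪ʳ B.K) AR)
            (adj-mono (λ _ → id) (⊆-∪ʳ (C.K ∪ P)) AQ) (adj-mono (⊆-∪ˡ R) (⊆-∪ʳ (C.K ∪ P)) BQ)
            (cyclic-mono cM (⊆-∪ˡ Q) (Conn.inh cCP) (two-cyclic-∪ cP (dP C) (miss-P C ap)))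
            (two-mono (λ v p → PQ⊆ v p) (two-of-adj A.conn (dP A) (dQ A) dPQ AP AQ))
            (two-mono (λ v p → PQ⊆ v p) (two-of-adj cBR (disj-∪ˡ (dP B) (sym-disj dPR)) (disj-∪ˡ (dQ B) (sym-disj dQR)) dPQ (adj-mono (⊆-∪ˡ R) (λ _ → id) BP) (adj-mono (⊆-∪ˡ R) (λ _ → id) BQ)))
            where
            cBR = conn-join B.conn cR BR
            cCP = conn-join C.conn cP CP
            cM = conn-join cCP cQ (adj-mono (⊆-∪ˡ P) (λ _ → id) CQ)
            dBRM : Disj (B.K ∪ R) ((C.K ∪ P) ∪ Q)
            dBRM = disj-∪ˡ (disj-∪ʳ (disj-∪ʳ dBC (dP B)) (dQ B)) (disj-∪ʳ (disj-∪ʳ (sym-disj (dR C)) (sym-disj dPR)) (sym-disj dQR))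
            PQ⊆ : P ∪ Q ⊆ (C.K ∪ P) ∪ Q
            PQ⊆ v p = taut 3 (λ c p q → (p ∨ q) ⇒ᵇ ((c ∨ p) ∨ q)) (C.K v) (P v) (Q v) $ᵇ p

          -- `A ∪ P` and `B ∪ Q` are joined by the edges from `A` to `Q` and from `P` to `B`, so
          -- their union is cyclic; `R` and `C` are adjacent and both are held twice by it.
          full-full-full : Full d C.K → ⊥
          full-full-full (CP , CQ , CR) = excl-A3 R C.K ((A.K ∪ P) ∪ (B.K ∪ Q)) cR C.conn cM (sym-disj (dR C))
            (disj-∪ʳ (disj-∪ʳ (sym-disj (dR A)) (sym-disj dPR)) (disj-∪ʳ (sym-disj (dR B)) (sym-disj dQR)))
            (disj-∪ʳ (disj-∪ʳ (sym-disj dAC) (dP C)) (disj-∪ʳ (sym-disj dBC) (dQ C)))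
            (sym-adj CR) (adj-mono (λ _ → id) (λ v p → ∨-l (∨-l p)) (sym-adj AR)) (adj-mono (λ _ → id) (λ v p → ∨-l (∨-r {A.K v} p)) CP)
            (cyclic-∪ cAP cBQ dAPBQ cross)
            (two-mono (λ v p → taut 4 (λ a b p q → (a ∨ b) ⇒ᵇ ((a ∨ p) ∨ (b ∨ q))) (A.K v) (B.K v) (P v) (Q v) $ᵇ p) (two-of-adj cR (sym-disj (dR A)) (sym-disj (dR B)) dAB (sym-adj AR) (sym-adj BR)))
            (two-mono (λ v p → taut 4 (λ a b p q → (p ∨ q) ⇒ᵇ ((a ∨ p) ∨ (b ∨ q))) (A.K v) (B.K v) (P v) (Q v) $ᵇ p) (two-of-adj C.conn (dP C) (dQ C) dPQ CP CQ))
            where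
            cAP = conn-join A.conn cP AP
            cBQ = conn-join B.conn cQ BQ
            dAPBQ : Disj (A.K ∪ P) (B.K ∪ Q)
            dAPBQ = disj-∪ˡ (disj-∪ʳ dAB (dQ A)) (disj-∪ʳ (sym-disj (dP B)) dPQ)
            cross : 2 ≤ bet (A.K ∪ P) (B.K ∪ Q)
            cross = bet-cross dAB (dQ A) (sym-disj (dP B)) dPQ (dQ B) AQ (sym-adj BP)
            cM = conn-join cAP cBQ (≤-trans (s≤s z≤n) cross)

      module _ {c} (C : Piece T c) (dAC : Disj (Piece.K A) (Piece.K C)) (dBC : Disj (Piece.K B) (Piece.K C)) where
        private module C = Piece C

        -- Merging the two deficient components with `P` and with `Q` makes them cyclic leaves at
        -- `A`; `R` is the third leaf because only `A` reaches it.
        full-miss-miss : T ⊆ A.K ∪ (B.K ∪ C.K) → Miss d B.K → Miss d C.K → ⊥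
        full-miss-miss cov (BP , BQ , bR) (CP , CQ , cR′) = excl-P2 A.K R (B.K ∪ P) (C.K ∪ Q) A.conn cR cBP cCQ
          (disj-∪ʳ (sym-disj (dR B)) (sym-disj dPR)) (disj-∪ʳ (sym-disj (dR C)) (sym-disj dQR)) (disj-∪ˡ (disj-∪ʳ dBC (dQ B)) (disj-∪ʳ (sym-disj (dP C)) dPQ))
          (sym-disj (dR A)) (disj-∪ˡ (sym-disj dAB) (sym-disj (dP A))) (disj-∪ˡ (sym-disj dAC) (sym-disj (dQ A)))
          (sym-adj AR) (two-apart (two-mono cov leaf-R) (n≤0⇒n≡0 (≤-trans (bet-∪-≤ R B.K C.K) (≤-reflexive (cong₂ _+_ (apart-sym {B.K} {R} bR) (apart-sym {C.K} {R} cR′))))))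
          bA (two-cyclic (two-cyclic-∪ cP (dP B) (miss-P B bR)) bA) cA (two-cyclic (two-cyclic-∪ cQ (dQ C) (miss-Q C cR′)) cA)
          where
          cBP = conn-join B.conn cP BP
          cCQ = conn-join C.conn cQ CQ
          bA = adj-mono (⊆-∪ʳ B.K) (λ _ → id) (sym-adj AP)
          cA = adj-mono (⊆-∪ʳ C.K) (λ _ → id) (sym-adj AQ)

        full-miss-miss′ : Miss d B.K → Two C.K R → Adj C.K Q → Adj C.K R → ⊥
        full-miss-miss′ (BP , BQ , bR) tC CQ CR = excl-A3 (A.K ∪ P) (C.K ∪ R) (B.K ∪ Q) cAP (conn-join C.conn cR CR) (conn-join B.conn cQ BQ)
          (disj-∪ˡ (disj-∪ʳ dAC (dR A)) (disj-∪ʳ (sym-disj (dP C)) dPR)) (disj-∪ˡ (disj-∪ʳ dAB (dQ A)) (disj-∪ʳ (sym-disj (dP B)) dPQ))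
          (disj-∪ˡ (disj-∪ʳ (sym-disj dBC) (dQ C)) (disj-∪ʳ (sym-disj (dR B)) (sym-disj dQR)))
          (adj-mono (⊆-∪ˡ P) (⊆-∪ʳ C.K) AR) (adj-mono (⊆-∪ˡ P) (⊆-∪ʳ B.K) AQ) cB (two-cyclic-∪ cQ (dQ B) (miss-Q B bR))
          (two-of-adj cAP (disj-∪ˡ dAB (sym-disj (dP B))) (disj-∪ˡ (dQ A) dPQ) (dQ B) (adj-mono (⊆-∪ʳ A.K) (λ _ → id) (sym-adj BP)) (adj-mono (⊆-∪ˡ P) (λ _ → id) AQ))
          (two-cyclic (two-cyclic-∪ cR (dR C) tC) cB)
          where
          cAP = conn-join A.conn cP AP
          cB = adj-mono (⊆-∪ˡ R) (⊆-∪ʳ B.K) CQ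

-- No three pairwise incomparable members, and the position of dense sets

module Structure (G : Graph) (J : BSet (nE G)) (excl : NoMinors G) (U : BSet (nV G))
               (cU : Gr.Conn (Cycles.s G) (Cycles.t G) J U)
               (coreU : ∀ S → S ⊆ U → Inh S → Inh (U ∖ S) → suc (cnt S) ≤ Counting.touch G J excl U S) where

  open Complements G J excl U cU coreU public
  private n = nV G

  pieces-differ : ∀ {T a b S} (A : Piece T a) (B : Piece T b) → Apart (Piece.K A) S → Adj (Piece.K B) S → Disj (Piece.K A) (Piece.K B)
  pieces-differ {b = b} A B ap ad = pieces-disj A B (¬t⇒f λ p → apart-¬adj ap (adj-mono
    (absorb (Piece.conn B) (Piece.sub B) (Piece.apart A) (b , Piece.has B ∧ⁱ p)) (λ _ → id) ad))

  link-piece : ∀ {X Y T} (L : Link X Y T) → Piece T (proj₁ (Conn.inh (Link.conn L)))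
  link-piece L = record { K = Link.K L ; sub = Link.sub L ; has = proj₂ (Conn.inh (Link.conn L)) ; conn = Link.conn L ; apart = Link.apart L }

  module TriAbsurd {X Y Z T : BSet n} (d : Tri X Y Z T) where
    open TriFacts d
    open TriCases d
    private
      d₁₂ = swap₁₂ d
      d₂₃ = swap₂₃ d
      d₁₃ = swap₁₃ d
      module D₂₃ = TriCases d₂₃
      module D₁₃ = TriCases d₁₃
      module D₁₂ = TriCases d₁₂

    data Kind (K : BSet n) : Set where
      all³  : Full d K → Kind K
      missR : Miss d K → Kind K
      missQ : Miss d₂₃ K → Kind K
      missP : Miss d₁₃ K → Kind K

    kind : ∀ {a} (K : Piece T a) → Kind (Piece.K K)
    kind K with adj? (Piece.K K) P | adj? (Piece.K K) Q | adj? (Piece.K K) R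
    ... | inj₁ p | inj₁ q | inj₁ r = all³ (p , q , r)
    ... | inj₁ p | inj₁ q | inj₂ r = missR (p , q , r)
    ... | inj₁ p | inj₂ q | inj₁ r = missQ (p , r , q)
    ... | inj₂ p | inj₁ q | inj₁ r = missP (r , q , p)
    ... | inj₂ p | inj₂ q | _ = ⊥-elim ([ apart-¬adj p , apart-¬adj q ]′ (adj-∪ P Q (adj-off K)))
    ... | inj₂ p | _ | inj₂ r = ⊥-elim ([ apart-¬adj p , apart-¬adj r ]′ (adj-∪ P R (TriFacts.adj-off d₂₃ K)))
    ... | _ | inj₂ q | inj₂ r = ⊥-elim ([ apart-¬adj r , apart-¬adj q ]′ (adj-∪ R Q (TriFacts.adj-off d₁₃ K)))

    f₁₂ : ∀ {K} → Full d K → Full d₁₂ K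
    f₁₂ (p , q , r) = q , p , r
    f₂₃ : ∀ {K} → Full d K → Full d₂₃ K
    f₂₃ (p , q , r) = p , r , q
    f₁₃ : ∀ {K} → Full d K → Full d₁₃ K
    f₁₃ (p , q , r) = r , q , p

    private
      dT : ∀ {L a} (K : Piece T a) → Disj T L → Disj (Piece.K K) L
      dT K = disj-⊆ (Piece.sub K) (λ _ → id)

    one-piece : ∀ {a} (A : Piece T a) → Full d (Piece.K A) → T ⊆ Piece.K A → ⊥
    one-piece A (AP , AQ , AR) cov = excl-P2 (Piece.K A) P Q R (Piece.conn A) cP cQ cR dPQ dPR dQR (sym-disj (dT A dTP)) (sym-disj (dT A dTQ)) (sym-disj (dT A dTR))
      (sym-adj AP) (two-mono cov (TriFacts.leaf-R d₁₃)) (sym-adj AQ) (two-mono cov (TriFacts.leaf-R d₂₃)) (sym-adj AR) (two-mono cov leaf-R)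

    two-pieces : ∀ {a b} (A : Piece T a) (B : Piece T b) → Disj (Piece.K A) (Piece.K B) → Full d (Piece.K A) → T ⊆ Piece.K A ∪ Piece.K B → ⊥
    two-pieces A B dAB fA cov with kind B
    ... | missR m = two-miss A B dAB fA cov m
    ... | missQ m = D₂₃.two-miss A B dAB (f₂₃ fA) cov m
    ... | missP m = D₁₃.two-miss A B dAB (f₁₃ fA) cov m
    ... | all³ fB with cnt (Piece.K A) ≤? ins (Piece.K A) | cnt (Piece.K B) ≤? ins (Piece.K B)
    ...   | yes c | _ = ground B A (sym-disj dAB) fB fA c
    ...   | _ | yes c = ground A B dAB fA fB c
    -- Each pair among the three complements contains a spare one, so at least two of them are
    -- spare.
    ...   | no a | no b with one-spare A B dAB fA fB cov a b | D₂₃.one-spare A B dAB (f₂₃ fA) (f₂₃ fB) cov a b | D₁₃.one-spare A B dAB (f₁₃ fA) (f₁₃ fB) cov a b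
    ...     | inj₁ p | inj₂ r | _      = D₂₃.two-spare A B dAB (f₂₃ fA) (f₂₃ fB) p r
    ...     | inj₁ p | inj₁ _ | inj₁ r = D₂₃.two-spare A B dAB (f₂₃ fA) (f₂₃ fB) p r
    ...     | inj₁ p | inj₁ _ | inj₂ q = two-spare A B dAB fA fB p q
    ...     | inj₂ q | inj₁ p | _      = two-spare A B dAB fA fB p q
    ...     | inj₂ q | inj₂ r | _      = D₁₃.two-spare A B dAB (f₁₃ fA) (f₁₃ fB) r q

    three-pieces : ∀ {a b c} (A : Piece T a) (B : Piece T b) (C : Piece T c) → Disj (Piece.K A) (Piece.K B) → Disj (Piece.K A) (Piece.K C) → Disj (Piece.K B) (Piece.K C) →
                   Full d (Piece.K A) → T ⊆ Piece.K A ∪ (Piece.K B ∪ Piece.K C) → ⊥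
    three-pieces A B C dAB dAC dBC fA cov with kind B | kind C
    ... | all³ fB | all³ fC = full-full-full A B dAB fA fB C dAC dBC fC
    ... | all³ fB | missR m = full-full-miss A B dAB fA fB C dAC dBC m
    ... | all³ fB | missQ m = D₂₃.full-full-miss A B dAB (f₂₃ fA) (f₂₃ fB) C dAC dBC m
    ... | all³ fB | missP m = D₁₃.full-full-miss A B dAB (f₁₃ fA) (f₁₃ fB) C dAC dBC m
    ... | missR m | all³ fC = full-full-miss A C dAC fA fC B dAB (sym-disj dBC) m
    ... | missQ m | all³ fC = D₂₃.full-full-miss A C dAC (f₂₃ fA) (f₂₃ fC) B dAB (sym-disj dBC) m
    ... | missP m | all³ fC = D₁₃.full-full-miss A C dAC (f₁₃ fA) (f₁₃ fC) B dAB (sym-disj dBC) m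
    ... | missR m | missR m′ = full-miss-miss A B dAB fA C dAC dBC cov m m′
    ... | missQ m | missQ m′ = D₂₃.full-miss-miss A B dAB (f₂₃ fA) C dAC dBC cov m m′
    ... | missP m | missP m′ = D₁₃.full-miss-miss A B dAB (f₁₃ fA) C dAC dBC cov m m′
    ... | missR m | missP (r , q , p) = full-miss-miss′ A B dAB fA C dAC dBC m (D₁₃.miss-P C p) q r
    ... | missP (r , q , p) | missR m = full-miss-miss′ A C dAC fA B dAB (sym-disj dBC) m (D₁₃.miss-P B p) q r
    ... | missR (p , q , r) | missQ (p′ , r′ , q′) = D₁₂.full-miss-miss′ A B dAB (f₁₂ fA) C dAC dBC (q , p , r) (D₂₃.miss-Q C q′) p′ r′
    ... | missQ (p′ , r′ , q′) | missR (p , q , r) = D₁₂.full-miss-miss′ A C dAC (f₁₂ fA) B dAB (sym-disj dBC) (q , p , r) (D₂₃.miss-Q B q′) p′ r′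
    ... | missQ m | missP (r , q , p) = D₂₃.full-miss-miss′ A B dAB (f₂₃ fA) C dAC dBC m (D₁₃.miss-Q C p) r q
    ... | missP (r , q , p) | missQ m = D₂₃.full-miss-miss′ A C dAC (f₂₃ fA) B dAB (sym-disj dBC) m (D₁₃.miss-Q B p) r q

    -- A full component and the three complements contract to one hub, and three further components
    -- are leaves of `P₂`.
    four-pieces : ∀ {a b c e} (A : Piece T a) (B : Piece T b) (C : Piece T c) (E : Piece T e) →
      Disj (Piece.K A) (Piece.K B) → Disj (Piece.K A) (Piece.K C) → Disj (Piece.K A) (Piece.K E) →
      Disj (Piece.K B) (Piece.K C) → Disj (Piece.K B) (Piece.K E) → Disj (Piece.K C) (Piece.K E) → Full d (Piece.K A) → ⊥
    four-pieces A B C E dAB dAC dAE dBC dBE dCE (AP , AQ , AR) = excl-P2 M (Piece.K B) (Piece.K C) (Piece.K E) cM (Piece.conn B) (Piece.conn C) (Piece.conn E)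
      dBC dBE dCE (dM B dAB) (dM C dAC) (dM E dAE) (toM B) (twoM B) (toM C) (twoM C) (toM E) (twoM E)
      where
      A₁ = Piece.K A
      M = ((A₁ ∪ P) ∪ Q) ∪ R
      cM : Conn J M
      cM = conn-join (conn-join (conn-join (Piece.conn A) cP AP) cQ (adj-mono (⊆-∪ˡ P) (λ _ → id) AQ)) cR (adj-mono (λ v p → ∨-l (∨-l p)) (λ _ → id) AR)
      PQ⊆M : P ∪ Q ⊆ M
      PQ⊆M v p = taut 4 (λ a p q r → (p ∨ q) ⇒ᵇ (((a ∨ p) ∨ q) ∨ r)) (A₁ v) (P v) (Q v) (R v) $ᵇ p
      dM : ∀ {b} (B : Piece T b) → Disj A₁ (Piece.K B) → Disj (Piece.K B) M
      dM B dAB = disj-∪ʳ (disj-∪ʳ (disj-∪ʳ (sym-disj dAB) (dT B dTP)) (dT B dTQ)) (dT B dTR)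
      toM : ∀ {b} (B : Piece T b) → Adj (Piece.K B) M
      toM B = adj-mono (λ _ → id) PQ⊆M (adj-off B)
      twoM : ∀ {b} (B : Piece T b) → Two (Piece.K B) M
      twoM B = two-mono PQ⊆M (two-off B)

    -- The number of components of `T` decides which configuration is used. Four suffice for `P₂`,
    -- so no further count is needed.
    with-full : ∀ {a} (A : Piece T a) → Full d (Piece.K A) → ⊥
    with-full A fA with inh⊎empty (T ∖ Piece.K A)
    ... | inj₂ em = one-piece A fA λ v p → taut 2 (λ t a → t ⇒ᵇ not (t ∧ not a) ⇒ᵇ a) (T v) (Piece.K A v) $ᵇ p $ᵇ not-t (em v)
    ... | inj₁ (v , hv) with inh⊎empty (T ∖ (Piece.K A ∪ Piece.K (piece T v (∧-l hv))))
    ...   | inj₂ em = two-pieces A B (pieces-disj A B (not-f (∧-r {T v} hv))) fA λ w p → taut 2 (λ t a → t ⇒ᵇ not (t ∧ not a) ⇒ᵇ a) (T w) ((Piece.K A ∪ Piece.K B) w) $ᵇ p $ᵇ not-t (em w)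
      where B = piece T v (∧-l hv)
    ...   | inj₁ (w , hw) with inh⊎empty (T ∖ (Piece.K A ∪ (Piece.K (piece T v (∧-l hv)) ∪ Piece.K (piece T w (∧-l hw)))))
    ...     | inj₂ em = three-pieces A B C (pieces-disj A B (not-f (∧-r {T v} hv))) (pieces-disj A C (not-f (taut 2 (λ a b → not (a ∨ b) ⇒ᵇ not a) (Piece.K A w) (Piece.K B w) $ᵇ ∧-r {T w} hw)))
                  (pieces-disj B C (not-f (taut 2 (λ a b → not (a ∨ b) ⇒ᵇ not b) (Piece.K A w) (Piece.K B w) $ᵇ ∧-r {T w} hw))) fA
                  λ x p → taut 2 (λ t a → t ⇒ᵇ not (t ∧ not a) ⇒ᵇ a) (T x) ((Piece.K A ∪ (Piece.K B ∪ Piece.K C)) x) $ᵇ p $ᵇ not-t (em x)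
      where B = piece T v (∧-l hv)
            C = piece T w (∧-l hw)
    ...     | inj₁ (x , hx) = four-pieces A B C E (pieces-disj A B (not-f (∧-r {T v} hv))) (pieces-disj A C (not-f (taut 2 (λ a b → not (a ∨ b) ⇒ᵇ not a) (Piece.K A w) (Piece.K B w) $ᵇ ∧-r {T w} hw)))
                  (pieces-disj A E (not-f (taut 3 (λ a b c → not (a ∨ (b ∨ c)) ⇒ᵇ not a) (Piece.K A x) (Piece.K B x) (Piece.K C x) $ᵇ ∧-r {T x} hx)))
                  (pieces-disj B C (not-f (taut 2 (λ a b → not (a ∨ b) ⇒ᵇ not b) (Piece.K A w) (Piece.K B w) $ᵇ ∧-r {T w} hw)))
                  (pieces-disj B E (not-f (taut 3 (λ a b c → not (a ∨ (b ∨ c)) ⇒ᵇ not b) (Piece.K A x) (Piece.K B x) (Piece.K C x) $ᵇ ∧-r {T x} hx)))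
                  (pieces-disj C E (not-f (taut 3 (λ a b c → not (a ∨ (b ∨ c)) ⇒ᵇ not c) (Piece.K A x) (Piece.K B x) (Piece.K C x) $ᵇ ∧-r {T x} hx))) fA
      where B = piece T v (∧-l hv)
            C = piece T w (∧-l hw)
            E = piece T x (∧-l hx)

    -- Each pair of complements is linked by a component of `T`. If such a component also touches
    -- the third complement it is full; otherwise the three links are different components and close
    -- a hexagon.
    absurd : ⊥
    absurd = main
      where
      L₁ = link-PQ
      L₂ = TriFacts.link-PQ d₁₃
      L₃ = TriFacts.link-PQ d₂₃
      A = link-piece L₁
      B = link-piece L₂
      C = link-piece L₃
      main : ⊥
      main with adj? (Link.K L₁) R | adj? (Link.K L₂) P | adj? (Link.K L₃) Q
      ... | inj₁ r | _ | _ = with-full A (Link.toX L₁ , Link.toY L₁ , r)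
      ... | _ | inj₁ p | _ = with-full B (p , Link.toY L₂ , Link.toX L₂)
      ... | _ | _ | inj₁ q = with-full C (Link.toX L₃ , q , Link.toY L₃)
      ... | inj₂ r | inj₂ p | inj₂ q = hexagon A B C (pieces-differ A B r (Link.toX L₂)) (pieces-differ A C r (Link.toY L₃)) (pieces-differ B C p (Link.toX L₃))
            (miss-P A r) (Link.toX L₁) (Link.toY L₁) (D₁₃.miss-Q B p) (Link.toY L₂) (Link.toX L₂) (D₂₃.miss-Q C q) (Link.toY L₃) (Link.toX L₃)

  -- `Cover` makes `X ∩ Y` one loopless vertex, which the complement `R` of `Z` fills, so `U` is
  -- just `P`, `Q` and `R`. Connectedness of `X` and `Y` gives the other adjacencies, hence all
  -- three are loopless, and the excess of each member supplies three parallel edges.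
  adjacent-complements : ∀ {X Y Z} → F X → F Y → F Z → U ⊆ X ∪ Y → U ⊆ X ∪ Z → U ⊆ Y ∪ Z → Adj (U ∖ X) (U ∖ Y) → ⊥
  adjacent-complements {X} {Y} {Z} fX fY fZ cXY cXZ cYZ PQ = excl-K3 P Q R X.co Y.co Z.co dPQ dPR dQR (three fZ dPQ iP iQ pP pQ Z⊆ (∪-⊆ P⊆Z Q⊆Z)) (three fX dQR iQ iR pQ pR X⊆ (∪-⊆ Q⊆X R⊆X)) (three fY dPR iP iR pP pR Y⊆ (∪-⊆ P⊆Y R⊆Y))
    where
    module X = F fX
    module Y = F fY
    module Z = F fZ
    P = U ∖ X
    Q = U ∖ Y
    R = U ∖ Z
    P⊆Y : P ⊆ Y
    P⊆Y v p = taut 3 (λ u x y → (u ⇒ᵇ (x ∨ y)) ⇒ᵇ (u ∧ not x) ⇒ᵇ y) (U v) (X v) (Y v) $ᵇ ⊆⇒ᵇ (cXY v) $ᵇ p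
    P⊆Z : P ⊆ Z
    P⊆Z v p = taut 3 (λ u x y → (u ⇒ᵇ (x ∨ y)) ⇒ᵇ (u ∧ not x) ⇒ᵇ y) (U v) (X v) (Z v) $ᵇ ⊆⇒ᵇ (cXZ v) $ᵇ p
    Q⊆X : Q ⊆ X
    Q⊆X v p = taut 3 (λ u x y → (u ⇒ᵇ (x ∨ y)) ⇒ᵇ (u ∧ not y) ⇒ᵇ x) (U v) (X v) (Y v) $ᵇ ⊆⇒ᵇ (cXY v) $ᵇ p
    Q⊆Z : Q ⊆ Z
    Q⊆Z v p = taut 3 (λ u x y → (u ⇒ᵇ (x ∨ y)) ⇒ᵇ (u ∧ not x) ⇒ᵇ y) (U v) (Y v) (Z v) $ᵇ ⊆⇒ᵇ (cYZ v) $ᵇ p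
    R⊆X : R ⊆ X
    R⊆X v p = taut 3 (λ u x y → (u ⇒ᵇ (x ∨ y)) ⇒ᵇ (u ∧ not y) ⇒ᵇ x) (U v) (X v) (Z v) $ᵇ ⊆⇒ᵇ (cXZ v) $ᵇ p
    R⊆Y : R ⊆ Y
    R⊆Y v p = taut 3 (λ u x y → (u ⇒ᵇ (x ∨ y)) ⇒ᵇ (u ∧ not y) ⇒ᵇ x) (U v) (Y v) (Z v) $ᵇ ⊆⇒ᵇ (cYZ v) $ᵇ p
    dPQ : Disj P Q
    dPQ v p q = absurdᵇ (P⊆Y v p) (not-f (∧-r {U v} q))
    dPR : Disj P R
    dPR v p q = absurdᵇ (P⊆Z v p) (not-f (∧-r {U v} q))
    dQR : Disj Q R
    dQR v p q = absurdᵇ (Q⊆Z v p) (not-f (∧-r {U v} q))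
    iP = Conn.inh X.co
    iQ = Conn.inh Y.co
    iR = Conn.inh Z.co
    module XY = Cover fX fY cXY (inh-mono (λ v p → R⊆X v p ∧ⁱ R⊆Y v p) iR) (sym-adj PQ)
    no-T : ∀ v → X v ≡ true → Y v ≡ true → Z v ≡ true → ⊥
    no-T v x y z = 1+n≰n (≤-trans (≤-trans (+-mono-≤ (∃-cnt {p = (X ∩ Y) ∩ Z} v ((x ∧ⁱ y) ∧ⁱ z))
      (∃-cnt {p = (X ∩ Y) ∖ Z} (proj₁ iR) ((R⊆X _ (proj₂ iR) ∧ⁱ R⊆Y _ (proj₂ iR)) ∧ⁱ ∧-r {U _} (proj₂ iR)))) (≤-reflexive (sym (cnt-split (X ∩ Y) Z)))) XY.one-vertex)
    split : ∀ {A B C} → A ⊆ U → (∀ v → A v ≡ true → B v ≡ true → C v ≡ true → ⊥) → A ⊆ (U ∖ B) ∪ (U ∖ C)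
    split {A} {B} {C} AU none v p with B v in b | C v in c
    ... | true  | true  = ⊥-elim (none v p b c)
    ... | true  | false = ∨-r {U v ∧ false} (AU v p ∧ⁱ refl)
    ... | false | _     = ∨-l (AU v p ∧ⁱ refl)
    X⊆ : X ⊆ Q ∪ R
    X⊆ = split X.sub no-T
    Y⊆ : Y ⊆ P ∪ R
    Y⊆ = split Y.sub λ v y x z → no-T v x y z
    Z⊆ : Z ⊆ P ∪ Q
    Z⊆ = split Z.sub λ v z x y → no-T v x y z
    QR : Adj Q R
    QR = adj-of (Conn-resp {J} (λ v → bool-iff (X⊆ v) (∪-⊆ Q⊆X R⊆X v)) X.conn) dQR iQ iR
    PR : Adj P R
    PR = adj-of (Conn-resp {J} (λ v → bool-iff (Y⊆ v) (∪-⊆ P⊆Y R⊆Y v)) Y.conn) dPR iP iR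
    module XZ = Cover fX fZ cXZ (inh-mono (λ v p → Q⊆X v p ∧ⁱ Q⊆Z v p) iQ) (sym-adj PR)
    module YZ = Cover fY fZ cYZ (inh-mono (λ v p → P⊆Y v p ∧ⁱ P⊆Z v p) iP) (sym-adj QR)
    pR : ins R ≡ 0
    pR = n≤0⇒n≡0 (≤-trans (ins-mono λ v p → R⊆X v p ∧ⁱ R⊆Y v p) (≤-reflexive XY.no-loops))
    pQ : ins Q ≡ 0
    pQ = n≤0⇒n≡0 (≤-trans (ins-mono λ v p → Q⊆X v p ∧ⁱ Q⊆Z v p) (≤-reflexive XZ.no-loops))
    pP : ins P ≡ 0
    pP = n≤0⇒n≡0 (≤-trans (ins-mono λ v p → P⊆Y v p ∧ⁱ P⊆Z v p) (≤-reflexive YZ.no-loops))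
    three : ∀ {A B C} → F A → Disj B C → Inh B → Inh C → ins B ≡ 0 → ins C ≡ 0 → A ⊆ B ∪ C → B ∪ C ⊆ A → 3 ≤ bet B C
    three {A} {B} {C} f dBC (b , Bb) (c , Cc) ib ic h k = lin (cnt A ∷ cnt B ∷ cnt C ∷ ins A ∷ ins (B ∪ C) ∷ ins B ∷ ins C ∷ bet B C ∷ cnt (B ∪ C) ∷ [])
      (λ { (a ∷ b ∷ c ∷ ia ∷ iu ∷ ib ∷ ic ∷ w ∷ u ∷ []) → (con 1 :+ a :≤ ia) ∷ (ia :≤ iu) ∷ (iu :≤ ib :+ ic :+ w) ∷ (ib :≤ con 0) ∷ (ic :≤ con 0) ∷ (con 1 :≤ b) ∷ (con 1 :≤ c) ∷ (b :+ c :≤ u) ∷ (u :≤ a) ∷ [] ⊢ (con 3 :≤ w) })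
      (F.exc f , ins-mono h , ins-∪-≤ B C , ≤-reflexive ib , ≤-reflexive ic , ∃-cnt b Bb , ∃-cnt c Cc , cnt-∪ dBC , cnt-⊆ k)

  covers : ∀ {X Y} → (∀ v → (U ∖ (X ∪ Y)) v ≡ false) → U ⊆ X ∪ Y
  covers {X} {Y} em v p = taut 2 (λ u x → u ⇒ᵇ not (u ∧ not x) ⇒ᵇ x) (U v) ((X ∪ Y) v) $ᵇ p $ᵇ not-t (em v)

  -- Two incomparable members are disjoint or cover `U`. If one pair does not cover, incomparability
  -- forces all three to be disjoint; otherwise all pairs cover, and it matters whether some
  -- complements are adjacent.
  triple-incomparable : ∀ {X Y Z} → F X → F Y → F Z → Incomp X Y → Incomp X Z → Incomp Y Z → ⊥
  triple-incomparable {X} {Y} {Z} fX fY fZ xy xz yz with inh⊎empty (U ∖ (X ∪ Y))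
  ... | inj₁ iD = triple-disjoint fX fY fZ dXY (disj fX fZ xz λ em → let y , h = proj₁ yz in
                    [ (λ p → dXY y p (∧-l h)) , (λ p → absurdᵇ p (not-f (∧-r {Y y} h))) ]′ (∨-case {X y} (covers {X} {Z} em y (F.sub fY y (∧-l h)))))
                  (disj fY fZ yz λ em → let x , h = proj₁ xz in
                    [ (λ p → dXY x (∧-l h) p) , (λ p → absurdᵇ p (not-f (∧-r {X x} h))) ]′ (∨-case {Y x} (covers {Y} {Z} em x (F.sub fX x (∧-l h)))))
    where
    dXY : Disj X Y
    dXY v p q = pair-disjoint fX fY xy iD (v , p ∧ⁱ q)
    disj : ∀ {A B} → F A → F B → Incomp A B → ¬ (∀ v → (U ∖ (A ∪ B)) v ≡ false) → Disj A B
    disj {A} {B} fA fB i ne v p q with inh⊎empty (U ∖ (A ∪ B))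
    ... | inj₁ iD = pair-disjoint fA fB i iD (v , p ∧ⁱ q)
    ... | inj₂ em = ne em
  ... | inj₂ em = main
    where
    cover : ∀ {A B} → F A → F B → Incomp A B → Inh (A ∩ B) → U ⊆ A ∪ B
    cover {A} {B} fA fB i iC with inh⊎empty (U ∖ (A ∪ B))
    ... | inj₁ iD = ⊥-elim (pair-disjoint fA fB i iD iC)
    ... | inj₂ em = covers {A} {B} em
    cXY = covers {X} {Y} em
    cXZ : U ⊆ X ∪ Z
    cXZ = let z , h = proj₂ yz in cover fX fZ xz (z , [ (λ p → p ∧ⁱ ∧-l h) , (λ p → absurdᵇ p (not-f (∧-r {Z z} h))) ]′ (∨-case {X z} (cXY z (F.sub fZ z (∧-l h)))))
    cYZ : U ⊆ Y ∪ Z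
    cYZ = let z , h = proj₂ xz in cover fY fZ yz (z , [ (λ p → absurdᵇ p (not-f (∧-r {Z z} h))) , (λ p → p ∧ⁱ ∧-l h) ]′ (∨-case {X z} (cXY z (F.sub fZ z (∧-l h)))))
    flip : ∀ {A B} → U ⊆ A ∪ B → U ⊆ B ∪ A
    flip {A} {B} h v p = trans (∨-comm (B v) (A v)) (h v p)
    main : ⊥
    main with adj? (U ∖ X) (U ∖ Y) | adj? (U ∖ X) (U ∖ Z) | adj? (U ∖ Y) (U ∖ Z)
    ... | inj₁ a | _ | _ = adjacent-complements fX fY fZ cXY cXZ cYZ a
    ... | _ | inj₁ a | _ = adjacent-complements fX fZ fY cXZ cXY (flip {Y} {Z} cYZ) a
    ... | _ | _ | inj₁ a = adjacent-complements fY fZ fX cYZ (flip {X} {Y} cXY) (flip {X} {Z} cXZ) a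
    ... | inj₂ pq | inj₂ pr | inj₂ qr = TriAbsurd.absurd {X} {Y} {Z} {(X ∩ Y) ∩ Z} record
          { fX = fX ; fY = fY ; fZ = fZ ; cXY = cXY ; cXZ = cXZ ; cYZ = cYZ ; TX = λ v p → ∧-l (∧-l {(X ∩ Y) v} p) ; TY = λ v p → ∧-r {X v} (∧-l {(X ∩ Y) v} p)
          ; TZ = λ v p → ∧-r {(X ∩ Y) v} p ; XYZ = λ v x y z → (x ∧ⁱ y) ∧ⁱ z ; pq = pq ; pr = pr ; qr = qr }

  module _ (J⊆U : J ⊆ E[ U ]) where

    opaque
      unfolding bet

      spread : ∀ {X Y} e → J e ≡ true → (U ∖ Y) (s e) ∧ (U ∖ X) (t e) ∨ (U ∖ X) (s e) ∧ (U ∖ Y) (t e) ≡ true → Adj (U ∖ Y) (U ∖ X)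
      spread e Je h = ∃-cnt e (Je ∧ⁱ h)

    -- The common edge `e` excludes `pair-disjoint`, so `X` and `Y` cover `U`. Then `f` joins the
    -- two complements, and `Cover` allows no edge such as `e` inside `X ∩ Y`.
    incomparable-edges : ∀ {X Y} → F X → F Y → Incomp X Y → ∀ {e f} → J e ≡ true → E[ X ] e ≡ true → E[ Y ] e ≡ true →
                         J f ≡ true → E[ X ] f ≡ false → E[ Y ] f ≡ false → ⊥
    incomparable-edges {X} {Y} fX fY inc {e} {f} Je Xe Ye Jf Xf Yf with inh⊎empty (U ∖ (X ∪ Y))
    ... | inj₁ iD = pair-disjoint fX fY inc iD (s e , ∧-l {X (s e)} Xe ∧ⁱ ∧-l {Y (s e)} Ye)
    ... | inj₂ em = 1+n≰n (≤-trans (edge-ins {X ∩ Y} e Je (∧-l {X (s e)} Xe ∧ⁱ ∧-l {Y (s e)} Ye) (∧-r {X (s e)} Xe ∧ⁱ ∧-r {Y (s e)} Ye))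
          (≤-reflexive (Cover.no-loops fX fY cov (s e , ∧-l {X (s e)} Xe ∧ⁱ ∧-l {Y (s e)} Ye) (spread f Jf
            (taut 6 (λ u u′ x x′ y y′ → (u ∧ u′) ⇒ᵇ (u ⇒ᵇ (x ∨ y)) ⇒ᵇ (u′ ⇒ᵇ (x′ ∨ y′)) ⇒ᵇ not (x ∧ x′) ⇒ᵇ not (y ∧ y′) ⇒ᵇ (((u ∧ not y) ∧ (u′ ∧ not x′)) ∨ ((u ∧ not x) ∧ (u′ ∧ not y′))))
              (U (s f)) (U (t f)) (X (s f)) (X (t f)) (Y (s f)) (Y (t f)) $ᵇ J⊆U f Jf $ᵇ ⊆⇒ᵇ (cov (s f)) $ᵇ ⊆⇒ᵇ (cov (t f)) $ᵇ not-t Xf $ᵇ not-t Yf)))))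
      where cov = covers {X} {Y} em

  opaque
    unfolding ins touch

    touch-all : ∀ {Z S} → Z ⊆ S → ins Z ≤ touch Z S
    touch-all {Z} h = cnt-⊆ λ e p → ∧-l {J e} p ∧ⁱ ∧-r {J e} p ∧ⁱ ∨-l (h _ (∧-l {Z (s e)} (∧-r {J e} p)))

    touch-ins : ∀ {X S} → touch X S ≤ ins X
    touch-ins {X} = cnt-⊆ λ e p → ∧-l {J e} p ∧ⁱ ∧-l {E[ X ] e} (∧-r {J e} p)

  -- `F` without the two demands on the complement; this is what a minimal violated Hall condition
  -- provides.
  record Dense (Z : BSet n) : Set where
    field
      sub  : Z ⊆ U
      conn : Conn J Z
      core : ∀ S → S ⊆ Z → Inh S → Inh (Z ∖ S) → suc (cnt S) ≤ touch Z S
      exc  : suc (cnt Z) ≤ ins Z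

  -- `Z` plays the part of the intersection of `L` and `R`, and `card` is modularity of cardinality
  -- together with the fact that their union lies in `U`.
  record Meet (Z : BSet n) : Set where
    field
      {L R} : BSet n
      fL    : F L
      fR    : F R
      inc   : Incomp L R
      ZL    : Z ⊆ L
      ZR    : Z ⊆ R
      card  : cnt L + cnt R ≤ cnt U + cnt Z

  module _ {Z : BSet n} (dZ : Dense Z) where
    private
      module Z = Dense dZ
      O = U ∖ Z
      iZ = Conn.inh Z.conn

    module _ {a} (A : Piece O a) (rest : Inh (O ∖ Piece.K A)) where
      private
        module A = Piece A
        K = O ∖ A.K
        X′ = Z ∪ A.K
        dZA : Disj Z A.K
        dZA v p q = absurdᵇ p (not-f (∧-r {U v} (A.sub v q)))
        dZK : Disj Z K
        dZK v p q = absurdᵇ p (not-f (∧-r {U v} (∧-l {O v} q)))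
        X′≡ : ∀ v → X′ v ≡ (U ∖ K) v
        X′≡ v = bool-iff (λ p → taut 3 (λ u z a → (z ⇒ᵇ u) ⇒ᵇ (a ⇒ᵇ (u ∧ not z)) ⇒ᵇ (z ∨ a) ⇒ᵇ (u ∧ not ((u ∧ not z) ∧ not a))) (U v) (Z v) (A.K v) $ᵇ ⊆⇒ᵇ (Z.sub v) $ᵇ ⊆⇒ᵇ (A.sub v) $ᵇ p)
                         (λ p → taut 3 (λ u z a → (u ∧ not ((u ∧ not z) ∧ not a)) ⇒ᵇ (z ∨ a)) (U v) (Z v) (A.K v) $ᵇ p)

      piece-to-Z : Adj A.K Z
      piece-to-Z = piece-adj {U} {Z} {O} cU (λ v p → taut 2 (λ u z → u ⇒ᵇ (z ∨ (u ∧ not z))) (U v) (Z v) $ᵇ p) (λ v p → ∧-l (A.sub v p)) (Conn.inh A.conn)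
        (proj₁ iZ , Z.sub _ (proj₂ iZ) ∧ⁱ not-t (¬t⇒f (dZA _ (proj₂ iZ)))) A.apart

      piece-two : Two A.K Z
      piece-two = two-apart (two-touch (coreU A.K (λ v p → ∧-l (A.sub v p)) (Conn.inh A.conn) (proj₁ iZ , Z.sub _ (proj₂ iZ) ∧ⁱ not-t (¬t⇒f (dZA _ (proj₂ iZ)))))
        (λ v p → taut 3 (λ u z a → u ⇒ᵇ (a ∨ (z ∨ ((u ∧ not z) ∧ not a)))) (U v) (Z v) (A.K v) $ᵇ p)) A.apart

      core′ : ∀ S → S ⊆ X′ → Inh S → suc (cnt S) ≤ touch X′ S
      core′ S S⊆ (w , Sw) = main
        where
        both : touch U (S ∖ Z) + touch Z (S ∩ Z) ≤ touch X′ S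
        both = touch-split {Z} {X′} {U} {K} {S} (λ v p → trans (sym (X′≡ v)) (S⊆ v p))
          (apart-sym {(U ∖ Z) ∖ K} {K} (apart-mono {A.K} {(U ∖ Z) ∖ K} (λ v p → taut 3 (λ u z a → ((u ∧ not z) ∧ not ((u ∧ not z) ∧ not a)) ⇒ᵇ a) (U v) (Z v) (A.K v) $ᵇ p) (λ _ → id) A.apart))
          (λ _ → ∨-l) (λ v p → trans (X′≡ v) p) dZK
        inZ : Inh (S ∩ Z) → suc (cnt (S ∩ Z)) ≤ touch Z (S ∩ Z)
        inZ i with inh⊎empty (Z ∖ (S ∩ Z))
        ... | inj₁ o = Z.core (S ∩ Z) (λ v → ∧-r {S v}) i o
        ... | inj₂ em = ≤-trans (s≤s (cnt-⊆ λ v → ∧-r {S v})) (≤-trans Z.exc (touch-all λ v p → taut 2 (λ z y → z ⇒ᵇ not (z ∧ not y) ⇒ᵇ y) (Z v) ((S ∩ Z) v) $ᵇ p $ᵇ not-t (em v)))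
        inK : Inh (S ∖ Z) → suc (cnt (S ∖ Z)) ≤ touch U (S ∖ Z)
        inK i = coreU (S ∖ Z) (λ v p → ∧-l (trans (sym (X′≡ v)) (S⊆ v (∧-l p)))) i (proj₁ iZ , Z.sub _ (proj₂ iZ) ∧ⁱ not-t (¬t⇒f λ p → absurdᵇ (proj₂ iZ) (not-f (∧-r {S _} p))))
        main : suc (cnt S) ≤ touch X′ S
        main with inh⊎empty (S ∖ Z) | inh⊎empty (S ∩ Z)
        ... | inj₁ i | inj₁ j = lin (cnt S ∷ cnt (S ∩ Z) ∷ cnt (S ∖ Z) ∷ touch U (S ∖ Z) ∷ touch Z (S ∩ Z) ∷ touch X′ S ∷ [])
              (λ { (c ∷ a ∷ b ∷ y ∷ x ∷ t ∷ []) → (c :≤ a :+ b) ∷ (con 1 :+ b :≤ y) ∷ (con 1 :+ a :≤ x) ∷ (y :+ x :≤ t) ∷ [] ⊢ (con 1 :+ c :≤ t) })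
              (≤-reflexive (cnt-split S Z) , inK i , inZ j , both)
        ... | inj₁ i | inj₂ em = lin (cnt S ∷ cnt (S ∩ Z) ∷ cnt (S ∖ Z) ∷ touch U (S ∖ Z) ∷ touch Z (S ∩ Z) ∷ touch X′ S ∷ [])
              (λ { (c ∷ a ∷ b ∷ y ∷ x ∷ t ∷ []) → (c :≤ a :+ b) ∷ (con 1 :+ b :≤ y) ∷ (a :≤ con 0) ∷ (y :+ x :≤ t) ∷ [] ⊢ (con 1 :+ c :≤ t) })
              (≤-reflexive (cnt-split S Z) , inK i , ≤-reflexive (cnt-none em) , both)
        ... | inj₂ em | inj₁ j = lin (cnt S ∷ cnt (S ∩ Z) ∷ cnt (S ∖ Z) ∷ touch U (S ∖ Z) ∷ touch Z (S ∩ Z) ∷ touch X′ S ∷ [])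
              (λ { (c ∷ a ∷ b ∷ y ∷ x ∷ t ∷ []) → (c :≤ a :+ b) ∷ (b :≤ con 0) ∷ (con 1 :+ a :≤ x) ∷ (y :+ x :≤ t) ∷ [] ⊢ (con 1 :+ c :≤ t) })
              (≤-reflexive (cnt-split S Z) , ≤-reflexive (cnt-none em) , inZ j , both)
        ... | inj₂ em | inj₂ em′ = ⊥-elim (1+n≰n (≤-trans (∃-cnt w Sw) (≤-trans (≤-reflexive (cnt-split S Z)) (≤-reflexive (cong₂ _+_ (cnt-none em′) (cnt-none em))))))

      enlarge : Conn J K → F X′
      enlarge cK = record { sub = X′⊆U ; out = inh-mono (λ v p → ∧-l (∧-l {O v} p) ∧ⁱ not-t (¬t⇒f λ q → absurdᵇ p (not-f (∧-r {U v} (trans (sym (X′≡ v)) q))))) rest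
                          ; conn = cX′ ; core = λ S S⊆ i _ → core′ S S⊆ i ; exc = ≤-trans (core′ X′ (λ _ → id) (Conn.inh cX′)) touch-ins
                          ; co = Conn-resp {J} (λ v → bool-iff (λ p → ∧-l (∧-l {O v} p) ∧ⁱ not-t (¬t⇒f λ q → absurdᵇ p (not-f (∧-r {U v} (trans (sym (X′≡ v)) q)))))
                              (λ p → taut 3 (λ u z a → (u ∧ not (z ∨ a)) ⇒ᵇ ((u ∧ not z) ∧ not a)) (U v) (Z v) (A.K v) $ᵇ p)) cK }
        where
        cX′ : Conn J X′
        cX′ = conn-join Z.conn A.conn (sym-adj piece-to-Z)
        X′⊆U : X′ ⊆ U
        X′⊆U v p = ∧-l (trans (sym (X′≡ v)) p)

    -- The cases are zero, one or two components outside `Z`. Every component is held twice by `Z`,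
    -- so three of them would give `P₂`.
    classify : (U ⊆ Z) ⊎ F Z ⊎ Meet Z
    classify with inh⊎empty O
    ... | inj₂ em = inj₁ λ v p → taut 2 (λ u z → u ⇒ᵇ not (u ∧ not z) ⇒ᵇ z) (U v) (Z v) $ᵇ p $ᵇ not-t (em v)
    ... | inj₁ (a , ha) with inh⊎empty (O ∖ Piece.K (piece O a ha))
    ...   | inj₂ em = inj₂ (inj₁ record { sub = Z.sub ; out = a , ha ; conn = Z.conn ; core = Z.core ; exc = Z.exc
              ; co = Conn-resp {J} (λ v → bool-iff (Piece.sub A v) (λ p → taut 2 (λ w k → w ⇒ᵇ not (w ∧ not k) ⇒ᵇ k) (O v) (Piece.K A v) $ᵇ p $ᵇ not-t (em v))) (Piece.conn A) })
      where A = piece O a ha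
    ...   | inj₁ (b , hb) with inh⊎empty (O ∖ (Piece.K (piece O a ha) ∪ Piece.K (piece O b (∧-l hb))))
    ...     | inj₁ (c , hc) = ⊥-elim (excl-P2 Z A.K B.K C.K Z.conn A.conn B.conn C.conn dAB dAC dBC (off A.sub) (off B.sub) (off C.sub)
                (piece-to-Z A (b , hb)) (piece-two A (b , hb)) (piece-to-Z B (a , away B (sym-disj dAB) a ha A.has)) (piece-two B (a , away B (sym-disj dAB) a ha A.has))
                (piece-to-Z C (a , away C (sym-disj dAC) a ha A.has)) (piece-two C (a , away C (sym-disj dAC) a ha A.has)))
      where
      A = piece O a ha
      B = piece O b (∧-l hb)
      C = piece O c (∧-l hc)
      module A = Piece A
      module B = Piece B
      module C = Piece C
      dAB = pieces-disj A B (not-f (∧-r {O b} hb))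
      dAC = pieces-disj A C (not-f (taut 2 (λ a b → not (a ∨ b) ⇒ᵇ not a) (A.K c) (B.K c) $ᵇ ∧-r {O c} hc))
      dBC = pieces-disj B C (not-f (taut 2 (λ a b → not (a ∨ b) ⇒ᵇ not b) (A.K c) (B.K c) $ᵇ ∧-r {O c} hc))
      off : ∀ {K} → K ⊆ O → Disj K Z
      off h v p q = absurdᵇ q (not-f (∧-r {U v} (h v p)))
      away : ∀ {x} (B : Piece O x) {A : BSet n} → Disj (Piece.K B) A → ∀ v → O v ≡ true → A v ≡ true → (O ∖ Piece.K B) v ≡ true
      away B d v p q = p ∧ⁱ not-t (¬t⇒f λ r → d v r q)
    ...     | inj₂ em = inj₂ (inj₂ record { L = Z ∪ A.K ; R = Z ∪ B.K ; fL = enlarge A (b , hb) (Conn-resp {J} (λ v → bool-iff (λ p → B.sub v p ∧ⁱ not-t (¬t⇒f λ q → dAB v q p)) (λ p →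
                  taut 3 (λ w a b → not (w ∧ not (a ∨ b)) ⇒ᵇ (w ∧ not a) ⇒ᵇ b) (O v) (A.K v) (B.K v) $ᵇ not-t (em v) $ᵇ p)) B.conn)
                ; fR = enlarge B (a , ha ∧ⁱ not-t (¬t⇒f λ q → dAB a A.has q)) (Conn-resp {J} (λ v → bool-iff (λ p → A.sub v p ∧ⁱ not-t (¬t⇒f (dAB v p))) (λ p →
                  taut 3 (λ w a b → not (w ∧ not (a ∨ b)) ⇒ᵇ (w ∧ not b) ⇒ᵇ a) (O v) (A.K v) (B.K v) $ᵇ not-t (em v) $ᵇ p)) A.conn)
                ; inc = (a , ∨-r {Z a} A.has ∧ⁱ not-t (¬t⇒f λ p → [ (λ z → off A.sub a z A.has) , (λ q → dAB a A.has q) ]′ (∨-case {Z a} p)))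
                      , (b , ∨-r {Z b} B.has ∧ⁱ not-t (¬t⇒f λ p → [ (λ z → off B.sub b z B.has) , (λ q → dAB b q B.has) ]′ (∨-case {Z b} p)))
                ; ZL = λ _ → ∨-l ; ZR = λ _ → ∨-l
                ; card = lin (cnt (Z ∪ A.K) ∷ cnt (Z ∪ B.K) ∷ cnt Z ∷ cnt A.K ∷ cnt B.K ∷ cnt (Z ∪ A.K ∪ B.K) ∷ cnt U ∷ [])
                    (λ { (l ∷ r ∷ z ∷ a ∷ b ∷ w ∷ u ∷ []) → (l :≤ z :+ a) ∷ (r :≤ z :+ b) ∷ (l :+ b :≤ w) ∷ (z :+ a :≤ l) ∷ (w :≤ u) ∷ [] ⊢ (l :+ r :≤ u :+ z) })
                    ( cnt-∪-≤ Z A.K , cnt-∪-≤ Z B.K , cnt-∪ (disj-∪ˡ (off B.sub) dAB) , cnt-∪ (off A.sub)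
                    , cnt-⊆ (∪-⊆ (∪-⊆ Z.sub (λ v p → ∧-l (A.sub v p))) (λ v p → ∧-l (B.sub v p)))) })
      where
      A = piece O a ha
      B = piece O b (∧-l hb)
      module A = Piece A
      module B = Piece B
      dAB = pieces-disj A B (not-f (∧-r {O b} hb))
      off : ∀ {K} → K ⊆ O → Disj Z K
      off h v p q = absurdᵇ p (not-f (∧-r {U v} (h v q)))

-- Certificates of dependence

record Matroid (m : ℕ) : Set₁ where
  field
    Ind   : BSet m → Set
    ext   : ∀ {I K} → (∀ e → I e ≡ K e) → Ind I → Ind K
    dec   : ∀ I → Dec (Ind I)
    empty : Ind ε
    hered : ∀ {I K} → K ⊆ I → Ind I → Ind K
    aug   : ∀ {I K} → Ind I → Ind K → cnt I < cnt K → ∃ λ x → K x ≡ true × I x ≡ false × Ind (I ∪ ⁅ x ⁆)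

≤-sum : ∀ {k} (f : Fin k → ℕ) i → f i ≤ sum f
≤-sum f zero    = m≤m+n _ _
≤-sum f (suc i) = ≤-trans (≤-sum (f ∘ suc) i) (m≤n+m _ _)

module Bases {m : ℕ} (M : Matroid m) where
  open Matroid M

  record Basis (A B : BSet m) : Set where
    field
      sub : B ⊆ A
      ind : Ind B
      max : ∀ x → A x ≡ true → B x ≡ false → ¬ Ind (B ∪ ⁅ x ⁆)

  extend : ∀ {I A} → Ind I → I ⊆ A → ∃ λ B → I ⊆ B × Basis A B
  extend {I} {A} iI I⊆A = go _ I iI I⊆A (λ _ → id) ≤-refl
    where
    go : ∀ b B → Ind B → B ⊆ A → I ⊆ B → cnt (A ∖ B) ≤ b → ∃ λ B → I ⊆ B × Basis A B
    go b B iB B⊆A I⊆B le with any? (λ x → ((A ∖ B) x ≟ᵇ true) ×-dec dec (B ∪ ⁅ x ⁆))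
    ... | no none = B , I⊆B , record { sub = B⊆A ; ind = iB ; max = λ x p q r → none (x , p ∧ⁱ not-t q , r) }
    go zero B iB B⊆A I⊆B le | yes (x , p , r) = ⊥-elim (1+n≰n (≤-trans (∃-cnt x p) le))
    go (suc b) B iB B⊆A I⊆B le | yes (x , p , r) = go b (B ∪ ⁅ x ⁆) r
      (∪-⊆ B⊆A λ v q → subst (λ z → A z ≡ true) (sym (==-t {i = v} q)) (∧-l p)) (λ v q → ∨-l (I⊆B v q))
      (s≤s⁻¹ (≤-trans (cnt-⊂ {p = A ∖ (B ∪ ⁅ x ⁆)} {q = A ∖ B} (λ i → (taut 3 (λ a k z → (a ∧ not (k ∨ z)) ⇒ᵇ (a ∧ not k)) (A i) (B i) (i == x)) $ᵇ_) x
        (¬t⇒f λ q → absurdᵇ (∨-r {B x} (==-refl x)) (not-f (∧-r {A x} q))) p) le))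

  basis-max : ∀ {A B I} → Basis A B → Ind I → I ⊆ A → cnt I ≤ cnt B
  basis-max {A} {B} {I} bs iI I⊆A = ≮⇒≥ λ lt → let x , Ix , Bx , r = aug (Basis.ind bs) iI lt in Basis.max bs x (I⊆A x Ix) Bx r

  -- A dependent set is detected by an initial segment D and a final segment T of the order κ:
  -- r(D) + r(T) < |I ∩ D ∩ T| + r(J).
  record Bad (J : BSet m) (κ : Fin m → ℕ) (I : BSet m) : Set where
    field
      D T   : BSet m
      D⊆    : D ⊆ J
      T⊆    : T ⊆ J
      down  : ∀ e f → D e ≡ true → J f ≡ true → D f ≡ false → κ e < κ f
      up    : ∀ e f → T e ≡ true → J f ≡ true → T f ≡ false → κ f < κ e
      d t   : ℕ
      rD    : ∀ K → Ind K → K ⊆ D → cnt K ≤ d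
      rT    : ∀ K → Ind K → K ⊆ T → cnt K ≤ t
      B     : BSet m
      indB  : Ind B
      B⊆    : B ⊆ J
      big   : suc (d + t) ≤ cnt (I ∩ (D ∩ T)) + cnt B
      -- Guards against segments whose overlap misses `I`, for which the window of interval indices
      -- may be empty.
      some  : 1 ≤ cnt (I ∩ (D ∩ T))

  Cert : BSet m → (Fin m → ℕ) → Set
  Cert J κ = ∀ I → I ⊆ J → ¬ Ind I → Bad J κ I

  cert-trivial : ∀ {J} → (∀ I → I ⊆ J → Ind I) → Cert J (λ _ → 0)
  cert-trivial h I I⊆ dep = ⊥-elim (dep (h I I⊆))

  -- All of `S` is ordered before the rest, by an offset above every value of `κ₁`. A pair of
  -- segments that detects dependence in one summand is completed by the whole other summand on one
  -- side, whose rank is added to both sides of the inequality.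
  module Split {J S : BSet m} (join : ∀ I → I ⊆ J → Ind (I ∩ S) → Ind (I ∖ S) → Ind I)
               {κ₁ κ₂ : Fin m → ℕ} (c₁ : Cert (J ∩ S) κ₁) (c₂ : Cert (J ∖ S) κ₂) where

    private
      N : ℕ
      N = suc (sum κ₁)
      J₁ J₂ : BSet m
      J₁ = J ∩ S
      J₂ = J ∖ S
      b₁ = extend {ε} {J₁} empty (λ _ ())
      b₂ = extend {ε} {J₂} empty (λ _ ())
      B₁ = proj₁ b₁
      B₂ = proj₁ b₂
      module B₁ = Basis (proj₂ (proj₂ b₁))
      module B₂ = Basis (proj₂ (proj₂ b₂))

    κ : Fin m → ℕ
    κ e = if S e then κ₁ e else N + κ₂ e

    private
      κ-in : ∀ {e} → S e ≡ true → κ e ≡ κ₁ e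
      κ-in p rewrite p = refl
      κ-out : ∀ {e} → S e ≡ false → κ e ≡ N + κ₂ e
      κ-out p rewrite p = refl

      mixed : ∀ {e f} → S e ≡ true → S f ≡ false → κ e < κ f
      mixed {e} {f} p q = subst₂ _<_ (sym (κ-in p)) (sym (κ-out q)) (≤-trans (s≤s (≤-sum κ₁ e)) (m≤m+n N (κ₂ f)))
      both-in : ∀ {e f} → S e ≡ true → S f ≡ true → κ₁ e < κ₁ f → κ e < κ f
      both-in p q = subst₂ _<_ (sym (κ-in p)) (sym (κ-in q))
      both-out : ∀ {e f} → S e ≡ false → S f ≡ false → κ₂ e < κ₂ f → κ e < κ f
      both-out p q h = subst₂ _<_ (sym (κ-out p)) (sym (κ-out q)) (+-monoʳ-< N h)

      glue : ∀ {A B} → A ⊆ J₁ → B ⊆ J₂ → Ind A → Ind B → Ind (A ∪ B)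
      glue {A} {B} hA hB iA iB = join (A ∪ B) (∪-⊆ (λ v p → ∧-l (hA v p)) (λ v p → ∧-l (hB v p)))
        (hered (λ v p → taut 4 (λ a b j s → (b ⇒ᵇ (j ∧ not s)) ⇒ᵇ ((a ∨ b) ∧ s) ⇒ᵇ a) (A v) (B v) (J v) (S v) $ᵇ ⊆⇒ᵇ (hB v) $ᵇ p) iA)
        (hered (λ v p → taut 4 (λ a b j s → (a ⇒ᵇ (j ∧ s)) ⇒ᵇ ((a ∨ b) ∧ not s) ⇒ᵇ b) (A v) (B v) (J v) (S v) $ᵇ ⊆⇒ᵇ (hA v) $ᵇ p) iB)

      disj-cnt : ∀ {A B} → A ⊆ J₁ → B ⊆ J₂ → cnt A + cnt B ≤ cnt (A ∪ B)
      disj-cnt hA hB = cnt-∪ λ v p q → absurdᵇ (∧-r {J v} (hA v p)) (not-f (∧-r {J v} (hB v q)))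

    cert : Cert J κ
    cert I I⊆ dep with dec (I ∩ S)
    ... | no dep₁ = record
      { D = D ; T = T ∪ J₂ ; D⊆ = λ v p → ∧-l (D⊆ v p) ; T⊆ = ∪-⊆ (λ v p → ∧-l (T⊆ v p)) (λ _ → ∧-l)
      ; down = λ e f De Jf Df → [ (λ Sf → both-in (∧-r {J e} (D⊆ e De)) Sf (down e f De (Jf ∧ⁱ Sf) Df)) , (λ Sf → mixed (∧-r {J e} (D⊆ e De)) Sf) ]′ (dichotomy (S f))
      ; up = λ e f Te Jf Tf → up′ e f Te Jf Tf (dichotomy (S f)) (∨-case {T e} Te)
      ; d = d ; t = t + cnt B₂ ; rD = rD
      ; rT = λ K iK K⊆ → ≤-trans (≤-reflexive (cnt-split K S)) (+-mono-≤
          (rT (K ∩ S) (hered (λ v → ∧-l) iK) λ v p → taut 4 (λ k s t j → (k ⇒ᵇ (t ∨ (j ∧ not s))) ⇒ᵇ (k ∧ s) ⇒ᵇ t) (K v) (S v) (T v) (J v) $ᵇ ⊆⇒ᵇ (K⊆ v) $ᵇ p)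
          (basis-max (proj₂ (proj₂ b₂)) (hered (λ v → ∧-l) iK) λ v p → taut 4 (λ k s t j → (k ⇒ᵇ (t ∨ (j ∧ not s))) ⇒ᵇ (t ⇒ᵇ (j ∧ s)) ⇒ᵇ (k ∧ not s) ⇒ᵇ (j ∧ not s)) (K v) (S v) (T v) (J v) $ᵇ ⊆⇒ᵇ (K⊆ v) $ᵇ ⊆⇒ᵇ (T⊆ v) $ᵇ p))
      ; B = B ∪ B₂ ; indB = glue B⊆ B₂.sub indB B₂.ind ; B⊆ = ∪-⊆ (λ v p → ∧-l (B⊆ v p)) (λ v p → ∧-l (B₂.sub v p))
      ; big = lin (d ∷ t ∷ cnt B₂ ∷ cnt B ∷ cnt (B ∪ B₂) ∷ cnt ((I ∩ S) ∩ (D ∩ T)) ∷ cnt (I ∩ (D ∩ (T ∪ J₂))) ∷ [])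
          (λ { (d ∷ t ∷ b₂ ∷ b ∷ u ∷ x ∷ y ∷ []) → (con 1 :+ (d :+ t) :≤ x :+ b) ∷ (b :+ b₂ :≤ u) ∷ (x :≤ y) ∷ [] ⊢ (con 1 :+ (d :+ (t :+ b₂)) :≤ y :+ u) })
          (big , disj-cnt B⊆ B₂.sub , more)
      ; some = ≤-trans some more }
      where
      open Bad (c₁ (I ∩ S) (λ v p → I⊆ v (∧-l p) ∧ⁱ ∧-r {I v} p) dep₁)
      more : cnt ((I ∩ S) ∩ (D ∩ T)) ≤ cnt (I ∩ (D ∩ (T ∪ J₂)))
      more = cnt-⊆ λ v → (taut 5 (λ i s d t j → ((i ∧ s) ∧ (d ∧ t)) ⇒ᵇ (i ∧ (d ∧ (t ∨ j)))) (I v) (S v) (D v) (T v) (J₂ v)) $ᵇ_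
      up′ : ∀ e f → (T ∪ J₂) e ≡ true → J f ≡ true → (T ∪ J₂) f ≡ false → (S f ≡ true) ⊎ (S f ≡ false) → (T e ≡ true) ⊎ (J₂ e ≡ true) → κ f < κ e
      up′ e f Te Jf Tf (inj₂ Sf) _ = absurdᵇ (∨-r {T f} (Jf ∧ⁱ not-t Sf)) Tf
      up′ e f Te Jf Tf (inj₁ Sf) (inj₁ q) = both-in Sf (∧-r {J e} (T⊆ e q)) (up e f q (Jf ∧ⁱ Sf) (¬t⇒f λ r → absurdᵇ (∨-l r) Tf))
      up′ e f Te Jf Tf (inj₁ Sf) (inj₂ q) = mixed Sf (not-f (∧-r {J e} q))
    ... | yes ind₁ = record
      { D = J₁ ∪ D ; T = T ; D⊆ = ∪-⊆ (λ _ → ∧-l) (λ v p → ∧-l (D⊆ v p)) ; T⊆ = λ v p → ∧-l (T⊆ v p)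
      ; down = λ e f De Jf Df → down′ e f De Jf Df (dichotomy (S f)) (∨-case {J₁ e} De)
      ; up = λ e f Te Jf Tf → [ (λ Sf → mixed Sf (not-f (∧-r {J e} (T⊆ e Te)))) , (λ Sf → both-out Sf (not-f (∧-r {J e} (T⊆ e Te))) (up e f Te (Jf ∧ⁱ not-t Sf) Tf)) ]′ (dichotomy (S f))
      ; d = cnt B₁ + d ; t = t ; rT = rT
      ; rD = λ K iK K⊆ → ≤-trans (≤-reflexive (cnt-split K S)) (+-mono-≤
          (basis-max (proj₂ (proj₂ b₁)) (hered (λ v → ∧-l) iK) λ v p → taut 4 (λ k s t j → (k ⇒ᵇ ((j ∧ s) ∨ t)) ⇒ᵇ (t ⇒ᵇ (j ∧ not s)) ⇒ᵇ (k ∧ s) ⇒ᵇ (j ∧ s)) (K v) (S v) (D v) (J v) $ᵇ ⊆⇒ᵇ (K⊆ v) $ᵇ ⊆⇒ᵇ (D⊆ v) $ᵇ p)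
          (rD (K ∖ S) (hered (λ v → ∧-l) iK) λ v p → taut 4 (λ k s t j → (k ⇒ᵇ ((j ∧ s) ∨ t)) ⇒ᵇ (k ∧ not s) ⇒ᵇ t) (K v) (S v) (D v) (J v) $ᵇ ⊆⇒ᵇ (K⊆ v) $ᵇ p))
      ; B = B₁ ∪ B ; indB = glue B₁.sub B⊆ B₁.ind indB ; B⊆ = ∪-⊆ (λ v p → ∧-l (B₁.sub v p)) (λ v p → ∧-l (B⊆ v p))
      ; big = lin (d ∷ t ∷ cnt B₁ ∷ cnt B ∷ cnt (B₁ ∪ B) ∷ cnt ((I ∖ S) ∩ (D ∩ T)) ∷ cnt (I ∩ ((J₁ ∪ D) ∩ T)) ∷ [])
          (λ { (d ∷ t ∷ b₁ ∷ b ∷ u ∷ x ∷ y ∷ []) → (con 1 :+ (d :+ t) :≤ x :+ b) ∷ (b₁ :+ b :≤ u) ∷ (x :≤ y) ∷ [] ⊢ (con 1 :+ ((b₁ :+ d) :+ t) :≤ y :+ u) })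
          (big , disj-cnt B₁.sub B⊆ , more)
      ; some = ≤-trans some more }
      where
      open Bad (c₂ (I ∖ S) (λ v p → I⊆ v (∧-l p) ∧ⁱ ∧-r {I v} p) (λ ind₂ → dep (join I I⊆ ind₁ ind₂)))
      more : cnt ((I ∖ S) ∩ (D ∩ T)) ≤ cnt (I ∩ ((J₁ ∪ D) ∩ T))
      more = cnt-⊆ λ v → (taut 5 (λ i s d t j → ((i ∧ not s) ∧ (d ∧ t)) ⇒ᵇ (i ∧ ((j ∨ d) ∧ t))) (I v) (S v) (D v) (T v) (J₁ v)) $ᵇ_
      down′ : ∀ e f → (J₁ ∪ D) e ≡ true → J f ≡ true → (J₁ ∪ D) f ≡ false → (S f ≡ true) ⊎ (S f ≡ false) → (J₁ e ≡ true) ⊎ (D e ≡ true) → κ e < κ f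
      down′ e f De Jf Df (inj₁ Sf) _ = absurdᵇ (∨-l (Jf ∧ⁱ Sf)) Df
      down′ e f De Jf Df (inj₂ Sf) (inj₁ q) = mixed (∧-r {J e} q) Sf
      down′ e f De Jf Df (inj₂ Sf) (inj₂ q) = both-out (not-f (∧-r {J e} (D⊆ e q))) Sf (down e f q (Jf ∧ⁱ not-t Sf) (¬t⇒f λ r → absurdᵇ (∨-r {J₁ f} r) Df))

-- The order of the edges and its certificates

sumV : ∀ n → (Vec Bool n → ℕ) → ℕ
sumV zero    f = f []
sumV (suc n) f = sumV n (f ∘ (true ∷_)) + sumV n (f ∘ (false ∷_))

sumV-mono : ∀ n {f g} → (∀ X → f X ≤ g X) → sumV n f ≤ sumV n g
sumV-mono zero    h = h []
sumV-mono (suc n) h = +-mono-≤ (sumV-mono n (λ X → h (true ∷ X))) (sumV-mono n (λ X → h (false ∷ X)))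

sumV-strict : ∀ n {f g} → (∀ X → f X ≤ g X) → ∀ X → f X < g X → sumV n f < sumV n g
sumV-strict zero    h []          p = p
sumV-strict (suc n) h (true ∷ X)  p = +-mono-<-≤ (sumV-strict n (λ X → h (true ∷ X)) X p) (sumV-mono n (λ X → h (false ∷ X)))
sumV-strict (suc n) h (false ∷ X) p = +-mono-≤-< (sumV-mono n (λ X → h (true ∷ X))) (sumV-strict n (λ X → h (false ∷ X)) X p)

trim : ∀ {n} k (A : BSet n) → k ≤ cnt A → ∃ λ B → B ⊆ A × cnt B ≡ k
trim {n} k A le = go _ A (λ _ → id) le ≤-refl
  where
  go : ∀ b B → B ⊆ A → k ≤ cnt B → cnt B ≤ b → ∃ λ B → B ⊆ A × cnt B ≡ k
  go b B h p q with cnt B ≤? k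
  ... | yes r = B , h , ≤-antisym r p
  go zero B h p q | no r = ⊥-elim (r (≤-trans q z≤n))
  go (suc b) B h p q | no r with cnt-∃ {p = B} (≤-trans (s≤s z≤n) (≰⇒> r))
  ... | x , Bx = go b (B ∖ ⁅ x ⁆) (λ v z → h v (∧-l z)) (s≤s⁻¹ (≤-trans (≰⇒> r) (≤-reflexive (cnt-remove B x Bx)))) (s≤s⁻¹ (≤-trans (≤-reflexive (sym (cnt-remove B x Bx))) q))

⊆? : ∀ {n} (A B : BSet n) → (A ⊆ B) ⊎ Inh (A ∖ B)
⊆? A B with inh⊎empty (A ∖ B)
... | inj₁ i = inj₂ i
... | inj₂ em = inj₁ λ v p → taut 2 (λ a b → a ⇒ᵇ not (a ∧ not b) ⇒ᵇ b) (A v) (B v) $ᵇ p $ᵇ not-t (em v)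

opaque
  _⊆ᵇ_ : ∀ {n} → BSet n → BSet n → Bool
  A ⊆ᵇ B = does (all? λ v → (A v ⇒ᵇ B v) ≟ᵇ true)

  ⊆ᵇ-t : ∀ {n} {A B : BSet n} → (A ⊆ᵇ B) ≡ true → A ⊆ B
  ⊆ᵇ-t {A = A} {B} p v q = does-t (all? λ v → (A v ⇒ᵇ B v) ≟ᵇ true) p v $ᵇ q

  t-⊆ᵇ : ∀ {n} {A B : BSet n} → A ⊆ B → (A ⊆ᵇ B) ≡ true
  t-⊆ᵇ {A = A} {B} h = dec-t (all? λ v → (A v ⇒ᵇ B v) ≟ᵇ true) λ v → ⊆⇒ᵇ (h v)

module Ordering (G : Graph) (J : BSet (nE G)) (excl : NoMinors G) (U : BSet (nV G))
              (cU : Gr.Conn (Cycles.s G) (Cycles.t G) J U)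
              (coreU : ∀ S → S ⊆ U → Inh S → Inh (U ∖ S) → suc (cnt S) ≤ Counting.touch G J excl U S)
              (J⊆U : J ⊆ Gr.E[_] (Cycles.s G) (Cycles.t G) U) where

  open Structure G J excl U cU coreU
  private
    n = nV G
    m = nE G

  opaque
    unfolding ins touch
    ins-cong : ∀ {X Y} → (∀ v → X v ≡ Y v) → ins X ≡ ins Y
    ins-cong h = cnt-cong λ e → cong (J e ∧_) (cong₂ _∧_ (h (s e)) (h (t e)))

    touch-cong : ∀ {X Y S R} → (∀ v → X v ≡ Y v) → (∀ v → S v ≡ R v) → touch X S ≡ touch Y R
    touch-cong h k = cnt-cong λ e → cong (J e ∧_) (cong₂ _∧_ (cong₂ _∧_ (h (s e)) (h (t e))) (cong₂ _∨_ (k (s e)) (k (t e))))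

  F-resp : ∀ {X Y} → (∀ v → X v ≡ Y v) → F X → F Y
  F-resp {X} {Y} h f = record
    { sub = λ v p → sub v (trans (h v) p) ; out = let v , p = out in v , trans (cong (λ b → U v ∧ not b) (sym (h v))) p ; conn = Conn-resp {J} h conn
    ; core = λ S S⊆ i (v , p) → ≤-trans (core S (λ w q → trans (h w) (S⊆ w q)) i (v , trans (cong (λ b → b ∧ not (S v)) (h v)) p)) (≤-reflexive (touch-cong h (λ _ → refl)))
    ; exc = subst₂ (λ a b → suc a ≤ b) (cnt-cong h) (ins-cong h) exc ; co = Conn-resp {J} (λ v → cong (λ b → U v ∧ not b) (h v)) co }
    where open F f

  conn? : ∀ A → Dec (Conn J A)
  conn? A with inh⊎empty A
  ... | inj₂ em = no λ c → absurdᵇ (proj₂ (Conn.inh c)) (em _)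
  ... | inj₁ i with conn⊎sep J A i
  ...   | inj₁ c = yes c
  ...   | inj₂ (S , a , b , none) = no λ c → let e , h = Conn.cut c S a b in absurdᵇ h (none e)

  private
    Weak : BSet n → BSet n → Set
    Weak X S = (S ⊆ᵇ X) ≡ true × Inh S × Inh (X ∖ S) × touch X S ≤ cnt S

    ⊆ᵇ-cong : ∀ {S R X : BSet n} → (∀ v → S v ≡ R v) → (S ⊆ᵇ X) ≡ true → (R ⊆ᵇ X) ≡ true
    ⊆ᵇ-cong {S} {R} {X} h p = t-⊆ᵇ λ v q → ⊆ᵇ-t {A = S} {X} p v (trans (h v) q)

  core? : ∀ X → (∃ λ S → Weak X S) ⊎ (∀ S → S ⊆ X → Inh S → Inh (X ∖ S) → suc (cnt S) ≤ touch X S)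
  core? X with search (Weak X)
      (λ {S} {R} h (a , (v , b) , (w , c) , d) → ⊆ᵇ-cong h a , (v , trans (sym (h v)) b) , (w , trans (cong (λ z → X w ∧ not z) (sym (h w))) c) , subst₂ _≤_ (touch-cong (λ _ → refl) h) (cnt-cong h) d)
      (λ S → (S ⊆ᵇ X ≟ᵇ true) ×-dec (all-true? S ×-dec (all-true? (X ∖ S) ×-dec (touch X S ≤? cnt S))))
  ... | inj₁ w = inj₁ w
  ... | inj₂ f = inj₂ λ S a b c → ≰⇒> λ d → f S (t-⊆ᵇ a , b , c , d)

  opaque
    F? : ∀ X → Dec (F X)
    F? X with ⊆? X U | all-true? (U ∖ X) | conn? X | core? X | suc (cnt X) ≤? ins X | conn? (U ∖ X)
    ... | inj₁ a | yes b | yes c | inj₂ d | yes e | yes f = yes record { sub = a ; out = b ; conn = c ; core = d ; exc = e ; co = f }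
    ... | inj₂ (v , p) | _ | _ | _ | _ | _ = no λ f → absurdᵇ (F.sub f v (∧-l p)) (not-f (∧-r {X v} p))
    ... | _ | no b | _ | _ | _ | _ = no λ f → b (F.out f)
    ... | _ | _ | no c | _ | _ | _ = no λ f → c (F.conn f)
    ... | _ | _ | _ | inj₁ (S , a , b , c , d) | _ | _ = no λ f → <⇒≱ (F.core f S (⊆ᵇ-t a) b c) d
    ... | _ | _ | _ | _ | no e | _ = no λ f → e (F.exc f)
    ... | _ | _ | _ | _ | _ | no g = no λ f → g (F.co f)

    base : ∃ F ⊎ (∀ X → ¬ F X)
    base = search F F-resp F?

    -- A reference member. For an empty family the value is a dummy, and `F-X₀` vouches for it as
    -- soon as some member exists.
    X₀ : BSet n
    X₀ = [ proj₁ , (λ _ → ε) ]′ base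

    F-X₀ : ∀ {X} → F X → F X₀
    F-X₀ {X} f with base
    ... | inj₁ (_ , g) = g
    ... | inj₂ none    = ⊥-elim (none X f)

  -- The members comparable to X₀ form one chain, the others a second one.
  comparable : BSet n → Bool
  comparable X = (X ⊆ᵇ X₀) ∨ (X₀ ⊆ᵇ X)

  Left Right : BSet n → Set
  Left X  = F X × comparable X ≡ true
  Right X = F X × comparable X ≡ false

  incomp : ∀ {X Y : BSet n} → (X ⊆ᵇ Y) ∨ (Y ⊆ᵇ X) ≡ false → Incomp X Y
  incomp {X} {Y} p with ⊆? X Y | ⊆? Y X
  ... | inj₂ a | inj₂ b = a , b
  ... | inj₁ a | _ = absurdᵇ (∨-l (t-⊆ᵇ a)) p
  ... | _ | inj₁ b = absurdᵇ (∨-r {X ⊆ᵇ Y} (t-⊆ᵇ b)) p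

  not-⊆ : ∀ {X Y : BSet n} → Inh (X ∖ Y) → ¬ (X ⊆ Y)
  not-⊆ {X} (v , p) h = absurdᵇ (h v (∧-l p)) (not-f (∧-r {X v} p))

  left-chain : ∀ {X Y} → Left X → Left Y → (X ⊆ Y) ⊎ (Y ⊆ X)
  left-chain {X} {Y} (fX , cX) (fY , cY) with ⊆? X Y | ⊆? Y X
  ... | inj₁ a | _ = inj₁ a
  ... | _ | inj₁ b = inj₂ b
  ... | inj₂ a | inj₂ b with ∨-case {X ⊆ᵇ X₀} cX | ∨-case {Y ⊆ᵇ X₀} cY
  ...   | inj₁ p | inj₁ q = ⊥-elim (triple-below fX fY (F-X₀ fX) (⊆ᵇ-t p) (⊆ᵇ-t q) (a , b))
  ...   | inj₂ p | inj₂ q = ⊥-elim (triple-above fX fY (F-X₀ fX) (⊆ᵇ-t p) (⊆ᵇ-t q) (a , b))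
  ...   | inj₁ p | inj₂ q = inj₁ (⊆-trans (⊆ᵇ-t {A = X} {X₀} p) (⊆ᵇ-t q))
  ...   | inj₂ p | inj₁ q = inj₂ (⊆-trans (⊆ᵇ-t {A = Y} {X₀} q) (⊆ᵇ-t p))

  right-chain : ∀ {X Y} → Right X → Right Y → (X ⊆ Y) ⊎ (Y ⊆ X)
  right-chain {X} {Y} (fX , cX) (fY , cY) with ⊆? X Y | ⊆? Y X
  ... | inj₁ a | _ = inj₁ a
  ... | _ | inj₁ b = inj₂ b
  ... | inj₂ a | inj₂ b = ⊥-elim (triple-incomparable fX fY (F-X₀ fX) (a , b) (incomp cX) (incomp cY))

  -- If `X` and `Y` were nested, comparing `X` with `X₀` would either make `Y` and `X₀` nested by
  -- transitivity or put `X` below or above both, which the triple lemmas forbid.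
  left-right : ∀ {X Y} → Left X → Right Y → Incomp X Y
  left-right {X} {Y} (fX , cX) (fY , cY) with ⊆? X Y | ⊆? Y X | ∨-case {X ⊆ᵇ X₀} cX | incomp cY
  ... | inj₂ a | inj₂ b | _ | _ = a , b
  ... | inj₁ a | _ | inj₁ p | i = ⊥-elim (triple-above fY (F-X₀ fX) fX a (⊆ᵇ-t p) i)
  ... | inj₁ a | _ | inj₂ p | i = ⊥-elim (not-⊆ (proj₂ i) (⊆-trans (⊆ᵇ-t {A = X₀} p) a))
  ... | _ | inj₁ b | inj₁ p | i = ⊥-elim (not-⊆ (proj₁ i) (⊆-trans b (⊆ᵇ-t p)))
  ... | _ | inj₁ b | inj₂ p | i = ⊥-elim (triple-below fY (F-X₀ fX) fX b (⊆ᵇ-t p) i)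

  isLeft isRight : BSet n → Bool
  isLeft X  = does (F? X) ∧ comparable X
  isRight X = does (F? X) ∧ not (comparable X)

  left-t : ∀ {X} → isLeft X ≡ true → Left X
  left-t {X} p = does-t (F? X) (∧-l p) , ∧-r {does (F? X)} p

  right-t : ∀ {X} → isRight X ≡ true → Right X
  right-t {X} p = does-t (F? X) (∧-l p) , not-f (∧-r {does (F? X)} p)

  -- An edge is late when many left members miss it and many right members contain it.
  κ : Fin m → ℕ
  κ e = sumV n (λ X → b2n (isLeft (lookup X) ∧ not (E[ lookup X ] e))) + sumV n (λ X → b2n (isRight (lookup X) ∧ E[ lookup X ] e))

  E-mono : ∀ {X Y} → X ⊆ Y → E[ X ] ⊆ E[ Y ]
  E-mono {X} h e p = h _ (∧-l p) ∧ⁱ h _ (∧-r {X (s e)} p)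

  private
    module _ {e f} (Je : J e ≡ true) (Jf : J f ≡ true) where

      left-mono : ∀ L → Left L → E[ L ] e ≡ true → E[ L ] f ≡ false → ∀ X → Left X → E[ X ] e ≡ false → E[ X ] f ≡ false
      left-mono L lL Le Lf X lX Xe = ¬t⇒f λ Xf →
        [ (λ h → absurdᵇ (E-mono h f Xf) Lf) , (λ h → absurdᵇ (E-mono h e Le) Xe) ]′ (left-chain lX lL)

      left-right-mono : ∀ L → Left L → E[ L ] e ≡ true → E[ L ] f ≡ false → ∀ X → Right X → E[ X ] e ≡ true → E[ X ] f ≡ true
      left-right-mono L lL Le Lf X rX Xe = ¬f⇒t λ Xf → incomparable-edges J⊆U (proj₁ lL) (proj₁ rX) (left-right lL rX) Je Le Xe Jf Lf Xf
        where
        ¬f⇒t : ∀ {b} → ¬ (b ≡ false) → b ≡ true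
        ¬f⇒t {true}  _ = refl
        ¬f⇒t {false} p = ⊥-elim (p refl)

      right-left-mono : ∀ R → Right R → E[ R ] e ≡ true → E[ R ] f ≡ false → ∀ X → Left X → E[ X ] f ≡ false → E[ X ] e ≡ false
      right-left-mono R rR Re Rf X lX Xf = ¬t⇒f λ Xe → incomparable-edges J⊆U (proj₁ lX) (proj₁ rR) (left-right lX rR) Je Xe Re Jf Xf Rf

      right-mono : ∀ R → Right R → E[ R ] e ≡ true → E[ R ] f ≡ false → ∀ X → Right X → E[ X ] f ≡ true → E[ X ] e ≡ true
      right-mono R rR Re Rf X rX Xf = [ (λ h → absurdᵇ (E-mono h f Xf) Rf) , (λ h → E-mono h e Re) ]′ (right-chain rX rR)

    tab-E : ∀ X e → E[ lookup (tabulate X) ] e ≡ E[ X ] e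
    tab-E X e = cong₂ _∧_ (lookup∘tabulate X (s e)) (lookup∘tabulate X (t e))

    tab-left : ∀ {X} → Left X → isLeft (lookup (tabulate X)) ≡ true
    tab-left {X} (f , c) = dec-t (F? _) (F-resp (λ v → sym (lookup∘tabulate X v)) f) ∧ⁱ
      [ (λ p → ∨-l (t-⊆ᵇ λ v q → ⊆ᵇ-t {A = X} {X₀} p v (trans (sym (lookup∘tabulate X v)) q)))
      , (λ p → ∨-r {lookup (tabulate X) ⊆ᵇ X₀} (t-⊆ᵇ λ v q → trans (lookup∘tabulate X v) (⊆ᵇ-t {A = X₀} {X} p v q))) ]′ (∨-case {X ⊆ᵇ X₀} c)

    tab-right : ∀ {X} → Right X → isRight (lookup (tabulate X)) ≡ true
    tab-right {X} (f , c) = dec-t (F? _) (F-resp (λ v → sym (lookup∘tabulate X v)) f) ∧ⁱ not-t (¬t⇒f λ q → absurdᵇ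
      ([ (λ p → ∨-l (t-⊆ᵇ λ v r → ⊆ᵇ-t {A = lookup (tabulate X)} {X₀} p v (trans (lookup∘tabulate X v) r)))
       , (λ p → ∨-r {X ⊆ᵇ X₀} (t-⊆ᵇ λ v r → trans (sym (lookup∘tabulate X v)) (⊆ᵇ-t {A = X₀} {lookup (tabulate X)} p v r))) ]′ (∨-case {lookup (tabulate X) ⊆ᵇ X₀} q)) c)

  -- Every left member that misses `e` also misses `f`, and `L` misses only `f`. By
  -- `incomparable-edges` every right member that contains `e` contains `f` too, so the second sum
  -- does not drop.
  left-below : ∀ {L e f} → Left L → J e ≡ true → J f ≡ true → E[ L ] e ≡ true → E[ L ] f ≡ false → κ e < κ f
  left-below {L} {e} {f} lL Je Jf Le Lf = +-mono-<-≤
    (sumV-strict n (λ X → b2n≤ λ p → ∧-l {isLeft (lookup X)} p ∧ⁱ not-t (left-mono Je Jf L lL Le Lf (lookup X) (left-t (∧-l p)) (not-f (∧-r {isLeft (lookup X)} p)))) (tabulate L)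
      (subst₂ (λ a b → b2n (isLeft (lookup (tabulate L)) ∧ not a) < b2n (isLeft (lookup (tabulate L)) ∧ not b)) (sym (trans (tab-E L e) Le)) (sym (trans (tab-E L f) Lf))
        (subst (λ z → b2n (z ∧ false) < b2n (z ∧ true)) (sym (tab-left lL)) (s≤s z≤n))))
    (sumV-mono n λ X → b2n≤ λ p → ∧-l {isRight (lookup X)} p ∧ⁱ left-right-mono Je Jf L lL Le Lf (lookup X) (right-t (∧-l p)) (∧-r {isRight (lookup X)} p))

  right-above : ∀ {R e f} → Right R → J e ≡ true → J f ≡ true → E[ R ] e ≡ true → E[ R ] f ≡ false → κ f < κ e
  right-above {R} {e} {f} rR Je Jf Re Rf = +-mono-≤-<
    (sumV-mono n λ X → b2n≤ λ p → ∧-l {isLeft (lookup X)} p ∧ⁱ not-t (right-left-mono Je Jf R rR Re Rf (lookup X) (left-t (∧-l p)) (not-f (∧-r {isLeft (lookup X)} p))))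
    (sumV-strict n (λ X → b2n≤ λ p → ∧-l {isRight (lookup X)} p ∧ⁱ right-mono Je Jf R rR Re Rf (lookup X) (right-t (∧-l p)) (∧-r {isRight (lookup X)} p)) (tabulate R)
      (subst₂ (λ a b → b2n (isRight (lookup (tabulate R)) ∧ a) < b2n (isRight (lookup (tabulate R)) ∧ b)) (sym (trans (tab-E R f) Rf)) (sym (trans (tab-E R e) Re))
        (subst (λ z → b2n (z ∧ false) < b2n (z ∧ true)) (sym (tab-right rR)) (s≤s z≤n))))

  color : ∀ {X} → F X → Left X ⊎ Right X
  color {X} f = [ (λ c → inj₁ (f , c)) , (λ c → inj₂ (f , c)) ]′ (dichotomy (comparable X))

  -- Dependent sets violate a minimal Hall condition, whose vertex set is dense.

  record Violation (I : BSet m) : Set where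
    field
      Z     : BSet n
      dense : Dense Z
      big   : suc (cnt Z) ≤ cnt (I ∩ E[ Z ])
      span  : BSet m
      indS  : Hall span
      span⊆ : span ⊆ J ∩ E[ Z ]
      large : cnt Z ≤ cnt span

  opaque
    unfolding ins touch

    -- At a minimal violated `X` all proper subsets obey the Hall bound. Applied to both sides of a
    -- separation this gives connectedness, applied to `X` without `S` it gives the density of `S`,
    -- and it makes any |X| of the violating edges independent.
    violation : ∀ {I} → I ⊆ J → ∀ b X → cnt X ≤ b → suc (cnt X) ≤ cnt (I ∩ E[ X ]) → Violation I
    violation {I} I⊆J b X le viol with search (λ S → (S ⊆ᵇ X) ≡ true × Inh (X ∖ S) × suc (cnt S) ≤ cnt (I ∩ E[ S ]))
        (λ {S} {R} h (a , (w , c) , d) → ⊆ᵇ-cong h a , (w , trans (cong (λ z → X w ∧ not z) (sym (h w))) c)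
           , subst₂ (λ x y → suc x ≤ y) (cnt-cong h) (cnt-cong λ e → cong (I e ∧_) (cong₂ _∧_ (h (s e)) (h (t e)))) d)
        (λ S → (S ⊆ᵇ X ≟ᵇ true) ×-dec (all-true? (X ∖ S) ×-dec (suc (cnt S) ≤? cnt (I ∩ E[ S ]))))
    violation {I} I⊆J zero X le viol | inj₁ (S , a , i , v) = ⊥-elim (1+n≰n (≤-trans (∃-cnt (proj₁ i) (∧-l (proj₂ i))) le))
    violation {I} I⊆J (suc b) X le viol | inj₁ (S , a , (w , hw) , v) = violation I⊆J b S
      (s≤s⁻¹ (≤-trans (cnt-⊂ (⊆ᵇ-t {A = S} a) w (not-f (∧-r {X w} hw)) (∧-l hw)) le)) v
    violation {I} I⊆J b X le viol | inj₂ none = record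
      { Z = X ; dense = record { sub = X⊆U ; conn = cX ; core = coreX ; exc = ≤-trans viol (cnt-⊆ λ e p → I⊆J e (∧-l {I e} p) ∧ⁱ ∧-r {I e} p) }
      ; big = viol ; span = K ; indS = indK ; span⊆ = λ e p → I⊆J e (∧-l {I e} (K-in e p)) ∧ⁱ ∧-r {I e} (K-in e p) ; large = ≤-reflexive (sym (proj₂ (proj₂ tr))) }
      where
      small : ∀ S → S ⊆ X → Inh (X ∖ S) → cnt (I ∩ E[ S ]) ≤ cnt S
      small S S⊆ i = ≮⇒≥ λ v → none S (t-⊆ᵇ S⊆ , i , v)
      edge : ∃ λ e → (I ∩ E[ X ]) e ≡ true
      edge = cnt-∃ (≤-trans (s≤s z≤n) viol)
      X⊆U : X ⊆ U
      X⊆U with ⊆? X U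
      ... | inj₁ h = h
      ... | inj₂ (v , hv) = ⊥-elim (1+n≰n (≤-trans viol (≤-trans (cnt-⊆ λ e p → ∧-l {I e} p ∧ⁱ
              (taut 4 (λ x x′ u u′ → (u ∧ u′) ⇒ᵇ (x ∧ x′) ⇒ᵇ ((x ∧ u) ∧ (x′ ∧ u′))) (X (s e)) (X (t e)) (U (s e)) (U (t e)) $ᵇ J⊆U e (I⊆J e (∧-l {I e} p)) $ᵇ ∧-r {I e} p))
              (≤-trans (small (X ∩ U) (λ _ → ∧-l) (v , ∧-l hv ∧ⁱ not-t (¬t⇒f λ p → absurdᵇ (∧-r {X v} p) (not-f (∧-r {X v} hv))))) (cnt-⊆ λ _ → ∧-l)))))
      cX : Conn J X
      cX with conn⊎sep J X (s (proj₁ edge) , ∧-l (∧-r {I (proj₁ edge)} (proj₂ edge)))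
      ... | inj₁ c = c
      ... | inj₂ (S , (a , ha) , (c , hc) , nocross) = ⊥-elim (1+n≰n (lin
              (cnt X ∷ cnt (I ∩ E[ X ]) ∷ cnt (X ∩ S) ∷ cnt (X ∖ S) ∷ cnt (I ∩ E[ X ∩ S ]) ∷ cnt (I ∩ E[ X ∖ S ]) ∷ [])
              (λ { (x ∷ i ∷ a ∷ b ∷ ia ∷ ib ∷ []) → (con 1 :+ x :≤ i) ∷ (i :≤ ia :+ ib) ∷ (ia :≤ a) ∷ (ib :≤ b) ∷ (a :+ b :≤ x) ∷ [] ⊢ (con 1 :+ x :≤ x) })
              ( viol , cnt1≤2 _ _ _ (λ e → ≤ᵇ-sound (taut 6 (λ i j x y a b → (i ⇒ᵇ j) ⇒ᵇ not (j ∧ ((x ∧ y) ∧ (a xor b))) ⇒ᵇ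
                  (b2n (i ∧ (x ∧ y)) ≤ᵇ b2n (i ∧ ((x ∧ a) ∧ (y ∧ b))) + b2n (i ∧ ((x ∧ not a) ∧ (y ∧ not b)))))
                  (I e) (J e) (X (s e)) (X (t e)) (S (s e)) (S (t e)) $ᵇ ⊆⇒ᵇ (I⊆J e) $ᵇ not-t (nocross e)))
              , small (X ∩ S) (λ _ → ∧-l) (c , ∧-l hc ∧ⁱ not-t (¬t⇒f λ p → absurdᵇ (∧-r {X c} p) (not-f (∧-r {X c} hc))))
              , small (X ∖ S) (λ _ → ∧-l) (a , ∧-l ha ∧ⁱ not-t (¬t⇒f λ p → absurdᵇ (∧-r {X a} ha) (not-f (∧-r {X a} p))))
              , ≤-reflexive (sym (cnt-split X S)))))
      coreX : ∀ S → S ⊆ X → Inh S → Inh (X ∖ S) → suc (cnt S) ≤ touch X S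
      coreX S S⊆ (w , Sw) _ = lin (cnt X ∷ cnt (X ∩ S) ∷ cnt S ∷ cnt (X ∖ S) ∷ cnt (I ∩ E[ X ]) ∷ cnt (I ∩ E[ X ∖ S ]) ∷ touch X S ∷ [])
        (λ { (x ∷ xs ∷ s ∷ r ∷ i ∷ ir ∷ t ∷ []) → (con 1 :+ x :≤ i) ∷ (i :≤ ir :+ t) ∷ (ir :≤ r) ∷ (s :≤ xs) ∷ (xs :+ r :≤ x) ∷ [] ⊢ (con 1 :+ s :≤ t) })
        ( viol , cnt1≤2 _ _ _ (λ e → ≤ᵇ-sound (taut 6 (λ i j x y a b → (i ⇒ᵇ j) ⇒ᵇ
            (b2n (i ∧ (x ∧ y)) ≤ᵇ b2n (i ∧ ((x ∧ not a) ∧ (y ∧ not b))) + b2n (j ∧ ((x ∧ y) ∧ (a ∨ b)))))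
            (I e) (J e) (X (s e)) (X (t e)) (S (s e)) (S (t e)) $ᵇ ⊆⇒ᵇ (I⊆J e)))
        , small (X ∖ S) (λ _ → ∧-l) (w , S⊆ w Sw ∧ⁱ not-t (¬t⇒f λ p → absurdᵇ Sw (not-f (∧-r {X w} p))))
        , cnt-⊆ (λ v p → S⊆ v p ∧ⁱ p) , ≤-reflexive (sym (cnt-split X S)))
      tr : ∃ λ B → B ⊆ I ∩ E[ X ] × cnt B ≡ cnt X
      tr = trim (cnt X) (I ∩ E[ X ]) (≤-trans (n≤1+n _) viol)
      K : BSet m
      K = proj₁ tr
      K-in : K ⊆ I ∩ E[ X ]
      K-in = proj₁ (proj₂ tr)
      indK : Hall K
      indK Y with ⊆? X Y
      ... | inj₁ h = ≤-trans (cnt-⊆ λ e → ∧-l) (≤-trans (≤-reflexive (proj₂ (proj₂ tr))) (cnt-⊆ h))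
      ... | inj₂ (v , hv) = ≤-trans (cnt-⊆ λ e p → ∧-l {I e} (K-in e (∧-l p)) ∧ⁱ
              (taut 4 (λ x x′ y y′ → (x ∧ x′) ⇒ᵇ (y ∧ y′) ⇒ᵇ ((x ∧ y) ∧ (x′ ∧ y′))) (X (s e)) (X (t e)) (Y (s e)) (Y (t e)) $ᵇ ∧-r {I e} (K-in e (∧-l p)) $ᵇ ∧-r {K e} p))
              (≤-trans (small (X ∩ Y) (λ _ → ∧-l) (v , ∧-l hv ∧ⁱ not-t (¬t⇒f λ p → absurdᵇ (∧-r {X v} p) (not-f (∧-r {X v} hv))))) (cnt-⊆ λ v → ∧-r {X v}))

  -- Every new vertex `v` enters with one edge, and for a set containing `v` the Hall bound follows
  -- from the one without `v`.
  grow-ind : ∀ b K B → K ⊆ U → Inh K → Hall B → B ⊆ J ∩ E[ K ] → cnt K ≤ cnt B → cnt (U ∖ K) ≤ b → ∃ λ B → Hall B × B ⊆ J × cnt U ≤ cnt B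
  grow-ind b K B K⊆ iK hB B⊆ sz le with inh⊎empty (U ∖ K)
  ... | inj₂ em = B , hB , (λ e p → ∧-l {J e} (B⊆ e p)) , ≤-trans (cnt-⊆ λ v p → taut 2 (λ u k → u ⇒ᵇ not (u ∧ not k) ⇒ᵇ k) (U v) (K v) $ᵇ p $ᵇ not-t (em v)) sz
  grow-ind zero K B K⊆ iK hB B⊆ sz le | inj₁ (w , hw) = ⊥-elim (1+n≰n (≤-trans (∃-cnt w hw) le))
  grow-ind (suc b) K B K⊆ iK hB B⊆ sz le | inj₁ (w , hw) with exit cU (proj₁ iK , K⊆ _ (proj₂ iK) ∧ⁱ proj₂ iK) (w , hw)
  ... | e , u , v , Je , Uu , Ku , Uv , Kv , es = grow-ind b (K ∪ ⁅ v ⁆) (B ∪ ⁅ e ⁆)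
        (∪-⊆ K⊆ λ x p → subst (λ z → U z ≡ true) (sym (==-t {i = x} p)) Uv) (proj₁ iK , ∨-l (proj₂ iK)) hall′ sub′
        (≤-trans (≤-reflexive (cnt-insert K v Kv)) (≤-trans (s≤s sz) (≤-reflexive (sym (cnt-insert B e Be)))))
        (s≤s⁻¹ (≤-trans (cnt-⊂ {p = U ∖ (K ∪ ⁅ v ⁆)} {q = U ∖ K} (λ i → (taut 3 (λ a k z → (a ∧ not (k ∨ z)) ⇒ᵇ (a ∧ not k)) (U i) (K i) (i == v)) $ᵇ_) v
          (¬t⇒f λ q → absurdᵇ (∨-r {K v} (==-refl v)) (not-f (∧-r {U v} q))) (Uv ∧ⁱ not-t Kv)) le))
    where
    inK : ∀ f → B f ≡ true → K (s f) ≡ true × K (t f) ≡ true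
    inK f p = ∧-l {K (s f)} (∧-r {J f} (B⊆ f p)) , ∧-r {K (s f)} (∧-r {J f} (B⊆ f p))
    Be : B e ≡ false
    Be = ¬t⇒f λ p → by-ends (λ x y → K x ≡ true × K y ≡ true → ⊥) es (λ (_ , q) → absurdᵇ q Kv) (λ (q , _) → absurdᵇ q Kv) (inK e p)
    sub′ : B ∪ ⁅ e ⁆ ⊆ J ∩ E[ K ∪ ⁅ v ⁆ ]
    sub′ f p = [ (λ q → ∧-l {J f} (B⊆ f q) ∧ⁱ ∨-l (proj₁ (inK f q)) ∧ⁱ ∨-l (proj₂ (inK f q)))
               , (λ q → subst (λ f → (J ∩ E[ K ∪ ⁅ v ⁆ ]) f ≡ true) (sym (==-t {i = f} q)) (Je ∧ⁱ by-ends (λ x y → (K ∪ ⁅ v ⁆) x ∧ (K ∪ ⁅ v ⁆) y ≡ true) es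
                   (∨-l Ku ∧ⁱ ∨-r {K v} (==-refl v)) (∨-r {K v} (==-refl v) ∧ⁱ ∨-l Ku))) ]′ (∨-case {B f} p)
    hall′ : Hall (B ∪ ⁅ e ⁆)
    hall′ X with X v in Xv
    ... | false = ≤-trans (cnt-⊆ λ f p → [ (λ q → q ∧ⁱ ∧-r {(B ∪ ⁅ e ⁆) f} p)
                    , (λ q → ⊥-elim (by-ends (λ x y → X x ∧ X y ≡ true → ⊥) es (λ r → absurdᵇ (∧-r {X u} r) Xv) (λ r → absurdᵇ (∧-l r) Xv)
                        (subst (λ f → E[ X ] f ≡ true) (==-t {i = f} q) (∧-r {(B ∪ ⁅ e ⁆) f} p)))) ]′ (∨-case {B f} (∧-l p))) (hB X)
    ... | true  = ≤-trans (cnt1≤2 _ ⁅ e ⁆ (B ∩ E[ X ∖ ⁅ v ⁆ ]) λ f → ≤ᵇ-sound (taut 6 (λ b q x x′ i i′ → (b ⇒ᵇ (not i ∧ not i′)) ⇒ᵇ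
                        (b2n ((b ∨ q) ∧ (x ∧ x′)) ≤ᵇ b2n q + b2n (b ∧ ((x ∧ not i) ∧ (x′ ∧ not i′))))) (B f) (f == e) (X (s f)) (X (t f)) (s f == v) (t f == v)
                        $ᵇ ⊆⇒ᵇ (λ p → not-t (==-f λ q → absurdᵇ (proj₁ (inK f p)) (trans (cong K q) Kv)) ∧ⁱ not-t (==-f λ q → absurdᵇ (proj₂ (inK f p)) (trans (cong K q) Kv)))))
                    (≤-trans (+-mono-≤ (≤-reflexive (sum-== e)) (hB (X ∖ ⁅ v ⁆))) (≤-reflexive (sym (cnt-remove X v Xv))))

  module _ (M : Matroid m) (same : ∀ I → Matroid.Ind M I → Hall I) (same′ : ∀ I → Hall I → Matroid.Ind M I) where
    open Bases M
    open Matroid M using (Ind; empty)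

    private
      rank-E : ∀ X K → Ind K → K ⊆ J ∩ E[ X ] → cnt K ≤ cnt X
      rank-E X K iK K⊆ = ≤-trans (cnt-⊆ λ e p → p ∧ⁱ ∧-r {J e} (K⊆ e p)) (same K iK X)

      bJ : ∃ λ B → ε ⊆ B × Basis J B
      bJ = extend {ε} {J} empty (λ _ ())
      BJ : BSet m
      BJ = proj₁ bJ
      module BJ = Basis (proj₂ (proj₂ bJ))

      J∩ : ∀ {X f} → (J ∩ E[ X ]) f ≡ false → J f ≡ true → E[ X ] f ≡ false
      J∩ {X} {f} p q = ¬t⇒f λ r → absurdᵇ (q ∧ⁱ r) p

    -- If `Z` is all of `U`, both segments are `J`; if `Z` is a member, one segment is its edge set
    -- and the other is `J`. For a meet they come from `L` and `R`, and the inequality is |L| + |R|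
    -- ≤ |U| + |Z|, where |Z| is exceeded by the edges of `I` in `Z` and |U| is reached by an
    -- independent set.
    certified : Cert J κ
    certified I I⊆ dep with hall⊎ I
    ... | inj₂ h = ⊥-elim (dep (same′ I h))
    ... | inj₁ (X , viol) = main
      where
      open Violation (violation I⊆ _ X ≤-refl viol)
      in-E : ∀ {Y} → Z ⊆ Y → ∀ e → (I ∩ E[ Z ]) e ≡ true → (J ∩ E[ Y ]) e ≡ true
      in-E h e p = I⊆ e (∧-l p) ∧ⁱ E-mono h e (∧-r {I e} p)
      main : Bad J κ I
      main with classify dense
      ... | inj₁ U⊆Z = record { D = J ; T = J ; D⊆ = λ _ → id ; T⊆ = λ _ → id ; down = λ e f _ a b → absurdᵇ a b ; up = λ e f _ a b → absurdᵇ a b ; d = cnt U ; t = cnt BJ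
            ; rD = λ K iK K⊆ → rank-E U K iK (λ e p → K⊆ e p ∧ⁱ J⊆U e (K⊆ e p)) ; rT = λ K iK K⊆ → basis-max (proj₂ (proj₂ bJ)) iK K⊆ ; B = BJ ; indB = BJ.ind ; B⊆ = BJ.sub
            ; big = +-monoˡ-≤ (cnt BJ) (≤-trans (s≤s (cnt-⊆ U⊆Z)) (≤-trans big sub)) ; some = ≤-trans (s≤s z≤n) (≤-trans big sub) }
        where
        sub : cnt (I ∩ E[ Z ]) ≤ cnt (I ∩ (J ∩ J))
        sub = cnt-⊆ λ e p → ∧-l {I e} p ∧ⁱ I⊆ e (∧-l p) ∧ⁱ I⊆ e (∧-l p)
      ... | inj₂ (inj₁ fZ) with color fZ
      ...   | inj₁ lZ = record { D = J ∩ E[ Z ] ; T = J ; D⊆ = λ _ → ∧-l ; T⊆ = λ _ → id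
            ; down = λ e f a b c → left-below lZ (∧-l a) b (∧-r {J e} a) (J∩ {Z} c b) ; up = λ e f _ a b → absurdᵇ a b ; d = cnt Z ; t = cnt BJ
            ; rD = rank-E Z ; rT = λ K iK K⊆ → basis-max (proj₂ (proj₂ bJ)) iK K⊆ ; B = BJ ; indB = BJ.ind ; B⊆ = BJ.sub
            ; big = +-monoˡ-≤ (cnt BJ) (≤-trans big sub) ; some = ≤-trans (s≤s z≤n) (≤-trans big sub) }
        where
        sub : cnt (I ∩ E[ Z ]) ≤ cnt (I ∩ ((J ∩ E[ Z ]) ∩ J))
        sub = cnt-⊆ λ e p → ∧-l {I e} p ∧ⁱ in-E {Z} (λ _ → id) e p ∧ⁱ I⊆ e (∧-l p)
      ...   | inj₂ rZ = record { D = J ; T = J ∩ E[ Z ] ; D⊆ = λ _ → id ; T⊆ = λ _ → ∧-l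
            ; down = λ e f _ a b → absurdᵇ a b ; up = λ e f a b c → right-above rZ (∧-l a) b (∧-r {J e} a) (J∩ {Z} c b) ; d = cnt BJ ; t = cnt Z
            ; rD = λ K iK K⊆ → basis-max (proj₂ (proj₂ bJ)) iK K⊆ ; rT = rank-E Z ; B = BJ ; indB = BJ.ind ; B⊆ = BJ.sub
            ; big = lin (cnt BJ ∷ cnt Z ∷ cnt (I ∩ E[ Z ]) ∷ cnt (I ∩ (J ∩ (J ∩ E[ Z ]))) ∷ [])
                (λ { (b ∷ z ∷ i ∷ y ∷ []) → (con 1 :+ z :≤ i) ∷ (i :≤ y) ∷ [] ⊢ (con 1 :+ (b :+ z) :≤ y :+ b) }) (big , sub) ; some = ≤-trans (s≤s z≤n) (≤-trans big sub) }
        where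
        sub : cnt (I ∩ E[ Z ]) ≤ cnt (I ∩ (J ∩ (J ∩ E[ Z ])))
        sub = cnt-⊆ λ e p → ∧-l {I e} p ∧ⁱ I⊆ e (∧-l p) ∧ⁱ in-E {Z} (λ _ → id) e p
      main | inj₂ (inj₂ meet) = meet-case (color fL) (color fR)
        where
        open Meet meet
        gB : ∃ λ B → Hall B × B ⊆ J × cnt U ≤ cnt B
        gB = grow-ind _ Z span (Dense.sub dense) (Conn.inh (Dense.conn dense)) indS span⊆ large ≤-refl
        B : BSet m
        B = proj₁ gB
        between : ∀ {L R} → Left L → Right R → Z ⊆ L → Z ⊆ R → cnt L + cnt R ≤ cnt U + cnt Z → Bad J κ I
        between {L} {R} lL rR ZL ZR card = record { D = J ∩ E[ L ] ; T = J ∩ E[ R ] ; D⊆ = λ _ → ∧-l ; T⊆ = λ _ → ∧-l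
            ; down = λ e f a b c → left-below lL (∧-l a) b (∧-r {J e} a) (J∩ {L} c b) ; up = λ e f a b c → right-above rR (∧-l a) b (∧-r {J e} a) (J∩ {R} c b)
            ; d = cnt L ; t = cnt R ; rD = rank-E L ; rT = rank-E R ; B = B ; indB = same′ B (proj₁ (proj₂ gB)) ; B⊆ = proj₁ (proj₂ (proj₂ gB))
            ; big = lin (cnt L ∷ cnt R ∷ cnt U ∷ cnt Z ∷ cnt B ∷ cnt (I ∩ E[ Z ]) ∷ cnt (I ∩ ((J ∩ E[ L ]) ∩ (J ∩ E[ R ]))) ∷ [])
                (λ { (l ∷ r ∷ u ∷ z ∷ b ∷ i ∷ y ∷ []) → (l :+ r :≤ u :+ z) ∷ (u :≤ b) ∷ (con 1 :+ z :≤ i) ∷ (i :≤ y) ∷ [] ⊢ (con 1 :+ (l :+ r) :≤ y :+ b) })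
                (card , proj₂ (proj₂ (proj₂ gB)) , big , sub) ; some = ≤-trans (s≤s z≤n) (≤-trans big sub) }
          where
          sub : cnt (I ∩ E[ Z ]) ≤ cnt (I ∩ ((J ∩ E[ L ]) ∩ (J ∩ E[ R ])))
          sub = cnt-⊆ λ e p → ∧-l {I e} p ∧ⁱ in-E ZL e p ∧ⁱ in-E ZR e p
        meet-case : Left L ⊎ Right L → Left R ⊎ Right R → Bad J κ I
        meet-case (inj₁ l) (inj₂ r) = between l r ZL ZR card
        meet-case (inj₂ l) (inj₁ r) = between r l ZR ZL (≤-trans (≤-reflexive (+-comm (cnt R) (cnt L))) card)
        meet-case (inj₁ l) (inj₁ r) = ⊥-elim ([ not-⊆ (proj₁ inc) , not-⊆ (proj₂ inc) ]′ (left-chain l r))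
        meet-case (inj₂ l) (inj₂ r) = ⊥-elim ([ not-⊆ (proj₁ inc) , not-⊆ (proj₂ inc) ]′ (right-chain l r))

-- Reduction to connected graphs of minimum degree two

module Certify (G : Graph) (excl : NoMinors G) (M : Matroid (nE G))
               (same : ∀ I → Matroid.Ind M I → Gr.Hall (Cycles.s G) (Cycles.t G) I)
               (same′ : ∀ I → Gr.Hall (Cycles.s G) (Cycles.t G) I → Matroid.Ind M I) where

  open Cycles G
  open Gr s t
  open Bases M
  private
    n = nV G
    m = nE G

  incident : Fin n → BSet m
  incident v e = s e == v ∨ t e == v

  used : BSet m → BSet n
  used J v = does (all-true? (J ∩ incident v))

  used-edge : ∀ {J v} → used J v ≡ true → Inh (J ∩ incident v)
  used-edge {J} {v} = does-t (all-true? (J ∩ incident v))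

  edge-used : ∀ {J e} → J e ≡ true → E[ used J ] e ≡ true
  edge-used {J} {e} Je = dec-t (all-true? (J ∩ incident (s e))) (e , Je ∧ⁱ ∨-l (==-refl (s e)))
                      ∧ⁱ dec-t (all-true? (J ∩ incident (t e))) (e , Je ∧ⁱ ∨-r {s e == t e} (==-refl (t e)))

  record Pendant (J : BSet m) : Set where
    field
      v    : Fin n
      e    : Fin m
      in-J : J e ≡ true
      at   : incident v e ≡ true
      only : ∀ f → J f ≡ true → f == e ≡ false → incident v f ≡ false

  two-edges : ∀ J v → used J v ≡ true → Pendant J ⊎ (2 ≤ dg J v)
  two-edges J v p with used-edge {J} p
  ... | e , h with inh⊎empty (J ∩ incident v ∖ ⁅ e ⁆)
  ...   | inj₂ em = inj₁ record { v = v ; e = e ; in-J = ∧-l h ; at = ∧-r {J e} h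
                                ; only = λ f Jf ne → ¬t⇒f λ q → absurdᵇ ((Jf ∧ⁱ q) ∧ⁱ not-t ne) (em f) }
  ...   | inj₁ (f , k) = inj₂ (≤-trans (≤-trans (s≤s (∃-cnt {p = J ∩ incident v ∖ ⁅ e ⁆} f k)) (≤-reflexive (sym (cnt-remove (J ∩ incident v) e h))))
      (≤-trans (≤-reflexive (cnt-sum (J ∩ incident v))) (sum-mono λ e → per (J e) (s e == v) (t e == v))))
    where
    per : ∀ j a b → b2n (j ∧ (a ∨ b)) ≤ (if j then b2n a + b2n b else 0)
    per false a b = z≤n
    per true true b = s≤s z≤n
    per true false b = ≤-refl

  -- The edge `e` alone meets `v`, so a set containing `v` pays for `e` with `v` and the bound for
  -- the remaining vertices does the rest: `e` is a coloop.
  join-pendant : ∀ {J} (p : Pendant J) → let open Pendant p in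
                 ∀ I → I ⊆ J → Hall (I ∖ ⁅ e ⁆) → Hall I
  join-pendant {J} p I I⊆ h X with dichotomy (X (Pendant.v p))
  ... | inj₂ Xv = ≤-trans (cnt-⊆ λ f q → (∧-l {I f} q ∧ⁱ not-t (==-f {i = f} {e} λ { refl → [ (λ r → absurdᵇ (trans (cong X (sym (==-t {i = s e} r))) (∧-l (∧-r {I e} q))) Xv)
                                                                         , (λ r → absurdᵇ (trans (cong X (sym (==-t {i = t e} r))) (∧-r {X (s e)} (∧-r {I e} q))) Xv) ]′ (∨-case {s e == v} at) })) ∧ⁱ ∧-r {I f} q) (h X)
    where open Pendant p
  ... | inj₁ Xv = ≤-trans (cnt1≤2 (I ∩ E[ X ]) ⁅ e ⁆ ((I ∖ ⁅ e ⁆) ∩ E[ X ∖ ⁅ v ⁆ ]) λ f → ≤ᵇ-sound (taut 7 (λ i j q x x′ a b → (i ⇒ᵇ j) ⇒ᵇ (j ⇒ᵇ not q ⇒ᵇ not (a ∨ b)) ⇒ᵇ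
                      (b2n (i ∧ (x ∧ x′)) ≤ᵇ b2n q + b2n ((i ∧ not q) ∧ ((x ∧ not a) ∧ (x′ ∧ not b))))) (I f) (J f) (f == e) (X (s f)) (X (t f)) (s f == v) (t f == v)
                      $ᵇ ⊆⇒ᵇ (I⊆ f) $ᵇ ⊆⇒ᵇ (λ Jf → ⊆⇒ᵇ (λ ne → not-t (only f Jf (not-f ne))))))
                  (≤-trans (+-mono-≤ (≤-reflexive (sum-== e)) (h (X ∖ ⁅ v ⁆))) (≤-reflexive (sym (cnt-remove X v Xv))))
    where open Pendant p

  single : ∀ e {I} → I ⊆ ⁅ e ⁆ → Hall I
  single e {I} I⊆ X with inh⊎empty (I ∩ E[ X ])
  ... | inj₂ em = ≤-trans (≤-reflexive (cnt-none em)) z≤n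
  ... | inj₁ (f , p) = ≤-trans (cnt-⊆ λ g q → I⊆ g (∧-l q)) (≤-trans (≤-reflexive (sum-== e)) (∃-cnt (s f) (∧-l (∧-r {I f} p))))

  join-sep : ∀ {J S} → Sep J (used J) S → ∀ I → I ⊆ J → Hall (I ∩ (S ∘ s)) → Hall (I ∖ (S ∘ s)) → Hall I
  join-sep {J} {S} (_ , _ , none) I I⊆ h k X = ≤-trans
    (cnt1≤2 _ ((I ∩ (S ∘ s)) ∩ E[ X ∩ S ]) ((I ∖ (S ∘ s)) ∩ E[ X ∖ S ]) λ e → ≤ᵇ-sound (taut 6 (λ i j x y a b → (i ⇒ᵇ j) ⇒ᵇ (j ⇒ᵇ not (a xor b)) ⇒ᵇ
        (b2n (i ∧ (x ∧ y)) ≤ᵇ b2n ((i ∧ a) ∧ ((x ∧ a) ∧ (y ∧ b))) + b2n ((i ∧ not a) ∧ ((x ∧ not a) ∧ (y ∧ not b)))))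
        (I e) (J e) (X (s e)) (X (t e)) (S (s e)) (S (t e)) $ᵇ ⊆⇒ᵇ (I⊆ e) $ᵇ ⊆⇒ᵇ (λ Je → not-t (¬t⇒f λ c → absurdᵇ (Je ∧ⁱ edge-used {J} Je ∧ⁱ c) (none e)))))
    (≤-trans (+-mono-≤ (h (X ∩ S)) (k (X ∖ S))) (≤-reflexive (sym (cnt-split X S))))

  -- The degrees in `S` add up to at least 2|S|, and they count the edges touching `S` once and
  -- those inside `S` a second time. Connectedness provides an edge leaving `S`, so more than half
  -- of the sum comes from touching edges.
  core-degree : ∀ {J} → Conn J (used J) → (∀ v → used J v ≡ true → 2 ≤ dg J v) →
                ∀ S → S ⊆ used J → Inh S → Inh (used J ∖ S) → suc (cnt S) ≤ Counting.touch G J excl (used J) S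
  core-degree {J} cU two S S⊆ (v , Sv) (w , hw) = ≰⇒> λ le → 1+n≰n
    (≤-trans (lin (cnt S ∷ C.ins S ∷ C.touch (used J) S ∷ [])
      (λ { (c ∷ i ∷ h ∷ []) → (c :+ c :≤ i :+ h) ∷ (con 1 :+ i :≤ h) ∷ (h :≤ c) ∷ [] ⊢ (con 1 :+ c :≤ h) }) (total , strict , le)) le)
    where
    module C = Counting G J excl
    opaque
      unfolding Excluded.ins Counting.touch
      strict : suc (C.ins S) ≤ C.touch (used J) S
      strict = cnt-⊂ (λ e p → ∧-l {J e} p ∧ⁱ edge-used {J} (∧-l p) ∧ⁱ ∨-l (∧-l {S (s e)} (∧-r {J e} p)))
          (proj₁ c) (¬t⇒f λ p → absurdᵇ (taut 2 (λ a b → (a ∧ b) ⇒ᵇ not (a xor b)) (S (s (proj₁ c))) (S (t (proj₁ c))) $ᵇ ∧-r {J (proj₁ c)} p)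
              (cong not (∧-r {E[ used J ] (proj₁ c)} (∧-r {J (proj₁ c)} (proj₂ c)))))
          (taut 4 (λ j u a b → (j ∧ (u ∧ (a xor b))) ⇒ᵇ (j ∧ (u ∧ (a ∨ b)))) (J (proj₁ c)) (E[ used J ] (proj₁ c)) (S (s (proj₁ c))) (S (t (proj₁ c))) $ᵇ proj₂ c)
        where
        c : Inh (J ∩ crosses (used J) S)
        c = Conn.cut cU S (v , S⊆ v Sv ∧ⁱ Sv) (w , hw)
      total : cnt S + cnt S ≤ C.ins S + C.touch (used J) S
      total = begin
        cnt S + cnt S                                        ≡⟨ cong₂ _+_ (cnt-sum S) (cnt-sum S) ⟩
        sum (b2n ∘ S) + sum (b2n ∘ S)                        ≡⟨ sym (∑-distrib-+ (b2n ∘ S) (b2n ∘ S)) ⟩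
        sum (λ v → b2n (S v) + b2n (S v))                    ≤⟨ sum-mono vertex ⟩
        sum (λ v → if S v then dg J v else 0)                ≡⟨ handshake J S ⟩
        sum (λ e → if J e then b2n (S (s e)) + b2n (S (t e)) else 0) ≤⟨ sum-mono edge ⟩
        sum (λ e → b2n ((J ∩ E[ S ]) e) + b2n ((J ∩ (E[ used J ] ∩ λ e → S (s e) ∨ S (t e))) e))
          ≡⟨ ∑-distrib-+ (b2n ∘ (J ∩ E[ S ])) (b2n ∘ (J ∩ (E[ used J ] ∩ λ e → S (s e) ∨ S (t e)))) ⟩
        _ ≡⟨ sym (cong₂ _+_ (cnt-sum (J ∩ E[ S ])) (cnt-sum (J ∩ (E[ used J ] ∩ λ e → S (s e) ∨ S (t e))))) ⟩
        _ ∎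
        where
        open ≤-Reasoning
        vertex : ∀ v → b2n (S v) + b2n (S v) ≤ (if S v then dg J v else 0)
        vertex v with S v in eq
        ... | true  = two v (S⊆ v eq)
        ... | false = z≤n
        edge : ∀ e → (if J e then b2n (S (s e)) + b2n (S (t e)) else 0) ≤ b2n ((J ∩ E[ S ]) e) + b2n ((J ∩ (E[ used J ] ∩ λ e → S (s e) ∨ S (t e))) e)
        edge e with J e in eq
        ... | false = z≤n
        ... | true rewrite edge-used {J} eq = ≤ᵇ-sound (taut 2 (λ a b → b2n a + b2n b ≤ᵇ b2n (a ∧ b) + b2n (a ∨ b)) (S (s e)) (S (t e)))

  certify : ∀ b J → cnt J ≤ b → ∃ λ κ → Cert J κ
  certify b J le with inh⊎empty J
  ... | inj₂ em = _ , cert-trivial λ I I⊆ → same′ I λ X → ≤-trans (≤-reflexive (cnt-none λ e → ¬t⇒f λ p → absurdᵇ (I⊆ e (∧-l p)) (em e))) z≤n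
  certify zero J le | inj₁ (e , Je) = ⊥-elim (1+n≰n (≤-trans (∃-cnt e Je) le))
  certify (suc b) J le | inj₁ (e₀ , Je₀) with any? (λ v → (used J v ≟ᵇ true) ×-dec (dg J v ≤? 1))
  ... | yes (v , Uv , d) = [ pendant , (λ h → ⊥-elim (<⇒≱ h d)) ]′ (two-edges J v Uv)
    where
    pendant : Pendant J → ∃ λ κ → Cert J κ
    pendant p = _ , Split.cert {S = not ∘ ⁅ e ⁆} (λ I I⊆ h _ → same′ I (join-pendant p I I⊆ (same _ h)))
        (proj₂ (certify b (J ∖ ⁅ e ⁆) (s≤s⁻¹ (≤-trans (≤-reflexive (sym (cnt-remove J e in-J))) le))))
        (cert-trivial λ I I⊆ → same′ I (single e λ f q → taut 2 (λ j x → (j ∧ not (not x)) ⇒ᵇ x) (J f) (f == e) $ᵇ I⊆ f q))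
      where open Pendant p
  ... | no deg with conn⊎sep J (used J) (s e₀ , ∧-l (edge-used {J} Je₀))
  ...   | inj₁ c = _ , certified M same same′
    where open Ordering G J excl (used J) c (core-degree c λ v p → ≰⇒> λ d → deg (v , p , d)) (λ e → edge-used {J})
  ...   | inj₂ (S , sep) = _ , Split.cert {S = S ∘ s} (λ I I⊆ h k → same′ I (join-sep sep I I⊆ (same _ h) (same _ k)))
        (proj₂ (certify b (J ∩ (S ∘ s)) (smaller {J ∩ (S ∘ s)} (λ _ → ∧-l) (out (proj₁ (proj₂ sep))))))
        (proj₂ (certify b (J ∖ (S ∘ s)) (smaller {J ∖ (S ∘ s)} (λ _ → ∧-l) (inside (proj₁ sep)))))
    where
    smaller : ∀ {K} → K ⊆ J → Inh (J ∖ K) → cnt K ≤ b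
    smaller {K} h (e , p) = s≤s⁻¹ (≤-trans (cnt-⊂ h e (not-f (∧-r {J e} p)) (∧-l p)) le)
    same-side : ∀ {v e} → J e ≡ true → incident v e ≡ true → S (s e) ≡ S v
    same-side {v} {e} Je at = [ (λ p → cong S (==-t p)) , (λ p → trans (eq _ _ (¬t⇒f λ c → absurdᵇ (Je ∧ⁱ edge-used {J} Je ∧ⁱ c) (proj₂ (proj₂ sep) e))) (cong S (==-t p))) ]′ (∨-case {s e == v} at)
      where
      eq : ∀ a b → a xor b ≡ false → a ≡ b
      eq true  true  _ = refl
      eq false false _ = refl
    out : Inh (used J ∖ S) → Inh (J ∖ (J ∩ (S ∘ s)))
    out (v , p) with used-edge {J} (∧-l p)
    ... | e , h = e , ∧-l h ∧ⁱ not-t (¬t⇒f λ q → absurdᵇ (trans (sym (same-side (∧-l h) (∧-r {J e} h))) (∧-r {J e} q)) (not-f (∧-r {used J v} p)))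
    inside : Inh (used J ∩ S) → Inh (J ∖ (J ∖ (S ∘ s)))
    inside (v , p) with used-edge {J} (∧-l p)
    ... | e , h = e , ∧-l h ∧ⁱ not-t (¬t⇒f λ q → absurdᵇ (trans (same-side (∧-l h) (∧-r {J e} h)) (∧-r {used J v} p)) (not-f (∧-r {J e} q)))

-- From certificates to intervals

cnt-inj : ∀ {m k} (A : BSet m) (B : BSet k) (φ : ∀ x → A x ≡ true → Fin k) → (∀ x p → B (φ x p) ≡ true) →
          (∀ x y p q → φ x p ≡ φ y q → x ≡ y) → cnt A ≤ cnt B
cnt-inj A B φ to inj = go _ A B φ to inj ≤-refl
  where
  go : ∀ {m k} b (A : BSet m) (B : BSet k) (φ : ∀ x → A x ≡ true → Fin k) → (∀ x p → B (φ x p) ≡ true) →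
       (∀ x y p q → φ x p ≡ φ y q → x ≡ y) → cnt A ≤ b → cnt A ≤ cnt B
  go b A B φ to inj le with inh⊎empty A
  ... | inj₂ em = ≤-trans (≤-reflexive (cnt-none em)) z≤n
  go zero A B φ to inj le | inj₁ (x , p) = ⊥-elim (1+n≰n (≤-trans (∃-cnt x p) le))
  go (suc b) A B φ to inj le | inj₁ (x , p) = begin
    cnt A                       ≡⟨ cnt-remove A x p ⟩
    suc (cnt (A ∖ ⁅ x ⁆))       ≤⟨ s≤s (go b (A ∖ ⁅ x ⁆) (B ∖ ⁅ φ x p ⁆) (λ y q → φ y (∧-l q))
        (λ y q → to y (∧-l q) ∧ⁱ not-t (==-f λ e → absurdᵇ (trans (cong (_== x) (inj y x _ _ e)) (==-refl x)) (not-f (∧-r {A y} q))))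
        (λ y z q r → inj y z _ _) (s≤s⁻¹ (≤-trans (≤-reflexive (sym (cnt-remove A x p))) le))) ⟩
    suc (cnt (B ∖ ⁅ φ x p ⁆))   ≡⟨ sym (cnt-remove B (φ x p) (to x p)) ⟩
    cnt B                       ∎
    where open ≤-Reasoning

cnt-full : ∀ m → cnt (full {m}) ≡ m
cnt-full m = trans (cnt-sum full) (sum-1 m)

cnt-bij : ∀ {m k} (f : Fin m → Fin k) (g : Fin k → Fin m) → (∀ x → g (f x) ≡ x) → (∀ y → f (g y) ≡ y) → ∀ K → cnt (K ∘ f) ≡ cnt K
cnt-bij f g gf fg K = trans (sym (im-cnt full K)) (cnt-cong λ y → cong (_∧ K y) (subst (λ y → im full y ≡ true) (fg y) (im-∋ {full} (g y) refl)))
  where open Image f (λ x y e → trans (sym (gf x)) (trans (cong g e) (gf y)))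

Match : ∀ {m k} → (Fin m → ℕ) → (Fin k → ℕ) → (Fin k → ℕ) → BSet m → Set
Match {m} {k} π lo hi I = Σ (∀ e → I e ≡ true → Fin k) λ φ →
  (∀ x y p q → φ x p ≡ φ y q → x ≡ y) × (∀ x p → lo (φ x p) ≤ π x × π x ≤ hi (φ x p))

module Sort {m : ℕ} (π : Fin m → ℕ) (π-inj : ∀ {x y} → π x ≡ π y → x ≡ y) where

  below : ℕ → BSet m
  below a e = does (π e <? a)

  rk : BSet m → ℕ → ℕ
  rk I a = cnt (I ∩ below a)

  below-t : ∀ {a e} → below a e ≡ true → π e < a
  below-t {a} {e} = does-t (π e <? a)

  t-below : ∀ {a e} → π e < a → below a e ≡ true
  t-below {a} {e} = dec-t (π e <? a)

  below-mono : ∀ {a b} → a ≤ b → below a ⊆ below b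
  below-mono le e p = t-below (≤-trans (below-t p) le)

  rk-mono : ∀ I {a b} → a ≤ b → rk I a ≤ rk I b
  rk-mono I le = cnt-⊆ λ e p → ∧-l p ∧ⁱ below-mono le e (∧-r {I e} p)

  rk-strict : ∀ I {e b} → I e ≡ true → π e < b → rk I (π e) < rk I b
  rk-strict I {e} Ie lt = cnt-⊂ (λ f p → ∧-l p ∧ⁱ below-mono (<⇒≤ lt) f (∧-r {I f} p)) e
    (¬t⇒f λ p → <-irrefl refl (below-t {π e} {e} (∧-r {I e} p))) (Ie ∧ⁱ t-below lt)

  rk-suc : ∀ I e → rk I (suc (π e)) ≤ suc (rk I (π e))
  rk-suc I e = ≤-trans (cnt1≤2 _ ⁅ e ⁆ (I ∩ below (π e)) λ f → ≤ᵇ-sound (taut 4 (λ i a b c → (a ⇒ᵇ (b ∨ c)) ⇒ᵇ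
      (b2n (i ∧ a) ≤ᵇ b2n b + b2n (i ∧ c))) (I f) (below (suc (π e)) f) (f == e) (below (π e) f) $ᵇ ⊆⇒ᵇ (last f)))
    (+-monoˡ-≤ _ (≤-reflexive (sum-== e)))
    where
    last : ∀ f → below (suc (π e)) f ≡ true → f == e ∨ below (π e) f ≡ true
    last f p with m≤n⇒m<n∨m≡n (s≤s⁻¹ (below-t {suc (π e)} {f} p))
    ... | inj₁ lt = ∨-r {f == e} (t-below lt)
    ... | inj₂ eq = ∨-l (subst (λ x → f == x ≡ true) (π-inj eq) (==-refl f))

  rk-inj : ∀ I {e f} → I e ≡ true → I f ≡ true → rk I (π e) ≡ rk I (π f) → e ≡ f
  rk-inj I {e} {f} Ie If eq with <-cmp (π e) (π f)
  ... | tri< lt _ _ = ⊥-elim (<-irrefl eq (rk-strict I Ie lt))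
  ... | tri≈ _ p _  = π-inj p
  ... | tri> _ _ gt = ⊥-elim (<-irrefl (sym eq) (rk-strict I If gt))

  N : ℕ
  N = suc (sum π)

  below-N : ∀ e → below N e ≡ true
  below-N e = t-below (s≤s (≤-sum π e))

  rk-N : ∀ I → rk I N ≡ cnt I
  rk-N I = cnt-cong λ e → trans (cong (I e ∧_) (below-N e)) (∧-identityʳ (I e))

  opaque
    select : ∀ I {i} → i < cnt I → ∃ λ e → I e ≡ true × rk I (π e) ≡ i
    select I {i} lt = jump N (subst (i <_) (sym (rk-N I)) lt)
      where
      jump : ∀ a → i < rk I a → ∃ λ e → I e ≡ true × rk I (π e) ≡ i
      jump zero h = ⊥-elim (n≮0 (≤-trans h (≤-reflexive (cnt-none λ e → ¬t⇒f λ p → n≮0 (below-t {0} {e} (∧-r {I e} p))))))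
      jump (suc a) h with rk I a ≤? i
      ... | no  r = jump a (≰⇒> r)
      ... | yes r with inh⊎empty ((I ∩ below (suc a)) ∖ below a)
      ...   | inj₂ em = ⊥-elim (<⇒≱ h (≤-trans (cnt-⊆ λ e p → ∧-l p ∧ⁱ (taut 2 (λ x y → x ⇒ᵇ not (x ∧ not y) ⇒ᵇ y) ((I ∩ below (suc a)) e) (below a e) $ᵇ p $ᵇ not-t (em e))) r))
      ...   | inj₁ (e , p) = e , Ie , ≤-antisym (subst (λ x → rk I x ≤ i) (sym πe) r) (s≤s⁻¹ (≤-trans (subst (λ x → i < rk I (suc x)) (sym πe) h) (rk-suc I e)))
        where
        Ie : I e ≡ true
        Ie = ∧-l (∧-l p)
        πe : π e ≡ a
        πe = ≤-antisym (s≤s⁻¹ (below-t {suc a} {e} (∧-r {I e} (∧-l p)))) (≮⇒≥ λ lt → absurdᵇ (t-below lt) (not-f (∧-r {(I ∩ below (suc a)) e} p)))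

  pos : Fin m → Fin m
  pos e = fromℕ< {rk full (π e)} (≤-trans (rk-strict full refl (s≤s (≤-sum π e))) (≤-trans (≤-reflexive (rk-N full)) (cnt≤n full)))

  toℕ-pos : ∀ e → toℕ (pos e) ≡ rk full (π e)
  toℕ-pos e = toℕ-fromℕ< _

  pos-mono : ∀ {e f} → π e < π f → toℕ (pos e) < toℕ (pos f)
  pos-mono {e} {f} lt = subst₂ _<_ (sym (toℕ-pos e)) (sym (toℕ-pos f)) (rk-strict full refl lt)

  pos-inj : ∀ {e f} → toℕ (pos e) ≡ toℕ (pos f) → e ≡ f
  pos-inj {e} {f} eq = rk-inj full refl refl (trans (sym (toℕ-pos e)) (trans eq (toℕ-pos f)))

  private
    sel : ∀ (y : Fin m) → ∃ λ e → full e ≡ true × rk full (π e) ≡ toℕ y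
    sel y = select full (≤-trans (toℕ<n y) (≤-reflexive (sym (cnt-full m))))

  inv : Fin m → Fin m
  inv y = proj₁ (sel y)

  pos-inv : ∀ y → pos (inv y) ≡ y
  pos-inv y = toℕ-injective (trans (toℕ-pos (inv y)) (proj₂ (proj₂ (sel y))))

  inv-pos : ∀ e → inv (pos e) ≡ e
  inv-pos e = pos-inj (cong toℕ (pos-inv (pos e)))

  opaque
    initial : ∀ (D : BSet m) → (∀ e f → D e ≡ true → D f ≡ false → π e < π f) → ∃ λ a → a ≤ N × (∀ e → D e ≡ below a e)
    initial D down = go N 0 (+-identityʳ N) (λ e p → ⊥-elim (n≮0 (below-t {0} {e} p)))
      where
      go : ∀ k a → k + a ≡ N → below a ⊆ D → ∃ λ a → a ≤ N × (∀ e → D e ≡ below a e)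
      go k a eq sub with inh⊎empty (D ∖ below a)
      ... | inj₂ em = a , subst (a ≤_) eq (m≤n+m a k) , λ e → bool-iff
            (λ p → taut 2 (λ d b → d ⇒ᵇ not (d ∧ not b) ⇒ᵇ b) (D e) (below a e) $ᵇ p $ᵇ not-t (em e)) (sub e)
      go zero a refl sub | inj₁ (e , p) = absurdᵇ (below-N e) (not-f (∧-r {D e} p))
      go (suc k) a eq sub | inj₁ (e , p) = go k (suc a) (trans (+-suc k a) eq) λ f q → [ id , (λ Df → ⊥-elim
          (<⇒≱ (down e f (∧-l p) Df) (≤-trans (s≤s⁻¹ (below-t {suc a} {f} q)) (≮⇒≥ λ lt → absurdᵇ (t-below lt) (not-f (∧-r {D e} p)))))) ]′ (dichotomy (D f))

module Path {m : ℕ} (M : Matroid m) (π : Fin m → ℕ) (π-inj : ∀ {x y} → π x ≡ π y → x ≡ y)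
            (certificate : Bases.Cert M full π) where

  open Matroid M
  open Bases M
  open Sort π π-inj

  -- One basis that meets every set of the sequence in as many elements as any independent set
  -- inside it.
  record Greedy (A : ℕ → BSet m) : Set where
    field
      B    : BSet m
      indB : Ind B
      best : ∀ a → a ≤ N → ∀ K → Ind K → K ⊆ A a → cnt K ≤ cnt (B ∩ A a)

  opaque
    greedy : ∀ A → (∀ a → A a ⊆ A (suc a)) → Greedy A
    greedy A mono = record { B = L N ; indB = Basis.ind (basis N) ; best = λ a le K iK K⊆ →
        ≤-trans (basis-max (basis a) iK K⊆) (cnt-⊆ λ e p → L-mono (≤⇒≤′ le) e p ∧ⁱ Basis.sub (basis a) e p) }
      where
      chain : ∀ a → ∃ (Basis (A a))
      next : ∀ a → ∃ λ B → proj₁ (chain a) ⊆ B × Basis (A (suc a)) B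
      chain zero    = let B , _ , b = extend {ε} {A 0} empty (λ _ ()) in B , b
      chain (suc a) = let B , _ , b = next a in B , b
      next a = extend (Basis.ind (proj₂ (chain a))) (λ e p → mono a e (Basis.sub (proj₂ (chain a)) e p))
      L : ℕ → BSet m
      L a = proj₁ (chain a)
      basis : ∀ a → Basis (A a) (L a)
      basis a = proj₂ (chain a)
      L-mono : ∀ {a b} → a ≤′ b → L a ⊆ L b
      L-mono ≤′-refl       e p = p
      L-mono (≤′-step {b} le) e p = proj₁ (proj₂ (next b)) e (L-mono le e p)

  private
    -- Final segments indexed so that they grow with `j`, as `greedy` demands; up to `N` they are
    -- the complements of the initial segments in reverse order.
    above : ℕ → BSet m
    above j e = does (N ≤? π e + j)

    above-∸ : ∀ {b} → b ≤ N → ∀ e → above (N ∸ b) e ≡ not (below b e)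
    above-∸ {b} le e = bool-iff
      (λ p → not-t (¬t⇒f λ q → <⇒≱ (≤-trans (+-monoˡ-≤ (N ∸ b) (below-t {b} {e} q)) (≤-reflexive (m+[n∸m]≡n le))) (does-t (N ≤? _) p)))
      (λ p → dec-t (N ≤? _) (≤-trans (≤-reflexive (sym (m+[n∸m]≡n le))) (+-monoˡ-≤ (N ∸ b) (≮⇒≥ λ lt → absurdᵇ (t-below lt) (not-f p)))))

  module G₀ = Greedy (greedy below λ a → below-mono (n≤1+n a))
  module G₁ = Greedy (greedy above λ a e p → dec-t (N ≤? _) (≤-trans (does-t (N ≤? _) p) (+-monoʳ-≤ (π e) (n≤1+n a))))
  open G₀ using () renaming (B to B₀)
  open G₁ using () renaming (B to B₁)

  lower : ∀ {a K} → a ≤ N → Ind K → K ⊆ below a → cnt K ≤ rk B₀ a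
  lower le iK K⊆ = G₀.best _ le _ iK K⊆

  upper : ∀ {b K} → b ≤ N → Ind K → Disj K (below b) → cnt K ≤ cnt (B₁ ∖ below b)
  upper {b} {K} le iK dis = ≤-trans (G₁.best (N ∸ b) (m∸n≤m N b) _ iK λ e p → trans (above-∸ le e) (not-t (¬t⇒f (dis e p))))
    (≤-reflexive (cnt-cong λ e → cong (B₁ e ∧_) (above-∸ le e)))

  r : ℕ
  r = cnt B₀

  ≤r : ∀ {K} → Ind K → cnt K ≤ r
  ≤r iK = ≤-trans (lower ≤-refl iK λ e _ → below-N e) (≤-reflexive (rk-N B₀))

  B₁-size : cnt B₁ ≡ r
  B₁-size = ≤-antisym (≤r G₁.indB) (≤-trans (upper z≤n G₀.indB λ e _ q → n≮0 (below-t {0} {e} q)) (cnt-⊆ λ _ → ∧-l))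

  rk-lower : ∀ {I a} → a ≤ N → Ind I → rk I a ≤ rk B₀ a
  rk-lower {I} le iI = lower le (hered (λ _ → ∧-l) iI) λ e → ∧-r {I e}

  rk-upper : ∀ {I b} → b ≤ N → Ind I → cnt I ≡ r → rk B₁ b ≤ rk I b
  rk-upper {I} {b} le iI card = lin (cnt I ∷ cnt B₁ ∷ r ∷ rk I b ∷ rk B₁ b ∷ cnt (I ∖ below b) ∷ cnt (B₁ ∖ below b) ∷ [])
    (λ { (i ∷ b ∷ r ∷ ib ∷ bb ∷ ia ∷ ba ∷ []) → (r :≤ i) ∷ (b :≤ r) ∷ (i :≤ ib :+ ia) ∷ (bb :+ ba :≤ b) ∷ (ia :≤ ba) ∷ [] ⊢ (bb :≤ ib) })
    ( ≤-reflexive (sym card) , ≤-reflexive B₁-size , ≤-reflexive (cnt-split I (below b)) , ≤-reflexive (sym (cnt-split B₁ (below b)))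
    , upper le (hered (λ _ → ∧-l) iI) λ e p q → absurdᵇ q (not-f (∧-r {I e} p)))

  private
    sel₀ : ∀ (i : Fin r) → ∃ λ e → B₀ e ≡ true × rk B₀ (π e) ≡ toℕ i
    sel₀ i = select B₀ (toℕ<n i)
    sel₁ : ∀ (i : Fin r) → ∃ λ e → B₁ e ≡ true × rk B₁ (π e) ≡ toℕ i
    sel₁ i = select B₁ (≤-trans (toℕ<n i) (≤-reflexive (sym B₁-size)))
    π<N : ∀ e → π e < N
    π<N e = s≤s (≤-sum π e)

  lo hi : Fin r → Fin m
  lo i = proj₁ (sel₀ i)
  hi i = proj₁ (sel₁ i)

  private
    rk-lo : ∀ i → rk B₀ (π (lo i)) ≡ toℕ i
    rk-lo i = proj₂ (proj₂ (sel₀ i))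
    rk-hi : ∀ i → rk B₁ (π (hi i)) ≡ toℕ i
    rk-hi i = proj₂ (proj₂ (sel₁ i))

    lo-≤ : ∀ {i x} → toℕ i < rk B₀ (suc (π x)) → π (lo i) ≤ π x
    lo-≤ {i} lt = ≮⇒≥ λ h → <⇒≱ lt (≤-trans (rk-mono B₀ h) (≤-reflexive (rk-lo i)))
    ≤-lo : ∀ {i x} → π (lo i) ≤ π x → toℕ i < rk B₀ (suc (π x))
    ≤-lo {i} le = ≤-trans (s≤s (≤-reflexive (sym (rk-lo i)))) (rk-strict B₀ (proj₁ (proj₂ (sel₀ i))) (s≤s le))
    ≤-hi : ∀ {i x} → rk B₁ (π x) ≤ toℕ i → π x ≤ π (hi i)
    ≤-hi {i} le = ≮⇒≥ λ h → <⇒≱ (rk-strict B₁ (proj₁ (proj₂ (sel₁ i))) h) (≤-trans le (≤-reflexive (sym (rk-hi i))))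
    hi-≤ : ∀ {i x} → π x ≤ π (hi i) → rk B₁ (π x) ≤ toℕ i
    hi-≤ {i} le = ≤-trans (rk-mono B₁ le) (≤-reflexive (rk-hi i))

  lo≤hi : ∀ i → π (lo i) ≤ π (hi i)
  lo≤hi i = lo-≤ {i} (≤-trans (s≤s (≤-reflexive (sym (rk-hi i)))) (≤-trans (rk-strict B₁ (proj₁ (proj₂ (sel₁ i))) ≤-refl) (rk-lower (π<N (hi i)) G₁.indB)))

  nested⇒≡ : ∀ i j → π (lo j) ≤ π (lo i) → π (hi i) ≤ π (hi j) → i ≡ j
  nested⇒≡ i j p q = toℕ-injective (≤-antisym (≤-trans (≤-reflexive (sym (rk-hi i))) (hi-≤ {j} q))
    (≤-trans (≤-reflexive (sym (rk-lo j))) (≤-trans (rk-mono B₀ p) (≤-reflexive (rk-lo i)))))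

  -- Each element is sent to its position in a basis containing `I`. Prefix counts of a basis lie
  -- between those of `B₁` and `B₀`, so its i-th element lies between the i-th elements of the
  -- greedy bases.
  ind⇒match : ∀ {I} → Ind I → Match π (π ∘ lo) (π ∘ hi) I
  ind⇒match {I} iI with extend {I} {full} iI (λ _ _ → refl)
  ... | B , I⊆B , bs = (λ e p → fromℕ< (small e p))
      , (λ x y p q eq → rk-inj B (I⊆B x p) (I⊆B y q) (trans (sym (toℕ-fromℕ< (small x p))) (trans (cong toℕ eq) (toℕ-fromℕ< (small y q)))))
      , λ x p → lo-≤ {fromℕ< (small x p)} (≤-trans (≤-reflexive (cong suc (toℕ-fromℕ< (small x p)))) (≤-trans (rk-strict B (I⊆B x p) ≤-refl) (rk-lower (π<N x) (Basis.ind bs))))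
              , ≤-hi {fromℕ< (small x p)} (≤-trans (rk-upper (<⇒≤ (π<N x)) (Basis.ind bs) card) (≤-reflexive (sym (toℕ-fromℕ< (small x p)))))
    where
    card : cnt B ≡ r
    card = ≤-antisym (≤r (Basis.ind bs)) (basis-max bs G₀.indB λ _ _ → refl)
    small : ∀ e → I e ≡ true → rk B (π e) < r
    small e p = ≤-trans (rk-strict B (I⊆B e p) (π<N e)) (≤-reflexive (trans (rk-N B) card))

  private
    cnt-< : ∀ {k} a → a ≤ k → cnt {k} (λ j → does (toℕ j <? a)) ≡ a
    cnt-< {k} zero    _  = cnt-none λ _ → refl
    cnt-< {suc k} (suc a) le = trans (cnt-sum _) (cong suc (trans (sym (cnt-sum _)) (trans (cnt-cong λ j → refl) (cnt-< a (s≤s⁻¹ le)))))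

  -- For a dependent `I` the segments are cut off at `a` and `b`. The elements of `I` in their
  -- overlap need intervals with indices from q up to p, hence number at most p - q. But p is at
  -- most `d` and r - q at most `t`, which contradicts `big`.
  match⇒ind : ∀ {I} → Match π (π ∘ lo) (π ∘ hi) I → Ind I
  match⇒ind {I} (φ , inj , fits) with dec I
  ... | yes iI = iI
  ... | no dep = ⊥-elim too-many
    where
    open Bad (certificate I (λ _ _ → refl) dep)
    iD : ∃ λ a → a ≤ N × (∀ e → D e ≡ below a e)
    iD = initial D λ e f p q → down e f p refl q
    iT : ∃ λ b → b ≤ N × (∀ e → not (T e) ≡ below b e)
    iT = initial (not ∘ T) λ e f p q → up f e (taut 1 (λ x → not (not x) ⇒ᵇ x) (T f) $ᵇ not-t q) refl (not-f p)
    a b p q : ℕ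
    a = proj₁ iD
    b = proj₁ iT
    a≤ : a ≤ N
    a≤ = proj₁ (proj₂ iD)
    A : BSet m
    A = I ∩ (D ∩ T)
    D-below : ∀ e → D e ≡ below a e
    D-below = proj₂ (proj₂ iD)
    T-below : ∀ e → not (T e) ≡ below b e
    T-below = proj₂ (proj₂ iT)
    p = rk B₀ a
    q = rk B₁ b
    under : ℕ → BSet r
    under c j = does (toℕ j <? c)
    window : cnt A ≤ cnt (under p ∖ under q)
    window = cnt-inj A (under p ∖ under q) (λ x h → φ x (∧-l h))
      (λ x h → let j = φ x (∧-l h) ; l , u = fits x (∧-l h) in
          dec-t (toℕ j <? p) (≤-trans (≤-lo {j} l) (rk-mono B₀ (below-t {a} {x} (trans (sym (D-below x)) (∧-l (∧-r {I x} h))))))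
        ∧ⁱ not-t (¬t⇒f λ lt → <⇒≱ (does-t (toℕ j <? q) lt) (≤-trans (rk-mono B₁ (≮⇒≥ λ x<b → absurdᵇ (∧-r {D x} (∧-r {I x} h)) (not-f (trans (T-below x) (t-below {b} {x} x<b))))) (hi-≤ {j} u))))
      (λ x y h k → inj x y _ _)
    p≤r : p ≤ r
    p≤r = ≤-trans (rk-mono B₀ a≤) (≤-reflexive (rk-N B₀))
    room : cnt A + q ≤ p
    room with q ≤? p
    ... | yes q≤p = lin (cnt A ∷ q ∷ p ∷ cnt (under p) ∷ cnt (under q) ∷ cnt (under p ∩ under q) ∷ cnt (under p ∖ under q) ∷ [])
        (λ { (a ∷ q ∷ p ∷ up ∷ uq ∷ i ∷ d ∷ []) → (a :≤ d) ∷ (i :+ d :≤ up) ∷ (up :≤ p) ∷ (q :≤ uq) ∷ (uq :≤ i) ∷ [] ⊢ (a :+ q :≤ p) })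
        ( window , ≤-reflexive (sym (cnt-split (under p) (under q))) , ≤-reflexive (cnt-< p p≤r) , ≤-reflexive (sym (cnt-< q (≤-trans q≤p p≤r)))
        , cnt-⊆ λ j h → dec-t (toℕ j <? p) (≤-trans (does-t (toℕ j <? q) h) q≤p) ∧ⁱ h)
    -- With q above p no index is available, while `some` provides an element that needs one.
    ... | no q≰p = ⊥-elim (1+n≰n (≤-trans some (≤-trans window (≤-reflexive (cnt-none λ j → ¬t⇒f λ h →
        <⇒≱ (≤-trans (does-t (toℕ j <? p) (∧-l h)) (<⇒≤ (≰⇒> q≰p))) (≮⇒≥ λ lt → absurdᵇ (dec-t (toℕ j <? q) lt) (not-f (∧-r {under p j} h))))))))
    too-many : ⊥
    too-many = 1+n≰n (lin (d ∷ t ∷ cnt A ∷ cnt B ∷ p ∷ q ∷ r ∷ cnt B₁ ∷ cnt (B₁ ∖ below b) ∷ [])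
      (λ { (d ∷ t ∷ a ∷ bb ∷ p ∷ q ∷ r ∷ b₁ ∷ u ∷ []) → (con 1 :+ (d :+ t) :≤ a :+ bb) ∷ (bb :≤ r) ∷ (a :+ q :≤ p) ∷ (p :≤ d) ∷ (u :≤ t) ∷ (r :≤ b₁) ∷ (b₁ :≤ q :+ u) ∷ [] ⊢ (con 1 :+ d :≤ d) })
      ( big , ≤r indB , room
      , rD _ (hered (λ _ → ∧-l) G₀.indB) (λ e h → trans (D-below e) (∧-r {B₀ e} h))
      , rT _ (hered (λ _ → ∧-l) G₁.indB) (λ e h → taut 2 (λ t b → not (t xor b) ⇒ᵇ t ⇒ᵇ b) (not (below b e)) (T e) $ᵇ agree (T e) (below b e) (T-below e) $ᵇ ∧-r {B₁ e} h)
      , ≤-reflexive (sym B₁-size) , ≤-reflexive (cnt-split B₁ (below b))))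
      where
      agree : ∀ x y → not x ≡ y → not (not y xor x) ≡ true
      agree true  _ refl = refl
      agree false _ refl = refl

-- Betweenness in lattice path matroids

⊆-size : ∀ {n} {A B : BSet n} → A ⊆ B → cnt B ≤ cnt A → B ⊆ A
⊆-size {A = A} h le v p with dichotomy (A v)
... | inj₁ q = q
... | inj₂ q = ⊥-elim (<⇒≱ (cnt-⊂ h v q p) le)

module Exchange {m : ℕ} (M : Matroid m) where

  open Matroid M
  open Bases M

  -- Extend `Q` to a basis `P` of `Q ∪ K`. It is at least as large as `K` and has no more elements
  -- in `Y` than `K` has, so outside `Y` it must contain everything that `K` contains.
  swap : ∀ {Y Q R K} → Basis Y Q → Basis Y R → Ind K → R ⊆ K → Ind (Q ∪ (K ∖ Y))
  swap {Y} {Q} {R} {K} bQ bR iK R⊆K with extend {Q} {Q ∪ K} (Basis.ind bQ) (λ _ → ∨-l)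
  ... | P , Q⊆P , bP = hered {P} (∪-⊆ Q⊆P λ e p → ∧-l (⊆-size {A = P ∖ Y} {K ∖ Y} outer card e p)) (Basis.ind bP)
    where
    outer : P ∖ Y ⊆ K ∖ Y
    outer e p = taut 4 (λ p y q k → (p ⇒ᵇ (q ∨ k)) ⇒ᵇ (q ⇒ᵇ y) ⇒ᵇ (p ∧ not y) ⇒ᵇ (k ∧ not y)) (P e) (Y e) (Q e) (K e)
      $ᵇ ⊆⇒ᵇ (Basis.sub bP e) $ᵇ ⊆⇒ᵇ (Basis.sub bQ e) $ᵇ p
    card : cnt (K ∖ Y) ≤ cnt (P ∖ Y)
    card = lin (cnt K ∷ cnt P ∷ cnt R ∷ cnt Q ∷ cnt (K ∩ Y) ∷ cnt (K ∖ Y) ∷ cnt (P ∩ Y) ∷ cnt (P ∖ Y) ∷ [])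
      (λ { (k ∷ p ∷ r ∷ q ∷ ki ∷ ko ∷ pi ∷ po ∷ []) → (ki :+ ko :≤ k) ∷ (k :≤ p) ∷ (p :≤ pi :+ po) ∷ (r :≤ ki) ∷ (pi :≤ q) ∷ (q :≤ r) ∷ [] ⊢ (ko :≤ po) })
      ( ≤-reflexive (sym (cnt-split K Y)) , basis-max bP iK (λ e → ∨-r {Q e}) , ≤-reflexive (cnt-split P Y)
      , cnt-⊆ (λ e p → R⊆K e p ∧ⁱ Basis.sub bR e p) , basis-max bQ (hered (λ _ → ∧-l) (Basis.ind bP)) (λ e → ∧-r {P e})
      , basis-max bR (Basis.ind bQ) (Basis.sub bQ))

Mid : ∀ {h} → (Fin h → ℕ) → Fin h → Fin h → Fin h → Set
Mid ρ x y z = (ρ x < ρ y × ρ y < ρ z) ⊎ (ρ z < ρ y × ρ y < ρ x)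

mid-one : ∀ {h} (ρ : Fin h → ℕ) → (∀ x y → ρ x ≡ ρ y → x ≡ y) → ∀ x y z → x == y ≡ false → x == z ≡ false → y == z ≡ false →
          Mid ρ x y z ⊎ Mid ρ y x z ⊎ Mid ρ x z y
mid-one ρ inj x y z xy xz yz with <-cmp (ρ x) (ρ y) | <-cmp (ρ x) (ρ z) | <-cmp (ρ y) (ρ z)
... | tri≈ _ e _ | _ | _ = absurdᵇ (subst (λ w → x == w ≡ true) (inj _ _ e) (==-refl x)) xy
... | _ | tri≈ _ e _ | _ = absurdᵇ (subst (λ w → x == w ≡ true) (inj _ _ e) (==-refl x)) xz
... | _ | _ | tri≈ _ e _ = absurdᵇ (subst (λ w → y == w ≡ true) (inj _ _ e) (==-refl y)) yz
... | tri< a _ _ | _ | tri< c _ _ = inj₁ (inj₁ (a , c))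
... | tri> _ _ a | _ | tri> _ _ c = inj₁ (inj₂ (c , a))
... | tri> _ _ a | tri< b _ _ | _ = inj₂ (inj₁ (inj₁ (a , b)))
... | tri< a _ _ | tri> _ _ b | _ = inj₂ (inj₁ (inj₂ (b , a)))
... | _ | tri< b _ _ | tri> _ _ c = inj₂ (inj₂ (inj₁ (b , c)))
... | _ | tri> _ _ b | tri< c _ _ = inj₂ (inj₂ (inj₂ (c , b)))

-- Lifting bases of a minor, and tests for forbidden betweenness

record MinorOf {m} (M : Matroid m) (H : Graph) : Set where
  open Matroid M
  open Bases M
  open Gr (Cycles.s H) (Cycles.t H) using (Hall)
  field
    f    : Fin (nE H) → Fin m
    inj  : ∀ x y → f x ≡ f y → x ≡ y
    C    : BSet m
    off  : ∀ x → C (f x) ≡ false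
    -- One direction supplies some basis of `C`, the other accepts any; `swap` later makes the
    -- choice immaterial.
    to   : ∀ S → Hall S → ∃ λ B → Basis C B × Ind (Image.im f inj S ∪ B)
    from : ∀ S B → Basis C B → Ind (Image.im f inj S ∪ B) → Hall S

module Test (H : Graph) where

  open Gr (Cycles.s H) (Cycles.t H) using (Hall)

  opaque
    -- Opaque, so that the truth tables are evaluated only for the eight concrete graphs, where the
    -- definitions are unfolded.
    hall base : BSet (nE H) → Bool
    hall = hallᵇ (Cycles.s H) (Cycles.t H)
    base S = hall S ∧ does (all? λ y → (S y ∨ not (hall (S ∪ ⁅ y ⁆))) ≟ᵇ true)

    base-hall : ∀ S → base S ≡ true → Hall S
    base-hall S p = hallᵇ-sound (Cycles.s H) (Cycles.t H) S (∧-l p)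

    not-hall : ∀ S → hall S ≡ false → ¬ Hall S
    not-hall S p h = absurdᵇ (hallᵇ-complete (Cycles.s H) (Cycles.t H) S h) p

    base-max : ∀ S → base S ≡ true → ∀ y → S y ≡ false → ¬ Hall (S ∪ ⁅ y ⁆)
    base-max S p y Sy = [ (λ q → absurdᵇ q Sy) , (λ q → not-hall (S ∪ ⁅ y ⁆) (not-f q)) ]′
      (∨-case {S y} (does-t (all? λ y → (S y ∨ not (hall (S ∪ ⁅ y ⁆))) ≟ᵇ true) (∧-r {hall S} p) y))

  away : BSet (nE H) → Fin (nE H) → Fin (nE H) → Fin (nE H) → Bool
  away A x y z = not (A x) ∧ not (A y) ∧ not (A z)

  obstructs₁ obstructs₂ : BSet (nE H) → Fin (nE H) → Fin (nE H) → Fin (nE H) → Bool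
  obstructs₁ A x y z = away A x y z ∧ base (A ∪ ⁅ x ⁆) ∧ base (A ∪ ⁅ z ⁆) ∧ not (hall (A ∪ ⁅ y ⁆))
  obstructs₂ A x y z = away A x y z ∧ base (A ∪ ⁅ x ⁆ ∪ ⁅ y ⁆) ∧ base (A ∪ ⁅ y ⁆ ∪ ⁅ z ⁆) ∧ not (hall (A ∪ ⁅ x ⁆ ∪ ⁅ z ⁆))

module Contraction {m : ℕ} (M : Matroid m) {H : Graph} (mo : MinorOf M H) where

  open Matroid M
  open Bases M
  open Exchange M
  open MinorOf mo
  open Image f inj
  open Gr (Cycles.s H) (Cycles.t H) using (Hall)
  open Test H
  private h = nE H

  im-insert : ∀ S x e → im (S ∪ ⁅ x ⁆) e ≡ im S e ∨ e == f x
  im-insert S x e = bool-iff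
    (λ p → let y , q , eq = im-∈ {S ∪ ⁅ x ⁆} p in
      [ (λ r → ∨-l (subst (λ e → im S e ≡ true) eq (im-∋ {S} y r)))
      , (λ r → ∨-r {im S e} (subst₂ (λ e y → e == f y ≡ true) eq (==-t r) (==-refl (f y)))) ]′ (∨-case {S y} q))
    (λ p → [ (λ q → let y , r , eq = im-∈ {S} q in subst (λ e → im (S ∪ ⁅ x ⁆) e ≡ true) eq (im-∋ {S ∪ ⁅ x ⁆} y (∨-l r)))
           , (λ q → subst (λ e → im (S ∪ ⁅ x ⁆) e ≡ true) (sym (==-t q)) (im-∋ {S ∪ ⁅ x ⁆} x (∨-r {S x} (==-refl x)))) ]′ (∨-case {im S e} p))

  im-off : ∀ {S e} → im S e ≡ true → C e ≡ false
  im-off {S} p = let y , _ , eq = im-∈ {S} p in subst (λ e → C e ≡ false) eq (off y)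

  private
    opaque
      core : ∃ λ B → ε ⊆ B × Basis C B
      core = extend {ε} empty (λ _ ())
    Y : BSet m
    Y = im full ∪ C

  B : BSet m
  B = proj₁ core

  bB : Basis C B
  bB = proj₂ (proj₂ core)

  hall⇒ind : ∀ S → Hall S → Ind (im S ∪ B)
  hall⇒ind S hS with to S hS
  ... | B′ , b , i = hered (∪-⊆ (λ e p → ∨-r {B e} (∨-l p ∧ⁱ not-t (im-off {S} p))) (λ e p → ∨-l p)) (swap bB b i λ e → ∨-r {im S e})

  ind⇒hall : ∀ S → Ind (im S ∪ B) → Hall S
  ind⇒hall S = from S B bB

  base-basis : ∀ S → base S ≡ true → Basis Y (im S ∪ B)
  base-basis S p = record
    { sub = ∪-⊆ (λ e q → let y , _ , eq = im-∈ {S} q in ∨-l (subst (λ e → im full e ≡ true) eq (im-∋ {full} y refl))) (λ e q → ∨-r {im full e} (Basis.sub bB e q))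
    ; ind = hall⇒ind S (base-hall S p)
    ; max = λ e q r i → [ (λ u → new e r i (im-∈ {full} u)) , (λ Ce → Basis.max bB e Ce (¬t⇒f λ w → absurdᵇ (∨-r {im S e} w) r)
        (hered (λ v w → [ (λ a → ∨-l (∨-r {im S v} a)) , (λ a → ∨-r {(im S ∪ B) v} a) ]′ (∨-case {B v} w)) i)) ]′ (∨-case {im full e} q) }
    where
    new : ∀ e → (im S ∪ B) e ≡ false → Ind ((im S ∪ B) ∪ ⁅ e ⁆) → (∃ λ y → full y ≡ true × f y ≡ e) → ⊥
    new _ r i (y , _ , refl) = base-max S p y (¬t⇒f λ Sy → absurdᵇ (∨-l (im-∋ {S} y Sy)) r) (ind⇒hall (S ∪ ⁅ y ⁆) (hered sub i))
      where
      sub : im (S ∪ ⁅ y ⁆) ∪ B ⊆ (im S ∪ B) ∪ ⁅ f y ⁆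
      sub v w = taut 3 (λ a b c → ((a ∨ b) ∨ c) ⇒ᵇ ((a ∨ c) ∨ b)) (im S v) (v == f y) (B v) $ᵇ subst (λ z → z ∨ B v ≡ true) (im-insert S y v) w

  module _ (S₁ : BSet h) (base₁ : base S₁ ≡ true) where

    private
      opaque
        big : ∃ λ K → im S₁ ∪ B ⊆ K × Basis full K
        big = extend {im S₁ ∪ B} (Basis.ind (base-basis S₁ base₁)) (λ _ _ → refl)
      K : BSet m
      K = proj₁ big
      bK : Basis full K
      bK = proj₂ (proj₂ big)

    -- S ↦ fill S carries the bases of the minor to bases of M.
    fill : BSet h → BSet m
    fill S = (im S ∪ B) ∪ (K ∖ Y)

    fill-insert : ∀ S x e → fill (S ∪ ⁅ x ⁆) e ≡ (fill S ∪ ⁅ f x ⁆) e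
    fill-insert S x e = trans (cong (λ z → (z ∨ B e) ∨ (K ∖ Y) e) (im-insert S x e)) (rotate (im S e) (e == f x) (B e) ((K ∖ Y) e))
      where
      rotate : ∀ a b c d → ((a ∨ b) ∨ c) ∨ d ≡ ((a ∨ c) ∨ d) ∨ b
      rotate a b c d = bool-iff
        (taut 4 (λ a b c d → (((a ∨ b) ∨ c) ∨ d) ⇒ᵇ (((a ∨ c) ∨ d) ∨ b)) a b c d $ᵇ_)
        (taut 4 (λ a b c d → (((a ∨ c) ∨ d) ∨ b) ⇒ᵇ (((a ∨ b) ∨ c) ∨ d)) a b c d $ᵇ_)

    fill-at : ∀ S x → S x ≡ false → fill S (f x) ≡ false
    fill-at S x p = ¬t⇒f λ q → [ (λ r → [ (λ u → absurdᵇ (trans (sym (im-at S x)) u) p) , (λ u → absurdᵇ (Basis.sub bB (f x) u) (off x)) ]′ (∨-case {im S (f x)} r))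
                              , (λ r → absurdᵇ (∨-l (im-∋ {full} x refl)) (not-f (∧-r {K (f x)} r))) ]′ (∨-case {(im S ∪ B) (f x)} q)

    -- Two bases of the minor, each joined with `B`, are bases of `Y`; `swap` replaces one by the
    -- other under the same elements outside `Y`.
    fill-ind : ∀ S → base S ≡ true → Ind (fill S)
    fill-ind S p = swap (base-basis S p) (base-basis S₁ base₁) (Basis.ind bK) (proj₁ (proj₂ big))

    fill-size : ∀ {k} → (∀ {B} → Basis full B → cnt B ≡ k) → (∀ {I} → Ind I → cnt I ≤ k) → ∀ S → base S ≡ true → cnt (fill S) ≡ k
    fill-size {k} card most S p = ≤-antisym (most (fill-ind S p)) (≤-trans (≤-reflexive (sym (card bK)))
      (≤-trans (≤-reflexive (cnt-split K Y)) (≤-trans (+-monoˡ-≤ (cnt (K ∖ Y)) (basis-max (base-basis S p) (hered (λ _ → ∧-l) (Basis.ind bK)) λ e → ∧-r {K e}))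
        (cnt-∪ λ e q r → absurdᵇ (Basis.sub (base-basis S p) e q) (not-f (∧-r {K e} r))))))

    fill-hall : ∀ S → Ind (fill S) → Hall S
    fill-hall S i = ind⇒hall S (hered (λ e → ∨-l) i)

record Presentation {m} (M : Matroid m) : Set where
  field
    π       : Fin m → ℕ
    π-inj   : ∀ {x y} → π x ≡ π y → x ≡ y
    k       : ℕ
    lo hi   : Fin k → ℕ
    at      : Fin k → Fin m
    π-at    : ∀ i → π (at i) ≡ lo i
    lo≤hi   : ∀ i → lo i ≤ hi i
    nested⇒≡  : ∀ i j → lo j ≤ lo i → hi i ≤ hi j → i ≡ j
    ind⇒match : ∀ {I} → Matroid.Ind M I → Match π lo hi I
    match⇒ind : ∀ {I} → Match π lo hi I → Matroid.Ind M I

module LatticePath {m : ℕ} (M : Matroid m) (P : Presentation M) where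

  open Matroid M
  open Bases M
  open Presentation P
  open Sort π π-inj

  private
    lo-inj : ∀ {i j} → lo i ≡ lo j → i ≡ j
    lo-inj {i} {j} eq = [ nested⇒≡ i j (≤-reflexive (sym eq)) , (λ le → sym (nested⇒≡ j i (≤-reflexive eq) le)) ]′ (≤-total (hi i) (hi j))

    module L = Sort lo lo-inj

    ended : ℕ → BSet k
    ended a l = does (hi l <? a)

  ind-≤ : ∀ {I} → Ind I → cnt I ≤ k
  ind-≤ {I} iI = ≤-trans (cnt-inj I full (proj₁ φ) (λ _ _ → refl) (proj₁ (proj₂ φ))) (≤-reflexive (cnt-full k))
    where
    φ : Match π lo hi I
    φ = ind⇒match iI

  basis-size : ∀ {B} → Basis full B → cnt B ≡ k
  basis-size {B} b = ≤-antisym (ind-≤ (Basis.ind b)) (≤-trans (≤-reflexive (sym card)) (basis-max b starts λ _ _ → refl))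
    where
    open Image at (λ x y e → lo-inj (trans (sym (π-at x)) (trans (cong π e) (π-at y))))
    starts : Ind (im full)
    starts = match⇒ind ( (λ e p → proj₁ (im-∈ {full} p))
                       , (λ x y p q e → trans (sym (proj₂ (proj₂ (im-∈ {full} p)))) (trans (cong at e) (proj₂ (proj₂ (im-∈ {full} q)))))
                       , (λ x p → ≤-reflexive (start x p) , ≤-trans (≤-reflexive (sym (start x p))) (lo≤hi _)))
      where
      start : ∀ x p → lo (proj₁ (im-∈ {full} {x} p)) ≡ π x
      start x p = trans (sym (π-at _)) (cong π (proj₂ (proj₂ (im-∈ {full} p))))
    card : cnt (im full) ≡ k
    card = trans (cnt-cong λ e → sym (∧-true (im full e))) (trans (im-cnt full full) (cnt-full k))
      where
      ∧-true : ∀ a → a ∧ true ≡ a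
      ∧-true true  = refl
      ∧-true false = refl

  rk-≤ : ∀ {I} a → Ind I → rk I a ≤ L.rk full a
  rk-≤ {I} a iI = cnt-inj (I ∩ below a) (full ∩ L.below a) (λ x p → proj₁ φ x (∧-l p))
    (λ x p → L.t-below (≤-trans (s≤s (proj₁ (proj₂ (proj₂ φ) x (∧-l p)))) (below-t {a} {x} (∧-r {I x} p)))) (λ x y p q → proj₁ (proj₂ φ) x y _ _)
    where
    φ : Match π lo hi I
    φ = ind⇒match iI

  -- A set of size `k` uses every interval, and the elements from `a` on cannot use those that have
  -- already ended.
  rk-≥ : ∀ {I} a → Ind I → cnt I ≡ k → cnt (ended a) ≤ rk I a
  rk-≥ {I} a iI card = lin (cnt I ∷ k ∷ rk I a ∷ cnt (I ∖ below a) ∷ cnt (full {k}) ∷ cnt (ended a) ∷ cnt (full ∖ ended a) ∷ [])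
    (λ { (i ∷ k ∷ r ∷ u ∷ f ∷ e ∷ v ∷ []) → (f :≤ k) ∷ (k :≤ i) ∷ (i :≤ r :+ u) ∷ (u :≤ v) ∷ (e :+ v :≤ f) ∷ [] ⊢ (e :≤ r) })
    ( ≤-reflexive (cnt-full k) , ≤-reflexive (sym card) , ≤-reflexive (cnt-split I (below a))
    , cnt-inj (I ∖ below a) (full ∖ ended a) (λ x p → proj₁ φ x (∧-l p))
        (λ x p → not-t (¬t⇒f λ q → absurdᵇ (t-below (≤-trans (s≤s (proj₂ (proj₂ (proj₂ φ) x (∧-l p)))) (does-t (_ <? a) q))) (not-f (∧-r {I x} p))))
        (λ x y p q → proj₁ (proj₂ φ) x y _ _)
    , ≤-reflexive (sym (cnt-split full (ended a))))
    where
    φ : Match π lo hi I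
    φ = ind⇒match iI

  -- Independence of a set of size k depends only on its prefix counts, which range over an interval.
  exchange : ∀ {I₁ I₂ I} → Ind I₁ → Ind I₂ → cnt I₁ ≡ k → cnt I₂ ≡ k → cnt I ≡ k →
             (∀ a → (rk I₁ a ≤ rk I a) ⊎ (rk I₂ a ≤ rk I a)) → (∀ a → (rk I a ≤ rk I₁ a) ⊎ (rk I a ≤ rk I₂ a)) → Ind I
  exchange {I₁} {I₂} {I} i₁ i₂ c₁ c₂ c low high = match⇒ind ((λ x p → proj₁ (sel x p))
      , (λ x y p q e → rk-inj I p q (trans (sym (rk-sel x p)) (trans (cong (L.rk full ∘ lo) e) (rk-sel y q))))
      , λ x p → ≮⇒≥ (starts x p) , ≮⇒≥ (stops x p))
    where
    -- The i-th element of `I` receives the i-th interval by left ends.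
    sel : ∀ x → I x ≡ true → ∃ λ i → full i ≡ true × L.rk full (lo i) ≡ rk I (π x)
    sel x p = L.select full (≤-trans (rk-strict I p (s≤s (≤-sum π x))) (≤-trans (≤-reflexive (trans (rk-N I) c)) (≤-reflexive (sym (cnt-full k)))))
    rk-sel : ∀ x p → L.rk full (lo (proj₁ (sel x p))) ≡ rk I (π x)
    rk-sel x p = proj₂ (proj₂ (sel x p))
    I-≤ : ∀ a → rk I a ≤ L.rk full a
    I-≤ a = [ (λ h → ≤-trans h (rk-≤ a i₁)) , (λ h → ≤-trans h (rk-≤ a i₂)) ]′ (high a)
    I-≥ : ∀ a → cnt (ended a) ≤ rk I a
    I-≥ a = [ (λ h → ≤-trans (rk-≥ a i₁ c₁) h) , (λ h → ≤-trans (rk-≥ a i₂ c₂) h) ]′ (low a)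
    starts : ∀ x p → ¬ (π x < lo (proj₁ (sel x p)))
    starts x p lt = <⇒≱ (rk-strict I p ≤-refl) (≤-trans (I-≤ (suc (π x))) (≤-trans (L.rk-mono full lt) (≤-reflexive (rk-sel x p))))
    -- If interval `i` ended before `x`, so would all intervals that start earlier, by
    -- incomparability. These are more intervals than `I` has elements before `x`.
    stops : ∀ x p → ¬ (hi (proj₁ (sel x p)) < π x)
    stops x p lt = <⇒≱ (cnt-⊂ {p = full ∩ L.below (lo i)} {q = ended (π x)} earlier i
        (¬t⇒f λ q → <-irrefl refl (L.below-t {lo i} {i} q)) (dec-t (hi i <? π x) lt)) (≤-trans (I-≥ (π x)) (≤-reflexive (sym (rk-sel x p))))
      where
      i = proj₁ (sel x p)
      earlier : ∀ l → (full ∩ L.below (lo i)) l ≡ true → ended (π x) l ≡ true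
      earlier l q = dec-t (hi l <? π x) (<-trans (≰⇒> λ le → <-irrefl (cong lo (sym (nested⇒≡ i l (<⇒≤ (L.below-t {lo i} {l} q)) le))) (L.below-t {lo i} {l} q)) lt)

  private
    rk-insert : ∀ I v a → I v ≡ false → rk (I ∪ ⁅ v ⁆) a ≡ rk I a + b2n (below a v)
    rk-insert I v a h with below a v in eq
    ... | true = trans (trans (cnt-cong λ e → pointwise e) (cnt-insert (I ∩ below a) v (cong (_∧ below a v) h))) (+-comm 1 _)
      where
      pointwise : ∀ e → (I e ∨ e == v) ∧ below a e ≡ (I e ∧ below a e) ∨ e == v
      pointwise e with e ≟ᶠ v
      ... | yes refl rewrite eq | h = refl
      ... | no _ = bool-iff (λ p → taut 2 (λ i b → ((i ∨ false) ∧ b) ⇒ᵇ ((i ∧ b) ∨ false)) (I e) (below a e) $ᵇ p)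
                            (λ p → taut 2 (λ i b → ((i ∧ b) ∨ false) ⇒ᵇ ((i ∨ false) ∧ b)) (I e) (below a e) $ᵇ p)
    ... | false = trans (cnt-cong λ e → pointwise e) (sym (+-identityʳ _))
      where
      pointwise : ∀ e → (I e ∨ e == v) ∧ below a e ≡ I e ∧ below a e
      pointwise e with e ≟ᶠ v
      ... | yes refl rewrite eq | h = refl
      ... | no _ = bool-iff (λ p → taut 2 (λ i b → ((i ∨ false) ∧ b) ⇒ᵇ (i ∧ b)) (I e) (below a e) $ᵇ p)
                            (λ p → taut 2 (λ i b → (i ∧ b) ⇒ᵇ ((i ∨ false) ∧ b)) (I e) (below a e) $ᵇ p)

    below-≤ : ∀ {u v} a → π u < π v → b2n (below a v) ≤ b2n (below a u)
    below-≤ {u} {v} a lt = b2n≤ λ p → t-below (<-trans lt (below-t {a} {v} p))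

    two : ∀ A u v a → A u ≡ false → A v ≡ false → ¬ u ≡ v → rk (A ∪ ⁅ u ⁆ ∪ ⁅ v ⁆) a ≡ (rk A a + b2n (below a u)) + b2n (below a v)
    two A u v a hu hv ne = trans (rk-insert (A ∪ ⁅ u ⁆) v a (cong₂ _∨_ hv (==-f (ne ∘ sym)))) (cong (_+ b2n (below a v)) (rk-insert A u a hu))

    mid-≢ : ∀ {x y z} → Mid π x y z → ¬ x ≡ y × ¬ y ≡ z × ¬ x ≡ z
    mid-≢ (inj₁ (a , b)) = (λ { refl → <-irrefl refl a }) , (λ { refl → <-irrefl refl b }) , (λ { refl → <-asym a b })
    mid-≢ (inj₂ (a , b)) = (λ { refl → <-irrefl refl b }) , (λ { refl → <-irrefl refl a }) , (λ { refl → <-asym a b })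

    split-mid : ∀ {x y z} → Mid π x y z → ∀ a → let b = λ u → b2n (below a u) in (b x ≤ b y × b y ≤ b z) ⊎ (b z ≤ b y × b y ≤ b x)
    split-mid (inj₁ (p , q)) a = inj₂ (below-≤ a q , below-≤ a p)
    split-mid (inj₂ (p , q)) a = inj₁ (below-≤ a q , below-≤ a p)

  one-mid : ∀ {A x y z} → Mid π x y z → A x ≡ false → A y ≡ false → A z ≡ false →
            Ind (A ∪ ⁅ x ⁆) → Ind (A ∪ ⁅ z ⁆) → cnt (A ∪ ⁅ x ⁆) ≡ k → Ind (A ∪ ⁅ y ⁆)
  one-mid {A} {x} {y} {z} mid hx hy hz ix iz c = exchange ix iz c (trans (card hz) (trans (sym (card hx)) c)) (trans (card hy) (trans (sym (card hx)) c))
      (λ a → [ (λ (p , q) → inj₁ (by a hx hy p)) , (λ (p , q) → inj₂ (by a hz hy p)) ]′ (split-mid mid a))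
      (λ a → [ (λ (p , q) → inj₂ (by a hy hz q)) , (λ (p , q) → inj₁ (by a hy hx q)) ]′ (split-mid mid a))
    where
    card : ∀ {v} → A v ≡ false → cnt (A ∪ ⁅ v ⁆) ≡ suc (cnt A)
    card h = cnt-insert A _ h
    by : ∀ {u v} a → A u ≡ false → A v ≡ false → b2n (below a u) ≤ b2n (below a v) → rk (A ∪ ⁅ u ⁆) a ≤ rk (A ∪ ⁅ v ⁆) a
    by {u} {v} a hu hv le = subst₂ _≤_ (sym (rk-insert A u a hu)) (sym (rk-insert A v a hv)) (+-monoʳ-≤ (rk A a) le)

  two-mid : ∀ {A x y z} → Mid π x y z → A x ≡ false → A y ≡ false → A z ≡ false →
            Ind (A ∪ ⁅ x ⁆ ∪ ⁅ y ⁆) → Ind (A ∪ ⁅ y ⁆ ∪ ⁅ z ⁆) → cnt (A ∪ ⁅ x ⁆ ∪ ⁅ y ⁆) ≡ k → Ind (A ∪ ⁅ x ⁆ ∪ ⁅ z ⁆)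
  two-mid {A} {x} {y} {z} mid hx hy hz ixy iyz c = exchange ixy iyz c (trans (card hy hz yz) (trans (sym (card hx hy xy)) c)) (trans (card hx hz xz) (trans (sym (card hx hy xy)) c))
      (λ a → [ (λ (p , q) → inj₁ (last a q)) , (λ (p , q) → inj₂ (first a q)) ]′ (split-mid mid a))
      (λ a → [ (λ (p , q) → inj₂ (first′ a p)) , (λ (p , q) → inj₁ (last′ a p)) ]′ (split-mid mid a))
    where
    xy = proj₁ (mid-≢ mid)
    yz = proj₁ (proj₂ (mid-≢ mid))
    xz = proj₂ (proj₂ (mid-≢ mid))
    card : ∀ {u v} → A u ≡ false → A v ≡ false → ¬ u ≡ v → cnt (A ∪ ⁅ u ⁆ ∪ ⁅ v ⁆) ≡ suc (suc (cnt A))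
    card hu hv ne = trans (cnt-insert (A ∪ ⁅ _ ⁆) _ (cong₂ _∨_ hv (==-f (ne ∘ sym)))) (cong suc (cnt-insert A _ hu))
    last : ∀ a → b2n (below a y) ≤ b2n (below a z) → rk (A ∪ ⁅ x ⁆ ∪ ⁅ y ⁆) a ≤ rk (A ∪ ⁅ x ⁆ ∪ ⁅ z ⁆) a
    last a le = subst₂ _≤_ (sym (two A x y a hx hy xy)) (sym (two A x z a hx hz xz)) (+-monoʳ-≤ _ le)
    last′ : ∀ a → b2n (below a z) ≤ b2n (below a y) → rk (A ∪ ⁅ x ⁆ ∪ ⁅ z ⁆) a ≤ rk (A ∪ ⁅ x ⁆ ∪ ⁅ y ⁆) a
    last′ a le = subst₂ _≤_ (sym (two A x z a hx hz xz)) (sym (two A x y a hx hy xy)) (+-monoʳ-≤ _ le)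
    first : ∀ a → b2n (below a y) ≤ b2n (below a x) → rk (A ∪ ⁅ y ⁆ ∪ ⁅ z ⁆) a ≤ rk (A ∪ ⁅ x ⁆ ∪ ⁅ z ⁆) a
    first a le = subst₂ _≤_ (sym (two A y z a hy hz yz)) (sym (two A x z a hx hz xz)) (+-monoˡ-≤ (b2n (below a z)) (+-monoʳ-≤ (rk A a) le))
    first′ : ∀ a → b2n (below a x) ≤ b2n (below a y) → rk (A ∪ ⁅ x ⁆ ∪ ⁅ z ⁆) a ≤ rk (A ∪ ⁅ y ⁆ ∪ ⁅ z ⁆) a
    first′ a le = subst₂ _≤_ (sym (two A x z a hx hz xz)) (sym (two A y z a hy hz yz)) (+-monoˡ-≤ (b2n (below a z)) (+-monoʳ-≤ (rk A a) le))

  module _ {H : Graph} (mo : MinorOf M H) where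

    open MinorOf mo using (f)
    open Contraction M mo
    open Test H

    not-mid₁ : ∀ A x y z → obstructs₁ A x y z ≡ true → ¬ Mid (π ∘ f) x y z
    not-mid₁ A x y z ob mid = not-hall (A ∪ ⁅ y ⁆) (not-f dep) (fill-hall Ax bx (A ∪ ⁅ y ⁆) (ext (λ e → sym (insert y e))
        (one-mid {fill Ax bx A} {f x} {f y} {f z} mid (at-A x hx) (at-A y hy) (at-A z hz)
          (ext (insert x) (fill-ind Ax bx Ax bx)) (ext (insert z) (fill-ind Ax bx (A ∪ ⁅ z ⁆) bz))
          (trans (sym (cnt-cong (insert x))) (fill-size Ax bx basis-size ind-≤ Ax bx)))))
      where
      Ax : BSet (nE H)
      Ax = A ∪ ⁅ x ⁆
      aw : away A x y z ≡ true
      aw = ∧-l {away A x y z} ob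
      hx : A x ≡ false
      hx = not-f (∧-l {not (A x)} aw)
      hy : A y ≡ false
      hy = not-f (∧-l {not (A y)} (∧-r {not (A x)} aw))
      hz : A z ≡ false
      hz = not-f (∧-r {not (A y)} (∧-r {not (A x)} aw))
      rest : base Ax ∧ base (A ∪ ⁅ z ⁆) ∧ not (hall (A ∪ ⁅ y ⁆)) ≡ true
      rest = ∧-r {away A x y z} ob
      bx : base Ax ≡ true
      bx = ∧-l {base Ax} rest
      bz : base (A ∪ ⁅ z ⁆) ≡ true
      bz = ∧-l {base (A ∪ ⁅ z ⁆)} (∧-r {base Ax} rest)
      dep : not (hall (A ∪ ⁅ y ⁆)) ≡ true
      dep = ∧-r {base (A ∪ ⁅ z ⁆)} (∧-r {base Ax} rest)
      insert : ∀ v e → fill Ax bx (A ∪ ⁅ v ⁆) e ≡ (fill Ax bx A ∪ ⁅ f v ⁆) e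
      insert v = fill-insert Ax bx A v
      at-A : ∀ v → A v ≡ false → fill Ax bx A (f v) ≡ false
      at-A = fill-at Ax bx A

    not-mid₂ : ∀ A x y z → obstructs₂ A x y z ≡ true → ¬ Mid (π ∘ f) x y z
    not-mid₂ A x y z ob mid = not-hall (A ∪ ⁅ x ⁆ ∪ ⁅ z ⁆) (not-f dep) (fill-hall Axy bxy (A ∪ ⁅ x ⁆ ∪ ⁅ z ⁆) (ext (λ e → sym (insert x z e))
        (two-mid {fill Axy bxy A} {f x} {f y} {f z} mid (at-A x hx) (at-A y hy) (at-A z hz)
          (ext (insert x y) (fill-ind Axy bxy Axy bxy)) (ext (insert y z) (fill-ind Axy bxy (A ∪ ⁅ y ⁆ ∪ ⁅ z ⁆) byz))
          (trans (sym (cnt-cong (insert x y))) (fill-size Axy bxy basis-size ind-≤ Axy bxy)))))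
      where
      Axy Ayz : BSet (nE H)
      Axy = A ∪ ⁅ x ⁆ ∪ ⁅ y ⁆
      Ayz = A ∪ ⁅ y ⁆ ∪ ⁅ z ⁆
      aw : away A x y z ≡ true
      aw = ∧-l {away A x y z} ob
      hx : A x ≡ false
      hx = not-f (∧-l {not (A x)} aw)
      hy : A y ≡ false
      hy = not-f (∧-l {not (A y)} (∧-r {not (A x)} aw))
      hz : A z ≡ false
      hz = not-f (∧-r {not (A y)} (∧-r {not (A x)} aw))
      rest : base Axy ∧ base Ayz ∧ not (hall (A ∪ ⁅ x ⁆ ∪ ⁅ z ⁆)) ≡ true
      rest = ∧-r {away A x y z} ob
      bxy : base Axy ≡ true
      bxy = ∧-l {base Axy} rest
      byz : base Ayz ≡ true
      byz = ∧-l {base Ayz} (∧-r {base Axy} rest)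
      dep : not (hall (A ∪ ⁅ x ⁆ ∪ ⁅ z ⁆)) ≡ true
      dep = ∧-r {base Ayz} (∧-r {base Axy} rest)
      insert : ∀ u v e → fill Axy bxy (A ∪ ⁅ u ⁆ ∪ ⁅ v ⁆) e ≡ (fill Axy bxy A ∪ ⁅ f u ⁆ ∪ ⁅ f v ⁆) e
      insert u v e = trans (fill-insert Axy bxy (A ∪ ⁅ u ⁆) v e) (cong (_∨ e == f v) (fill-insert Axy bxy A u e))
      at-A : ∀ v → A v ≡ false → fill Axy bxy A (f v) ≡ false
      at-A = fill-at Axy bxy A

set : ∀ {h} → List (Fin h) → BSet h
set []       e = false
set (x ∷ xs) e = e == x ∨ set xs e

-- one A: A+x and A+z are bases and A+y is dependent; two A: the same for A+x+y, A+y+z and A+x+z.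
data Witness (h : ℕ) : Set where
  one two : List (Fin h) → Witness h

module Evidence (H : Graph) where

  open Test H

  excludes : Witness (nE H) → Fin (nE H) → Fin (nE H) → Fin (nE H) → Bool
  excludes (one A) = obstructs₁ (set A)
  excludes (two A) = obstructs₂ (set A)

  distinct₃ : Fin (nE H) → Fin (nE H) → Fin (nE H) → Bool
  distinct₃ x y z = not (x == y) ∧ not (x == z) ∧ not (y == z)

  -- None of x, y, z can lie between the other two.
  unordered : (x y z : Fin (nE H)) → Witness (nE H) → Witness (nE H) → Witness (nE H) → Bool
  unordered x y z a b c = distinct₃ x y z ∧ excludes a y x z ∧ excludes b x y z ∧ excludes c x z y

  only-mid : (x y z : Fin (nE H)) → Witness (nE H) → Witness (nE H) → Bool
  only-mid x y z a c = distinct₃ x y z ∧ excludes a y x z ∧ excludes c x z y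

  module _ {m} {M : Matroid m} (P : Presentation M) (mo : MinorOf M H) where

    open LatticePath M P
    private
      ρ : Fin (nE H) → ℕ
      ρ = Presentation.π P ∘ MinorOf.f mo
      ρ-inj : ∀ x y → ρ x ≡ ρ y → x ≡ y
      ρ-inj x y e = MinorOf.inj mo x y (Presentation.π-inj P e)

    excluded : ∀ w x y z → excludes w x y z ≡ true → ¬ Mid ρ x y z
    excluded (one A) = not-mid₁ mo (set A)
    excluded (two A) = not-mid₂ mo (set A)

    mids : ∀ x y z → distinct₃ x y z ≡ true → Mid ρ x y z ⊎ Mid ρ y x z ⊎ Mid ρ x z y
    mids x y z p = mid-one ρ ρ-inj x y z (not-f (∧-l {not (x == y)} p)) (not-f (∧-l {not (x == z)} (∧-r {not (x == y)} p))) (not-f (∧-r {not (x == z)} (∧-r {not (x == y)} p)))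

    mid-only : ∀ x y z a c → only-mid x y z a c ≡ true → Mid ρ x y z
    mid-only x y z a c p = [ id , [ (λ m → ⊥-elim (excluded a y x z (∧-l {excludes a y x z} q) m)) , (λ m → ⊥-elim (excluded c x z y (∧-r {excludes a y x z} q) m)) ]′ ]′
        (mids x y z (∧-l {distinct₃ x y z} p))
      where
      q : excludes a y x z ∧ excludes c x z y ≡ true
      q = ∧-r {distinct₃ x y z} p

    no-order : ∀ x y z a b c → unordered x y z a b c ≡ true → ⊥
    no-order x y z a b c p = [ excluded b x y z (∧-l {excludes b x y z} r) , [ excluded a y x z (∧-l {excludes a y x z} q) , excluded c x z y (∧-r {excludes b x y z} r) ]′ ]′
        (mids x y z (∧-l {distinct₃ x y z} p))
      where
      q : excludes a y x z ∧ excludes b x y z ∧ excludes c x z y ≡ true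
      q = ∧-r {distinct₃ x y z} p
      r : excludes b x y z ∧ excludes c x z y ≡ true
      r = ∧-r {excludes a y x z} q

-- Since `a` separates `b` from `c`, the element `d` would have to lie beyond `b` on one side of `a`
-- and beyond `c` on the other.
mid-crossing : ∀ {h} (ρ : Fin h → ℕ) a b c d → Mid ρ b a c → Mid ρ a b d → Mid ρ a c d → ⊥
mid-crossing ρ a b c d (inj₁ (ba , ac)) (inj₁ (ab , bd)) _ = <-asym ab ba
mid-crossing ρ a b c d (inj₁ (ba , ac)) (inj₂ (db , _)) (inj₁ (_ , cd)) = <-asym (<-trans (<-trans ba ac) cd) db
mid-crossing ρ a b c d (inj₁ (ba , ac)) (inj₂ _) (inj₂ (dc , ca)) = <-asym ac ca
mid-crossing ρ a b c d (inj₂ (ca , ab)) _ (inj₁ (ac , cd)) = <-asym ca ac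
mid-crossing ρ a b c d (inj₂ (ca , ab)) (inj₂ (db , ba)) (inj₂ _) = <-asym ab ba
mid-crossing ρ a b c d (inj₂ (ca , ab)) (inj₁ (_ , bd)) (inj₂ (dc , _)) = <-asym (<-trans (<-trans ca ab) bd) dc

module _ {m} {M : Matroid m} (P : Presentation M) where
  open Evidence

  opaque
    unfolding Test.hall Test.base

    -- Two loops and the edge joining their vertices are dependent, while the two loops and either
    -- other triangle edge form a base. So no triangle edge lies between the other two.
    not-W : ¬ MinorOf M W
    not-W mo = no-order W P mo (# 0) (# 1) (# 2) (one (# 3 ∷ # 4 ∷ [])) (one (# 4 ∷ # 5 ∷ [])) (one (# 3 ∷ # 5 ∷ [])) refl

    not-R₃ : ¬ MinorOf M R₃
    not-R₃ mo = no-order R₃ P mo (# 1) (# 3) (# 5) (two (# 0 ∷ [])) (one (# 2 ∷ # 4 ∷ [])) (one (# 2 ∷ # 6 ∷ [])) refl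

    -- Three parallel edges are dependent; two of them and an edge of another class form a base.
    -- Hence representatives of the three classes have no middle one.
    not-K₃³ : ¬ MinorOf M K₃³
    not-K₃³ mo = no-order K₃³ P mo (# 0) (# 3) (# 6) (one (# 1 ∷ # 2 ∷ [])) (one (# 4 ∷ # 5 ∷ [])) (one (# 7 ∷ # 8 ∷ [])) refl

    -- Two double edges have four edges on three vertices. Exchanging one of these edges for an edge
    -- of the third pair gives a base.
    not-P₂ : ¬ MinorOf M P₂
    not-P₂ mo = no-order P₂ P mo (# 0) (# 2) (# 4) (two (# 3 ∷ # 5 ∷ [])) (two (# 1 ∷ # 5 ∷ [])) (two (# 1 ∷ # 3 ∷ [])) refl

    not-R₄ : ¬ MinorOf M R₄
    not-R₄ mo = no-order R₄ P mo (# 0) (# 3) (# 5) (two (# 1 ∷ # 4 ∷ [])) (two (# 1 ∷ # 2 ∷ [])) (one (# 2 ∷ # 4 ∷ # 6 ∷ [])) refl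

    not-D₄ : ¬ MinorOf M D₄
    not-D₄ mo = no-order D₄ P mo (# 0) (# 3) (# 6) (one (# 1 ∷ # 2 ∷ # 7 ∷ [])) (one (# 4 ∷ # 5 ∷ # 7 ∷ [])) (two (# 1 ∷ # 4 ∷ [])) refl

    not-S₁ : ¬ MinorOf M S₁
    not-S₁ mo = no-order S₁ P mo (# 0) (# 1) (# 2) (two (# 3 ∷ # 4 ∷ # 5 ∷ [])) (two (# 3 ∷ # 6 ∷ # 7 ∷ [])) (two (# 4 ∷ # 5 ∷ # 6 ∷ [])) refl

    -- Here the middle element is forced in three triples taken from four edges, and the three
    -- demands contradict each other.
    not-A₃ : ¬ MinorOf M A₃
    not-A₃ mo = mid-crossing (Presentation.π P ∘ MinorOf.f mo) (# 0) (# 1) (# 3) (# 5)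
      (mid-only A₃ P mo (# 1) (# 0) (# 3) (one (# 2 ∷ # 5 ∷ [])) (one (# 4 ∷ # 5 ∷ [])) refl)
      (mid-only A₃ P mo (# 0) (# 1) (# 5) (two (# 2 ∷ [])) (one (# 3 ∷ # 4 ∷ [])) refl)
      (mid-only A₃ P mo (# 0) (# 3) (# 5) (two (# 4 ∷ [])) (one (# 1 ∷ # 2 ∷ [])) refl)

-- Translation to and from the definitions of the theorem

size-cnt : ∀ {n} (p : Subset n) → Sub.∣ p ∣ ≡ cnt (lookup p)
size-cnt p = trans (go p) (sym (cnt-sum (lookup p)))
  where
  go : ∀ {n} (p : Subset n) → Sub.∣ p ∣ ≡ sum (b2n ∘ lookup p)
  go []          = refl
  go (true ∷ p)  = cong suc (go p)
  go (false ∷ p) = go p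

∈⇒t : ∀ {n} {p : Subset n} {x} → x Sub.∈ p → lookup p x ≡ true
∈⇒t = []=⇒lookup

t⇒∈ : ∀ {n} {p : Subset n} {x} → lookup p x ≡ true → x Sub.∈ p
t⇒∈ {p = p} {x} = lookup⇒[]= x p

lookup-∪⁅⁆ : ∀ {n} (p : Subset n) x v → lookup (p Sub.∪ Sub.⁅ x ⁆) v ≡ (lookup p ∪ ⁅ x ⁆) v
lookup-∪⁅⁆ p x v = trans (lookup-∪ p Sub.⁅ x ⁆ v) (cong (lookup p v ∨_)
  (bool-iff (λ q → dec-t (v ≟ᶠ x) (x∈⁅y⁆⇒x≡y x (t⇒∈ q))) (λ q → subst (λ v → lookup Sub.⁅ x ⁆ v ≡ true) (sym (==-t {i = v} q)) (∈⇒t (x∈⁅x⁆ x)))))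

module Transversals {n k} (f g : Fin n → Fin n) (gf : ∀ x → g (f x) ≡ x) (fg : ∀ y → f (g y) ≡ y) (lo hi : Fin k → Fin n)
                    (S T : Subset n) (S⇔T : ∀ x → (x Sub.∈ S) ⇔ₚ (f x Sub.∈ T)) where

  match⇒trans : Match (toℕ ∘ f) (toℕ ∘ lo) (toℕ ∘ hi) (lookup S) → Indep (Transversal n k (InInterval lo hi)) T
  match⇒trans (φ , inj , fits) = (λ y p → φ (g y) (back y p))
    , (λ x y p q e → trans (sym (fg x)) (trans (cong f (inj _ _ _ _ e)) (fg y)))
    , λ y p → subst (λ z → InInterval lo hi (φ (g y) (back y p)) z) (fg y) (fits (g y) (back y p))
    where
    back : ∀ y → y Sub.∈ T → lookup S (g y) ≡ true
    back y p = ∈⇒t (proj₂ (S⇔T (g y)) (subst (Sub._∈ T) (sym (fg y)) p))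

  trans⇒match : Indep (Transversal n k (InInterval lo hi)) T → Match (toℕ ∘ f) (toℕ ∘ lo) (toℕ ∘ hi) (lookup S)
  trans⇒match (φ , inj , fits) = (λ x p → φ (f x) (there x p))
    , (λ x y p q e → trans (sym (gf x)) (trans (cong g (inj _ _ _ _ e)) (gf y)))
    , λ x p → fits (f x) (there x p)
    where
    there : ∀ x → lookup S x ≡ true → f x Sub.∈ T
    there x p = proj₁ (S⇔T x) (t⇒∈ p)

module Bicircular (M : SetSystem) (isM : IsMatroid M) (bic : IsBicircular M) where

  private
    m = size M
    G₀ = proj₁ bic
    f = proj₁ (proj₂ bic)
    g = proj₁ (proj₂ (proj₂ bic))
    gf = proj₁ (proj₂ (proj₂ (proj₂ bic)))
    fg = proj₁ (proj₂ (proj₂ (proj₂ (proj₂ bic))))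
    iso = proj₂ (proj₂ (proj₂ (proj₂ (proj₂ bic))))

  -- The representing graph with its edges renamed along the isomorphism, so that `M`, its
  -- bicircular matroid and their minors share one ground set.
  G : Graph
  G = record { nV = nV G₀ ; nE = m ; ends = ends G₀ ∘ f }

  open Cycles G using (s; t; hall⇒bic; bic⇒hall)
  open Gr s t
  private
    module C₀ = Cycles G₀
    module H₀ = Gr C₀.s C₀.t

    along : Subset m → Subset (nE G₀)
    along S = tabulate (lookup S ∘ g)

    same : ∀ S X → cnt (lookup S ∩ E[ X ]) ≡ cnt (lookup (along S) ∩ H₀.E[ X ])
    same S X = trans (cnt-cong λ e → cong (_∧ E[ X ] e) (sym (trans (lookup∘tabulate (lookup S ∘ g) (f e)) (cong (lookup S) (gf e)))))
      (cnt-bij f g gf fg (lookup (along S) ∩ H₀.E[ X ]))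

    across : ∀ S x → (x Sub.∈ S) ⇔ₚ (f x Sub.∈ along S)
    across S x = (λ p → lookup-∈ {p = lookup S ∘ g} (trans (cong (lookup S) (gf x)) (∈⇒t p)))
               , (λ p → t⇒∈ (trans (cong (lookup S) (sym (gf x))) (∈-lookup {p = lookup S ∘ g} p)))

  indep⇒hall : ∀ S → Indep M S → Hall (lookup S)
  indep⇒hall S i X = ≤-trans (≤-reflexive (same S X)) (C₀.bic⇒hall (along S) (proj₁ (iso S (along S) (across S)) i) X)

  hall⇒indep : ∀ S → Hall (lookup S) → Indep M S
  hall⇒indep S h = proj₂ (iso S (along S) (across S)) (C₀.hall⇒bic (along S) λ X → ≤-trans (≤-reflexive (sym (same S X))) (h X))

  -- Augmentation is carried over from `isM`; the remaining axioms are read off the Hall condition.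
  matroid : Matroid m
  matroid = record
    { Ind = Hall ; ext = Hall-resp ; dec = hall? ; empty = λ X → ≤-trans (≤-reflexive (cnt-none λ _ → refl)) z≤n
    ; hered = Hall-⊆ ; aug = augment }
    where
    augment : ∀ {I K} → Hall I → Hall K → cnt I < cnt K → ∃ λ x → K x ≡ true × I x ≡ false × Hall (I ∪ ⁅ x ⁆)
    augment {I} {K} hI hK lt = let x , xK , xI , i = IsMatroid.indep-aug isM {tabulate I} {tabulate K} (as hI) (as hK) (subst₂ _<_ (sz I) (sz K) lt)
      in x , ∈-lookup {p = K} xK , ¬t⇒f (λ p → xI (lookup-∈ {p = I} p))
       , Hall-resp (λ e → trans (lookup-∪⁅⁆ (tabulate I) x e) (cong (_∨ e == x) (lookup∘tabulate I e))) (indep⇒hall _ i)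
      where
      as : ∀ {I} → Hall I → Indep M (tabulate I)
      as {I} h = hall⇒indep (tabulate I) (Hall-resp (λ e → sym (lookup∘tabulate I e)) h)
      sz : ∀ I → cnt I ≡ Sub.∣ tabulate I ∣
      sz I = trans (cnt-cong λ e → sym (lookup∘tabulate I e)) (sym (size-cnt (tabulate I)))

  open Bases matroid

  contr-to : ∀ {C T} → ContrIndep (Bic G) C T → ContrIndep M C T
  contr-to {C} {T} (B , B⊆ , i , mx , j) = B , B⊆ , hall⇒indep B (bic⇒hall B i) , (λ x p q r → mx x p q (hall⇒bic (B Sub.∪ Sub.⁅ x ⁆) (indep⇒hall _ r)))
    , hall⇒indep (T Sub.∪ B) (bic⇒hall (T Sub.∪ B) j)

  contr-from : ∀ {C T} → ContrIndep M C T → ContrIndep (Bic G) C T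
  contr-from {C} {T} (B , B⊆ , i , mx , j) = B , B⊆ , hall⇒bic B (indep⇒hall B i) , (λ x p q r → mx x p q (hall⇒indep (B Sub.∪ Sub.⁅ x ⁆) (bic⇒hall _ r)))
    , hall⇒bic (T Sub.∪ B) (indep⇒hall (T Sub.∪ B) j)

  has-minor : ∀ {N} → HasMinorIso (Bic G) N → HasMinorIso M N
  has-minor (C , X , h , a , b , c , d , e) = C , X , h , a , b , c , d
    , λ S T T⊆ st → (λ i → contr-to (proj₁ (e S T T⊆ st) i)) , (λ i → proj₂ (e S T T⊆ st) (contr-from i))

  minor-of : ∀ {H} → HasMinorIso M (Bic H) → MinorOf matroid H
  minor-of {H} (C , X , h , disjoint , into , onto , inj , indep) = record
    { f = h ; inj = inj ; C = lookup C ; off = λ x → ¬t⇒f λ p → disjoint (h x) (into x) (t⇒∈ p)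
    ; to = λ S hS → to S (proj₁ (indep (tabulate S) (image S) (image⊆ S) (image⇔ S)) (Cycles.hall⇒bic H (tabulate S) (HH.Hall-resp (λ e → sym (lookup∘tabulate S e)) hS)))
    ; from = λ S B bB i → HH.Hall-resp (lookup∘tabulate S) (Cycles.bic⇒hall H (tabulate S) (proj₂ (indep (tabulate S) (image S) (image⊆ S) (image⇔ S)) (from S B bB i))) }
    where
    open Image h inj
    module HH = Gr (Cycles.s H) (Cycles.t H)
    image : BSet (nE H) → Subset m
    image S = tabulate (im S)
    image⊆ : ∀ S → image S Sub.⊆ X
    image⊆ S p = let y , _ , q = im-∈ {S} (∈-lookup {p = im S} p) in subst (Sub._∈ X) q (into y)
    image⇔ : ∀ S y → (y Sub.∈ tabulate S) ⇔ₚ (h y Sub.∈ image S)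
    image⇔ S y = (λ p → lookup-∈ {p = im S} (im-∋ {S} y (∈-lookup {p = S} p))) , (λ p → lookup-∈ {p = S} (trans (sym (im-at S y)) (∈-lookup {p = im S} p)))
    to : ∀ S → ContrIndep M C (image S) → ∃ λ B → Basis (lookup C) B × Hall (im S ∪ B)
    to S (B , B⊆ , i , mx , j) = lookup B
      , record { sub = λ e p → ∈⇒t (B⊆ (t⇒∈ p)) ; ind = indep⇒hall B i
               ; max = λ x p q r → mx x (t⇒∈ p) (λ u → absurdᵇ (∈⇒t u) q) (hall⇒indep _ (Hall-resp (λ e → sym (lookup-∪⁅⁆ B x e)) r)) }
      , Hall-resp (λ e → trans (lookup-∪ (image S) B e) (cong (_∨ lookup B e) (lookup∘tabulate (im S) e))) (indep⇒hall _ j)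
    from : ∀ S B → Basis (lookup C) B → Hall (im S ∪ B) → ContrIndep M C (image S)
    from S B bB i = tabulate B , (λ p → t⇒∈ (Basis.sub bB _ (∈-lookup {p = B} p)))
      , hall⇒indep (tabulate B) (Hall-resp (λ e → sym (lookup∘tabulate B e)) (Basis.ind bB))
      , (λ x p q r → Basis.max bB x (∈⇒t p) (¬t⇒f λ u → q (lookup-∈ {p = B} u))
          (Hall-resp (λ e → trans (lookup-∪⁅⁆ (tabulate B) x e) (cong (_∨ e == x) (lookup∘tabulate B e))) (indep⇒hall _ r)))
      , hall⇒indep _ (Hall-resp (λ e → sym (trans (lookup-∪ (image S) (tabulate B) e) (cong₂ _∨_ (lookup∘tabulate (im S) e) (lookup∘tabulate B e)))) i)

  presentation : IsLPM M → Presentation matroid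
  presentation (k , lo , hi , le , inc , p , q , qp , pq , equiv) = record
    { π = toℕ ∘ p ; π-inj = λ {x} {y} e → trans (sym (qp x)) (trans (cong q (toℕ-injective e)) (qp y))
    ; k = k ; lo = toℕ ∘ lo ; hi = toℕ ∘ hi ; at = q ∘ lo ; π-at = λ i → cong toℕ (pq (lo i)) ; lo≤hi = le
    ; nested⇒≡ = nested
    ; ind⇒match = λ {I} h → match-resp (lookup∘tabulate I) (Transversals.trans⇒match p q qp pq lo hi (tabulate I) (image I) (image⇔ I)
        (proj₁ (equiv (tabulate I) (image I) (image⇔ I)) (hall⇒indep _ (Hall-resp (λ e → sym (lookup∘tabulate I e)) h))))
    ; match⇒ind = λ {I} h → Hall-resp (lookup∘tabulate I) (indep⇒hall _ (proj₂ (equiv (tabulate I) (image I) (image⇔ I))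
        (Transversals.match⇒trans p q qp pq lo hi (tabulate I) (image I) (image⇔ I) (match-resp (λ e → sym (lookup∘tabulate I e)) h)))) }
    where
    nested : ∀ i j → toℕ (lo j) ≤ toℕ (lo i) → toℕ (hi i) ≤ toℕ (hi j) → i ≡ j
    nested i j a b with i ≟ᶠ j
    ... | yes e = e
    ... | no ne = ⊥-elim (inc i j ne λ x (c , d) → ≤-trans a c , ≤-trans d b)
    image : BSet m → Subset m
    image I = tabulate (I ∘ q)
    image⇔ : ∀ I x → (x Sub.∈ tabulate I) ⇔ₚ (p x Sub.∈ image I)
    image⇔ I x = (λ u → lookup-∈ {p = I ∘ q} (trans (cong I (qp x)) (∈-lookup {p = I} u))) , (λ u → lookup-∈ {p = I} (trans (cong I (sym (qp x))) (∈-lookup {p = I ∘ q} u)))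
    match-resp : ∀ {I K} → (∀ e → I e ≡ K e) → Match (toℕ ∘ p) (toℕ ∘ lo) (toℕ ∘ hi) I → Match (toℕ ∘ p) (toℕ ∘ lo) (toℕ ∘ hi) K
    match-resp h (φ , inj , fits) = (λ e u → φ e (trans (h e) u)) , (λ x y u v → inj x y _ _) , (λ x u → fits x _)

  is-lpm : NoMinors G → IsLPM M
  is-lpm excl = P.r , S.pos ∘ P.lo , S.pos ∘ P.hi , P.lo≤hi
    , (λ i j ne sub → ne (P.nested⇒≡ i j (proj₁ (sub _ (≤-refl , P.lo≤hi i))) (proj₂ (sub _ (P.lo≤hi i , ≤-refl)))))
    , S.pos , S.inv , S.inv-pos , S.pos-inv
    , λ A T st → let open Transversals S.pos S.inv S.inv-pos S.pos-inv (S.pos ∘ P.lo) (S.pos ∘ P.hi) A T st in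
        (λ i → match⇒trans (P.ind⇒match (indep⇒hall A i))) , (λ i → hall⇒indep A (P.match⇒ind (trans⇒match i)))
    where
    cert : ∃ λ κ → Cert full κ
    cert = Certify.certify G excl matroid (λ _ → id) (λ _ → id) _ full ≤-refl
    κ κ′ : Fin m → ℕ
    κ = proj₁ cert
    -- Ties of `κ` are broken by the index, which stays below `m` and therefore cannot reverse a
    -- strict inequality.
    κ′ e = κ e * m + toℕ e
    κ′-mono : ∀ {e f} → κ e < κ f → κ′ e < κ′ f
    κ′-mono {e} {f} lt = begin-strict
      κ e * m + toℕ e   <⟨ +-monoʳ-< (κ e * m) (toℕ<n e) ⟩
      κ e * m + m       ≡⟨ +-comm (κ e * m) m ⟩
      suc (κ e) * m     ≤⟨ *-monoˡ-≤ m lt ⟩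
      κ f * m           ≤⟨ m≤m+n (κ f * m) (toℕ f) ⟩
      κ′ f              ∎
      where open ≤-Reasoning
    κ′-inj : ∀ {e f} → κ′ e ≡ κ′ f → e ≡ f
    κ′-inj {e} {f} eq with <-cmp (κ e) (κ f)
    ... | tri< lt _ _ = ⊥-elim (<-irrefl eq (κ′-mono {e} {f} lt))
    ... | tri> _ _ gt = ⊥-elim (<-irrefl (sym eq) (κ′-mono {f} {e} gt))
    ... | tri≈ _ p _  = toℕ-injective (+-cancelˡ-≡ (κ e * m) _ _ (trans eq (cong (λ x → x * m + toℕ f) (sym p))))
    module S = Sort κ′ κ′-inj
    cert′ : Cert full (toℕ ∘ S.pos)
    cert′ I I⊆ dep = record
      { D = D ; T = T ; D⊆ = D⊆ ; T⊆ = T⊆ ; down = λ e f a b c → S.pos-mono (κ′-mono {e} {f} (down e f a b c)) ; up = λ e f a b c → S.pos-mono (κ′-mono {f} {e} (up e f a b c))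
      ; d = d ; t = t′ ; rD = rD ; rT = rT ; B = B ; indB = indB ; B⊆ = B⊆ ; big = big ; some = some }
      where open Bad (proj₂ cert I I⊆ dep) renaming (t to t′)
    module P = Path matroid (toℕ ∘ S.pos) S.pos-inj cert′

theorem2 : (M : SetSystem) → IsMatroid M → IsBicircular M →
    (IsLPM M ⇔ₚ
      (¬ HasMinorIso M (Bic P₂) × ¬ HasMinorIso M (Bic W) ×
       ¬ HasMinorIso M (Bic A₃) × ¬ HasMinorIso M (Bic R₃) ×
       ¬ HasMinorIso M (Bic R₄) × ¬ HasMinorIso M (Bic D₄) ×
       ¬ HasMinorIso M (Bic K₃³) × ¬ HasMinorIso M (Bic S₁)))
theorem2 M isM bic =
    (λ l → let p = presentation l in
      not-P₂ p ∘ minor-of , not-W p ∘ minor-of , not-A₃ p ∘ minor-of , not-R₃ p ∘ minor-of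
      , not-R₄ p ∘ minor-of , not-D₄ p ∘ minor-of , not-K₃³ p ∘ minor-of , not-S₁ p ∘ minor-of)
  , λ (nP₂ , nW , nA₃ , nR₃ , nR₄ , nD₄ , nK₃ , nS₁) → is-lpm record
      { noP2 = nP₂ ∘ has-minor ; noW = nW ∘ has-minor ; noA3 = nA₃ ∘ has-minor ; noR3 = nR₃ ∘ has-minor
      ; noR4 = nR₄ ∘ has-minor ; noD4 = nD₄ ∘ has-minor ; noK3 = nK₃ ∘ has-minor ; noS1 = nS₁ ∘ has-minor }
  where open Bicircular M isM bic
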